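{- For every positive integer $n$, \[ \sum_{A \in \mathrm{ASM}_n} \omega_A(u,v,w;\mathbf{x}) = \mathcal{A}_{n,1}(1,u,v,w;\mathbf{x}), \] where $\mathbf{x}=(x_1,\ldots,x_n)$.
   Context: Partitions: a partition is a weakly decreasing sequence of non-negative integers; $\lambda'$ denotes the conjugate partition, $\lambda'_i=|\{j:\lambda_j\ge i\}|$. If $l=\max\{i:\lambda_i\ge i\}$ (the side length of the Durfee square), the Frobenius notation of $\lambda$ is $(a_1,\ldots,a_l\mid b_1,\ldots,b_l)$ with $a_i=\lambda_i-i$, $b_i=\lambda'_i-i$; conversely such a symbol with $a_1>\dots>a_l\ge 0$, $b_1>\dots>b_l\ge0$ determines a partition. $s_\lambda(\mathbf{x})$ is the Schur polynomial in the variables $\mathbf{x}$ (zero if $\lambda$ has more nonzero parts than there are variables). Totally symmetric plane partitions: $\mathrm{TSPP}_m$ is the set of arrays $T=(T_{i,j})_{1\le i,j\le m}$ of integers in $\{0,\ldots,m\}$ with weakly decreasing rows and columns such that the set $\{(i,j,c): 1\le c\le T_{i,j}\}\subseteq[m]^3$ is invariant under all permutations of the three coordinates. For $T\in\mathrm{TSPP}_m$ let $\mathrm{diag}(T)$ be the conjugate of the partition $(T_{1,1},T_{2,2},\ldots,T_{m,m})$, with Frobenius notation $(a_1,\ldots,a_l\mid b_1,\ldots,b_l)$. For an integer $k\ge0$, $\pi_k(T)$ is the partition with Frobenius notation $(a_1,\ldots,a_l\mid b_1+k,\ldots,b_l+k)$. For $T\in\mathrm{TSPP}_{n-1}$ put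 \[ \omega(T)=r^l u^{\sum_{i=1}^l(a_i+1)} v^{\binom{n}{2}-\sum_{i=1}^l(b_i+1)} w^{\sum_{i=1}^l(b_i-a_i)}, \] and define $\mathcal{A}_{n,k}(r,u,v,w;\mathbf{x})=\sum_{T\in\mathrm{TSPP}_{n-1}}\omega(T)\,s_{\pi_k(T)}(\mathbf{x})$ with $\mathbf{x}=(x_1,\ldots,x_{n+k-1})$. ASMs and their weight: $\mathrm{ASM}_n$ is the set of $n\times n$ matrices with entries in $\{ -1,0,1\}$ whose row and column sums all equal $1$ and whose nonzero entries alternate in sign along every row and column. To $A=(a_{i,j})\in\mathrm{ASM}_n$ associate the monotone triangle $M=(m_{i,j})_{1\le j\le i\le n}$ whose $i$-th row $m_{i,1}<\dots<m_{i,i}$ lists the column indices $j$ with $\sum_{i'\le i}a_{i',j}=1$ (so $m_{i+1,j}\le m_{i,j}\le m_{i+1,j+1}$ and the bottom row is $1,2,\ldots,n$). An entry $m_{i,j}$ with $i<n$ is special if $m_{i+1,j}<m_{i,j}<m_{i+1,j+1}$, left-leaning if $m_{i,j}=m_{i+1,j}$, right-leaning if $m_{i,j}=m_{i+1,j+1}$. For $1\le i\le n-1$ let $s_i(M),l_i(M),r_i(M)$ be the numbers of special, left-leaning, right-leaning entries in row $i$, and $s_0=l_0=r_0=0$; let $l(M)=\sum_i l_i(M)$, $r(M)=\sum_i r_i(M)$. For $1\le i\le n$ let $\widehat d_i(M)=\sum_{j=1}^i m_{i,j}-\sum_{j=1}^{i-1}m_{i-1,j}+r_{i-1}(M)-l_{i-1}(M)-1$.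 Then \[ \omega_A(u,v,w;\mathbf{x})=u^{r(M)}v^{l(M)}\prod_{i=1}^n x_i^{\widehat d_i(M)}\,(u x_i+w+v x_i^{ -1})^{s_{i-1}(M)}. \] -}

module Defs where

open import Data.Bool using (Bool; true; false; _∧_; _∨_; not; if_then_else_)
open import Data.Nat using (ℕ; zero; suc; _+_; _∸_; _⊔_; _≤ᵇ_; _<ᵇ_; _≡ᵇ_)
open import Data.Nat.Combinatorics using (_C_)
open import Data.Integer as ℤ using (ℤ; +_; -[1+_])
open import Data.List using (List; []; _∷_; [_]; map; length; zip; drop; upTo;
  concatMap; filterᵇ; foldr; tabulate; replicate; zipWith)
import Data.List as L
open import Data.Fin using (Fin)
open import Data.Product using (_×_; _,_; proj₁; proj₂)
open import Relation.Nullary.Decidable using (⌊_⌋)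
open import Algebra.Bundles using (CommutativeRing)

-- Generic list helpers (all indices are 1-based, as in the paper)

at : ∀ {a} {A : Set a} → A → List A → ℕ → A
at d []       _             = d
at d (x ∷ xs) zero          = d
at d (x ∷ xs) (suc zero)    = x
at d (x ∷ xs) (suc (suc k)) = at d xs (suc k)

range : ℕ → List ℕ
range m = map suc (upTo m)

words : ∀ {a} {A : Set a} → ℕ → List A → List (List A)
words zero    as = [ [] ]
words (suc k) as = concatMap (λ x → map (x ∷_) (words k as)) as

all : ∀ {a} {A : Set a} → (A → Bool) → List A → Bool
all p = foldr (λ x b → p x ∧ b) true

count : ∀ {a} {A : Set a} → (A → Bool) → List A → ℕ
count p xs = length (filterᵇ p xs)

sumℕ : List ℕ → ℕ
sumℕ = foldr _+_ 0

maxℕ : List ℕ → ℕ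
maxℕ = foldr _⊔_ 0

sumℤ : List ℕ → ℤ
sumℤ xs = + sumℕ xs

weaklyDec : List ℕ → Bool
weaklyDec (a ∷ b ∷ r) = (b ≤ᵇ a) ∧ weaklyDec (b ∷ r)
weaklyDec _           = true

weaklyInc : List ℕ → Bool
weaklyInc (a ∷ b ∷ r) = (a ≤ᵇ b) ∧ weaklyInc (b ∷ r)
weaklyInc _           = true

columns : ∀ {a} {A : Set a} → A → ℕ → List (List A) → List (List A)
columns d n M = map (λ j → map (λ row → at d row j) M) (range n)

conj : List ℕ → List ℕ
conj la = map (λ i → count (λ p → i ≤ᵇ p) la) (range (maxℕ la))

durfee : List ℕ → ℕ
durfee la = maxℕ (map (λ i → if i ≤ᵇ at 0 la i then i else 0) (range (length la)))

frobA : List ℕ → List ℕ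
frobA la = map (λ i → at 0 la i ∸ i) (range (durfee la))

frobB : List ℕ → List ℕ
frobB la = map (λ i → at 0 (conj la) i ∸ i) (range (durfee la))

-- the partition with Frobenius notation (a_1..a_l | b_1..b_l)
-- (assumes a_1 > ... > a_l ≥ 0, b_1 > ... > b_l ≥ 0, l = length a = length b):
-- it has b_1 + 1 rows (none if l = 0); row i has length a_i + i for i ≤ l
-- and |{ j ≤ l : b_j + j ≥ i }| for i > l
fromFrobenius : List ℕ → List ℕ → List ℕ
fromFrobenius a b = map row (range nrows)
  where
  l = length a
  nrows = if l ≡ᵇ 0 then 0 else suc (at 0 b 1)
  row : ℕ → ℕ
  row i = if i ≤ᵇ l then at 0 a i + i
          else count (λ j → i ≤ᵇ at 0 b j + j) (range l)

rowFillings : List ℕ → List ℕ → List (List (List ℕ))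
rowFillings alph []       = [ [] ]
rowFillings alph (p ∷ ps) =
  concatMap (λ r → map (r ∷_) (rowFillings alph ps)) (filterᵇ weaklyInc (words p alph))

-- columns strictly increasing (row i+1 is not longer than row i)
colStrict : List (List ℕ) → Bool
colStrict (r ∷ r' ∷ rs) = all (λ pq → proj₁ pq <ᵇ proj₂ pq) (zip r r') ∧ colStrict (r' ∷ rs)
colStrict _             = true

SSYT : ℕ → List ℕ → List (List (List ℕ))
SSYT N la = filterᵇ colStrict (rowFillings (range N) la)

entry : List (List ℕ) → ℕ → ℕ → ℕ
entry T i j = at 0 (at [] T i) j

inSolid : List (List ℕ) → ℕ → ℕ → ℕ → Bool
inSolid T i j c = (1 ≤ᵇ c) ∧ (c ≤ᵇ entry T i j)

isTSPP : ℕ → List (List ℕ) → Bool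
isTSPP m T =
  (length T ≡ᵇ m) ∧ all (λ r → length r ≡ᵇ m) T
  ∧ all (all (λ e → e ≤ᵇ m)) T
  ∧ all weaklyDec T ∧ all weaklyDec (columns 0 m T)
  ∧ all (λ i → all (λ j → all (λ c → not (inSolid T i j c) ∨
        (inSolid T i j c ∧ inSolid T i c j ∧ inSolid T j i c
         ∧ inSolid T j c i ∧ inSolid T c i j ∧ inSolid T c j i))
        (range m)) (range m)) (range m)

TSPP : ℕ → List (List (List ℕ))
TSPP m = filterᵇ (isTSPP m) (words m (words m (upTo (suc m))))

diagT : ℕ → List (List ℕ) → List ℕ
diagT m T = conj (map (λ i → entry T i i) (range m))

piK : ℕ → ℕ → List (List ℕ) → List ℕ
piK m k T = fromFrobenius (frobA (diagT m T)) (map (_+ k) (frobB (diagT m T)))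

nonzeros : List ℤ → List ℤ
nonzeros = filterᵇ (λ e → not ⌊ e ℤ.≟ + 0 ⌋)

alternating : List ℤ → Bool
alternating (e ∷ e' ∷ r) = ⌊ e ℤ.* e' ℤ.<? + 0 ⌋ ∧ alternating (e' ∷ r)
alternating _            = true

lineOK : List ℤ → Bool
lineOK r = all (λ e → ⌊ e ℤ.≟ -[1+ 0 ] ⌋ ∨ ⌊ e ℤ.≟ + 0 ⌋ ∨ ⌊ e ℤ.≟ + 1 ⌋) r
         ∧ ⌊ foldr ℤ._+_ (+ 0) r ℤ.≟ + 1 ⌋
         ∧ alternating (nonzeros r)

isASM : ℕ → List (List ℤ) → Bool
isASM n A = (length A ≡ᵇ n) ∧ all (λ r → length r ≡ᵇ n) A
          ∧ all lineOK A ∧ all lineOK (columns (+ 0) n A)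

ASM : ℕ → List (List (List ℤ))
ASM n = filterᵇ (isASM n) (words n (words n (-[1+ 0 ] ∷ + 0 ∷ + 1 ∷ [])))

partialColumnSums : ℕ → List (List ℤ) → List (List ℤ)
partialColumnSums n A = go (replicate n (+ 0)) A
  where
  go : List ℤ → List (List ℤ) → List (List ℤ)
  go acc []       = []
  go acc (r ∷ rs) = zipWith ℤ._+_ acc r ∷ go (zipWith ℤ._+_ acc r) rs

onesPositions : List ℤ → List ℕ
onesPositions r = map proj₁ (filterᵇ (λ p → ⌊ proj₂ p ℤ.≟ + 1 ⌋) (zip (range (length r)) r))

monotoneTriangle : ℕ → List (List ℤ) → List (List ℕ)
monotoneTriangle n A = map onesPositions (partialColumnSums n A)

triples : List (List ℕ) → ℕ → List (ℕ × ℕ × ℕ)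
triples M i = zip (at [] M i) (zip (at [] M (suc i)) (drop 1 (at [] M (suc i))))

-- s_i, l_i, r_i  (automatically 0 for i = 0 and i ≥ n)
specialᵢ leftᵢ rightᵢ : List (List ℕ) → ℕ → ℕ
specialᵢ M i = count (λ { (m , p , q) → (p <ᵇ m) ∧ (m <ᵇ q) }) (triples M i)
leftᵢ    M i = count (λ { (m , p , q) → m ≡ᵇ p }) (triples M i)
rightᵢ   M i = count (λ { (m , p , q) → m ≡ᵇ q }) (triples M i)

leftTotal rightTotal : ℕ → List (List ℕ) → ℕ
leftTotal  n M = sumℕ (map (leftᵢ M) (range (n ∸ 1)))
rightTotal n M = sumℕ (map (rightᵢ M) (range (n ∸ 1)))

dHat : List (List ℕ) → ℕ → ℤ
dHat M i = sumℤ (at [] M i) ℤ.- sumℤ (at [] M (i ∸ 1))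
           ℤ.+ + rightᵢ M (i ∸ 1) ℤ.- + leftᵢ M (i ∸ 1) ℤ.- + 1

module _ {c ℓ} (R : CommutativeRing c ℓ) where
  open CommutativeRing R renaming (_+_ to _+ᴿ_)

  pow : Carrier → ℕ → Carrier
  pow x zero    = 1#
  pow x (suc k) = x * pow x k

  -- x^k for k ∈ ℤ, where xinv is (intended to be) the inverse of x
  zpow : Carrier → Carrier → ℤ → Carrier
  zpow x xinv (+ k)     = pow x k
  zpow x xinv -[1+ k ]  = pow xinv (suc k)

  Σ : List Carrier → Carrier
  Σ = foldr _+ᴿ_ 0#

  Π : List Carrier → Carrier
  Π = foldr _*_ 1#

  schur : (N : ℕ) → (Fin N → Carrier) → List ℕ → Carrier
  schur N x la = Σ (map (λ P → Π (map (λ e → at 0# (tabulate x) e) (L.concat P))) (SSYT N la))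

  ωT : ℕ → Carrier → Carrier → Carrier → Carrier → List (List ℕ) → Carrier
  ωT n r u v w T =
    pow r (length a) * pow u (sumℕ (map suc a))
    * pow v ((n C 2) ∸ sumℕ (map suc b)) * pow w (sumℕ b ∸ sumℕ a)
    where
    a = frobA (diagT (n ∸ 1) T)
    b = frobB (diagT (n ∸ 1) T)

  calA : (n k : ℕ) → Carrier → Carrier → Carrier → Carrier → (Fin (k + n ∸ 1) → Carrier) → Carrier
  calA n k r u v w x =
    Σ (map (λ T → ωT n r u v w T * schur (k + n ∸ 1) x (piK (n ∸ 1) k T)) (TSPP (n ∸ 1)))

  -- ω_A(u,v,w; x_1..x_n), xinv i playing the role of x_i^{-1}
  ωA : (n : ℕ) → Carrier → Carrier → Carrier → (x xinv : Fin n → Carrier) → List (List ℤ) → Carrier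
  ωA n u v w x xinv A =
    pow u (rightTotal n M) * pow v (leftTotal n M)
    * Π (map (λ i → zpow (xi i) (xinvi i) (dHat M i)
                    * pow (u * xi i +ᴿ w +ᴿ v * xinvi i) (specialᵢ M (i ∸ 1)))
             (range n))
    where
    M = monotoneTriangle n A
    xi xinvi : ℕ → Carrier
    xi    = at 0# (tabulate x)
    xinvi = at 0# (tabulate xinv)

  ASMsum : (n : ℕ) → Carrier → Carrier → Carrier → (x xinv : Fin n → Carrier) → Carrier
  ASMsum n u v w x xinv = Σ (map (ωA n u v w x xinv) (ASM n))

{-# OPTIONS --safe #-}

-- Both sides are evaluated by linear functionals on polynomials in t₁, …, tₙ that are alternating in
-- the exponents, so that the quotients by Vandermonde determinants never have to be formed: the
-- functional t^κ ↦ (generalised) Schur function of κ is built one variable y at a time, by inverting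
-- ∏ (tᵢ − y) on functionals.
--
-- A row of a monotone triangle is a transfer of the six-vertex model.  Multiplied by ∏ (tᵢ − y), the sum
-- over the row above telescopes in every tᵢ, and what is left over is killed by antisymmetry because
-- F(tᵢ,tᵢ₊₁) F(tᵢ₊₁,tᵢ) is symmetric, F(s,t) = v + w s + u s t.  Hence the sum over triangles with bottom
-- row k is the value of the Schur functional at ∏_{i<j} F(tᵢ,tⱼ) ∏ tᵢ^(kᵢ−1).
--
-- For k = (1, …, n), antisymmetrisation turns this product into the wedge of the n polynomials
-- v^b t^(n−1−b) + (−1)^b u tⁿ (w + ut)^(b−1), with b = 0 giving t^(n−1).  Passing from b to b + 1 multiplies
-- tⁿ, tⁿ⁺¹, … by −(w + ut) and moves the lower monomials down by one with a factor v; on the Frobenius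
-- symbols indexing the basis of the wedge this is exactly how diag(T) grows when a totally symmetric
-- plane partition is extended by the walls {(p, q, q)}.

module Submission where

open import Defs
import Data.Nat.Properties as ℕₚ
import Data.Integer.Properties as ℤₚ
import Relation.Binary.PropositionalEquality as ≡
import Algebra.Solver.Ring
import Algebra.Properties.Ring
import Algebra.Properties.AbelianGroup
import Algebra.Properties.Semiring.Mult.TCOptimised
import Data.List.Properties as Listₚ
import Level
import Data.Bool.Properties as Boolₚ
import Algebra.Bundles
import Algebra.Properties.Group
import Data.Nat.Solver
import Data.Integer.Solver
import Data.List.Relation.Unary.Unique.Propositional.Properties as Uniqueₚ
open import Data.Nat as ℕ using (ℕ; zero; suc; _⊓_; _⊔_; _≤_)
open import Data.Integer as ℤ using (ℤ; +_; -[1+_])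
open import Data.Maybe using (Maybe; just; nothing)
open import Algebra.Bundles using (CommutativeRing)
open import Algebra.Solver.Ring.AlmostCommutativeRing using (fromCommutativeRing; _-Raw-AlmostCommutative⟶_)
open import Data.List
  using (List; []; _∷_; map; length; _++_; downFrom; concatMap; filterᵇ; replicate; zip; upTo; concat; _ʳ++_; reverse; zipWith; drop; foldr; applyUpTo; tabulate)
open import Data.Product using (_×_; _,_; proj₁; proj₂; ∃)
open import Function using (_∘_; id; mk⇔)
open import Data.Bool using (Bool; true; false; T; if_then_else_; _∧_; not; _∨_)
open import Data.List.Membership.Propositional using (_∈_)
open import Data.List.Membership.Propositional.Properties
  using (∈-map⁺; ∈-∃++; ∈-downFrom⁺; ∈-downFrom⁻; ∈-map⁻; ∈-++⁻; ∈-upTo⁻; ∈-++⁺ˡ; ∈-++⁺ʳ; ∈-upTo⁺)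
open import Data.List.Relation.Unary.Any using (here; there)
open import Data.Unit using (⊤; tt)
open import Data.Empty using (⊥-elim; ⊥)
open import Data.List.Relation.Binary.Permutation.Propositional as Perm using (_↭_)
open import Data.Sum using (inj₁; inj₂; _⊎_)
open import Data.List.Relation.Unary.All as All using (All; []; _∷_)
open import Relation.Nullary.Decidable using (Dec; yes; no; ⌊_⌋; T?)
open import Data.Fin using (Fin; fromℕ<)
open import Data.List.Membership.Propositional.Properties.WithK using (unique∧set⇒bag)
open import Data.List.Relation.Binary.BagAndSetEquality using (∼bag⇒↭)
open import Data.List.Relation.Unary.AllPairs using ([]; _∷_)
open import Data.List.Relation.Unary.Unique.Propositional using (Unique)
open import Data.Nat.Combinatorics using (_C_; nC1≡n; nCk+nC[k+1]≡[n+1]C[k+1])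
open ≡ using (_≡_)

-- Over an arbitrary commutative ring, differences of variables may be zero divisors and 2 may be
-- zero. So no quotient is available, and alternation has to be recorded twice, as a change of sign
-- and as vanishing on equal neighbours. Division of functionals by t - y is possible but does not
-- commute with multiplication by t, so it cannot be carried past the factors F. Multiplication by t
-- - y can: the functional for the rows above is first written as such a multiple, and only then are
-- the factors F inserted.
--
-- The two sides are never matched object by object; both equal one sum over basis vectors of a
-- wedge. Two facts make that sum come out right. The column with b = 0, t^(n-1), is not touched by
-- the passage from b to b + 1, so every hook gets one cell more in its leg than the position of its
-- column shows; this is k = 1. And a letter with arm a at a position followed by b others carries
-- the sign (-1)^(b+1), while sorting the exponents moves it past exactly b + 1 letters, so all
-- signs cancel.

module IntegerSolver {c ℓ} (R : CommutativeRing c ℓ) where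
  open CommutativeRing R hiding (zero)
  open Algebra.Properties.Ring ring using (-‿distribˡ-*; -‿distribʳ-*; -‿involutive; -0#≈0#)
  open Algebra.Properties.AbelianGroup +-abelianGroup using (⁻¹-∙-comm)
  open Algebra.Properties.Semiring.Mult.TCOptimised semiring
    using (×-homo-+; ×1-homo-*; 1+×) renaming (_×_ to _×ᴿ_)
  open import Relation.Binary.Reasoning.Setoid setoid

  fromℤ : ℤ → Carrier
  fromℤ (+ n)     = n ×ᴿ 1#
  fromℤ (-[1+ n ]) = - (suc n ×ᴿ 1#)

  private
    cancel : ∀ a b x → (x + a) - (x + b) ≈ a - b
    cancel a b x = begin
      (x + a) - (x + b)       ≈⟨ +-congˡ (⁻¹-∙-comm x b) ⟨
      (x + a) + (- x + - b)   ≈⟨ +-congʳ (+-comm x a) ⟩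
      (a + x) + (- x + - b)   ≈⟨ +-assoc a x _ ⟩
      a + (x + (- x + - b))   ≈⟨ +-congˡ (+-assoc x (- x) (- b)) ⟨
      a + ((x + - x) + - b)   ≈⟨ +-congˡ (+-congʳ (-‿inverseʳ x)) ⟩
      a + (0# + - b)          ≈⟨ +-congˡ (+-identityˡ _) ⟩
      a - b                   ∎

    ⊖-homo : ∀ m n → fromℤ (m ℤ.⊖ n) ≈ m ×ᴿ 1# - n ×ᴿ 1#
    ⊖-homo zero zero = sym (-‿inverseʳ 0#)
    ⊖-homo zero (suc n) = sym (+-identityˡ _)
    ⊖-homo (suc m) zero = sym (trans (+-congˡ -0#≈0#) (+-identityʳ _))
    ⊖-homo (suc m) (suc n) = begin
      fromℤ (suc m ℤ.⊖ suc n)              ≈⟨ reflexive (≡.cong fromℤ (ℤₚ.[1+m]⊖[1+n]≡m⊖n m n)) ⟩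
      fromℤ (m ℤ.⊖ n)                      ≈⟨ ⊖-homo m n ⟩
      m ×ᴿ 1# - n ×ᴿ 1#                      ≈⟨ cancel _ _ 1# ⟨
      (1# + m ×ᴿ 1#) - (1# + n ×ᴿ 1#)        ≈⟨ +-cong (1+× m 1#) (-‿cong (1+× n 1#)) ⟨
      suc m ×ᴿ 1# - suc n ×ᴿ 1#              ∎

    +-homo : ∀ i j → fromℤ (i ℤ.+ j) ≈ fromℤ i + fromℤ j
    +-homo (+ m) (+ n) = ×-homo-+ 1# m n
    +-homo (+ m) (-[1+ n ]) = ⊖-homo m (suc n)
    +-homo (-[1+ m ]) (+ n) = trans (⊖-homo n (suc m)) (+-comm _ _)
    +-homo (-[1+ m ]) (-[1+ n ]) = begin
      - (suc (suc (m ℕ.+ n)) ×ᴿ 1#)        ≈⟨ -‿cong (reflexive (≡.cong (_×ᴿ 1#) (≡.cong suc (ℕₚ.+-suc m n)))) ⟨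
      - ((suc m ℕ.+ suc n) ×ᴿ 1#)          ≈⟨ -‿cong (×-homo-+ 1# (suc m) (suc n)) ⟩
      - (suc m ×ᴿ 1# + suc n ×ᴿ 1#)         ≈⟨ ⁻¹-∙-comm _ _ ⟨
      - (suc m ×ᴿ 1#) - suc n ×ᴿ 1#         ∎

    -‿homo : ∀ i → fromℤ (ℤ.- i) ≈ - fromℤ i
    -‿homo (+ zero) = sym -0#≈0#
    -‿homo (+ suc n) = refl
    -‿homo (-[1+ n ]) = sym (-‿involutive _)

    *-homo⁺ : ∀ m j → fromℤ (+ m ℤ.* j) ≈ m ×ᴿ 1# * fromℤ j
    *-homo⁺ m (+ n) = trans (reflexive (≡.cong fromℤ (≡.sym (ℤₚ.pos-* m n)))) (×1-homo-* m n)
    *-homo⁺ m (-[1+ n ]) = begin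
      fromℤ (+ m ℤ.* (ℤ.- (+ suc n)))      ≈⟨ reflexive (≡.cong fromℤ (ℤₚ.neg-distribʳ-* (+ m) (+ suc n))) ⟨
      fromℤ (ℤ.- (+ m ℤ.* + suc n))        ≈⟨ -‿homo (+ m ℤ.* + suc n) ⟩
      - fromℤ (+ m ℤ.* + suc n)            ≈⟨ -‿cong (*-homo⁺ m (+ suc n)) ⟩
      - (m ×ᴿ 1# * (suc n ×ᴿ 1#))            ≈⟨ -‿distribʳ-* _ _ ⟩
      m ×ᴿ 1# * - (suc n ×ᴿ 1#)              ∎

    *-homo : ∀ i j → fromℤ (i ℤ.* j) ≈ fromℤ i * fromℤ j
    *-homo (+ m) j = *-homo⁺ m j
    *-homo (-[1+ m ]) j = begin
      fromℤ ((ℤ.- (+ suc m)) ℤ.* j)  ≈⟨ reflexive (≡.cong fromℤ (ℤₚ.neg-distribˡ-* (+ suc m) j)) ⟨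
      fromℤ (ℤ.- (+ suc m ℤ.* j))    ≈⟨ -‿homo (+ suc m ℤ.* j) ⟩
      - fromℤ (+ suc m ℤ.* j)        ≈⟨ -‿cong (*-homo⁺ (suc m) j) ⟩
      - (suc m ×ᴿ 1# * fromℤ j)       ≈⟨ -‿distribˡ-* _ _ ⟩
      - (suc m ×ᴿ 1#) * fromℤ j       ∎

    morphism : ℤ.+-*-rawRing -Raw-AlmostCommutative⟶ fromCommutativeRing R
    morphism = record
      { ⟦_⟧ = fromℤ ; +-homo = +-homo ; *-homo = *-homo ; -‿homo = -‿homo
      ; 0-homo = refl ; 1-homo = refl }

    -- Coefficients are integers because equality in `R` need not be decidable; over ℤ the solver
    -- can recognise that terms cancel.
    dec : ∀ i j → Maybe (fromℤ i ≈ fromℤ j)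
    dec i j with i ℤ.≟ j
    ... | yes i≡j = just (reflexive (≡.cong fromℤ i≡j))
    ... | no  _   = nothing

  open Algebra.Solver.Ring ℤ.+-*-rawRing (fromCommutativeRing R) morphism dec public
    using (solve; _:=_; _:+_; _:*_; _:-_; :-_; con; Polynomial)

-- Multilinear and alternating functionals on words of exponents.

module Functionals {c ℓ} (R : CommutativeRing c ℓ) where
  open CommutativeRing R hiding (zero)
  open IntegerSolver R
  open import Relation.Binary.Reasoning.Setoid setoid

  Fun : ∀ {a} → Set a → Set _
  Fun X = List X → Carrier

  infixl 9 _⟨_⟩
  _⟨_⟩ : ∀ {a} {X : Set a} → Fun X → X → Fun X
  (A ⟨ x ⟩) xs = A (x ∷ xs)

  record IsLinear {i} {I : Set i} (L : (I → Carrier) → Carrier) : Set (i Level.⊔ c Level.⊔ ℓ) where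
    field
      cong   : ∀ {F G} → (∀ i → F i ≈ G i) → L F ≈ L G
      +-homo : ∀ F G → L (λ i → F i + G i) ≈ L F + L G
      *-homo : ∀ a F → L (λ i → a * F i) ≈ a * L F

    0-homo : L (λ _ → 0#) ≈ 0#
    0-homo = begin
      L (λ _ → 0#)      ≈⟨ cong (λ _ → sym (zeroˡ 0#)) ⟩
      L (λ _ → 0# * 0#) ≈⟨ *-homo 0# _ ⟩
      0# * L (λ _ → 0#) ≈⟨ zeroˡ _ ⟩
      0#                ∎

    vanish : ∀ {F} → (∀ i → F i ≈ 0#) → L F ≈ 0#
    vanish F≈0 = trans (cong F≈0) 0-homo

    -‿homo : ∀ F → L (λ i → - F i) ≈ - L F
    -‿homo F = begin
      L (λ i → - F i)          ≈⟨ cong (λ i → solve 1 (λ x → :- x := :- con (ℤ.+ 1) :* x) refl (F i)) ⟩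
      L (λ i → - 1# * F i)     ≈⟨ *-homo (- 1#) F ⟩
      - 1# * L F               ≈⟨ solve 1 (λ x → :- x := :- con (ℤ.+ 1) :* x) refl (L F) ⟨
      - L F                    ∎

    lin₂ : ∀ a F b G → L (λ i → a * F i + b * G i) ≈ a * L F + b * L G
    lin₂ a F b G = trans (+-homo _ _) (+-cong (*-homo a F) (*-homo b G))

    lin₃ : ∀ a F b G d H → L (λ i → a * F i + b * G i + d * H i) ≈ a * L F + b * L G + d * L H
    lin₃ a F b G d H = trans (+-homo _ _) (+-cong (lin₂ a F b G) (*-homo d H))

    sub-homo : ∀ F G → L (λ i → F i - G i) ≈ L F - L G
    sub-homo F G = trans (+-homo _ _) (+-congˡ (-‿homo G))

  Lin : ∀ {a} → Set a → Set _
  Lin X = List (Carrier × X)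

  ap : ∀ {a} {X : Set a} → Lin X → (X → Carrier) → Carrier
  ap []            f = 0#
  ap ((a , x) ∷ p) f = a * f x + ap p f

  Ev : ∀ {a} {X : Set a} → Fun X → Fun (Lin X)
  Ev A []       = A []
  Ev A (p ∷ ps) = ap p (λ x → Ev (A ⟨ x ⟩) ps)

  ap-linear : ∀ {a} {X : Set a} (p : Lin X) → IsLinear (ap p)
  ap-linear [] = record
    { cong = λ _ → refl ; +-homo = λ _ _ → sym (+-identityˡ 0#) ; *-homo = λ a _ → sym (zeroʳ a) }
  ap-linear ((a , x) ∷ p) = record
    { cong = λ e → +-cong (*-congˡ (e x)) (cong e)
    ; +-homo = λ F G → trans (+-congˡ (+-homo F G))
        (solve 5 (λ a x y m n → a :* (x :+ y) :+ (m :+ n) := (a :* x :+ m) :+ (a :* y :+ n)) refl a (F x) (G x) _ _)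
    ; *-homo = λ b F → trans (+-congˡ (*-homo b F))
        (solve 4 (λ a x b m → a :* (b :* x) :+ b :* m := b :* (a :* x :+ m)) refl a (F x) b _) }
    where open IsLinear (ap-linear p)

  Ev-linear : ∀ {a} {X : Set a} (ps : List (Lin X)) → IsLinear (λ A → Ev A ps)
  Ev-linear [] = record { cong = λ e → e [] ; +-homo = λ _ _ → refl ; *-homo = λ _ _ → refl }
  Ev-linear (p ∷ ps) = record
    { cong = λ e → P.cong (λ x → E.cong (λ xs → e (x ∷ xs)))
    ; +-homo = λ F G → trans (P.cong (λ x → E.+-homo _ _)) (P.+-homo _ _)
    ; *-homo = λ b F → trans (P.cong (λ x → E.*-homo _ _)) (P.*-homo _ _) }
    where
    module P = IsLinear (ap-linear p)
    module E = IsLinear (Ev-linear ps)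

  linear-∘ : ∀ {i j} {I : Set i} {J : Set j} {L : (I → Carrier) → Carrier} →
    IsLinear L → (h : I → J) → IsLinear (λ F → L (F ∘ h))
  linear-∘ lin h = record
    { cong = λ e → cong (λ i → e (h i)) ; +-homo = λ F G → +-homo _ _ ; *-homo = λ a F → *-homo a _ }
    where open IsLinear lin

  ap-swap : ∀ {i a} {I : Set i} {X : Set a} {L : (I → Carrier) → Carrier} → IsLinear L →
    (p : Lin X) (G : X → I → Carrier) → L (λ i → ap p (λ x → G x i)) ≈ ap p (λ x → L (G x))
  ap-swap lin []            G = IsLinear.0-homo lin
  ap-swap lin ((a , x) ∷ p) G =
    trans (+-homo _ _) (+-cong (*-homo a (G x)) (ap-swap lin p G))
    where open IsLinear lin

  -- Off-diagonal terms cancel in pairs. The diagonal has its own hypothesis, because being equal to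
  -- its own negative does not make an element zero when 2 is a zero divisor.
  ap-alternating : ∀ {a} {X : Set a} (p : Lin X) (M : X → X → Carrier) →
    (∀ x → M x x ≈ 0#) → (∀ x y → M x y ≈ - M y x) → ap p (λ x → ap p (M x)) ≈ 0#
  ap-alternating [] M M-diag M-swap = refl
  ap-alternating ((a , x) ∷ p) M M-diag M-swap = begin
    a * (a * M x x + ap p (M x)) + ap p (λ y → a * M y x + ap p (M y))
      ≈⟨ +-cong (*-congˡ (+-congʳ (*-congˡ (M-diag x)))) (P.+-homo _ _) ⟩
    a * (a * 0# + ap p (M x)) + (ap p (λ y → a * M y x) + ap p (λ y → ap p (M y)))
      ≈⟨ +-congˡ (+-cong (P.cong (λ y → *-congˡ (M-swap y x))) (ap-alternating p M M-diag M-swap)) ⟩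
    a * (a * 0# + ap p (M x)) + (ap p (λ y → a * - M x y) + 0#)
      ≈⟨ +-congˡ (+-congʳ (trans (P.*-homo a _) (*-congˡ (P.-‿homo _)))) ⟩
    a * (a * 0# + ap p (M x)) + (a * - ap p (M x) + 0#)
      ≈⟨ solve 2 (λ a m → a :* (a :* con (ℤ.+ 0) :+ m) :+ (a :* :- m :+ con (ℤ.+ 0)) := con (ℤ.+ 0)) refl a _ ⟩
    0# ∎
    where module P = IsLinear (ap-linear p)

  record Alternating {a} {X : Set a} (A : Fun X) : Set (a Level.⊔ c Level.⊔ ℓ) where
    constructor alternating′
    field
      adjacent : ∀ α x γ → A (α ++ x ∷ x ∷ γ) ≈ 0#
      exchange : ∀ α x y γ → A (α ++ x ∷ y ∷ γ) ≈ - A (α ++ y ∷ x ∷ γ)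

  open Alternating

  head-alternating : ∀ {a} {X : Set a} {A : Fun X} → Alternating A → ∀ x → Alternating (A ⟨ x ⟩)
  head-alternating alt x = record
    { adjacent = λ α → adjacent alt (x ∷ α) ; exchange = λ α → exchange alt (x ∷ α) }

  map-alternating : ∀ {a b} {X : Set a} {Y : Set b} {A : Fun Y} → Alternating A →
    (h : X → Y) → Alternating (A ∘ map h)
  map-alternating {A = A} alt h = record
    { adjacent = λ α x γ → trans (reflexive (≡.cong A (Listₚ.map-++ h α _))) (adjacent alt (map h α) (h x) (map h γ))
    ; exchange = λ α x y γ → trans (reflexive (≡.cong A (Listₚ.map-++ h α _)))
        (trans (exchange alt (map h α) (h x) (h y) (map h γ)) (-‿cong (reflexive (≡.cong A (≡.sym (Listₚ.map-++ h α _)))))) }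

  Ev-alternating : ∀ {a} {X : Set a} {A : Fun X} → Alternating A → Alternating (Ev A)
  Ev-alternating alt = record { adjacent = adj alt ; exchange = exc alt }
    where
    adj : ∀ {A} → Alternating A → ∀ α p γ → Ev A (α ++ p ∷ p ∷ γ) ≈ 0#
    adj alt []      p γ = ap-alternating p _
      (λ x → IsLinear.vanish (Ev-linear γ) (λ xs → adjacent alt [] x xs))
      (λ x y → trans (IsLinear.cong (Ev-linear γ) (λ xs → exchange alt [] x y xs)) (IsLinear.-‿homo (Ev-linear γ) _))
    adj alt (q ∷ α) p γ = IsLinear.vanish (ap-linear q) (λ x → adj (head-alternating alt x) α p γ)
    exc : ∀ {A} → Alternating A → ∀ α p q γ → Ev A (α ++ p ∷ q ∷ γ) ≈ - Ev A (α ++ q ∷ p ∷ γ)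
    exc {A} alt [] p q γ = begin
      ap p (λ x → ap q (λ y → Ev (A ⟨ x ⟩ ⟨ y ⟩) γ))
        ≈⟨ ap-swap (ap-linear p) q (λ y x → Ev (A ⟨ x ⟩ ⟨ y ⟩) γ) ⟩
      ap q (λ y → ap p (λ x → Ev (A ⟨ x ⟩ ⟨ y ⟩) γ))
        ≈⟨ IsLinear.cong (ap-linear q) (λ y → IsLinear.cong (ap-linear p) (λ x →
             trans (IsLinear.cong (Ev-linear γ) (λ xs → exchange alt [] x y xs)) (IsLinear.-‿homo (Ev-linear γ) _))) ⟩
      ap q (λ y → ap p (λ x → - Ev (A ⟨ y ⟩ ⟨ x ⟩) γ))
        ≈⟨ IsLinear.cong (ap-linear q) (λ y → IsLinear.-‿homo (ap-linear p) _) ⟩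
      ap q (λ y → - ap p (λ x → Ev (A ⟨ y ⟩ ⟨ x ⟩) γ))
        ≈⟨ IsLinear.-‿homo (ap-linear q) _ ⟩
      - ap q (λ y → ap p (λ x → Ev (A ⟨ y ⟩ ⟨ x ⟩) γ)) ∎
    exc alt (r ∷ α) p q γ = trans (IsLinear.cong (ap-linear r) (λ x → exc (head-alternating alt x) α p q γ))
      (IsLinear.-‿homo (ap-linear r) _)

  sign : ℕ → Carrier
  sign zero    = 1#
  sign (suc n) = - sign n

  front-to-back : ∀ {a} {X : Set a} {A : Fun X} → Alternating A → ∀ x β γ →
    A (x ∷ β ++ γ) ≈ sign (length β) * A (β ++ x ∷ γ)
  front-to-back alt x []      γ = sym (*-identityˡ _)
  front-to-back {A = A} alt x (y ∷ β) γ = begin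
    A (x ∷ y ∷ β ++ γ)                             ≈⟨ exchange alt [] x y _ ⟩
    - A (y ∷ x ∷ β ++ γ)                           ≈⟨ -‿cong (front-to-back (head-alternating alt y) x β γ) ⟩
    - (sign (length β) * A (y ∷ β ++ x ∷ γ))       ≈⟨ solve 2 (λ s m → :- (s :* m) := :- s :* m) refl _ _ ⟩
    - sign (length β) * A (y ∷ β ++ x ∷ γ)         ∎

  repeated : ∀ {a} {X : Set a} {A : Fun X} → Alternating A → ∀ α x β γ →
    A (α ++ x ∷ β ++ x ∷ γ) ≈ 0#
  repeated alt (y ∷ α) x β γ = repeated (head-alternating alt y) α x β γ
  repeated {A = A} alt [] x β γ = begin
    A (x ∷ β ++ x ∷ γ)                     ≈⟨ front-to-back alt x β (x ∷ γ) ⟩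
    sign (length β) * A (β ++ x ∷ x ∷ γ)   ≈⟨ *-congˡ (adjacent alt β x γ) ⟩
    sign (length β) * 0#                   ≈⟨ zeroʳ _ ⟩
    0#                                     ∎

  pow-+ : ∀ x m n → pow R x (m ℕ.+ n) ≈ pow R x m * pow R x n
  pow-+ x zero    n = sym (*-identityˡ _)
  pow-+ x (suc m) n = trans (*-congˡ (pow-+ x m n)) (sym (*-assoc _ _ _))

  -- The antisymmetrised product of the one-variable functional k ↦ yᵏ and A.
  Wd : Carrier → Fun ℕ → Fun ℕ
  Wd y A []       = 0#
  Wd y A (k ∷ ks) = pow R y k * A ks - Wd y (A ⟨ k ⟩) ks

  Wd-linear : ∀ y ks → IsLinear (λ A → Wd y A ks)
  Wd-linear y [] = record
    { cong = λ _ → refl ; +-homo = λ _ _ → sym (+-identityˡ 0#) ; *-homo = λ a _ → sym (zeroʳ a) }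
  Wd-linear y (k ∷ ks) = record
    { cong = λ e → +-cong (*-congˡ (e ks)) (-‿cong (W.cong (λ ls → e (k ∷ ls))))
    ; +-homo = λ F G → trans (+-congˡ (-‿cong (W.+-homo _ _)))
        (solve 5 (λ p f g m n → p :* (f :+ g) :- (m :+ n) := (p :* f :- m) :+ (p :* g :- n)) refl _ _ _ _ _)
    ; *-homo = λ a F → trans (+-congˡ (-‿cong (W.*-homo a _)))
        (solve 4 (λ p a f m → p :* (a :* f) :- a :* m := a :* (p :* f :- m)) refl _ a _ _) }
    where module W = IsLinear (Wd-linear y ks)

  Wd-alternating : ∀ y {A} → Alternating A → Alternating (Wd y A)
  Wd-alternating y alt = record { adjacent = adj alt ; exchange = exc alt }
    where
    adj : ∀ {A} → Alternating A → ∀ α x γ → Wd y A (α ++ x ∷ x ∷ γ) ≈ 0#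
    adj {A} alt [] x γ = trans
      (+-congˡ (-‿cong (+-congˡ (-‿cong (IsLinear.vanish (Wd-linear y γ) (adjacent alt [] x))))))
      (solve 1 (λ m → m :- (m :- con (ℤ.+ 0)) := con (ℤ.+ 0)) refl _)
    adj {A} alt (k ∷ α) x γ = trans
      (+-cong (*-congˡ (adjacent alt α x γ)) (-‿cong (adj (head-alternating alt k) α x γ)))
      (solve 1 (λ m → m :* con (ℤ.+ 0) :- con (ℤ.+ 0) := con (ℤ.+ 0)) refl _)
    exc : ∀ {A} → Alternating A → ∀ α x z γ → Wd y A (α ++ x ∷ z ∷ γ) ≈ - Wd y A (α ++ z ∷ x ∷ γ)
    exc {A} alt [] x z γ = trans
      (+-congˡ (-‿cong (+-congˡ (-‿cong (trans (IsLinear.cong (Wd-linear y γ) (exchange alt [] x z))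
        (IsLinear.-‿homo (Wd-linear y γ) _))))))
      (solve 3 (λ a b m → a :- (b :- :- m) := :- (b :- (a :- m))) refl _ _ _)
    exc {A} alt (k ∷ α) x z γ = trans
      (+-cong (*-congˡ (exchange alt α x z γ)) (-‿cong (exc (head-alternating alt k) α x z γ)))
      (solve 3 (λ p m n → p :* :- m :- :- n := :- (p :* m :- n)) refl _ _ _)

positions : ℕ → List Bool → List ℕ
positions p []           = []
positions p (false ∷ bs) = positions (suc p) bs
positions p (true ∷ bs)  = p ∷ positions (suc p) bs

-- Operators acting on every variable, and division by t - y.

module Tensor {c ℓ} (R : CommutativeRing c ℓ) where
  open CommutativeRing R hiding (zero)
  open IntegerSolver R
  open Functionals R
  open import Relation.Binary.Reasoning.Setoid setoid

  Ten : (ℕ → Lin ℕ) → Fun ℕ → Fun ℕ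
  Ten K A ks = Ev A (map K ks)

  Ten-linear : ∀ K ks → IsLinear (λ A → Ten K A ks)
  Ten-linear K ks = Ev-linear (map K ks)

  Ten-alternating : ∀ K {A} → Alternating A → Alternating (Ten K A)
  Ten-alternating K alt = map-alternating (Ev-alternating alt) K

  -- As operators on sequences, difference y is T − y for the shift T, and antidifference y is a
  -- right inverse of it.
  difference antidifference : Carrier → ℕ → Lin ℕ
  difference y k = (1# , suc k) ∷ (- y , k) ∷ []
  antidifference y zero    = []
  antidifference y (suc k) = (1# , k) ∷ map (λ q → y * proj₁ q , proj₂ q) (antidifference y k)

  ap-scale : ∀ {a} {X : Set a} y (p : Lin X) f → ap (map (λ q → y * proj₁ q , proj₂ q) p) f ≈ y * ap p f
  ap-scale y []            f = sym (zeroʳ y)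
  ap-scale y ((a , x) ∷ p) f = trans (+-congˡ (ap-scale y p f))
    (solve 4 (λ y a x m → y :* a :* x :+ y :* m := y :* (a :* x :+ m)) refl y a (f x) _)

  difference-antidifference : ∀ y k f → ap (difference y k) (λ i → ap (antidifference y i) f) ≈ f k
  difference-antidifference y k f = trans
    (+-congʳ (*-congˡ (+-congˡ (ap-scale y (antidifference y k) f))))
    (solve 3 (λ y f m → con (ℤ.+ 1) :* (con (ℤ.+ 1) :* f :+ y :* m) :+ (:- y :* m :+ con (ℤ.+ 0)) := f) refl y (f k) _)

  -- This is division of a functional by the product of the t_i - y: composing the quotient with
  -- multiplication by that product returns the functional.
  Ten-difference-antidifference : ∀ y A ks →
    Ten (difference y) (Ten (antidifference y) A) ks ≈ A ks
  Ten-difference-antidifference y A [] = refl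
  Ten-difference-antidifference y A (k ∷ ks) = begin
    ap (difference y k) (λ i → Ten (difference y) (λ ls → ap (antidifference y i) (λ j → Ten (antidifference y) (A ⟨ j ⟩) ls)) ks)
      ≈⟨ IsLinear.cong (ap-linear (difference y k)) (λ i →
           trans (ap-swap (Ten-linear (difference y) ks) (antidifference y i) _)
                 (IsLinear.cong (ap-linear (antidifference y i)) (λ j → Ten-difference-antidifference y (A ⟨ j ⟩) ks))) ⟩
    ap (difference y k) (λ i → ap (antidifference y i) (λ j → A (j ∷ ks)))
      ≈⟨ difference-antidifference y k _ ⟩
    A (k ∷ ks) ∎

-- The factors F, and the transfer of one row of a triangle.

module Coupling {c ℓ} (R : CommutativeRing c ℓ) (u v w : CommutativeRing.Carrier R) where
  open CommutativeRing R hiding (zero)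
  open IntegerSolver R
  open Functionals R
  open Tensor R
  open Alternating
  open import Relation.Binary.Reasoning.Setoid setoid

  cons : ℕ × List ℕ → List ℕ
  cons (k , ks) = k ∷ ks

  insert : ℕ → ℕ × List ℕ → ℕ × List ℕ
  insert l (k , ks) = k , l ∷ ks

  -- With a functional A standing for a linear form on polynomials and a list ks for the monomial
  -- t₁^k₁ t₂^k₂ ⋯, couple evaluates A at the monomial times ∏ⱼ (v + w t₁ + u t₁ tⱼ), j > 1, and
  -- coupleAll at the monomial times ∏_{i<j} (v + w tᵢ + u tᵢ tⱼ).
  couple : (ℕ × List ℕ → Carrier) → ℕ → Fun ℕ
  couple A k []       = A (k , [])
  couple A k (l ∷ ls) = v * couple (A ∘ insert l) k ls + w * couple (A ∘ insert l) (suc k) ls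
                        + u * couple (A ∘ insert (suc l)) (suc k) ls

  coupleAll : Fun ℕ → Fun ℕ
  coupleAll A []       = A []
  coupleAll A (k ∷ ks) = coupleAll (couple (A ∘ cons) k) ks

  combine-linear : ∀ {i} {I : Set i} {L M N : (I → Carrier) → Carrier} →
    IsLinear L → IsLinear M → IsLinear N → IsLinear (λ F → v * L F + w * M F + u * N F)
  combine-linear l m n = record
    { cong = λ e → +-cong (+-cong (*-congˡ (L.cong e)) (*-congˡ (M.cong e))) (*-congˡ (N.cong e))
    ; +-homo = λ F G → trans (+-cong (+-cong (*-congˡ (L.+-homo F G)) (*-congˡ (M.+-homo F G))) (*-congˡ (N.+-homo F G)))
        (solve 9 (λ v w u a b c d e f → v :* (a :+ b) :+ w :* (c :+ d) :+ u :* (e :+ f)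
          := (v :* a :+ w :* c :+ u :* e) :+ (v :* b :+ w :* d :+ u :* f)) refl v w u _ _ _ _ _ _)
    ; *-homo = λ a F → trans (+-cong (+-cong (*-congˡ (L.*-homo a F)) (*-congˡ (M.*-homo a F))) (*-congˡ (N.*-homo a F)))
        (solve 7 (λ v w u a b c d → v :* (a :* b) :+ w :* (a :* c) :+ u :* (a :* d)
          := a :* (v :* b :+ w :* c :+ u :* d)) refl v w u a _ _ _) }
    where
    module L = IsLinear l
    module M = IsLinear m
    module N = IsLinear n

  couple-linear : ∀ k ls → IsLinear (λ A → couple A k ls)
  couple-linear k [] = record { cong = λ e → e (k , []) ; +-homo = λ _ _ → refl ; *-homo = λ _ _ → refl }
  couple-linear k (l ∷ ls) = combine-linear
    (linear-∘ (couple-linear k ls) (insert l)) (linear-∘ (couple-linear (suc k) ls) (insert l))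
    (linear-∘ (couple-linear (suc k) ls) (insert (suc l)))

  coupleAll-linear : ∀ ks → IsLinear (λ A → coupleAll A ks)
  coupleAll-linear [] = record { cong = λ e → e [] ; +-homo = λ _ _ → refl ; *-homo = λ _ _ → refl }
  coupleAll-linear (k ∷ ks) = record
    { cong = λ e → D.cong (λ ls → IsLinear.cong (couple-linear k ls) (λ i → e (cons i)))
    ; +-homo = λ F G → trans (D.cong (λ ls → IsLinear.+-homo (couple-linear k ls) _ _)) (D.+-homo _ _)
    ; *-homo = λ a F → trans (D.cong (λ ls → IsLinear.*-homo (couple-linear k ls) _ _)) (D.*-homo a _) }
    where module D = IsLinear (coupleAll-linear ks)

  couple-shift : ∀ A k ls → couple (λ q → A (suc (proj₁ q) , proj₂ q)) k ls ≈ couple A (suc k) ls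
  couple-shift A k [] = refl
  couple-shift A k (l ∷ ls) = +-cong (+-cong (*-congˡ (couple-shift (A ∘ insert l) k ls))
    (*-congˡ (couple-shift (A ∘ insert l) (suc k) ls))) (*-congˡ (couple-shift (A ∘ insert (suc l)) (suc k) ls))

  -- The product multiplied in is symmetric in the tail variables. On equal neighbours at the front,
  -- the terms that do not vanish by themselves come in pairs with exponents (x, x + 1) and (x + 1,
  -- x).
  couple-alternating : ∀ {A} → (∀ k → Alternating (λ ls → A (k , ls))) → ∀ k → Alternating (couple A k)
  couple-alternating alt k = record { adjacent = adj alt k ; exchange = exc alt k }
    where
    adj : ∀ {A} → (∀ k → Alternating (λ ls → A (k , ls))) → ∀ k α x γ → couple A k (α ++ x ∷ x ∷ γ) ≈ 0#
    exc : ∀ {A} → (∀ k → Alternating (λ ls → A (k , ls))) → ∀ k α x y γ →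
      couple A k (α ++ x ∷ y ∷ γ) ≈ - couple A k (α ++ y ∷ x ∷ γ)
    adj alt k (z ∷ α) x γ = trans
      (+-cong (+-cong (*-congˡ (adj (λ k → head-alternating (alt k) z) k α x γ))
        (*-congˡ (adj (λ k → head-alternating (alt k) z) (suc k) α x γ)))
        (*-congˡ (adj (λ k → head-alternating (alt k) (suc z)) (suc k) α x γ)))
      (solve 3 (λ v w u → v :* con (ℤ.+ 0) :+ w :* con (ℤ.+ 0) :+ u :* con (ℤ.+ 0) := con (ℤ.+ 0)) refl v w u)
    adj {A} alt k [] x γ = trans
      (+-cong (+-cong
        (*-congˡ (+-cong (+-cong (*-congˡ (diag x k)) (*-congˡ (diag x _))) refl))
        (*-congˡ (+-cong (+-cong (*-congˡ (diag x _)) (*-congˡ (diag x _))) refl)))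
        (*-congˡ (+-cong (+-cong (*-congˡ (anti (suc x) x _)) (*-congˡ (anti (suc x) x _))) (*-congˡ (diag (suc x) _)))))
      (solve 5 (λ v w u m n → v :* (v :* con (ℤ.+ 0) :+ w :* con (ℤ.+ 0) :+ u :* m)
          :+ w :* (v :* con (ℤ.+ 0) :+ w :* con (ℤ.+ 0) :+ u :* n)
          :+ u :* (v :* :- m :+ w :* :- n :+ u :* con (ℤ.+ 0)) := con (ℤ.+ 0)) refl v w u _ _)
      where
      diag : ∀ x k → couple (A ∘ insert x ∘ insert x) k γ ≈ 0#
      diag x k = IsLinear.vanish (couple-linear k γ) (λ q → adjacent (alt (proj₁ q)) [] x (proj₂ q))
      anti : ∀ x y k → couple (A ∘ insert x ∘ insert y) k γ ≈ - couple (A ∘ insert y ∘ insert x) k γ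
      anti x y k = trans (IsLinear.cong (couple-linear k γ) (λ q → exchange (alt (proj₁ q)) [] x y (proj₂ q)))
        (IsLinear.-‿homo (couple-linear k γ) _)
    exc alt k (z ∷ α) x y γ = trans
      (+-cong (+-cong (*-congˡ (exc (λ k → head-alternating (alt k) z) k α x y γ))
        (*-congˡ (exc (λ k → head-alternating (alt k) z) (suc k) α x y γ)))
        (*-congˡ (exc (λ k → head-alternating (alt k) (suc z)) (suc k) α x y γ)))
      (solve 6 (λ v w u a b d → v :* :- a :+ w :* :- b :+ u :* :- d := :- (v :* a :+ w :* b :+ u :* d)) refl v w u _ _ _)
    exc {A} alt k [] x y γ = trans
      (+-cong (+-cong
        (*-congˡ (+-cong (+-cong (*-congˡ (anti x y k)) (*-congˡ (anti x y _))) (*-congˡ (anti x (suc y) _))))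
        (*-congˡ (+-cong (+-cong (*-congˡ (anti x y _)) (*-congˡ (anti x y _))) (*-congˡ (anti x (suc y) _)))))
        (*-congˡ (+-cong (+-cong (*-congˡ (anti (suc x) y _)) (*-congˡ (anti (suc x) y _))) (*-congˡ (anti (suc x) (suc y) _)))))
      (solve 11 (λ v w u a b d e f g h i →
          v :* (v :* :- a :+ w :* :- b :+ u :* :- d) :+ w :* (v :* :- b :+ w :* :- e :+ u :* :- f) :+ u :* (v :* :- g :+ w :* :- h :+ u :* :- i)
          := :- (v :* (v :* a :+ w :* b :+ u :* g) :+ w :* (v :* b :+ w :* e :+ u :* h) :+ u :* (v :* d :+ w :* f :+ u :* i)))
        refl v w u _ _ _ _ _ _ _ _)
      where
      anti : ∀ x y k → couple (A ∘ insert x ∘ insert y) k γ ≈ - couple (A ∘ insert y ∘ insert x) k γ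
      anti x y k = trans (IsLinear.cong (couple-linear k γ) (λ q → exchange (alt (proj₁ q)) [] x y (proj₂ q)))
        (IsLinear.-‿homo (couple-linear k γ) _)

  -- Two heads, coupled to the tail but not to each other.
  couple₂ : (ℕ × ℕ × List ℕ → Carrier) → ℕ → ℕ → Fun ℕ
  couple₂ A a b γ = couple (λ q → couple (λ p → A (proj₁ p , proj₁ q , proj₂ p)) a (proj₂ q)) b γ

  insert₂ : ℕ → ℕ × ℕ × List ℕ → ℕ × ℕ × List ℕ
  insert₂ l (a , b , ls) = a , b , l ∷ ls

  couple₂-∷ : ∀ A a b l γ → couple₂ A a b (l ∷ γ) ≈
    v * (v * couple₂ (A ∘ insert₂ l) a b γ + w * couple₂ (A ∘ insert₂ l) (suc a) b γ
         + u * couple₂ (A ∘ insert₂ (suc l)) (suc a) b γ)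
    + w * (v * couple₂ (A ∘ insert₂ l) a (suc b) γ + w * couple₂ (A ∘ insert₂ l) (suc a) (suc b) γ
         + u * couple₂ (A ∘ insert₂ (suc l)) (suc a) (suc b) γ)
    + u * (v * couple₂ (A ∘ insert₂ (suc l)) a (suc b) γ + w * couple₂ (A ∘ insert₂ (suc l)) (suc a) (suc b) γ
         + u * couple₂ (A ∘ insert₂ (suc (suc l))) (suc a) (suc b) γ)
  couple₂-∷ A a b l γ = +-cong (+-cong
    (*-congˡ (IsLinear.lin₃ (couple-linear b γ) v _ w _ u _))
    (*-congˡ (IsLinear.lin₃ (couple-linear (suc b) γ) v _ w _ u _)))
    (*-congˡ (IsLinear.lin₃ (couple-linear (suc b) γ) v _ w _ u _))

  -- The tail factors of the two heads are the product of all F(t₁, t_j) F(t₂, t_j), which is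
  -- symmetric in t₁ and t₂, so antisymmetry in the heads survives.
  couple₂-exchange : ∀ {A} → (∀ a b ls → A (a , b , ls) ≈ - A (b , a , ls)) →
    ∀ a b γ → couple₂ A a b γ ≈ - couple₂ A b a γ
  couple₂-exchange anti a b [] = anti a b []
  couple₂-exchange {A} anti a b (l ∷ γ) = begin
    couple₂ A a b (l ∷ γ) ≈⟨ couple₂-∷ A a b l γ ⟩
    _ ≈⟨ +-cong (+-cong
        (*-congˡ (+-cong (+-cong (*-congˡ (IH l a b)) (*-congˡ (IH l _ b))) (*-congˡ (IH (suc l) _ b))))
        (*-congˡ (+-cong (+-cong (*-congˡ (IH l a _)) (*-congˡ (IH l _ _))) (*-congˡ (IH (suc l) _ _)))))
        (*-congˡ (+-cong (+-cong (*-congˡ (IH (suc l) a _)) (*-congˡ (IH (suc l) _ _))) (*-congˡ (IH (suc (suc l)) _ _)))) ⟩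
    _ ≈⟨ solve 11 (λ v w u m₀ m₁ m₂ m₃ m₄ m₅ m₆ m₇ →
          v :* (v :* :- m₀ :+ w :* :- m₁ :+ u :* :- m₂) :+ w :* (v :* :- m₃ :+ w :* :- m₄ :+ u :* :- m₅)
            :+ u :* (v :* :- m₆ :+ w :* :- m₅ :+ u :* :- m₇)
          := :- (v :* (v :* m₀ :+ w :* m₃ :+ u :* m₆) :+ w :* (v :* m₁ :+ w :* m₄ :+ u :* m₅)
            :+ u :* (v :* m₂ :+ w :* m₅ :+ u :* m₇))) refl v w u _ _ _ _ _ _ _ _ ⟩
    _ ≈⟨ -‿cong (couple₂-∷ A b a l γ) ⟨
    - couple₂ A b a (l ∷ γ) ∎
    where
    IH : ∀ l a b → couple₂ (A ∘ insert₂ l) a b γ ≈ - couple₂ (A ∘ insert₂ l) b a γ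
    IH l a b = couple₂-exchange (λ a b ls → anti a b (l ∷ ls)) a b γ

  couple₂-diagonal : ∀ {A} → (∀ a ls → A (a , a , ls) ≈ 0#) → (∀ a b ls → A (a , b , ls) ≈ - A (b , a , ls)) →
    ∀ a γ → couple₂ A a a γ ≈ 0#
  couple₂-diagonal diag anti a [] = diag a []
  couple₂-diagonal {A} diag anti a (l ∷ γ) = begin
    couple₂ A a a (l ∷ γ) ≈⟨ couple₂-∷ A a a l γ ⟩
    _ ≈⟨ +-cong (+-cong
        (*-congˡ (+-cong (+-cong (*-congˡ (IH l a)) refl) refl))
        (*-congˡ (+-cong (+-cong (*-congˡ (ex l a _)) (*-congˡ (IH l _))) (*-congˡ (IH (suc l) _)))))
        (*-congˡ (+-cong (+-cong (*-congˡ (ex (suc l) a _)) (*-congˡ (IH (suc l) _))) (*-congˡ (IH (suc (suc l)) _)))) ⟩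
    _ ≈⟨ solve 5 (λ v w u m₁ m₂ →
          v :* (v :* con (ℤ.+ 0) :+ w :* m₁ :+ u :* m₂) :+ w :* (v :* :- m₁ :+ w :* con (ℤ.+ 0) :+ u :* con (ℤ.+ 0))
            :+ u :* (v :* :- m₂ :+ w :* con (ℤ.+ 0) :+ u :* con (ℤ.+ 0)) := con (ℤ.+ 0)) refl v w u _ _ ⟩
    0# ∎
    where
    IH : ∀ l a → couple₂ (A ∘ insert₂ l) a a γ ≈ 0#
    IH l a = couple₂-diagonal (λ a ls → diag a (l ∷ ls)) (λ a b ls → anti a b (l ∷ ls)) a γ
    ex : ∀ l a b → couple₂ (A ∘ insert₂ l) a b γ ≈ - couple₂ (A ∘ insert₂ l) b a γ
    ex l a b = couple₂-exchange (λ a b ls → anti a b (l ∷ ls)) a b γ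

  -- Splits off the factor F(t₁, t₂) between the two heads. The rest is symmetric in them, so all
  -- failure of antisymmetry sits in this factor.
  couple-couple : ∀ A a b γ → couple (couple A a ∘ cons) b γ ≈
    v * couple₂ (λ q → A (proj₁ q , cons (proj₂ q))) a b γ + w * couple₂ (λ q → A (proj₁ q , cons (proj₂ q))) (suc a) b γ
    + u * couple₂ (λ q → A (proj₁ q , cons (proj₂ q))) (suc a) (suc b) γ
  couple-couple A a b γ = trans (IsLinear.lin₃ (couple-linear b γ) v _ w _ u _)
    (+-congˡ (*-congˡ (couple-shift (λ q → couple (λ p → A (proj₁ p , proj₁ q ∷ proj₂ p)) (suc a) (proj₂ q)) b γ)))

  -- What survives of antisymmetry after multiplication by ∏_{i<j} (v + w tᵢ + u tᵢ tⱼ): the product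
  -- with v + w tᵢ₊₁ + u tᵢ tᵢ₊₁ is symmetric in tᵢ and tᵢ₊₁.
  Deformed : Fun ℕ → Set ℓ
  Deformed B = ∀ α k γ →
    v * B (α ++ k ∷ k ∷ γ) + w * B (α ++ k ∷ suc k ∷ γ) + u * B (α ++ suc k ∷ suc k ∷ γ) ≈ 0#

  -- Variables are peeled off on the left until the two neighbours are the heads. There the
  -- multiplier F(t₂, t₁) completes F(t₁, t₂) to a symmetric product, and an alternating functional
  -- vanishes on a symmetric polynomial of this kind.
  coupleAll-deformed : ∀ {A} → Alternating A → Deformed (coupleAll A)
  coupleAll-deformed {A} alt (x ∷ α) k γ = coupleAll-deformed (couple-alternating (λ k → head-alternating alt k) x) α k γ
  coupleAll-deformed {A} alt [] k γ = begin
    v * coupleAll (E k k) γ + w * coupleAll (E k (suc k)) γ + u * coupleAll (E (suc k) (suc k)) γ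
      ≈⟨ IsLinear.lin₃ (coupleAll-linear γ) v _ w _ u _ ⟨
    coupleAll (λ ls → v * E k k ls + w * E k (suc k) ls + u * E (suc k) (suc k) ls) γ
      ≈⟨ IsLinear.vanish (coupleAll-linear γ) pointwise ⟩
    0# ∎
    where
    E : ℕ → ℕ → Fun ℕ
    E a b = couple (couple (A ∘ cons) a ∘ cons) b
    C₂ : ℕ → ℕ → Fun ℕ
    C₂ = couple₂ (λ q → A (proj₁ q ∷ cons (proj₂ q)))
    anti : ∀ a b ls → C₂ a b ls ≈ - C₂ b a ls
    anti = couple₂-exchange (λ a b → exchange alt [] a b)
    diag : ∀ a ls → C₂ a a ls ≈ 0#
    diag = couple₂-diagonal (λ a → adjacent alt [] a) (λ a b → exchange alt [] a b)
    pointwise : ∀ ls → v * E k k ls + w * E k (suc k) ls + u * E (suc k) (suc k) ls ≈ 0#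
    pointwise ls = begin
      v * E k k ls + w * E k (suc k) ls + u * E (suc k) (suc k) ls
        ≈⟨ +-cong (+-cong (*-congˡ (couple-couple (A ∘ cons) k k ls)) (*-congˡ (couple-couple (A ∘ cons) k (suc k) ls)))
             (*-congˡ (couple-couple (A ∘ cons) (suc k) (suc k) ls)) ⟩
      _ ≈⟨ +-cong (+-cong
             (*-congˡ (+-cong (+-cong (*-congˡ (diag k ls)) (*-congˡ (anti (suc k) k ls))) (*-congˡ (diag (suc k) ls))))
             (*-congˡ (+-cong (+-cong refl (*-congˡ (diag (suc k) ls))) refl)))
             (*-congˡ (+-cong (+-cong (*-congˡ (diag (suc k) ls)) (*-congˡ (anti (suc (suc k)) (suc k) ls))) (*-congˡ (diag (suc (suc k)) ls)))) ⟩
      _ ≈⟨ solve 5 (λ v w u m n →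
             v :* (v :* con (ℤ.+ 0) :+ w :* :- m :+ u :* con (ℤ.+ 0)) :+ w :* (v :* m :+ w :* con (ℤ.+ 0) :+ u :* n)
             :+ u :* (v :* con (ℤ.+ 0) :+ w :* :- n :+ u :* con (ℤ.+ 0)) := con (ℤ.+ 0)) refl v w u _ _ ⟩
      0# ∎

  -- That K commutes with multiplication by t. `antidifference` fails this at exponent 0; the
  -- operators carried through the coupling are `difference` and `boundary`.
  Equivariant : (ℕ → Lin ℕ) → Set (c Level.⊔ ℓ)
  Equivariant K = ∀ k f → ap (K (suc k)) f ≈ ap (K k) (f ∘ suc)

  couple-Ten : ∀ K → Equivariant K → ∀ A k ls →
    couple (λ q → ap (K (proj₁ q)) (λ i → Ten K (λ ls′ → A (i , ls′)) (proj₂ q))) k ls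
    ≈ ap (K k) (λ i → Ten K (couple A i) ls)
  couple-Ten K eqv A k [] = refl
  couple-Ten K eqv A k (l ∷ ls) = begin
    _ ≈⟨ +-cong (+-cong (*-congˡ (step k l)) (*-congˡ (step (suc k) l))) (*-congˡ (step (suc k) (suc l))) ⟩
    v * ap (K l) (λ j → ap (K k) (Φ j)) + w * ap (K l) (λ j → ap (K (suc k)) (Φ j))
      + u * ap (K (suc l)) (λ j → ap (K (suc k)) (Φ j))
      ≈⟨ +-cong (+-congˡ (*-congˡ (L.cong (λ j → eqv k (Φ j)))))
           (*-congˡ (trans (eqv l _) (L.cong (λ j → eqv k (Φ (suc j)))))) ⟩
    v * ap (K l) (λ j → ap (K k) (Φ j)) + w * ap (K l) (λ j → ap (K k) (Φ j ∘ suc))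
      + u * ap (K l) (λ j → ap (K k) (Φ (suc j) ∘ suc))
      ≈⟨ L.lin₃ v _ w _ u _ ⟨
    ap (K l) (λ j → v * ap (K k) (Φ j) + w * ap (K k) (Φ j ∘ suc) + u * ap (K k) (Φ (suc j) ∘ suc))
      ≈⟨ L.cong (λ j → IsLinear.lin₃ (ap-linear (K k)) v _ w _ u _) ⟨
    ap (K l) (λ j → ap (K k) (λ i → v * Φ j i + w * Φ j (suc i) + u * Φ (suc j) (suc i)))
      ≈⟨ L.cong (λ j → IsLinear.cong (ap-linear (K k)) (λ i → IsLinear.lin₃ (Ten-linear K ls) v _ w _ u _)) ⟨
    ap (K l) (λ j → ap (K k) (λ i → Ten K (couple A i ⟨ j ⟩) ls))
      ≈⟨ ap-swap (ap-linear (K l)) (K k) (λ i j → Ten K (couple A i ⟨ j ⟩) ls) ⟩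
    ap (K k) (λ i → Ten K (couple A i) (l ∷ ls)) ∎
    where
    module L = IsLinear (ap-linear (K l))
    Φ : ℕ → ℕ → Carrier
    Φ j i = Ten K (couple (A ∘ insert j) i) ls
    step : ∀ k l → couple ((λ q → ap (K (proj₁ q)) (λ i → Ten K (λ ls′ → A (i , ls′)) (proj₂ q))) ∘ insert l) k ls
           ≈ ap (K l) (λ j → ap (K k) (λ i → Ten K (couple (A ∘ insert j) i) ls))
    step k l = begin
      _ ≈⟨ IsLinear.cong (couple-linear k ls) (λ q → ap-swap (ap-linear (K (proj₁ q))) (K l) (λ j i → Ten K (λ ls′ → A (i , j ∷ ls′)) (proj₂ q))) ⟩
      _ ≈⟨ ap-swap (couple-linear k ls) (K l) _ ⟩
      _ ≈⟨ IsLinear.cong (ap-linear (K l)) (λ j → couple-Ten K eqv (A ∘ insert j) k ls) ⟩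
      _ ∎

  coupleAll-Ten : ∀ K → Equivariant K → ∀ A ks → coupleAll (Ten K A) ks ≈ Ten K (coupleAll A) ks
  coupleAll-Ten K eqv A [] = refl
  coupleAll-Ten K eqv A (k ∷ ks) = begin
    coupleAll (couple (Ten K A ∘ cons) k) ks
      ≈⟨ D.cong (λ ls → couple-Ten K eqv (A ∘ cons) k ls) ⟩
    coupleAll (λ ls → ap (K k) (λ i → Ten K (couple (A ∘ cons) i) ls)) ks
      ≈⟨ ap-swap (coupleAll-linear ks) (K k) _ ⟩
    ap (K k) (λ i → coupleAll (Ten K (couple (A ∘ cons) i)) ks)
      ≈⟨ IsLinear.cong (ap-linear (K k)) (λ i → coupleAll-Ten K eqv (couple (A ∘ cons) i) ks) ⟩
    ap (K k) (λ i → Ten K (coupleAll (couple (A ∘ cons) i)) ks) ∎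
    where module D = IsLinear (coupleAll-linear ks)

  difference-equivariant : ∀ y → Equivariant (difference y)
  difference-equivariant y k f = refl

  -- Multiplication by F(y, t), for the variables to the right of the place taken by y. Its
  -- counterpart `attach` is multiplication by t^k F(t, y), for a variable to the left.
  boundary : Carrier → ℕ → Lin ℕ
  boundary y k = (v + w * y , k) ∷ (u * y , suc k) ∷ []

  attach : Carrier → ℕ → Fun ℕ → Fun ℕ
  attach y k B ls = v * B (k ∷ ls) + (w + u * y) * B (suc k ∷ ls)

  deformedWd : Carrier → Fun ℕ → Fun ℕ
  deformedWd y B []       = 0#
  deformedWd y B (k ∷ ks) = pow R y k * Ten (boundary y) B ks - deformedWd y (attach y k B) ks

  deformedWd-cong : ∀ y ks {A B} → (∀ ls → A ls ≈ B ls) → deformedWd y A ks ≈ deformedWd y B ks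
  deformedWd-cong y []       e = refl
  deformedWd-cong y (k ∷ ks) e = +-cong (*-congˡ (IsLinear.cong (Ten-linear (boundary y) ks) e))
    (-‿cong (deformedWd-cong y ks (λ ls → +-cong (*-congˡ (e (k ∷ ls))) (*-congˡ (e (suc k ∷ ls))))))

  couple-pow : ∀ y A k ls → couple (λ q → pow R y (proj₁ q) * A (proj₂ q)) k ls ≈ pow R y k * Ten (boundary y) A ls
  couple-pow y A k [] = refl
  couple-pow y A k (l ∷ ls) = trans
    (+-cong (+-cong (*-congˡ (couple-pow y (A ⟨ l ⟩) k ls)) (*-congˡ (couple-pow y (A ⟨ l ⟩) (suc k) ls)))
      (*-congˡ (couple-pow y (A ⟨ suc l ⟩) (suc k) ls)))
    (solve 7 (λ v w u y p m n → v :* (p :* m) :+ w :* (y :* p :* m) :+ u :* (y :* p :* n)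
      := p :* ((v :+ w :* y) :* m :+ (u :* y :* n :+ con (ℤ.+ 0)))) refl v w u y _ _ _)

  couple-Wd-tail : ∀ y A k ls → couple (λ q → Wd y (λ ls′ → A (proj₁ q , ls′)) (proj₂ q)) k ls
    ≈ Wd y (λ ls′ → v * couple A k ls′ + (w + u * y) * couple A (suc k) ls′) ls
  couple-Wd-tail y A k [] = refl
  couple-Wd-tail y A k (l ∷ ls) = begin
    _ ≈⟨ +-cong (+-cong (*-congˡ (step l k)) (*-congˡ (step l (suc k)))) (*-congˡ (step (suc l) (suc k))) ⟩
    _ ≈⟨ solve 12 (λ v w u y p c₀ c₁ a₀ a₁ a₂ b₁ b₂ →
           v :* (p :* c₀ :- (v :* a₀ :+ (w :+ u :* y) :* a₁)) :+ w :* (p :* c₁ :- (v :* a₁ :+ (w :+ u :* y) :* a₂))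
             :+ u :* (y :* p :* c₁ :- (v :* b₁ :+ (w :+ u :* y) :* b₂))
           := p :* (v :* c₀ :+ (w :+ u :* y) :* c₁) :- (v :* (v :* a₀ :+ w :* a₁ :+ u :* b₁) :+ (w :+ u :* y) :* (v :* a₁ :+ w :* a₂ :+ u :* b₂)))
         refl v w u y _ _ _ _ _ _ _ _ ⟩
    _ ≈⟨ +-congˡ (-‿cong (+-cong (*-congˡ (W.lin₃ v _ w _ u _)) (*-congˡ (W.lin₃ v _ w _ u _)))) ⟨
    _ ≈⟨ +-congˡ (-‿cong (W.lin₂ v _ (w + u * y) _)) ⟨
    _ ∎
    where
    module W = IsLinear (Wd-linear y ls)
    step : ∀ l k → couple ((λ q → Wd y (λ ls′ → A (proj₁ q , ls′)) (proj₂ q)) ∘ insert l) k ls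
      ≈ pow R y l * couple A k ls - (v * Wd y (couple (A ∘ insert l) k) ls + (w + u * y) * Wd y (couple (A ∘ insert l) (suc k)) ls)
    step l k = trans (IsLinear.sub-homo (couple-linear k ls) _ _)
      (+-cong (IsLinear.*-homo (couple-linear k ls) _ _)
        (-‿cong (trans (couple-Wd-tail y (A ∘ insert l) k ls) (W.lin₂ v _ (w + u * y) _))))

  -- In each term of the expansion one variable is evaluated at y. Its couplings then become F(y,
  -- t_j) with the later variables and F(t_j, y) with the earlier ones, which is what `deformedWd`
  -- collects.
  coupleAll-Wd : ∀ y A ks → coupleAll (Wd y A) ks ≈ deformedWd y (coupleAll A) ks
  coupleAll-Wd y A [] = refl
  coupleAll-Wd y A (k ∷ ks) = begin
    coupleAll (couple (Wd y A ∘ cons) k) ks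
      ≈⟨ D.cong (λ ls → trans (IsLinear.sub-homo (couple-linear k ls) _ _)
           (+-cong (couple-pow y A k ls) (-‿cong (couple-Wd-tail y (A ∘ cons) k ls)))) ⟩
    coupleAll (λ ls → pow R y k * Ten (boundary y) A ls - Wd y (attached) ls) ks
      ≈⟨ trans (D.sub-homo _ _) (+-congʳ (D.*-homo _ _)) ⟩
    pow R y k * coupleAll (Ten (boundary y) A) ks - coupleAll (Wd y attached) ks
      ≈⟨ +-cong (*-congˡ (coupleAll-Ten (boundary y) (λ _ _ → refl) A ks)) (-‿cong (coupleAll-Wd y attached ks)) ⟩
    pow R y k * Ten (boundary y) (coupleAll A) ks - deformedWd y (coupleAll attached) ks
      ≈⟨ +-congˡ (-‿cong (deformedWd-cong y ks (λ ls → IsLinear.lin₂ (coupleAll-linear ls) v _ (w + u * y) _))) ⟩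
    deformedWd y (coupleAll A) (k ∷ ks) ∎
    where
    module D = IsLinear (coupleAll-linear ks)
    attached : Fun ℕ
    attached ls = v * couple (A ∘ cons) k ls + (w + u * y) * couple (A ∘ cons) (suc k) ls

  -- Row-to-row transfer of the six-vertex model: the bits mark the lower row of a monotone triangle,
  -- the list handed to g the upper row, and the state tells whether the last position read was
  -- a lower-row entry.
  vertex : Carrier → Bool → List Bool → Fun Bool → Carrier
  vertex y false []           g = 0#
  vertex y true  []           g = g []
  vertex y false (false ∷ bs) g = y * vertex y false bs (g ⟨ false ⟩)
  vertex y true  (false ∷ bs) g = vertex y true bs (g ⟨ false ⟩) + (v + w * y + u * y * y) * vertex y false bs (g ⟨ true ⟩)
  vertex y false (true ∷ bs)  g = vertex y true bs (g ⟨ false ⟩) + v * vertex y false bs (g ⟨ true ⟩)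
  vertex y true  (true ∷ bs)  g = u * y * vertex y true bs (g ⟨ true ⟩)

  vertex-linear : ∀ y s bs → IsLinear (vertex y s bs)
  vertex-linear y false [] = ap-linear {X = List Bool} []
  vertex-linear y true [] = record { cong = λ e → e [] ; +-homo = λ _ _ → refl ; *-homo = λ _ _ → refl }
  vertex-linear y false (false ∷ bs) = record
    { cong = λ e → *-congˡ (W.cong (λ xs → e (false ∷ xs)))
    ; +-homo = λ F G → trans (*-congˡ (W.+-homo _ _)) (distribˡ _ _ _)
    ; *-homo = λ a F → trans (*-congˡ (W.*-homo a _)) (solve 3 (λ a b c → a :* (b :* c) := b :* (a :* c)) refl _ _ _) }
    where module W = IsLinear (vertex-linear y false bs)
  vertex-linear y true (true ∷ bs) = record
    { cong = λ e → *-congˡ (W.cong (λ xs → e (true ∷ xs)))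
    ; +-homo = λ F G → trans (*-congˡ (W.+-homo _ _)) (distribˡ _ _ _)
    ; *-homo = λ a F → trans (*-congˡ (W.*-homo a _)) (solve 3 (λ a b c → a :* (b :* c) := b :* (a :* c)) refl _ _ _) }
    where module W = IsLinear (vertex-linear y true bs)
  vertex-linear y true (false ∷ bs) = record
    { cong = λ e → +-cong (V.cong (λ xs → e (false ∷ xs))) (*-congˡ (W.cong (λ xs → e (true ∷ xs))))
    ; +-homo = λ F G → trans (+-cong (V.+-homo _ _) (*-congˡ (W.+-homo _ _)))
        (solve 5 (λ z a b c d → (a :+ b) :+ z :* (c :+ d) := (a :+ z :* c) :+ (b :+ z :* d)) refl _ _ _ _ _)
    ; *-homo = λ a F → trans (+-cong (V.*-homo a _) (*-congˡ (W.*-homo a _)))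
        (solve 4 (λ z a b c → a :* b :+ z :* (a :* c) := a :* (b :+ z :* c)) refl _ a _ _) }
    where
    module V = IsLinear (vertex-linear y true bs)
    module W = IsLinear (vertex-linear y false bs)
  vertex-linear y false (true ∷ bs) = record
    { cong = λ e → +-cong (V.cong (λ xs → e (false ∷ xs))) (*-congˡ (W.cong (λ xs → e (true ∷ xs))))
    ; +-homo = λ F G → trans (+-cong (V.+-homo _ _) (*-congˡ (W.+-homo _ _)))
        (solve 5 (λ z a b c d → (a :+ b) :+ z :* (c :+ d) := (a :+ z :* c) :+ (b :+ z :* d)) refl _ _ _ _ _)
    ; *-homo = λ a F → trans (+-cong (V.*-homo a _) (*-congˡ (W.*-homo a _)))
        (solve 4 (λ z a b c → a :* b :+ z :* (a :* c) := a :* (b :+ z :* c)) refl _ a _ _) }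
    where
    module V = IsLinear (vertex-linear y true bs)
    module W = IsLinear (vertex-linear y false bs)

  -- `deformedWd` with y^p divided out and the powers of y released one position at a time, in the
  -- way in which `vertex` collects them.
  columnWd : Carrier → ℕ → List Bool → Fun ℕ → Carrier
  columnWd y p []           B = 0#
  columnWd y p (false ∷ bs) B = y * columnWd y (suc p) bs B
  columnWd y p (true ∷ bs)  B = Ten (boundary y) B (positions (suc p) bs) - y * columnWd y (suc p) bs (attach y p B)

  columnWd-correct : ∀ y p bs B → pow R y p * columnWd y p bs B ≈ deformedWd y B (positions p bs)
  columnWd-correct y p [] B = zeroʳ _
  columnWd-correct y p (false ∷ bs) B = trans
    (solve 3 (λ p y m → p :* (y :* m) := y :* p :* m) refl _ y _) (columnWd-correct y (suc p) bs B)
  columnWd-correct y p (true ∷ bs) B = trans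
    (solve 4 (λ p y t m → p :* (t :- y :* m) := p :* t :- y :* p :* m) refl _ y _ _)
    (+-congˡ (-‿cong (columnWd-correct y (suc p) bs (attach y p B))))

  columnWd-linear : ∀ y p bs → IsLinear (columnWd y p bs)
  columnWd-linear y p [] = ap-linear {X = List ℕ} []
  columnWd-linear y p (false ∷ bs) = record
    { cong = λ e → *-congˡ (W.cong e)
    ; +-homo = λ F G → trans (*-congˡ (W.+-homo _ _)) (distribˡ _ _ _)
    ; *-homo = λ a F → trans (*-congˡ (W.*-homo a _)) (solve 3 (λ a b c → a :* (b :* c) := b :* (a :* c)) refl _ _ _) }
    where module W = IsLinear (columnWd-linear y (suc p) bs)
  columnWd-linear y p (true ∷ bs) = record
    { cong = λ e → +-cong (T.cong e) (-‿cong (*-congˡ (W.cong (λ ls → +-cong (*-congˡ (e (p ∷ ls))) (*-congˡ (e (suc p ∷ ls)))))))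
    ; +-homo = λ F G → trans (+-cong (T.+-homo _ _) (-‿cong (*-congˡ (trans
          (W.cong (λ ls → solve 6 (λ v z a b c d → v :* (a :+ b) :+ z :* (c :+ d) := (v :* a :+ z :* c) :+ (v :* b :+ z :* d)) refl v (w + u * y) _ _ _ _))
          (W.+-homo _ _)))))
        (solve 5 (λ y a b c d → (a :+ b) :- y :* (c :+ d) := (a :- y :* c) :+ (b :- y :* d)) refl y _ _ _ _)
    ; *-homo = λ a F → trans (+-cong (T.*-homo a _) (-‿cong (*-congˡ (trans
          (W.cong (λ ls → solve 5 (λ v z a b c → v :* (a :* b) :+ z :* (a :* c) := a :* (v :* b :+ z :* c)) refl v (w + u * y) a _ _))
          (W.*-homo a _)))))
        (solve 4 (λ y a b c → a :* b :- y :* (a :* c) := a :* (b :- y :* c)) refl y a _ _) }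
    where
    module T = IsLinear (Ten-linear (boundary y) (positions (suc p) bs))
    module W = IsLinear (columnWd-linear y (suc p) bs)

  -- Multiplication by t - y reduces the weighted sum over the place of an upper entry to its two
  -- ends. In state `true` that sum starts at the current position p, and its lower end is the
  -- subtracted term of `vertex-difference′`.
  vertex-difference : ∀ y p bs {B} → Deformed B →
    vertex y false bs (Ten (difference y) B ∘ positions p) ≈ columnWd y p bs B
  vertex-difference′ : ∀ y p bs {B} → Deformed B →
    vertex y true bs (Ten (difference y) B ∘ positions p)
    ≈ Ten (boundary y) B (positions p bs) - (v + w * y + u * y * y) * columnWd y p bs (B ⟨ p ⟩)

  private
    split : ∀ y s p bs B → vertex y s bs (λ acc → Ten (difference y) B (p ∷ positions (suc p) acc))
      ≈ vertex y s bs (Ten (difference y) (B ⟨ suc p ⟩) ∘ positions (suc p))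
        - y * vertex y s bs (Ten (difference y) (B ⟨ p ⟩) ∘ positions (suc p))
    split y s p bs B = trans
      (W.cong (λ acc → solve 3 (λ y a b → con (ℤ.+ 1) :* a :+ (:- y :* b :+ con (ℤ.+ 0)) := a :+ (:- y) :* b) refl y _ _))
      (trans (W.+-homo _ _) (trans (+-congˡ (W.*-homo (- y) _)) (+-congˡ (solve 2 (λ y a → :- y :* a := :- (y :* a)) refl y _))))
      where module W = IsLinear (vertex-linear y s bs)

  vertex-difference y p [] def = refl
  vertex-difference y p (false ∷ bs) def = *-congˡ (vertex-difference y (suc p) bs def)
  vertex-difference y p (true ∷ bs) {B} def = begin
    _ ≈⟨ +-cong (vertex-difference′ y (suc p) bs def) (*-congˡ (trans (split y false p bs B)
           (+-cong (vertex-difference y (suc p) bs (λ α → def (suc p ∷ α)))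
             (-‿cong (*-congˡ (vertex-difference y (suc p) bs (λ α → def (p ∷ α)))))))) ⟩
    _ ≈⟨ solve 7 (λ v w u y t a b → (t :- (v :+ w :* y :+ u :* y :* y) :* a) :+ v :* (a :- y :* b)
           := t :- y :* (v :* b :+ (w :+ u :* y) :* a)) refl v w u y _ _ _ ⟩
    _ ≈⟨ +-congˡ (-‿cong (*-congˡ (IsLinear.lin₂ (columnWd-linear y (suc p) bs) v _ (w + u * y) _))) ⟨
    _ ∎
  vertex-difference′ y p [] def = solve 2 (λ a f → a := a :- f :* con (ℤ.+ 0)) refl _ _
  vertex-difference′ y p (false ∷ bs) {B} def = begin
    _ ≈⟨ +-cong (vertex-difference′ y (suc p) bs def) (*-congˡ (trans (split y false p bs B)
           (+-cong (vertex-difference y (suc p) bs (λ α → def (suc p ∷ α)))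
             (-‿cong (*-congˡ (vertex-difference y (suc p) bs (λ α → def (p ∷ α)))))))) ⟩
    _ ≈⟨ solve 5 (λ f y t a b → (t :- f :* a) :+ f :* (a :- y :* b) := t :- f :* (y :* b)) refl _ y _ _ _ ⟩
    _ ∎
  vertex-difference′ y p (true ∷ bs) {B} def = begin
    u * y * vertex y true bs (λ acc → Ten (difference y) B (p ∷ positions (suc p) acc))
      ≈⟨ *-congˡ (trans (split y true p bs B)
           (+-cong (vertex-difference′ y (suc p) bs (λ α → def (suc p ∷ α)))
             (-‿cong (*-congˡ (vertex-difference′ y (suc p) bs (λ α → def (p ∷ α))))))) ⟩
    _ ≈⟨ solve 9 (λ v w u y t₁ t₀ g₁₁ g₀₁ g₀₀ →
           let f = v :+ w :* y :+ u :* y :* y in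
           u :* y :* ((t₁ :- f :* g₁₁) :- y :* (t₀ :- f :* g₀₁))
           := ((v :+ w :* y) :* t₀ :+ (u :* y :* t₁ :+ con (ℤ.+ 0))) :- f :* (t₀ :- y :* (v :* g₀₀ :+ (w :+ u :* y) :* g₀₁))
              :- y :* f :* (v :* g₀₀ :+ w :* g₀₁ :+ u :* g₁₁))
         refl v w u y _ _ _ _ (W (B ⟨ p ⟩ ⟨ p ⟩)) ⟩
    -- The remainder is y F(y, y) times the deformed relation for two neighbours with exponent p, so
    -- `Deformed` kills it.
    _ ≈⟨ +-congˡ (-‿cong (*-congˡ (trans (sym (L.lin₃ v _ w _ u _)) (L.vanish (def [] p))))) ⟩
    _ ≈⟨ solve 2 (λ a b → a :- b :* con (ℤ.+ 0) := a) refl _ _ ⟩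
    _ ≈⟨ +-congˡ (-‿cong (*-congˡ (+-congˡ (-‿cong (*-congˡ (L.lin₂ v _ (w + u * y) _)))))) ⟨
    _ ∎
    where
    W = columnWd y (suc p) bs
    module L = IsLinear (columnWd-linear y (suc p) bs)

-- schurExt xs is the alternating extension of λ + δ ↦ s_λ; the variables are listed from the last.
module SchurExtension {c ℓ} (R : CommutativeRing c ℓ) where
  open CommutativeRing R hiding (zero)
  open Functionals R
  open Tensor R
  open IntegerSolver R

  emptyFun : ∀ {a} {X : Set a} → Fun X
  emptyFun []      = 1#
  emptyFun (_ ∷ _) = 0#

  schurExt : List Carrier → Fun ℕ
  schurExt []       = emptyFun
  -- In the determinant of powers, subtracting the row of y from every other row leaves entries t^k
  -- - y^k. Divided by t - y, which is the share of the Vandermonde determinant, they are the sums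
  -- given by `antidifference`.
  schurExt (y ∷ xs) = Wd y (Ten (antidifference y) (schurExt xs))

  schurExt-alternating : ∀ xs → Alternating (schurExt xs)
  schurExt-alternating [] = record
    { adjacent = λ { [] x γ → refl ; (_ ∷ _) x γ → refl }
    ; exchange = λ { [] x y γ → zero-neg ; (_ ∷ _) x y γ → zero-neg } }
    where
    zero-neg : 0# ≈ - 0#
    zero-neg = solve 0 (con (ℤ.+ 0) := :- con (ℤ.+ 0)) refl
  schurExt-alternating (y ∷ xs) = Wd-alternating y (Ten-alternating (antidifference y) (schurExt-alternating xs))

-- Sums over monotone triangles as values of the Schur functional.

module Triangles {c ℓ} (R : CommutativeRing c ℓ) (u v w : CommutativeRing.Carrier R) where
  open CommutativeRing R hiding (zero)
  open Functionals R
  open Tensor R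
  open Coupling R u v w
  open SchurExtension R
  open IntegerSolver R
  open import Relation.Binary.Reasoning.Setoid setoid

  triangleSum : List Carrier → Fun Bool
  triangleSum []       bs = emptyFun (positions 0 bs)
  triangleSum (y ∷ xs) bs = vertex y false bs (triangleSum xs)

  coupleAll-emptyFun : ∀ ks → coupleAll emptyFun ks ≈ emptyFun ks
  coupleAll-emptyFun []       = refl
  coupleAll-emptyFun (k ∷ ks) =
    IsLinear.vanish (coupleAll-linear ks) (λ ls → IsLinear.vanish (couple-linear k ls) (λ _ → refl))

  -- Induction on rows. Dividing the functional of the rows above by the product of the t_i - y
  -- makes the sum over the row above telescope, and y itself re-enters through `Wd`.
  triangleSum-coupleAll : ∀ xs bs → triangleSum xs bs ≈ coupleAll (schurExt xs) (positions 0 bs)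
  triangleSum-coupleAll [] bs = sym (coupleAll-emptyFun (positions 0 bs))
  triangleSum-coupleAll (y ∷ xs) bs = begin
    vertex y false bs (triangleSum xs)
      ≈⟨ V.cong (triangleSum-coupleAll xs) ⟩
    vertex y false bs (coupleAll (schurExt xs) ∘ positions 0)
      ≈⟨ V.cong (λ acc → trans
           (IsLinear.cong (coupleAll-linear (positions 0 acc)) (λ ls → sym (Ten-difference-antidifference y (schurExt xs) ls)))
           (coupleAll-Ten (difference y) (difference-equivariant y) A′ (positions 0 acc))) ⟩
    vertex y false bs (Ten (difference y) (coupleAll A′) ∘ positions 0)
      ≈⟨ vertex-difference y 0 bs (coupleAll-deformed (Ten-alternating (antidifference y) (schurExt-alternating xs))) ⟩
    columnWd y 0 bs (coupleAll A′)
      ≈⟨ trans (sym (*-identityˡ _)) (columnWd-correct y 0 bs (coupleAll A′)) ⟩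
    deformedWd y (coupleAll A′) (positions 0 bs)
      ≈⟨ coupleAll-Wd y A′ (positions 0 bs) ⟨
    coupleAll (schurExt (y ∷ xs)) (positions 0 bs) ∎
    where
    module V = IsLinear (vertex-linear y false bs)
    A′ = Ten (antidifference y) (schurExt xs)

-- Letters of the wedge, formal linear forms and convolution sums.

interval : ℕ → ℕ → List ℕ
interval p zero    = []
interval p (suc n) = p ∷ interval (suc p) n

map-suc-interval : ∀ p n → map suc (interval p n) ≡ interval (suc p) n
map-suc-interval p zero    = ≡.refl
map-suc-interval p (suc n) = ≡.cong (suc p ∷_) (map-suc-interval (suc p) n)

-- In Λ(t⁰, t¹, …) relative to the vacuum t⁰ ∧ ⋯ ∧ t^N: low b is t^(N − b) and high a is t^(N + 1 + a).
data Letter : Set where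
  low high : ℕ → Letter

exponent : ℕ → Letter → ℕ
exponent N (low b)  = N ℕ.∸ b
exponent N (high a) = suc (N ℕ.+ a)

module LinearForms {c ℓ} (R : CommutativeRing c ℓ) where
  open CommutativeRing R hiding (zero)
  open IntegerSolver R
  open Functionals R
  open Tensor R
  open Alternating
  open import Relation.Binary.Reasoning.Setoid setoid

  mapLin : ∀ {a b} {X : Set a} {Y : Set b} → (X → Y) → Lin X → Lin Y
  mapLin h = map (λ q → proj₁ q , h (proj₂ q))

  ap-mapLin : ∀ {a b} {X : Set a} {Y : Set b} (h : X → Y) p f → ap (mapLin h p) f ≈ ap p (f ∘ h)
  ap-mapLin h []      f = refl
  ap-mapLin h (_ ∷ p) f = +-congˡ (ap-mapLin h p f)

  Ev-mapLin : ∀ {a b} {X : Set a} {Y : Set b} (h : X → Y) A ps → Ev A (map (mapLin h) ps) ≈ Ev (A ∘ map h) ps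
  Ev-mapLin h A []       = refl
  Ev-mapLin h A (p ∷ ps) = trans (ap-mapLin h p _)
    (IsLinear.cong (ap-linear p) (λ x → Ev-mapLin h (A ⟨ h x ⟩) ps))

  ap-++ : ∀ {a} {X : Set a} (p q : Lin X) f → ap (p ++ q) f ≈ ap p f + ap q f
  ap-++ []            q f = sym (+-identityˡ _)
  ap-++ ((a , x) ∷ p) q f = trans (+-congˡ (ap-++ p q f)) (sym (+-assoc _ _ _))

  bind : ∀ {a b} {X : Set a} {Y : Set b} → Lin X → (X → Lin Y) → Lin Y
  bind []            K = []
  bind ((a , x) ∷ p) K = map (λ q → a * proj₁ q , proj₂ q) (K x) ++ bind p K

  ap-bind : ∀ {a b} {X : Set a} {Y : Set b} (p : Lin X) (K : X → Lin Y) f → ap (bind p K) f ≈ ap p (λ x → ap (K x) f)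
  ap-bind []            K f = refl
  ap-bind ((a , x) ∷ p) K f = trans (ap-++ (map _ (K x)) (bind p K) f) (+-cong (ap-scale a (K x) f) (ap-bind p K f))

  Ev-bind : ∀ {a b} {X : Set a} {Y : Set b} (K : X → Lin Y) A ps →
    Ev A (map (λ p → bind p K) ps) ≈ Ev (Ev A ∘ map K) ps
  Ev-bind K A []       = refl
  Ev-bind K A (p ∷ ps) = trans (ap-bind p K _) (IsLinear.cong (ap-linear p) (λ x →
    trans (IsLinear.cong (ap-linear (K x)) (λ y → Ev-bind K (A ⟨ y ⟩) ps))
          (sym (ap-swap (Ev-linear ps) (K x) (λ y xs → Ev (A ⟨ y ⟩) (map K xs))))))

  Ev-map-cong : ∀ {a b} {X : Set a} {I : Set b} (P Q : I → Lin X) (is : List I) →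
    (∀ i → i ∈ is → ∀ f → ap (P i) f ≈ ap (Q i) f) → ∀ A → Ev A (map P is) ≈ Ev A (map Q is)
  Ev-map-cong P Q []       e A = refl
  Ev-map-cong P Q (i ∷ is) e A = trans (e i (here ≡.refl) _)
    (IsLinear.cong (ap-linear (Q i)) (λ x → Ev-map-cong P Q is (λ j j∈ → e j (there j∈)) (A ⟨ x ⟩)))

  -- The expansion in elementary symmetric functions depends on the number of variables, so the
  -- functionals to be compared there agree only on words of one length.
  Ev-cong-length : ∀ {a} {X : Set a} (ps : List (Lin X)) {A B : Fun X} →
    (∀ xs → length xs ≡ length ps → A xs ≈ B xs) → Ev A ps ≈ Ev B ps
  Ev-cong-length []       e = e [] ≡.refl
  Ev-cong-length (p ∷ ps) e = IsLinear.cong (ap-linear p) (λ x →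
    Ev-cong-length ps (λ xs eq → e (x ∷ xs) (≡.cong suc eq)))

  repeated-head : ∀ {a} {X : Set a} {A : Fun X} → Alternating A → ∀ {x xs} → x ∈ xs → A (x ∷ xs) ≈ 0#
  repeated-head {A = A} alt {x} x∈xs with β , γ , ≡.refl ← ∈-∃++ x∈xs = repeated alt [] x β γ

  -- The sum over m + q = N. Both indices are handed to h, so that neither has to be obtained by
  -- subtraction.
  convolve : ℕ → (ℕ → ℕ → Carrier) → Carrier
  convolve zero    h = h 0 0
  convolve (suc N) h = h (suc N) 0 + convolve N (λ m q → h m (suc q))

  convolve-cong : ∀ N {h k} → (∀ m q → h m q ≈ k m q) → convolve N h ≈ convolve N k
  convolve-cong zero    e = e 0 0
  convolve-cong (suc N) e = +-cong (e (suc N) 0) (convolve-cong N (λ m q → e m (suc q)))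

  convolve-vanish : ∀ N {h} → (∀ m q → m ℕ.+ q ≡ N → h m q ≈ 0#) → convolve N h ≈ 0#
  convolve-vanish zero    e = e 0 0 ≡.refl
  convolve-vanish (suc N) e = trans
    (+-cong (e (suc N) 0 (ℕₚ.+-identityʳ _)) (convolve-vanish N (λ m q eq → e m (suc q) (≡.trans (ℕₚ.+-suc m q) (≡.cong suc eq)))))
    (+-identityˡ 0#)

  convolve-+ : ∀ N h k → convolve N (λ m q → h m q + k m q) ≈ convolve N h + convolve N k
  convolve-+ zero    h k = refl
  convolve-+ (suc N) h k = trans (+-congˡ (convolve-+ N _ _))
    (solve 4 (λ a b c d → (a :+ b) :+ (c :+ d) := (a :+ c) :+ (b :+ d)) refl _ _ _ _)

  convolve-* : ∀ N a h → convolve N (λ m q → a * h m q) ≈ a * convolve N h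
  convolve-* zero    a h = refl
  convolve-* (suc N) a h = trans (+-congˡ (convolve-* N a _)) (sym (distribˡ _ _ _))

  convolve-swap : ∀ {i} {I : Set i} {L : (I → Carrier) → Carrier} → IsLinear L → ∀ N (h : ℕ → ℕ → I → Carrier) →
    L (λ i → convolve N (λ m q → h m q i)) ≈ convolve N (λ m q → L (h m q))
  convolve-swap lin zero    h = refl
  convolve-swap lin (suc N) h = trans (IsLinear.+-homo lin _ _) (+-congˡ (convolve-swap lin N _))

  convolve-defect : ∀ N (h p x : ℕ → ℕ → Carrier) → (∀ q → h 0 q ≈ p 0 q) → (∀ m q → h (suc m) q ≈ p (suc m) q - x m q) →
    convolve (suc N) h ≈ convolve (suc N) p - convolve N x
  convolve-defect zero h p x e₀ e₁ = trans (+-cong (e₁ 0 0) (e₀ 1))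
    (solve 3 (λ a b c → (a :- b) :+ c := (a :+ c) :- b) refl _ _ _)
  convolve-defect (suc N) h p x e₀ e₁ = trans
    (+-cong (e₁ (suc N) 0) (convolve-defect N (λ m q → h m (suc q)) (λ m q → p m (suc q)) (λ m q → x m (suc q)) (λ q → e₀ (suc q)) (λ m q → e₁ m (suc q))))
    (solve 4 (λ a b c d → (a :- b) :+ (c :- d) := (a :+ c) :- (b :+ d)) refl _ _ _ _)

  -- Both sides are the sum of v^m g r over m + r = N + 1, with the term split off at one end or at
  -- the other.
  convolve-pow : ∀ N v (g : ℕ → Carrier) →
    v * convolve N (λ m r → pow R v m * g r) + g (suc N)
    ≈ pow R v (suc N) * g 0 + convolve N (λ m r → pow R v m * g (suc r))
  convolve-pow zero v g = solve 3 (λ v a b → v :* (con (ℤ.+ 1) :* a) :+ b := v :* con (ℤ.+ 1) :* a :+ con (ℤ.+ 1) :* b) refl v _ _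
  convolve-pow (suc N) v g = trans
    (solve 5 (λ v p a c b → v :* (p :* a :+ c) :+ b := v :* p :* a :+ (v :* c :+ b)) refl v _ _ _ _)
    (+-congˡ (convolve-pow N v (g ∘ suc)))

-- The antisymmetrised product of the F as a wedge of columns.

-- The wedge ∧ₖ hₖ(v, −t(w + ut)) of complete homogeneous polynomials is the determinant that
-- antisymmetrisation of ∏_{i<j} (v + w tᵢ + u tᵢ tⱼ) produces: with bⱼ = −(w + u tⱼ), expanding
-- ∏_{j>1} (v − t₁ bⱼ) in elementary symmetric functions of all the bⱼ leaves a single term that is not
-- killed by antisymmetry.
module Determinant {c ℓ} (R : CommutativeRing c ℓ) (u v w : CommutativeRing.Carrier R) where
  open CommutativeRing R hiding (zero)
  open IntegerSolver R
  open Functionals R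
  open Tensor R
  open Coupling R u v w
  open LinearForms R
  open Alternating
  open import Relation.Binary.Reasoning.Setoid setoid

  -- Multiplication by the r-th elementary symmetric polynomial in the w + u tⱼ.
  elementary : ℕ → Fun ℕ → Fun ℕ
  elementary zero    A ks       = A ks
  elementary (suc r) A []       = 0#
  elementary (suc r) A (k ∷ ks) = elementary (suc r) (A ⟨ k ⟩) ks
                                  + elementary r (λ ls → w * A (k ∷ ls) + u * A (suc k ∷ ls)) ks

  elementary-linear : ∀ r ks → IsLinear (λ A → elementary r A ks)
  elementary-linear zero ks = record { cong = λ e → e ks ; +-homo = λ _ _ → refl ; *-homo = λ _ _ → refl }
  elementary-linear (suc r) [] = ap-linear {X = List ℕ} []
  elementary-linear (suc r) (k ∷ ks) = record
    { cong = λ e → +-cong (E.cong (λ ls → e (k ∷ ls))) (D.cong (λ ls → +-cong (*-congˡ (e (k ∷ ls))) (*-congˡ (e (suc k ∷ ls)))))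
    ; +-homo = λ F G → trans
        (+-cong (E.+-homo _ _) (trans
          (D.cong (λ ls → solve 6 (λ w u a b c d → w :* (a :+ b) :+ u :* (c :+ d) := (w :* a :+ u :* c) :+ (w :* b :+ u :* d)) refl w u _ _ _ _))
          (D.+-homo _ _)))
        (solve 4 (λ a b c d → (a :+ b) :+ (c :+ d) := (a :+ c) :+ (b :+ d)) refl _ _ _ _)
    ; *-homo = λ a F → trans
        (+-cong (E.*-homo _ _) (trans
          (D.cong (λ ls → solve 5 (λ w u a b c → w :* (a :* b) :+ u :* (a :* c) := a :* (w :* b :+ u :* c)) refl w u a _ _))
          (D.*-homo _ _)))
        (sym (distribˡ _ _ _)) }
    where
    module E = IsLinear (elementary-linear (suc r) ks)
    module D = IsLinear (elementary-linear r ks)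

  elementary-cons₂ : ∀ r A x y γ → elementary (suc (suc r)) A (x ∷ y ∷ γ) ≈
    elementary (suc (suc r)) (A ⟨ x ⟩ ⟨ y ⟩) γ
    + (w * elementary (suc r) (A ⟨ x ⟩ ⟨ y ⟩) γ + u * elementary (suc r) (A ⟨ x ⟩ ⟨ suc y ⟩) γ)
    + (w * elementary (suc r) (A ⟨ x ⟩ ⟨ y ⟩) γ + u * elementary (suc r) (A ⟨ suc x ⟩ ⟨ y ⟩) γ)
    + (w * (w * elementary r (A ⟨ x ⟩ ⟨ y ⟩) γ + u * elementary r (A ⟨ suc x ⟩ ⟨ y ⟩) γ)
       + u * (w * elementary r (A ⟨ x ⟩ ⟨ suc y ⟩) γ + u * elementary r (A ⟨ suc x ⟩ ⟨ suc y ⟩) γ))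
  elementary-cons₂ r A x y γ = trans
    (+-cong (+-congˡ (S.lin₂ w _ u _)) (+-cong (S.lin₂ w _ u _)
      (trans (Z.lin₂ w _ u _) (+-cong (*-congˡ (Z.lin₂ w _ u _)) (*-congˡ (Z.lin₂ w _ u _))))))
    (sym (+-assoc _ _ _))
    where
    module S = IsLinear (elementary-linear (suc r) γ)
    module Z = IsLinear (elementary-linear r γ)

  -- The multiplier is symmetric in all variables. Exchanges at the front separate two variables
  -- from the rest, which needs degree at least 2; degree 1 is done apart.
  elementary-alternating : ∀ r {A} → Alternating A → Alternating (elementary r A)
  elementary-alternating zero    alt = alt
  elementary-alternating (suc r) alt = record { adjacent = adj r alt ; exchange = exc r alt }
    where
    adj : ∀ r {A} → Alternating A → ∀ α x γ → elementary (suc r) A (α ++ x ∷ x ∷ γ) ≈ 0#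
    exc : ∀ r {A} → Alternating A → ∀ α x y γ → elementary (suc r) A (α ++ x ∷ y ∷ γ) ≈ - elementary (suc r) A (α ++ y ∷ x ∷ γ)
    tail-alternating : ∀ {A} → Alternating A → ∀ k → Alternating (λ ls → w * A (k ∷ ls) + u * A (suc k ∷ ls))
    tail-alternating alt k = record
      { adjacent = λ α x γ → trans (+-cong (*-congˡ (adjacent alt (k ∷ α) x γ)) (*-congˡ (adjacent alt (suc k ∷ α) x γ)))
          (solve 2 (λ w u → w :* con (ℤ.+ 0) :+ u :* con (ℤ.+ 0) := con (ℤ.+ 0)) refl w u)
      ; exchange = λ α x y γ → trans (+-cong (*-congˡ (exchange alt (k ∷ α) x y γ)) (*-congˡ (exchange alt (suc k ∷ α) x y γ)))
          (solve 4 (λ w u a b → w :* :- a :+ u :* :- b := :- (w :* a :+ u :* b)) refl w u _ _) }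
    adj zero {A} alt (k ∷ α) x γ = trans
      (+-cong (adj zero (head-alternating alt k) α x γ) (adjacent (tail-alternating alt k) α x γ)) (+-identityˡ 0#)
    adj (suc r) {A} alt (k ∷ α) x γ = trans
      (+-cong (adj (suc r) (head-alternating alt k) α x γ) (adj r (tail-alternating alt k) α x γ)) (+-identityˡ 0#)
    adj zero {A} alt [] x γ = trans
      (+-cong (+-cong (IsLinear.vanish (elementary-linear 1 γ) (adjacent alt [] x))
          (+-cong (*-congˡ (adjacent alt [] x γ)) refl))
        (+-cong (*-congˡ (adjacent alt [] x γ)) (*-congˡ (exchange alt [] (suc x) x γ))))
      (solve 3 (λ w u m → (con (ℤ.+ 0) :+ (w :* con (ℤ.+ 0) :+ u :* m)) :+ (w :* con (ℤ.+ 0) :+ u :* :- m) := con (ℤ.+ 0)) refl w u _)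
    adj (suc r) {A} alt [] x γ = trans (elementary-cons₂ r A x x γ) (trans
      (+-cong (+-cong (+-cong (diag (2 ℕ.+ r) x) (+-cong (*-congˡ (diag (1 ℕ.+ r) x)) refl))
          (+-cong (*-congˡ (diag (1 ℕ.+ r) x)) (*-congˡ (anti (1 ℕ.+ r) (suc x) x))))
        (+-cong (*-congˡ (+-cong (*-congˡ (diag r x)) (*-congˡ (anti r (suc x) x)))) (*-congˡ (+-congˡ (*-congˡ (diag r (suc x)))))))
      (solve 4 (λ w u m n → con (ℤ.+ 0) :+ (w :* con (ℤ.+ 0) :+ u :* m) :+ (w :* con (ℤ.+ 0) :+ u :* :- m)
         :+ (w :* (w :* con (ℤ.+ 0) :+ u :* :- n) :+ u :* (w :* n :+ u :* con (ℤ.+ 0))) := con (ℤ.+ 0)) refl w u _ _))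
      where
      diag : ∀ r x → elementary r (A ⟨ x ⟩ ⟨ x ⟩) γ ≈ 0#
      diag r x = IsLinear.vanish (elementary-linear r γ) (adjacent alt [] x)
      anti : ∀ r x y → elementary r (A ⟨ x ⟩ ⟨ y ⟩) γ ≈ - elementary r (A ⟨ y ⟩ ⟨ x ⟩) γ
      anti r x y = trans (IsLinear.cong (elementary-linear r γ) (exchange alt [] x y)) (IsLinear.-‿homo (elementary-linear r γ) _)
    exc zero {A} alt (k ∷ α) x y γ = trans
      (+-cong (exc zero (head-alternating alt k) α x y γ) (exchange (tail-alternating alt k) α x y γ))
      (solve 2 (λ a b → :- a :+ :- b := :- (a :+ b)) refl _ _)
    exc (suc r) {A} alt (k ∷ α) x y γ = trans
      (+-cong (exc (suc r) (head-alternating alt k) α x y γ) (exc r (tail-alternating alt k) α x y γ))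
      (solve 2 (λ a b → :- a :+ :- b := :- (a :+ b)) refl _ _)
    exc zero {A} alt [] x y γ = trans
      (+-cong (+-cong (trans (IsLinear.cong (elementary-linear 1 γ) (exchange alt [] x y)) (IsLinear.-‿homo (elementary-linear 1 γ) _))
          (+-cong (*-congˡ (exchange alt [] x y γ)) (*-congˡ (exchange alt [] x (suc y) γ))))
        (+-cong (*-congˡ (exchange alt [] x y γ)) (*-congˡ (exchange alt [] (suc x) y γ))))
      (solve 6 (λ w u e m n o → (:- e :+ (w :* :- m :+ u :* :- n)) :+ (w :* :- m :+ u :* :- o)
         := :- ((e :+ (w :* m :+ u :* o)) :+ (w :* m :+ u :* n))) refl w u _ _ _ _)
    exc (suc r) {A} alt [] x y γ = trans (elementary-cons₂ r A x y γ) (trans (trans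
      (+-cong (+-cong (+-cong (anti (2 ℕ.+ r) x y) (+-cong (*-congˡ (anti (1 ℕ.+ r) x y)) (*-congˡ (anti (1 ℕ.+ r) x (suc y)))))
          (+-cong (*-congˡ (anti (1 ℕ.+ r) x y)) (*-congˡ (anti (1 ℕ.+ r) (suc x) y))))
        (+-cong (*-congˡ (+-cong (*-congˡ (anti r x y)) (*-congˡ (anti r (suc x) y))))
                (*-congˡ (+-cong (*-congˡ (anti r x (suc y))) (*-congˡ (anti r (suc x) (suc y)))))))
      (solve 10 (λ w u e m n o p q s t → :- e :+ (w :* :- m :+ u :* :- n) :+ (w :* :- m :+ u :* :- o)
         :+ (w :* (w :* :- p :+ u :* :- q) :+ u :* (w :* :- s :+ u :* :- t))
         := :- (e :+ (w :* m :+ u :* o) :+ (w :* m :+ u :* n) :+ (w :* (w :* p :+ u :* s) :+ u :* (w :* q :+ u :* t)))) refl w u _ _ _ _ _ _ _ _))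
      (-‿cong (sym (elementary-cons₂ r A y x γ))))
      where
      anti : ∀ r x y → elementary r (A ⟨ x ⟩ ⟨ y ⟩) γ ≈ - elementary r (A ⟨ y ⟩ ⟨ x ⟩) γ
      anti r x y = trans (IsLinear.cong (elementary-linear r γ) (exchange alt [] x y)) (IsLinear.-‿homo (elementary-linear r γ) _)

  elementary-vanish : ∀ r A ks → length ks ℕ.< r → elementary r A ks ≈ 0#
  elementary-vanish (suc r) A []       _         = refl
  elementary-vanish (suc r) A (k ∷ ks) (ℕ.s≤s lt) = trans
    (+-cong (elementary-vanish (suc r) _ ks (ℕₚ.m<n⇒m<1+n lt)) (elementary-vanish r _ ks lt)) (+-identityˡ 0#)

  -- Expands the product over j of v + t₁ (w + u t_j) in powers of t₁. The vanishing elementary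
  -- function of degree N + 1 is inserted so that `convolve-pow` applies.
  couple-elementary : ∀ A ks →
    couple A 0 ks ≈ convolve (length ks) (λ m r → pow R v m * elementary r (λ ls → A (r , ls)) ks)
  couple-elementary A [] = sym (*-identityˡ _)
  couple-elementary A (l ∷ ls) = begin
    v * couple (A ∘ insert l) 0 ls + w * couple (A ∘ insert l) 1 ls + u * couple (A ∘ insert (suc l)) 1 ls
      ≈⟨ +-assoc _ _ _ ⟩
    v * couple (A ∘ insert l) 0 ls + (w * couple (A ∘ insert l) 1 ls + u * couple (A ∘ insert (suc l)) 1 ls)
      ≈⟨ +-cong (*-congˡ (couple-elementary (A ∘ insert l) ls))
           (trans (+-cong (*-congˡ (sym (couple-shift (A ∘ insert l) 0 ls))) (*-congˡ (sym (couple-shift (A ∘ insert (suc l)) 0 ls))))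
             (trans (sym (IsLinear.lin₂ (couple-linear 0 ls) w _ u _)) (couple-elementary B ls))) ⟩
    v * convolve N (λ m r → pow R v m * g r) + convolve N (λ m r → pow R v m * f r)
      ≈⟨ +-congʳ (trans (sym (+-identityʳ _)) (+-congˡ (sym (elementary-vanish (suc N) _ ls ℕₚ.≤-refl)))) ⟩
    v * convolve N (λ m r → pow R v m * g r) + g (suc N) + convolve N (λ m r → pow R v m * f r)
      ≈⟨ +-congʳ (convolve-pow N v g) ⟩
    pow R v (suc N) * g 0 + convolve N (λ m r → pow R v m * g (suc r)) + convolve N (λ m r → pow R v m * f r)
      ≈⟨ trans (+-assoc _ _ _) (+-congˡ (trans (sym (convolve-+ N _ _)) (convolve-cong N (λ m r → sym (distribˡ _ _ _))))) ⟩
    convolve (suc N) (λ m r → pow R v m * elementary r (λ ls → A (r , ls)) (l ∷ ls)) ∎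
    where
    N = length ls
    B : ℕ × List ℕ → Carrier
    B q = w * A (suc (proj₁ q) , l ∷ proj₂ q) + u * A (suc (proj₁ q) , suc l ∷ proj₂ q)
    g f : ℕ → Carrier
    g r = elementary r (λ ls → A (r , l ∷ ls)) ls
    f r = elementary r (λ ls → B (r , ls)) ls

  -- Values at tᵏ of the polynomials bᵐ, hₘ(v, b) and vᵐ − u t² bᵐ⁻¹ for b = −t(w + ut), as operators on
  -- sequences.
  power complete column : ℕ → (ℕ → Carrier) → ℕ → Carrier
  power zero    φ k = φ k
  power (suc m) φ k = - (w * power m φ (suc k) + u * power m φ (suc (suc k)))
  complete zero    φ k = φ k
  complete (suc m) φ k = pow R v (suc m) * φ k - (w * complete m φ (suc k) + u * complete m φ (suc (suc k)))
  column zero    φ k = φ k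
  column (suc m) φ k = pow R v (suc m) * φ k - u * power m φ (suc (suc k))

  power-shift : ∀ m φ k → power m (φ ∘ suc) k ≈ power m φ (suc k)
  power-shift zero    φ k = refl
  power-shift (suc m) φ k = -‿cong (+-cong (*-congˡ (power-shift m φ _)) (*-congˡ (power-shift m φ _)))

  complete-shift : ∀ m φ k → complete m (φ ∘ suc) k ≈ complete m φ (suc k)
  complete-shift zero    φ k = refl
  complete-shift (suc m) φ k = +-congˡ (-‿cong (+-cong (*-congˡ (complete-shift m φ _)) (*-congˡ (complete-shift m φ _))))

  column-shift : ∀ m φ k → column m (φ ∘ suc) k ≈ column m φ (suc k)
  column-shift zero    φ k = refl
  column-shift (suc m) φ k = +-congˡ (-‿cong (*-congˡ (power-shift m φ _)))

  complete-suc : ∀ m φ k → complete (suc m) φ k ≈ v * complete m φ k + power (suc m) φ k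
  complete-suc zero φ k = solve 6 (λ v w u a b c → v :* con (ℤ.+ 1) :* a :- (w :* b :+ u :* c) := v :* a :+ :- (w :* b :+ u :* c)) refl v w u _ _ _
  complete-suc (suc m) φ k = trans
    (+-congˡ (-‿cong (+-cong (*-congˡ (complete-suc m φ _)) (*-congˡ (complete-suc m φ _)))))
    (solve 9 (λ v w u p a b c d e → v :* p :* a :- (w :* (v :* b :+ c) :+ u :* (v :* d :+ e))
      := v :* (p :* a :- (w :* b :+ u :* d)) :+ :- (w :* c :+ u :* e)) refl v w u _ _ _ _ _ _)

  column-complete₁ : ∀ φ k → column 1 φ k ≈ complete 1 φ k + w * complete 0 φ (suc k)
  column-complete₁ φ k = solve 6 (λ p w u a b c → p :* a :- u :* c := (p :* a :- (w :* b :+ u :* c)) :+ w :* b) refl _ w u _ _ _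

  -- With `column-complete₁` this says that t^(N-m) times column m and t^(N-m) h_m(v, b) differ by a
  -- unitriangular change, so they have the same wedge. It follows from h_(m+1) = v h_m + b^(m+1).
  column-complete₂ : ∀ m φ k → column (suc (suc m)) φ k ≈
    complete (suc (suc m)) φ k + w * complete (suc m) φ (suc k) + u * v * complete m φ (suc (suc k))
  column-complete₂ m φ k = begin
    _ ≈⟨ solve 7 (λ v w u p a b q → p :- u :* q := (p :- (w :* a :+ u :* (v :* b :+ q))) :+ w :* a :+ u :* v :* b)
           refl v w u _ (complete (suc m) φ (suc k)) (complete m φ (suc (suc k))) _ ⟩
    _ ≈⟨ +-congʳ (+-congʳ (+-congˡ (-‿cong (+-congˡ (*-congˡ (complete-suc m φ (suc (suc k)))))))) ⟨
    _ ∎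

  -- Solves the unitriangular relations of `column-complete₁` and `column-complete₂` for `complete`,
  -- by recursion on m along m + j + 1 = N.
  complete-vanish : ∀ N φ → (∀ m j → m ℕ.+ suc j ≡ N → column m φ (suc j) ≈ 0#) →
    ∀ m j → m ℕ.+ suc j ≡ N → complete m φ (suc j) ≈ 0#
  complete-vanish N φ e zero j eq = e zero j eq
  complete-vanish N φ e (suc zero) j eq = begin
    complete 1 φ (suc j) ≈⟨ solve 3 (λ h w a → h := (h :+ w :* a) :- w :* a) refl _ w _ ⟩
    complete 1 φ (suc j) + w * complete 0 φ (suc (suc j)) - w * complete 0 φ (suc (suc j))
      ≈⟨ +-cong (trans (sym (column-complete₁ φ (suc j))) (e 1 j eq)) (-‿cong (*-congˡ (complete-vanish N φ e zero (suc j) eq))) ⟩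
    0# - w * 0# ≈⟨ solve 1 (λ w → con (ℤ.+ 0) :- w :* con (ℤ.+ 0) := con (ℤ.+ 0)) refl w ⟩
    0# ∎
  complete-vanish N φ e (suc (suc m)) j eq = begin
    complete (suc (suc m)) φ (suc j) ≈⟨ solve 5 (λ h w a z b → h := ((h :+ w :* a) :+ z :* b) :- w :* a :- z :* b) refl _ w _ (u * v) _ ⟩
    _ ≈⟨ +-cong (+-cong (trans (sym (column-complete₂ m φ (suc j))) (e (suc (suc m)) j eq))
           (-‿cong (*-congˡ (complete-vanish N φ e (suc m) (suc j) (≡.trans (≡.cong suc (ℕₚ.+-suc m (suc j))) eq)))))
           (-‿cong (*-congˡ (complete-vanish N φ e m (suc (suc j)) (≡.trans (ℕₚ.+-suc m (suc (suc j))) (≡.trans (≡.cong suc (ℕₚ.+-suc m (suc j))) eq))))) ⟩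
    0# - w * 0# - u * v * 0# ≈⟨ solve 2 (λ w z → con (ℤ.+ 0) :- w :* con (ℤ.+ 0) :- z :* con (ℤ.+ 0) := con (ℤ.+ 0)) refl w (u * v) ⟩
    0# ∎

  complete-column : ∀ N φ → (∀ m j → m ℕ.+ suc j ≡ N → column m φ (suc j) ≈ 0#) → complete N φ 0 ≈ column N φ 0
  complete-column zero φ e = refl
  complete-column (suc zero) φ e = begin
    complete 1 φ 0 ≈⟨ solve 2 (λ h w → h := h :+ w :* con (ℤ.+ 0)) refl _ w ⟩
    complete 1 φ 0 + w * 0# ≈⟨ +-congˡ (*-congˡ (e 0 0 ≡.refl)) ⟨
    complete 1 φ 0 + w * φ 1 ≈⟨ column-complete₁ φ 0 ⟨
    column 1 φ 0 ∎
  complete-column (suc (suc N)) φ e = begin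
    complete (suc (suc N)) φ 0 ≈⟨ solve 3 (λ h w z → h := h :+ w :* con (ℤ.+ 0) :+ z :* con (ℤ.+ 0)) refl _ w (u * v) ⟩
    _ ≈⟨ +-cong (+-congˡ (*-congˡ (complete-vanish _ φ e (suc N) 0 (≡.cong suc (ℕₚ.+-comm N 1)))))
                (*-congˡ (complete-vanish _ φ e N 1 (ℕₚ.+-comm N 2))) ⟨
    _ ≈⟨ column-complete₂ N φ 0 ⟨
    column (suc (suc N)) φ 0 ∎

  -- G stands for elementary functions of the tail, Z for those of all variables, with e_r(all) =
  -- e_r(tail) + (w + u t₁) e_(r-1)(tail). Each elimination of G brings a factor b = -t₁ (w + u t₁),
  -- and these powers build up h_m(v, b).
  convolve-complete : ∀ M (G Z : ℕ → ℕ → Carrier) → (∀ k → Z 0 k ≈ G 0 k) →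
    (∀ r k → Z (suc r) k ≈ G (suc r) k + (w * G r k + u * G r (suc k))) →
    convolve M (λ m r → pow R v m * G r r) ≈ convolve M (λ m q → complete m (Z q) q)
  convolve-complete zero G Z e₀ e₁ = trans (*-identityˡ _) (sym (e₀ 0))
  convolve-complete (suc M) G Z e₀ e₁ = begin
    pow R v (suc M) * G 0 0 + convolve M (λ m r → pow R v m * G (suc r) (suc r))
      ≈⟨ +-cong (*-congˡ (sym (e₀ 0))) (trans (convolve-cong M (λ m r → trans (*-congˡ (step r))
           (solve 4 (λ p z a b → p :* (z :- (a :+ b)) := p :* z :+ ((:- con (ℤ.+ 1)) :* (p :* a) :+ (:- con (ℤ.+ 1)) :* (p :* b))) refl _ _ _ _)))
           (trans (convolve-+ M _ _) (+-congˡ (trans (convolve-+ M _ _) (+-cong (convolve-* M _ _) (convolve-* M _ _)))))) ⟩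
    pow R v (suc M) * Z 0 0 + (convolve M (λ m r → pow R v m * Z (suc r) (suc r))
      + ((- 1#) * convolve M (λ m r → pow R v m * (w * G r (suc r))) + (- 1#) * convolve M (λ m r → pow R v m * (u * G r (suc (suc r))))))
      ≈⟨ solve 4 (λ a b c d → a :+ (b :+ ((:- con (ℤ.+ 1)) :* c :+ (:- con (ℤ.+ 1)) :* d)) := (a :+ b) :- (c :+ d)) refl _ _ _ _ ⟩
    convolve (suc M) (λ m r → pow R v m * Z r r)
      - (convolve M (λ m r → pow R v m * (w * G r (suc r))) + convolve M (λ m r → pow R v m * (u * G r (suc (suc r)))))
      ≈⟨ +-congˡ (-‿cong (+-cong (scaled w (λ r k → G r (suc k)) (λ r k → Z r (suc k)) (λ k → e₀ (suc k)) (λ r k → e₁ r (suc k)))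
           (scaled u (λ r k → G r (suc (suc k))) (λ r k → Z r (suc (suc k))) (λ k → e₀ (suc (suc k))) (λ r k → e₁ r (suc (suc k)))))) ⟩
    convolve (suc M) (λ m r → pow R v m * Z r r)
      - (convolve M (λ m q → w * complete m (Z q ∘ suc) q) + convolve M (λ m q → u * complete m (Z q ∘ suc ∘ suc) q))
      ≈⟨ +-congˡ (-‿cong (trans (sym (convolve-+ M _ _)) (convolve-cong M (λ m q → +-cong
           (*-congˡ (complete-shift m (Z q) q))
           (*-congˡ (trans (complete-shift m (Z q ∘ suc) q) (complete-shift m (Z q) (suc q)))))))) ⟩
    convolve (suc M) (λ m r → pow R v m * Z r r) - convolve M (λ m q → w * complete m (Z q) (suc q) + u * complete m (Z q) (suc (suc q)))
      ≈⟨ convolve-defect M (λ m q → complete m (Z q) q) (λ m q → pow R v m * Z q q) (λ m q → w * complete m (Z q) (suc q) + u * complete m (Z q) (suc (suc q))) (λ q → sym (*-identityˡ _)) (λ m q → refl) ⟨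
    convolve (suc M) (λ m q → complete m (Z q) q) ∎
    where
    step : ∀ r → G (suc r) (suc r) ≈ Z (suc r) (suc r) - (w * G r (suc r) + u * G r (suc (suc r)))
    step r = trans (solve 2 (λ g x → g := (g :+ x) :- x) refl _ _) (+-congʳ (sym (e₁ r (suc r))))
    scaled : ∀ a (G Z : ℕ → ℕ → Carrier) → (∀ k → Z 0 k ≈ G 0 k) →
      (∀ r k → Z (suc r) k ≈ G (suc r) k + (w * G r k + u * G r (suc k))) →
      convolve M (λ m r → pow R v m * (a * G r r)) ≈ convolve M (λ m q → a * complete m (Z q) q)
    scaled a G Z e₀ e₁ = trans (convolve-cong M (λ m r → solve 3 (λ p a g → p :* (a :* g) := a :* (p :* g)) refl _ a _))
      (trans (convolve-* M a _) (trans (*-congˡ (convolve-complete M G Z e₀ e₁)) (sym (convolve-* M a _))))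

  raise : Letter → Lin Letter
  raise (low b)  = (v , low (suc b)) ∷ []
  raise (high a) = (- w , high a) ∷ (- u , high (suc a)) ∷ []

  columnWord : ℕ → Lin Letter
  columnWord zero          = (1# , low 0) ∷ []
  columnWord (suc zero)    = (v , low 1) ∷ (- u , high 0) ∷ []
  columnWord (suc (suc b)) = bind (columnWord (suc b)) raise

  powerWord : ℕ → (Letter → Carrier) → ℕ → Carrier
  powerWord zero    ψ a = ψ (high a)
  powerWord (suc m) ψ a = - (w * powerWord m ψ a + u * powerWord m ψ (suc a))

  powerWord-raise : ∀ m ψ a → powerWord m (λ x → ap (raise x) ψ) a ≈ powerWord (suc m) ψ a
  powerWord-raise zero    ψ a = solve 4 (λ w u x y → (:- w :* x :+ (:- u :* y :+ con (ℤ.+ 0))) := :- (w :* x :+ u :* y)) refl w u _ _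
  powerWord-raise (suc m) ψ a = -‿cong (+-cong (*-congˡ (powerWord-raise m ψ a)) (*-congˡ (powerWord-raise m ψ (suc a))))

  ap-columnWord : ∀ m ψ → ap (columnWord (suc m)) ψ ≈ pow R v (suc m) * ψ (low (suc m)) - u * powerWord m ψ 0
  ap-columnWord zero    ψ = solve 4 (λ v u x y → v :* x :+ (:- u :* y :+ con (ℤ.+ 0)) := v :* con (ℤ.+ 1) :* x :- u :* y) refl v u _ _
  ap-columnWord (suc m) ψ = trans (ap-bind (columnWord (suc m)) raise ψ)
    (trans (ap-columnWord m (λ x → ap (raise x) ψ))
      (+-cong (solve 3 (λ p v x → p :* (v :* x :+ con (ℤ.+ 0)) := v :* p :* x) refl _ v _) (-‿cong (*-congˡ (powerWord-raise m ψ 0)))))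

  -- `raise` multiplies a high letter by -(w + u t), whereas b = -t (w + u t); the condition on the
  -- exponents accounts for the missing t^m.
  powerWord-power : ∀ N m φ k a → k ℕ.+ m ≡ suc (N ℕ.+ a) → powerWord m (φ ∘ exponent N) a ≈ power m φ k
  powerWord-power N zero φ k a eq = reflexive (≡.cong φ (≡.trans (≡.sym eq) (ℕₚ.+-identityʳ k)))
  powerWord-power N (suc m) φ k a eq = -‿cong (+-cong
    (*-congˡ (powerWord-power N m φ (suc k) a eq′))
    (*-congˡ (powerWord-power N m φ (suc (suc k)) (suc a) (≡.cong suc (≡.trans eq′ (≡.sym (ℕₚ.+-suc N a)))))))
    where eq′ = ≡.trans (≡.sym (ℕₚ.+-suc k m)) eq

  columnPoly : ℕ → ℕ → Lin ℕ
  columnPoly N m = mapLin (exponent N) (columnWord m)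

  ap-columnPoly : ∀ N m j → m ℕ.+ j ≡ N → ∀ φ → ap (columnPoly N m) φ ≈ column m φ j
  ap-columnPoly N zero j ≡.refl φ = solve 1 (λ x → con (ℤ.+ 1) :* x :+ con (ℤ.+ 0) := x) refl _
  ap-columnPoly N (suc m) j eq φ = trans (ap-mapLin (exponent N) (columnWord (suc m)) φ)
    (trans (ap-columnWord m (φ ∘ exponent N)) (+-cong
      (*-congˡ (reflexive (≡.cong φ (≡.trans (≡.cong (ℕ._∸ suc m) (≡.sym eq)) (ℕₚ.m+n∸m≡n m j)))))
      (-‿cong (*-congˡ (powerWord-power N m φ (suc (suc j)) 0
        (≡.cong suc (≡.trans (≡.cong suc (ℕₚ.+-comm j m)) (≡.trans eq (≡.sym (ℕₚ.+-identityʳ N))))))))))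

  columns-of : ℕ → ℕ → List (Lin ℕ)
  columns-of N n = map (columnPoly N) (downFrom n)

  -- The product is the sum of t₁^q h_(N-q)(v, b) e_q(all). For q > 0 the factor in t₁ lies in the
  -- span of the columns of the tail, and the symmetric e_q does not disturb alternation, so the
  -- term vanishes. For q = 0 the same columns turn h_N into column N.
  couple-head : ∀ N {A} → Alternating A →
    Ev (couple (A ∘ cons) 0) (columns-of N N) ≈ Ev A (columnPoly N N ∷ columns-of N N)
  couple-head N {A} alt = begin
    Ev (couple (A ∘ cons) 0) ps
      ≈⟨ Ev-cong-length ps (λ ks eq → trans (couple-elementary (A ∘ cons) ks)
           (reflexive (≡.cong (λ n → convolve n (λ m r → pow R v m * elementary r (A ⟨ r ⟩) ks))
             (≡.trans eq (≡.trans (Listₚ.length-map (columnPoly N) (downFrom N)) (Listₚ.length-downFrom N)))))) ⟩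
    Ev (λ ks → convolve N (λ m r → pow R v m * elementary r (A ⟨ r ⟩) ks)) ps
      ≈⟨ convolve-swap (Ev-linear ps) N _ ⟩
    convolve N (λ m r → Ev (λ ks → pow R v m * elementary r (A ⟨ r ⟩) ks) ps)
      ≈⟨ convolve-cong N (λ m r → E.*-homo _ _) ⟩
    convolve N (λ m r → pow R v m * G r r)
      ≈⟨ convolve-complete N G Z (λ k → refl) (λ r k → trans (E.+-homo _ _) (+-congˡ (trans
           (E.cong (λ ks → IsLinear.lin₂ (elementary-linear r ks) w _ u _)) (E.lin₂ w _ u _)))) ⟩
    convolve N (λ m q → complete m (Z q) q)
      ≈⟨ head-only N ≡.refl ⟩
    complete N (Z 0) 0
      ≈⟨ complete-column N (Z 0) (killed 0) ⟩
    column N (Z 0) 0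
      ≈⟨ ap-columnPoly N N 0 (ℕₚ.+-identityʳ N) (Z 0) ⟨
    Ev A (columnPoly N N ∷ ps) ∎
    where
    ps = columns-of N N
    module E = IsLinear (Ev-linear ps)
    G Z : ℕ → ℕ → Carrier
    G r k = Ev (elementary r (A ⟨ k ⟩)) ps
    Z r k = Ev (elementary r A ⟨ k ⟩) ps
    killed : ∀ q m j → m ℕ.+ suc j ≡ N → column m (Z q) (suc j) ≈ 0#
    killed q m j eq = trans (sym (ap-columnPoly N m (suc j) eq (Z q)))
      (repeated-head (Ev-alternating (elementary-alternating q alt))
        (∈-map⁺ (columnPoly N) (∈-downFrom⁺ (≡.subst (suc m ℕ.≤_) (≡.trans (≡.sym (ℕₚ.+-suc m j)) eq) (ℕ.s≤s (ℕₚ.m≤m+n m j))))))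
    head-only : ∀ M → M ≡ N → convolve M (λ m q → complete m (Z q) q) ≈ complete M (Z 0) 0
    head-only zero    eq = refl
    head-only (suc M) eq = trans (+-congˡ (convolve-vanish M (λ m q eq′ →
      complete-vanish N (Z (suc q)) (killed (suc q)) m q (≡.trans (ℕₚ.+-suc m q) (≡.trans (≡.cong suc eq′) eq))))) (+-identityʳ _)

  couple-map-suc : ∀ A k ls → couple A k (map suc ls) ≈ couple (λ q → A (proj₁ q , map suc (proj₂ q))) k ls
  couple-map-suc A k []       = refl
  couple-map-suc A k (l ∷ ls) = +-cong (+-cong (*-congˡ (couple-map-suc (A ∘ insert (suc l)) k ls))
    (*-congˡ (couple-map-suc (A ∘ insert (suc l)) (suc k) ls))) (*-congˡ (couple-map-suc (A ∘ insert (suc (suc l))) (suc k) ls))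

  coupleAll-map-suc : ∀ A ks → coupleAll A (map suc ks) ≈ coupleAll (A ∘ map suc) ks
  coupleAll-map-suc A []       = refl
  coupleAll-map-suc A (k ∷ ks) = trans (coupleAll-map-suc (couple (A ∘ cons) (suc k)) ks)
    (IsLinear.cong (coupleAll-linear ks) (λ ls → trans (couple-map-suc (A ∘ cons) (suc k) ls)
      (sym (couple-shift (λ q → A (proj₁ q ∷ map suc (proj₂ q))) k ls))))

  -- The tail exponents are those of the smaller case raised by one, and multiplying a column by t
  -- replaces its N by N + 1.
  coupleAll-interval : ∀ N {A} → Alternating A →
    coupleAll A (interval 0 (suc N)) ≈ Ev A (columns-of N (suc N))
  coupleAll-interval zero    {A} alt = solve 1 (λ x → x := con (ℤ.+ 1) :* x :+ con (ℤ.+ 0)) refl _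
  coupleAll-interval (suc N) {A} alt = begin
    coupleAll A′ (interval 1 (suc N))
      ≡⟨ ≡.cong (coupleAll A′) (map-suc-interval 0 (suc N)) ⟨
    coupleAll A′ (map suc (interval 0 (suc N)))
      ≈⟨ coupleAll-map-suc A′ (interval 0 (suc N)) ⟩
    coupleAll (A′ ∘ map suc) (interval 0 (suc N))
      ≈⟨ coupleAll-interval N (map-alternating (couple-alternating (λ k → head-alternating alt k) 0) suc) ⟩
    Ev (A′ ∘ map suc) (columns-of N (suc N))
      ≈⟨ Ev-mapLin suc A′ (columns-of N (suc N)) ⟨
    Ev A′ (map (mapLin suc) (map (columnPoly N) (downFrom (suc N))))
      ≡⟨ ≡.cong (Ev A′) (Listₚ.map-∘ {g = mapLin suc} {f = columnPoly N} (downFrom (suc N))) ⟨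
    Ev A′ (map (mapLin suc ∘ columnPoly N) (downFrom (suc N)))
      ≈⟨ Ev-map-cong (mapLin suc ∘ columnPoly N) (columnPoly (suc N)) (downFrom (suc N)) shifted A′ ⟩
    Ev A′ (columns-of (suc N) (suc N))
      ≈⟨ couple-head (suc N) alt ⟩
    Ev A (columns-of (suc N) (suc (suc N))) ∎
    where
    A′ = couple (A ∘ cons) 0
    shifted : ∀ m → m ∈ downFrom (suc N) → ∀ f → ap (mapLin suc (columnPoly N m)) f ≈ ap (columnPoly (suc N) m) f
    shifted m m∈ f = trans (ap-mapLin suc (columnPoly N m) f) (trans (ap-columnPoly N m (N ℕ.∸ m) eq (f ∘ suc))
      (trans (column-shift m f _) (sym (ap-columnPoly (suc N) m (suc (N ℕ.∸ m)) (≡.trans (ℕₚ.+-suc m _) (≡.cong suc eq)) f))))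
      where eq = ℕₚ.m+[n∸m]≡n (ℕ.s≤s⁻¹ (∈-downFrom⁻ m∈))

∈-filterᵇ⁻ : ∀ {a} {X : Set a} (p : X → Bool) {x} xs → x ∈ filterᵇ p xs → x ∈ xs × p x ≡ true
∈-filterᵇ⁻ p (y ∷ xs) x∈ with p y in eq
∈-filterᵇ⁻ p (y ∷ xs) (here ≡.refl) | true = here ≡.refl , eq
∈-filterᵇ⁻ p (y ∷ xs) (there x∈) | true with x∈′ , px ← ∈-filterᵇ⁻ p xs x∈ = there x∈′ , px
∈-filterᵇ⁻ p (y ∷ xs) x∈ | false with x∈′ , px ← ∈-filterᵇ⁻ p xs x∈ = there x∈′ , px

-- Finite sums over lists.

module Sums {c ℓ} (R : CommutativeRing c ℓ) where
  open CommutativeRing R hiding (zero)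
  open IntegerSolver R
  open import Relation.Binary.Reasoning.Setoid setoid

  ∑ : ∀ {a} {X : Set a} → List X → (X → Carrier) → Carrier
  ∑ xs f = Σ R (map f xs)

  ∑-cong : ∀ {a} {X : Set a} (xs : List X) {f g} → (∀ x → x ∈ xs → f x ≈ g x) → ∑ xs f ≈ ∑ xs g
  ∑-cong []       e = refl
  ∑-cong (x ∷ xs) e = +-cong (e x (here ≡.refl)) (∑-cong xs (λ y y∈ → e y (there y∈)))

  ∑-map : ∀ {a b} {X : Set a} {Y : Set b} (h : X → Y) xs f → ∑ (map h xs) f ≈ ∑ xs (f ∘ h)
  ∑-map h []       f = refl
  ∑-map h (x ∷ xs) f = +-congˡ (∑-map h xs f)

  ∑-++ : ∀ {a} {X : Set a} (xs ys : List X) f → ∑ (xs ++ ys) f ≈ ∑ xs f + ∑ ys f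
  ∑-++ []       ys f = sym (+-identityˡ _)
  ∑-++ (x ∷ xs) ys f = trans (+-congˡ (∑-++ xs ys f)) (sym (+-assoc _ _ _))

  ∑-concatMap : ∀ {a b} {X : Set a} {Y : Set b} (h : X → List Y) xs f →
    ∑ (concatMap h xs) f ≈ ∑ xs (λ x → ∑ (h x) f)
  ∑-concatMap h []       f = refl
  ∑-concatMap h (x ∷ xs) f = trans (∑-++ (h x) (concatMap h xs) f) (+-congˡ (∑-concatMap h xs f))

  ∑-zero : ∀ {a} {X : Set a} (xs : List X) → ∑ xs (λ _ → 0#) ≈ 0#
  ∑-zero []       = refl
  ∑-zero (x ∷ xs) = trans (+-identityˡ _) (∑-zero xs)

  ∑-*ˡ : ∀ {a} {X : Set a} z (xs : List X) f → ∑ xs (λ x → z * f x) ≈ z * ∑ xs f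
  ∑-*ˡ z []       f = sym (zeroʳ z)
  ∑-*ˡ z (x ∷ xs) f = trans (+-congˡ (∑-*ˡ z xs f)) (sym (distribˡ z _ _))

  ∑-+ : ∀ {a} {X : Set a} (xs : List X) f g → ∑ xs (λ x → f x + g x) ≈ ∑ xs f + ∑ xs g
  ∑-+ []       f g = sym (+-identityˡ 0#)
  ∑-+ (x ∷ xs) f g = trans (+-congˡ (∑-+ xs f g))
    (solve 4 (λ a b c d → (a :+ b) :+ (c :+ d) := (a :+ c) :+ (b :+ d)) refl _ _ _ _)

  ∑-swap : ∀ {a b} {X : Set a} {Y : Set b} (xs : List X) (ys : List Y) (f : X → Y → Carrier) →
    ∑ xs (λ x → ∑ ys (f x)) ≈ ∑ ys (λ y → ∑ xs (λ x → f x y))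
  ∑-swap []       ys f = sym (∑-zero ys)
  ∑-swap (x ∷ xs) ys f = trans (+-congˡ (∑-swap xs ys f)) (sym (∑-+ ys _ _))

  ∑-filterᵇ : ∀ {a} {X : Set a} (p : X → Bool) xs f → ∑ (filterᵇ p xs) f ≈ ∑ xs (λ x → if p x then f x else 0#)
  ∑-filterᵇ p []       f = refl
  ∑-filterᵇ p (x ∷ xs) f with p x
  ... | true  = +-congˡ (∑-filterᵇ p xs f)
  ... | false = trans (∑-filterᵇ p xs f) (sym (+-identityˡ _))

  ∑-↭ : ∀ {a} {X : Set a} {xs ys : List X} → xs ↭ ys → ∀ f → ∑ xs f ≈ ∑ ys f
  ∑-↭ Perm.refl          f = refl
  ∑-↭ (Perm.prep x p)    f = +-congˡ (∑-↭ p f)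
  ∑-↭ (Perm.swap x y p)  f = trans (+-congˡ (+-congˡ (∑-↭ p f)))
    (solve 3 (λ a b m → a :+ (b :+ m) := b :+ (a :+ m)) refl _ _ _)
  ∑-↭ (Perm.trans p q)   f = trans (∑-↭ p f) (∑-↭ q f)

-- Expansion of the wedge of columns in basis vectors.

-- A state is a basis vector of the wedge of the columns m, …, 1: at the position followed by b
-- others, nothing stands for the letter low (b + 1) and just a for high a.  The nonempty positions
-- form a Frobenius symbol: armsOf gives the a's, legsOf the b's.
State : Set
State = List (Maybe ℕ)

armsOf legsOf : State → List ℕ
armsOf []            = []
armsOf (nothing ∷ r) = armsOf r
armsOf (just a ∷ r)  = a ∷ armsOf r
legsOf []            = []
legsOf (nothing ∷ r) = legsOf r
legsOf (just a ∷ r)  = length r ∷ legsOf r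

below : ℕ → State → Bool
below a []            = true
below a (nothing ∷ r) = below a r
below a (just b ∷ r)  = b ℕ.<ᵇ a

-- Arms decrease strictly and no arm exceeds its leg. The second condition makes the truncated
-- exponent of w in `stateWeight` a true difference.
Valid : State → Set
Valid []            = ⊤
Valid (nothing ∷ r) = Valid r
Valid (just a ∷ r)  = Valid r × below a r ≡ true × a ℕ.≤ length r

-- The letters that arise when `raise` acts on every position and `columnWord 1` joins at the end. A
-- term with the letter `high a` twice dies in the wedge, whence the filter.
successors : State → List State
successors []            = (nothing ∷ []) ∷ (just 0 ∷ []) ∷ []
successors (nothing ∷ r) = map (nothing ∷_) (successors r)
successors (just a ∷ r)  = map (just a ∷_) (filterᵇ (below a) (successors r)) ++ map (just (suc a) ∷_) (successors r)

states : ℕ → List State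
states zero    = [] ∷ []
states (suc m) = concatMap successors (states m)

length-successors : ∀ s t → t ∈ successors s → length t ≡ suc (length s)
length-successors [] t (here ≡.refl) = ≡.refl
length-successors [] t (there (here ≡.refl)) = ≡.refl
length-successors (nothing ∷ s) t t∈ with t′ , t′∈ , ≡.refl ← ∈-map⁻ (nothing ∷_) t∈ =
  ≡.cong suc (length-successors s t′ t′∈)
length-successors (just a ∷ s) t t∈ with ∈-++⁻ (map (just a ∷_) (filterᵇ (below a) (successors s))) t∈
... | inj₁ t∈₁ with t′ , t′∈ , ≡.refl ← ∈-map⁻ (just a ∷_) t∈₁ =
  ≡.cong suc (length-successors s t′ (proj₁ (∈-filterᵇ⁻ (below a) (successors s) t′∈)))
... | inj₂ t∈₂ with t′ , t′∈ , ≡.refl ← ∈-map⁻ (just (suc a) ∷_) t∈₂ =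
  ≡.cong suc (length-successors s t′ t′∈)

<ᵇ-suc : ∀ a b → (a ℕ.<ᵇ b) ≡ true → (a ℕ.<ᵇ suc b) ≡ true
<ᵇ-suc zero    b       eq = ≡.refl
<ᵇ-suc (suc a) (suc b) eq = <ᵇ-suc a b eq

-- One step raises an arm by at most one, so arms below a stay below a + 1. Hence the successors in
-- which the first arm grows are valid without a filter.
below-successors : ∀ a s → below a s ≡ true → ∀ t → t ∈ successors s → below (suc a) t ≡ true
below-successors a [] _ t (here ≡.refl) = ≡.refl
below-successors a [] _ t (there (here ≡.refl)) = ≡.refl
below-successors a (nothing ∷ s) bel t t∈ with t′ , t′∈ , ≡.refl ← ∈-map⁻ (nothing ∷_) t∈ =
  below-successors a s bel t′ t′∈
below-successors a (just b ∷ s) bel t t∈ with ∈-++⁻ (map (just b ∷_) (filterᵇ (below b) (successors s))) t∈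
... | inj₁ t∈₁ with t′ , t′∈ , ≡.refl ← ∈-map⁻ (just b ∷_) t∈₁ = <ᵇ-suc b a bel
... | inj₂ t∈₂ with t′ , t′∈ , ≡.refl ← ∈-map⁻ (just (suc b) ∷_) t∈₂ = bel

successors-valid : ∀ s → Valid s → ∀ t → t ∈ successors s → Valid t
successors-valid [] _ t (here ≡.refl) = tt
successors-valid [] _ t (there (here ≡.refl)) = tt , ≡.refl , ℕ.z≤n
successors-valid (nothing ∷ s) val t t∈ with t′ , t′∈ , ≡.refl ← ∈-map⁻ (nothing ∷_) t∈ = successors-valid s val t′ t′∈
successors-valid (just a ∷ s) (val , bel , a≤) t t∈ with ∈-++⁻ (map (just a ∷_) (filterᵇ (below a) (successors s))) t∈
... | inj₁ t∈₁ with t′ , t′∈ , ≡.refl ← ∈-map⁻ (just a ∷_) t∈₁ =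
  let t′∈′ , bel′ = ∈-filterᵇ⁻ (below a) (successors s) t′∈ in
  successors-valid s val t′ t′∈′ , bel′ , ≡.subst (a ℕ.≤_) (≡.sym (length-successors s t′ t′∈′)) (ℕₚ.m≤n⇒m≤1+n a≤)
... | inj₂ t∈₂ with t′ , t′∈ , ≡.refl ← ∈-map⁻ (just (suc a) ∷_) t∈₂ =
  successors-valid s val t′ t′∈ , below-successors a s bel t′ t′∈ ,
  ≡.subst (suc a ℕ.≤_) (≡.sym (length-successors s t′ t′∈)) (ℕ.s≤s a≤)

concatMap-∈ : ∀ {a b} {X : Set a} {Y : Set b} (h : X → List Y) xs {y} → y ∈ concatMap h xs → ∃ λ x → x ∈ xs × y ∈ h x
concatMap-∈ h (x ∷ xs) y∈ with ∈-++⁻ (h x) y∈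
... | inj₁ y∈₁ = x , here ≡.refl , y∈₁
... | inj₂ y∈₂ with x′ , x′∈ , y∈′ ← concatMap-∈ h xs y∈₂ = x′ , there x′∈ , y∈′

states-valid : ∀ m s → s ∈ states m → Valid s
states-valid zero    s (here ≡.refl) = tt
states-valid (suc m) s s∈ with t , t∈ , s∈′ ← concatMap-∈ successors (states m) s∈ =
  successors-valid t (states-valid m t t∈) s s∈′

length-states : ∀ m s → s ∈ states m → length s ≡ m
length-states zero    s (here ≡.refl) = ≡.refl
length-states (suc m) s s∈ with t , t∈ , s∈′ ← concatMap-∈ successors (states m) s∈ =
  ≡.trans (length-successors t s s∈′) (≡.cong suc (length-states m t t∈))

letters : State → List Letter
letters []            = []
letters (nothing ∷ r) = low (suc (length r)) ∷ letters r
letters (just a ∷ r)  = high a ∷ letters r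

lows : State → List Letter
lows []            = []
lows (nothing ∷ r) = low (suc (length r)) ∷ lows r
lows (just a ∷ r)  = lows r

highs : State → List Letter → List Letter
highs []            hs = hs
highs (nothing ∷ r) hs = highs r hs
highs (just a ∷ r)  hs = highs r (high a ∷ hs)

-- For a valid state these exponents increase. `low 0` belongs to no position and always stays, so
-- `high a` in place of `low (b + 1)` is a hook with leg b + 1, not b.
sortedExponents : ℕ → State → List ℕ
sortedExponents N s = map (exponent N) (lows s ++ low 0 ∷ highs s [])

<ᵇ-antisym : ∀ a b → (a ℕ.<ᵇ b) ≡ false → (a ℕ.<ᵇ suc b) ≡ true → a ≡ b
<ᵇ-antisym zero    zero    p q = ≡.refl
<ᵇ-antisym (suc a) (suc b) p q = ≡.cong suc (<ᵇ-antisym a b p q)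

not-below : ∀ a s → below a s ≡ false → below (suc a) s ≡ true → high a ∈ letters s
not-below a (nothing ∷ s) p q = there (not-below a s p q)
not-below a (just b ∷ s)  p q with ≡.refl ← <ᵇ-antisym b a p q = here ≡.refl

map-downFrom-suc : ∀ {a} {X : Set a} (f : ℕ → X) m → map f (downFrom (suc m)) ≡ map (f ∘ suc) (downFrom m) ++ f 0 ∷ []
map-downFrom-suc f zero    = ≡.refl
map-downFrom-suc f (suc m) = ≡.cong (f (suc m) ∷_) (map-downFrom-suc f m)

module StateExpansion {c ℓ} (R : CommutativeRing c ℓ) (u v w : CommutativeRing.Carrier R) where
  open CommutativeRing R hiding (zero)
  open IntegerSolver R
  open Functionals R
  open Sums R
  open LinearForms R
  open Coupling R u v w
  open Determinant R u v w
  open Alternating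
  open import Relation.Binary.Reasoning.Setoid setoid

  stateWeight : State → Carrier
  stateWeight []            = 1#
  stateWeight (nothing ∷ r) = pow R v (suc (length r)) * stateWeight r
  stateWeight (just a ∷ r)  = pow R u (suc a) * pow R w (length r ℕ.∸ a) * stateWeight r

  -- The sign of -u (-u)^a (-w)^(b-a), the contribution of `high a` at a position followed by b
  -- others.
  stateSign : State → Carrier
  stateSign []            = 1#
  stateSign (nothing ∷ r) = stateSign r
  stateSign (just a ∷ r)  = sign (suc (length r)) * stateSign r

  suffix-alternating : ∀ {a} {X : Set a} {A : Fun X} → Alternating A → ∀ zs → Alternating (λ xs → A (xs ++ zs))
  suffix-alternating {A = A} alt zs = record
    { adjacent = λ α x γ → trans (reflexive (≡.cong A (Listₚ.++-assoc α _ zs))) (adjacent alt α x (γ ++ zs))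
    ; exchange = λ α x y γ → trans (reflexive (≡.cong A (Listₚ.++-assoc α _ zs)))
        (trans (exchange alt α x y (γ ++ zs)) (-‿cong (reflexive (≡.cong A (≡.sym (Listₚ.++-assoc α _ zs)))))) }

  Ev-++ : ∀ {a} {X : Set a} (A : Fun X) ps qs → Ev A (ps ++ qs) ≈ Ev (λ xs → Ev (λ ys → A (xs ++ ys)) qs) ps
  Ev-++ A []       qs = refl
  Ev-++ A (p ∷ ps) qs = IsLinear.cong (ap-linear p) (λ x → Ev-++ (A ⟨ x ⟩) ps qs)

  successors-sum : ∀ s → Valid s → ∀ {A} → Alternating A →
    stateSign s * stateWeight s * Ev A (map raise (letters s) ++ columnWord 1 ∷ [])
    ≈ ∑ (successors s) (λ t → stateSign t * stateWeight t * A (letters t))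
  successors-sum [] _ {A} alt = solve 4 (λ u v x y →
    con (ℤ.+ 1) :* con (ℤ.+ 1) :* (v :* x :+ (:- u :* y :+ con (ℤ.+ 0)))
    := con (ℤ.+ 1) :* (v :* con (ℤ.+ 1) :* con (ℤ.+ 1)) :* x
       :+ (:- con (ℤ.+ 1) :* con (ℤ.+ 1) :* (u :* con (ℤ.+ 1) :* con (ℤ.+ 1) :* con (ℤ.+ 1)) :* y :+ con (ℤ.+ 0))) refl u v _ _
  successors-sum (nothing ∷ s) val {A} alt = begin
    stateSign s * (pow R v k * stateWeight s) * (v * E + 0#)
      ≈⟨ solve 5 (λ a p b v e → a :* (p :* b) :* (v :* e :+ con (ℤ.+ 0)) := v :* p :* (a :* b :* e)) refl _ _ _ v _ ⟩
    v * pow R v k * (stateSign s * stateWeight s * E)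
      ≈⟨ *-congˡ (successors-sum s val (head-alternating alt (low (suc k)))) ⟩
    v * pow R v k * ∑ (successors s) (λ t → stateSign t * stateWeight t * A (low (suc k) ∷ letters t))
      ≈⟨ ∑-*ˡ _ (successors s) _ ⟨
    ∑ (successors s) (λ t → pow R v (suc k) * (stateSign t * stateWeight t * A (low (suc k) ∷ letters t)))
      ≈⟨ ∑-cong (successors s) (λ t t∈ → trans
           (reflexive (≡.cong (λ j → pow R v (suc j) * (stateSign t * stateWeight t * A (low (suc j) ∷ letters t))) (≡.sym (length-successors s t t∈))))
           (solve 4 (λ p a b e → p :* (a :* b :* e) := a :* (p :* b) :* e) refl _ _ _ _)) ⟩
    ∑ (successors s) (λ t → stateSign (nothing ∷ t) * stateWeight (nothing ∷ t) * A (letters (nothing ∷ t)))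
      ≈⟨ ∑-map (nothing ∷_) (successors s) _ ⟨
    ∑ (successors (nothing ∷ s)) (λ t → stateSign t * stateWeight t * A (letters t)) ∎
    where
    k = suc (length s)
    E = Ev (A ⟨ low (suc k) ⟩) (map raise (letters s) ++ columnWord 1 ∷ [])
  successors-sum (just a ∷ s) (val , bel , a≤) {A} alt = begin
    sg * stateSign s * (pow R u (suc a) * pow R w (length s ℕ.∸ a) * stateWeight s) * ((- w) * E a + ((- u) * E (suc a) + 0#))
      ≈⟨ solve 9 (λ g a p q b w u e f → g :* a :* (p :* q :* b) :* (:- w :* e :+ (:- u :* f :+ con (ℤ.+ 0)))
           := :- g :* p :* (w :* q) :* (a :* b :* e) :+ :- g :* (u :* p) :* q :* (a :* b :* f)) refl sg _ _ _ _ w u _ _ ⟩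
    (- sg) * pow R u (suc a) * (w * pow R w (length s ℕ.∸ a)) * (stateSign s * stateWeight s * E a)
      + (- sg) * pow R u (suc (suc a)) * pow R w (length s ℕ.∸ a) * (stateSign s * stateWeight s * E (suc a))
      ≈⟨ +-cong (*-congˡ (successors-sum s val (head-alternating alt (high a)))) (*-congˡ (successors-sum s val (head-alternating alt (high (suc a))))) ⟩
    _ ≈⟨ +-cong (∑-*ˡ _ (successors s) _) (∑-*ˡ _ (successors s) _) ⟨
    _ ≈⟨ +-cong first second ⟩
    ∑ (map (just a ∷_) (filterᵇ (below a) (successors s))) F + ∑ (map (just (suc a) ∷_) (successors s)) F
      ≈⟨ ∑-++ (map (just a ∷_) (filterᵇ (below a) (successors s))) _ F ⟨
    ∑ (successors (just a ∷ s)) F ∎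
    where
    sg = sign (suc (length s))
    E : ℕ → Carrier
    E a = Ev (A ⟨ high a ⟩) (map raise (letters s) ++ columnWord 1 ∷ [])
    F : State → Carrier
    F t = stateSign t * stateWeight t * A (letters t)
    first : ∑ (successors s) (λ t → (- sg) * pow R u (suc a) * (w * pow R w (length s ℕ.∸ a)) * (stateSign t * stateWeight t * A (high a ∷ letters t)))
      ≈ ∑ (map (just a ∷_) (filterᵇ (below a) (successors s))) F
    first = begin
      _ ≈⟨ ∑-cong (successors s) pointwise ⟩
      ∑ (successors s) (λ t → if below a t then F (just a ∷ t) else 0#)
        ≈⟨ ∑-filterᵇ (below a) (successors s) _ ⟨
      ∑ (filterᵇ (below a) (successors s)) (λ t → F (just a ∷ t))
        ≈⟨ ∑-map (just a ∷_) (filterᵇ (below a) (successors s)) F ⟨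
      _ ∎
      where
      pointwise : ∀ t → t ∈ successors s →
        (- sg) * pow R u (suc a) * (w * pow R w (length s ℕ.∸ a)) * (stateSign t * stateWeight t * A (high a ∷ letters t))
        ≈ (if below a t then F (just a ∷ t) else 0#)
      pointwise t t∈ with below a t in eq
      ... | true = trans
        (solve 6 (λ g p q a b e → g :* p :* q :* (a :* b :* e) := g :* a :* (p :* q :* b) :* e) refl _ _ _ _ _ _)
        (*-congʳ (*-cong (*-congʳ (reflexive (≡.cong (λ j → sign (suc j)) (≡.sym (length-successors s t t∈)))))
          (*-congʳ (*-congˡ (reflexive (≡.cong (pow R w) (≡.trans (≡.sym (ℕₚ.+-∸-assoc 1 a≤)) (≡.cong (ℕ._∸ a) (≡.sym (length-successors s t t∈))))))))))
      -- A successor that is not below a, yet below a + 1, contains `high a` a second time.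
      ... | false = trans (*-congˡ (*-congˡ (repeated-head alt (not-below a t eq (below-successors a s bel t t∈)))))
        (solve 2 (λ a b → a :* (b :* con (ℤ.+ 0)) := con (ℤ.+ 0)) refl _ _)
    second : ∑ (successors s) (λ t → (- sg) * pow R u (suc (suc a)) * pow R w (length s ℕ.∸ a) * (stateSign t * stateWeight t * A (high (suc a) ∷ letters t)))
      ≈ ∑ (map (just (suc a) ∷_) (successors s)) F
    second = trans (∑-cong (successors s) (λ t t∈ → trans
        (solve 6 (λ g p q a b e → g :* p :* q :* (a :* b :* e) := g :* a :* (p :* q :* b) :* e) refl _ _ _ _ _ _)
        (reflexive (≡.cong (λ j → sign (suc j) * stateSign t * (pow R u (suc (suc a)) * pow R w (j ℕ.∸ suc a) * stateWeight t) * A (high (suc a) ∷ letters t))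
          (≡.sym (length-successors s t t∈))))))
      (sym (∑-map (just (suc a) ∷_) (successors s) F))

  -- Columns m + 1, ..., 2 are columns m, ..., 1 raised. So raising, together with the appended
  -- column 1, is absorbed into the functional before the induction hypothesis is used.
  columns-sum : ∀ m {A} → Alternating A →
    Ev A (map (columnWord ∘ suc) (downFrom m)) ≈ ∑ (states m) (λ s → stateSign s * stateWeight s * A (letters s))
  columns-sum zero    {A} alt = solve 1 (λ x → x := con (ℤ.+ 1) :* con (ℤ.+ 1) :* x :+ con (ℤ.+ 0)) refl _
  columns-sum (suc m) {A} alt = begin
    Ev A (map (columnWord ∘ suc) (downFrom (suc m)))
      ≡⟨ ≡.cong (Ev A) (map-downFrom-suc (columnWord ∘ suc) m) ⟩
    Ev A (map (columnWord ∘ suc ∘ suc) (downFrom m) ++ columnWord 1 ∷ [])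
      ≈⟨ Ev-++ A (map (columnWord ∘ suc ∘ suc) (downFrom m)) _ ⟩
    Ev Γ (map (columnWord ∘ suc ∘ suc) (downFrom m))
      ≡⟨ ≡.cong (Ev Γ) (Listₚ.map-∘ {g = λ p → bind p raise} {f = columnWord ∘ suc} (downFrom m)) ⟩
    Ev Γ (map (λ p → bind p raise) (map (columnWord ∘ suc) (downFrom m)))
      ≈⟨ Ev-bind raise Γ (map (columnWord ∘ suc) (downFrom m)) ⟩
    Ev (Ev Γ ∘ map raise) (map (columnWord ∘ suc) (downFrom m))
      ≈⟨ IsLinear.cong (Ev-linear (map (columnWord ∘ suc) (downFrom m))) (λ xs → Ev-++ A (map raise xs) _) ⟨
    Ev B (map (columnWord ∘ suc) (downFrom m))
      ≈⟨ columns-sum m (map-alternating (suffix-alternating (Ev-alternating alt) (columnWord 1 ∷ [])) raise) ⟩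
    ∑ (states m) (λ s → stateSign s * stateWeight s * B (letters s))
      ≈⟨ ∑-cong (states m) (λ s s∈ → successors-sum s (states-valid m s s∈) alt) ⟩
    ∑ (states m) (λ s → ∑ (successors s) (λ t → stateSign t * stateWeight t * A (letters t)))
      ≈⟨ ∑-concatMap successors (states m) _ ⟨
    ∑ (states (suc m)) (λ t → stateSign t * stateWeight t * A (letters t)) ∎
    where
    B Γ : _
    Γ = λ xs → Ev (λ ys → A (xs ++ ys)) (columnWord 1 ∷ [])
    B = λ (xs : List Letter) → Ev A (map raise xs ++ columnWord 1 ∷ [])

  length-letters : ∀ s → length (letters s) ≡ length s
  length-letters []            = ≡.refl
  length-letters (nothing ∷ s) = ≡.cong suc (length-letters s)
  length-letters (just a ∷ s)  = ≡.cong suc (length-letters s)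

  sign-square : ∀ n → sign n * sign n ≈ 1#
  sign-square zero    = *-identityˡ 1#
  sign-square (suc n) = trans (solve 1 (λ s → :- s :* :- s := s :* s) refl _) (sign-square n)

  -- Moving `high a` behind `low 0` passes the b letters to its right and `low 0` itself: b + 1
  -- transpositions, which is the sign kept in `stateSign`.
  sort-letters : ∀ s {A} → Alternating A → ∀ hs →
    stateSign s * A (letters s ++ low 0 ∷ hs) ≈ A (lows s ++ low 0 ∷ highs s hs)
  sort-letters []            alt hs = *-identityˡ _
  sort-letters (nothing ∷ s) alt hs = sort-letters s (head-alternating alt _) hs
  sort-letters (just a ∷ s) {A} alt hs = begin
    sign (suc (length s)) * stateSign s * A (high a ∷ letters s ++ low 0 ∷ hs)
      ≈⟨ *-congˡ (trans (reflexive (≡.cong (λ xs → A (high a ∷ xs)) (≡.sym (Listₚ.++-assoc (letters s) (low 0 ∷ []) hs))))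
           (front-to-back alt (high a) (letters s ++ low 0 ∷ []) hs)) ⟩
    sign (suc (length s)) * stateSign s * (sign (length (letters s ++ low 0 ∷ [])) * A ((letters s ++ low 0 ∷ []) ++ high a ∷ hs))
      ≈⟨ *-congˡ (*-cong (reflexive (≡.cong sign (≡.trans (Listₚ.length-++ (letters s)) (≡.trans (ℕₚ.+-comm _ 1) (≡.cong suc (length-letters s))))))
           (reflexive (≡.cong A (Listₚ.++-assoc (letters s) (low 0 ∷ []) (high a ∷ hs))))) ⟩
    sign (suc (length s)) * stateSign s * (sign (suc (length s)) * A (letters s ++ low 0 ∷ high a ∷ hs))
      ≈⟨ solve 3 (λ g a e → g :* a :* (g :* e) := g :* g :* (a :* e)) refl _ _ _ ⟩
    sign (suc (length s)) * sign (suc (length s)) * (stateSign s * A (letters s ++ low 0 ∷ high a ∷ hs))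
      ≈⟨ trans (*-cong (sign-square (suc (length s))) (sort-letters s alt (high a ∷ hs))) (*-identityˡ _) ⟩
    A (lows s ++ low 0 ∷ highs s (high a ∷ hs)) ∎

  coupleAll-states : ∀ N {A} → Alternating A →
    coupleAll A (interval 0 (suc N)) ≈ ∑ (states N) (λ s → stateWeight s * A (sortedExponents N s))
  coupleAll-states N {A} alt = begin
    coupleAll A (interval 0 (suc N))
      ≈⟨ coupleAll-interval N alt ⟩
    Ev A (map (columnPoly N) (downFrom (suc N)))
      ≡⟨ ≡.cong (Ev A) (Listₚ.map-∘ {g = mapLin (exponent N)} {f = columnWord} (downFrom (suc N))) ⟩
    Ev A (map (mapLin (exponent N)) (map columnWord (downFrom (suc N))))
      ≈⟨ Ev-mapLin (exponent N) A (map columnWord (downFrom (suc N))) ⟩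
    Ev B (map columnWord (downFrom (suc N)))
      ≡⟨ ≡.cong (Ev B) (map-downFrom-suc columnWord N) ⟩
    Ev B (map (columnWord ∘ suc) (downFrom N) ++ columnWord 0 ∷ [])
      ≈⟨ Ev-++ B (map (columnWord ∘ suc) (downFrom N)) _ ⟩
    Ev (λ xs → 1# * B (xs ++ low 0 ∷ []) + 0#) (map (columnWord ∘ suc) (downFrom N))
      ≈⟨ IsLinear.cong (Ev-linear (map (columnWord ∘ suc) (downFrom N)))
           (λ xs → solve 1 (λ x → con (ℤ.+ 1) :* x :+ con (ℤ.+ 0) := x) refl _) ⟩
    Ev (λ xs → B (xs ++ low 0 ∷ [])) (map (columnWord ∘ suc) (downFrom N))
      ≈⟨ columns-sum N (suffix-alternating altB (low 0 ∷ [])) ⟩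
    ∑ (states N) (λ s → stateSign s * stateWeight s * B (letters s ++ low 0 ∷ []))
      ≈⟨ ∑-cong (states N) (λ s _ → trans
           (solve 3 (λ a b e → a :* b :* e := b :* (a :* e)) refl _ _ _) (*-congˡ (sort-letters s altB []))) ⟩
    ∑ (states N) (λ s → stateWeight s * A (sortedExponents N s)) ∎
    where
    B : Fun Letter
    B = A ∘ map (exponent N)
    altB : Alternating B
    altB = map-alternating alt (exponent N)

-- The branching rule for the Schur functional.

addStaircase : ℕ → List ℕ → List ℕ
addStaircase j []       = []
addStaircase j (m ∷ ms) = m ℕ.+ j ∷ addStaircase (suc j) ms

Increasing : ℕ → List ℕ → Set
Increasing m []        = ⊤
Increasing m (m′ ∷ ms) = m ℕ.≤ m′ × Increasing m′ ms

Decreasing : ℕ → List ℕ → Set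
Decreasing p []        = ⊤
Decreasing p (p′ ∷ ps) = p′ ℕ.≤ p × Decreasing p′ ps

Decreasing-weaken : ∀ {p q} ps → p ℕ.≤ q → Decreasing p ps → Decreasing q ps
Decreasing-weaken []       le dec         = tt
Decreasing-weaken (_ ∷ ps) le (le′ , dec) = ℕₚ.≤-trans le′ le , dec

Positive : ℕ → List ℕ → Set
Positive zero    qs       = ⊤
Positive (suc k) []       = ⊥
Positive (suc k) (q ∷ qs) = 1 ℕ.≤ q × Positive k qs

lastOf : ℕ → List ℕ → ℕ
lastOf p []        = p
lastOf p (p′ ∷ ps) = lastOf p′ ps

lastOf-≤ : ∀ p ps → Decreasing p ps → lastOf p ps ℕ.≤ p
lastOf-≤ p []        _            = ℕₚ.≤-refl
lastOf-≤ p (p′ ∷ ps) (p′≤p , dec) = ℕₚ.≤-trans (lastOf-≤ p′ ps dec) p′≤p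

suc-≤ᵇ-suc : ∀ a q → (suc a ℕ.≤ᵇ suc q) ≡ (a ℕ.≤ᵇ q)
suc-≤ᵇ-suc zero    q = ≡.refl
suc-≤ᵇ-suc (suc a) q = ≡.refl

module Branching {c ℓ} (R : CommutativeRing c ℓ) (y : CommutativeRing.Carrier R) where
  open CommutativeRing R hiding (zero)
  open IntegerSolver R
  open Functionals R
  open Tensor R
  open LinearForms R
  open SchurExtension R
  open Alternating
  open import Relation.Binary.Reasoning.Setoid setoid

  convolve-cong′ : ∀ N {h k} → (∀ m q → m ℕ.+ q ≡ N → h m q ≈ k m q) → convolve N h ≈ convolve N k
  convolve-cong′ zero    e = e 0 0 ≡.refl
  convolve-cong′ (suc N) e = +-cong (e (suc N) 0 (ℕₚ.+-identityʳ _))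
    (convolve-cong′ N (λ m q eq → e m (suc q) (≡.trans (ℕₚ.+-suc m q) (≡.cong suc eq))))

  -- The sum over lists interlacing with m ∷ ms, an entry chosen between neighbours m and m′ being
  -- weighted by y to its distance from m′: horizontal strips, read from the smallest part.
  branch : ℕ → List ℕ → Fun ℕ → Carrier
  branch m []        g = g []
  branch m (m′ ∷ ms) g = convolve (m′ ℕ.∸ m) (λ d i → pow R y d * branch m′ ms (g ⟨ m ℕ.+ i ⟩))

  convolve-weighted-linear : ∀ {a} {I : Set a} N {L : ℕ → (I → Carrier) → Carrier} → (∀ i → IsLinear (L i)) →
    IsLinear (λ F → convolve N (λ d i → pow R y d * L i F))
  convolve-weighted-linear N lin = record
    { cong = λ e → convolve-cong N (λ d i → *-congˡ (IsLinear.cong (lin i) e))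
    ; +-homo = λ F G → trans (convolve-cong N (λ d i → trans (*-congˡ (IsLinear.+-homo (lin i) F G)) (distribˡ _ _ _))) (convolve-+ N _ _)
    ; *-homo = λ a F → trans (convolve-cong N (λ d i → trans (*-congˡ (IsLinear.*-homo (lin i) a F))
        (solve 3 (λ p a x → p :* (a :* x) := a :* (p :* x)) refl _ a _))) (convolve-* N a _) }

  branch-linear : ∀ m ms → IsLinear (branch m ms)
  branch-linear m []        = record { cong = λ e → e [] ; +-homo = λ _ _ → refl ; *-homo = λ _ _ → refl }
  branch-linear m (m′ ∷ ms) = convolve-weighted-linear (m′ ℕ.∸ m) (λ i → linear-∘ (branch-linear m′ ms) (m ℕ.+ i ∷_))

  telescope : ∀ D (φ : ℕ → Carrier) → convolve D (λ d i → pow R y d * (φ (suc i) - y * φ i)) ≈ φ (suc D) - pow R y (suc D) * φ 0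
  telescope zero    φ = solve 3 (λ y a b → con (ℤ.+ 1) :* (a :- y :* b) := a :- y :* con (ℤ.+ 1) :* b) refl y _ _
  telescope (suc D) φ = trans (+-congˡ (telescope D (φ ∘ suc)))
    (solve 5 (λ y p a b e → y :* p :* (a :- y :* b) :+ (e :- y :* p :* a) := e :- y :* (y :* p) :* b) refl y _ _ _ _)

  -- The expansion `Wd` with the power of y of its first exponent divided out; what remains are the
  -- powers by which successive exponents differ.
  relativeWd : ℕ → ℕ → List ℕ → Fun ℕ → Carrier
  relativeWd j m []        A = A []
  relativeWd j m (m′ ∷ ms) A = A (addStaircase (suc j) (m′ ∷ ms)) - pow R y (suc (m′ ℕ.∸ m)) * relativeWd (suc j) m′ ms (A ⟨ m ℕ.+ j ⟩)

  relativeWd-vanish : ∀ j m ms {A} → (∀ xs → A xs ≈ 0#) → relativeWd j m ms A ≈ 0#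
  relativeWd-vanish j m []        e = e []
  relativeWd-vanish j m (m′ ∷ ms) e = trans (+-cong (e _) (-‿cong (*-congˡ (relativeWd-vanish (suc j) m′ ms (λ xs → e _)))))
    (solve 1 (λ p → con (ℤ.+ 0) :- p :* con (ℤ.+ 0) := con (ℤ.+ 0)) refl _)

  -- Every further term of the expansion contains m + j twice.
  relativeWd-diagonal : ∀ j m ms {A} → Alternating A →
    relativeWd j m ms (A ⟨ m ℕ.+ j ⟩) ≈ A (addStaircase j (m ∷ ms))
  relativeWd-diagonal j m []        alt = refl
  relativeWd-diagonal j m (m′ ∷ ms) alt = trans
    (+-congˡ (-‿cong (*-congˡ (relativeWd-vanish (suc j) m′ ms (adjacent alt [] (m ℕ.+ j))))))
    (solve 2 (λ a p → a :- p :* con (ℤ.+ 0) := a) refl _ _)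

  relativeWd-correct : ∀ j m ms A → Increasing m ms →
    pow R y (m ℕ.+ j) * (relativeWd j m ms A) ≈ Wd y A (addStaircase j (m ∷ ms))
  relativeWd-correct j m [] A inc = solve 2 (λ p a → p :* a := p :* a :- con (ℤ.+ 0)) refl _ _
  relativeWd-correct j m (m′ ∷ ms) A (m≤ , inc) = trans
    (trans (solve 4 (λ p a q b → p :* (a :- q :* b) := p :* a :- (p :* q) :* b) refl _ _ _ _)
      (+-congˡ (-‿cong (*-congʳ (trans (sym (pow-+ y (m ℕ.+ j) (suc (m′ ℕ.∸ m)))) (reflexive (≡.cong (pow R y) shuffle)))))))
    (+-congˡ (-‿cong (relativeWd-correct (suc j) m′ ms (A ⟨ m ℕ.+ j ⟩) inc)))
    where
    shuffle : m ℕ.+ j ℕ.+ suc (m′ ℕ.∸ m) ≡ m′ ℕ.+ suc j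
    shuffle = ≡.trans (ℕₚ.+-assoc m j _) (≡.trans (≡.cong (m ℕ.+_) (≡.trans (ℕₚ.+-suc j _) (ℕₚ.+-comm (suc j) (m′ ℕ.∸ m))))
      (≡.trans (≡.sym (ℕₚ.+-assoc m _ (suc j))) (≡.cong (ℕ._+ suc j) (ℕₚ.m+[n∸m]≡n m≤))))

  -- Each interlacing entry runs through an interval, on which multiplication by t - y telescopes.
  -- The upper end equals the next exponent and collapses by `relativeWd-diagonal`; the lower end
  -- supplies the remaining terms of the expansion.
  branch-difference : ∀ j m ms {A} → Increasing m ms → Alternating A →
    branch m ms (Ten (difference y) A ∘ addStaircase j) ≈ relativeWd j m ms A
  branch-difference j m [] inc alt = refl
  branch-difference j m (m′ ∷ ms) {A} (m≤ , inc) alt = begin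
    convolve (m′ ℕ.∸ m) (λ d i → pow R y d * branch m′ ms (Ten (difference y) A ∘ addStaircase j ∘ (m ℕ.+ i ∷_)))
      ≈⟨ convolve-cong (m′ ℕ.∸ m) (λ d i → *-congˡ (step i)) ⟩
    convolve (m′ ℕ.∸ m) (λ d i → pow R y d * (φ (suc i) - y * φ i))
      ≈⟨ telescope (m′ ℕ.∸ m) φ ⟩
    φ (suc (m′ ℕ.∸ m)) - pow R y (suc (m′ ℕ.∸ m)) * φ 0
      ≈⟨ +-cong (trans (reflexive (≡.cong (λ k → relativeWd (suc j) m′ ms (A ⟨ k ⟩)) top)) (relativeWd-diagonal (suc j) m′ ms alt))
           (-‿cong (*-congˡ (reflexive (≡.cong (λ k → relativeWd (suc j) m′ ms (A ⟨ k ℕ.+ j ⟩)) (ℕₚ.+-identityʳ m))))) ⟩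
    relativeWd j m (m′ ∷ ms) A ∎
    where
    φ : ℕ → Carrier
    φ i = relativeWd (suc j) m′ ms (A ⟨ m ℕ.+ i ℕ.+ j ⟩)
    module B = IsLinear (branch-linear m′ ms)
    top : m ℕ.+ suc (m′ ℕ.∸ m) ℕ.+ j ≡ m′ ℕ.+ suc j
    top = ≡.trans (≡.cong (ℕ._+ j) (≡.trans (ℕₚ.+-suc m _) (≡.cong suc (ℕₚ.m+[n∸m]≡n m≤)))) (≡.sym (ℕₚ.+-suc m′ j))
    step : ∀ i → branch m′ ms (Ten (difference y) A ∘ addStaircase j ∘ (m ℕ.+ i ∷_)) ≈ φ (suc i) - y * φ i
    step i = begin
      _ ≈⟨ B.cong (λ xs → solve 3 (λ y a b → con (ℤ.+ 1) :* a :+ (:- y :* b :+ con (ℤ.+ 0)) := a :+ :- y :* b) refl y _ _) ⟩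
      _ ≈⟨ trans (B.+-homo _ _) (+-congˡ (B.*-homo (- y) _)) ⟩
      _ ≈⟨ +-cong (branch-difference (suc j) m′ ms inc (head-alternating alt _)) (*-congˡ (branch-difference (suc j) m′ ms inc (head-alternating alt _))) ⟩
      _ ≈⟨ +-cong (reflexive (≡.cong (λ k → relativeWd (suc j) m′ ms (A ⟨ k ⟩)) (≡.cong (ℕ._+ j) (≡.sym (ℕₚ.+-suc m i)))))
             (solve 2 (λ y a → :- y :* a := :- (y :* a)) refl y _) ⟩
      φ (suc i) - y * φ i ∎

  -- The rule s_λ(x, y) = Σ s_μ(x) y^|λ/μ| over horizontal strips. The power of y split off is the
  -- smallest part of λ, which μ lacks.
  schurExt-branch : ∀ xs m ms → Increasing m ms →
    schurExt (y ∷ xs) (addStaircase 0 (m ∷ ms)) ≈ pow R y m * branch m ms (schurExt xs ∘ addStaircase 0)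
  schurExt-branch xs m ms inc = begin
    Wd y A′ (addStaircase 0 (m ∷ ms))
      ≈⟨ relativeWd-correct 0 m ms A′ inc ⟨
    pow R y (m ℕ.+ 0) * relativeWd 0 m ms A′
      ≈⟨ *-cong (reflexive (≡.cong (pow R y) (ℕₚ.+-identityʳ m)))
           (sym (branch-difference 0 m ms inc (Ten-alternating (antidifference y) (schurExt-alternating xs)))) ⟩
    pow R y m * branch m ms (Ten (difference y) A′ ∘ addStaircase 0)
      ≈⟨ *-congˡ (IsLinear.cong (branch-linear m ms) (λ μ → Ten-difference-antidifference y (schurExt xs) (addStaircase 0 μ))) ⟩
    pow R y m * branch m ms (schurExt xs ∘ addStaircase 0) ∎
    where A′ = Ten (antidifference y) (schurExt xs)

  -- For a decreasing list: branch↓ has no last part in the smaller partition, strips allows it to be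
  -- nonzero.
  branch↓ : ℕ → List ℕ → Fun ℕ → Carrier
  branch↓ p []        g = g []
  branch↓ p (p′ ∷ ps) g = convolve (p ℕ.∸ p′) (λ d i → pow R y d * branch↓ p′ ps (g ⟨ p′ ℕ.+ i ⟩))

  fits : ℕ → List ℕ → Bool
  fits q []       = true
  fits q (p ∷ ps) = p ℕ.≤ᵇ q

  strips : List ℕ → Fun ℕ → Carrier
  strips []       g = g []
  strips (p ∷ ps) g = convolve p (λ d q → pow R y d * (if fits q ps then strips ps (g ⟨ q ⟩) else 0#))

  branch↓-linear : ∀ p ps → IsLinear (branch↓ p ps)
  branch↓-linear p []        = record { cong = λ e → e [] ; +-homo = λ _ _ → refl ; *-homo = λ _ _ → refl }
  branch↓-linear p (p′ ∷ ps) = convolve-weighted-linear (p ℕ.∸ p′) (λ i → linear-∘ (branch↓-linear p′ ps) (p′ ℕ.+ i ∷_))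

  if-linear : ∀ {a} {I : Set a} b {L : (I → Carrier) → Carrier} → IsLinear L → IsLinear (λ F → if b then L F else 0#)
  if-linear true  lin = lin
  if-linear {I = I} false lin = ap-linear {X = I} []

  strips-linear : ∀ ps → IsLinear (strips ps)
  strips-linear []       = record { cong = λ e → e [] ; +-homo = λ _ _ → refl ; *-homo = λ _ _ → refl }
  strips-linear (p ∷ ps) = convolve-weighted-linear p (λ q → if-linear (fits q ps) (linear-∘ (strips-linear ps) (q ∷_)))

  branchList : List ℕ → Fun ℕ → Carrier
  branchList []       g = 0#
  branchList (m ∷ ms) g = branch m ms g

  -- Tableaux list parts downwards and the staircase lists them upwards; this turns the sum over
  -- strips round, `acc` being the parts already turned.
  branch-reverse : ∀ p ps acc g →
    branchList (ps ʳ++ (p ∷ acc)) g ≈ branch↓ p ps (λ qs → branch p acc (λ μ → g (qs ʳ++ μ)))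
  branch-reverse p []        acc g = refl
  branch-reverse p (p′ ∷ ps) acc g = trans (branch-reverse p′ ps (p ∷ acc) g)
    (trans (convolve-swap (branch↓-linear p′ ps) (p ℕ.∸ p′) _)
      (convolve-cong (p ℕ.∸ p′) (λ d i → IsLinear.*-homo (branch↓-linear p′ ps) _ _)))

  branch↓-cong : ∀ b p ps {f g : Fun ℕ} → p ℕ.≤ b → Decreasing p ps →
    (∀ qs → length qs ≡ length ps → Decreasing b qs → f qs ≈ g qs) → branch↓ p ps f ≈ branch↓ p ps g
  branch↓-cong b p []        p≤b dec e = e [] ≡.refl tt
  branch↓-cong b p (p′ ∷ ps) p≤b (p′≤p , dec) e = convolve-cong′ (p ℕ.∸ p′) (λ d i eq → *-congˡ
    (branch↓-cong (p′ ℕ.+ i) p′ ps (ℕₚ.m≤m+n p′ i) dec (λ qs len dec′ → e (p′ ℕ.+ i ∷ qs) (≡.cong suc len)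
      (ℕₚ.≤-trans (ℕₚ.+-monoʳ-≤ p′ (≡.subst (i ℕ.≤_) eq (ℕₚ.m≤n+m i d))) (ℕₚ.≤-trans (ℕₚ.≤-reflexive (ℕₚ.m+[n∸m]≡n p′≤p)) p≤b) , dec′))))

  convolve-from : ∀ a D (f : ℕ → Carrier) →
    convolve (a ℕ.+ D) (λ d q → pow R y d * (if a ℕ.≤ᵇ q then f q else 0#)) ≈ convolve D (λ d i → pow R y d * f (a ℕ.+ i))
  convolve-from zero D f = refl
  convolve-from (suc a) D f = trans (+-congʳ (zeroʳ _)) (trans (+-identityˡ _)
    (trans (convolve-cong (a ℕ.+ D) (λ d q → *-congˡ (reflexive (≡.cong (λ b → if b then f (suc q) else 0#) (suc-≤ᵇ-suc a q)))))
      (convolve-from a D (f ∘ suc))))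

  -- Both sums run over interlacing lists, but in `strips` the last part of the smaller partition
  -- may be positive. The hypothesis removes those terms, and a last part 0 costs y to the power
  -- `lastOf p ps`.
  strips-branch↓ : ∀ p ps g → Decreasing p ps →
    (1 ℕ.≤ lastOf p ps → ∀ qs → Decreasing p qs → Positive (suc (length ps)) qs → g qs ≈ 0#) →
    strips (p ∷ ps) g ≈ pow R y (lastOf p ps) * branch↓ p ps (λ qs → g (qs ++ 0 ∷ []))
  strips-branch↓ zero [] g dec e = refl
  strips-branch↓ (suc p) [] g dec e = trans
    (+-congˡ (convolve-vanish p (λ d q eq → trans (*-congˡ (e (ℕ.s≤s ℕ.z≤n) (suc q ∷ []) (ℕ.s≤s (ℕₚ.m+n≤o⇒n≤o d (ℕₚ.≤-reflexive eq)) , tt) (ℕ.s≤s ℕ.z≤n , tt))) (zeroʳ _))))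
    (+-identityʳ _)
  strips-branch↓ p (p′ ∷ ps) g (p′≤p , dec) e = begin
    convolve p (λ d q → pow R y d * (if p′ ℕ.≤ᵇ q then strips (p′ ∷ ps) (g ⟨ q ⟩) else 0#))
      ≡⟨ ≡.cong (λ n → convolve n (λ d q → pow R y d * (if p′ ℕ.≤ᵇ q then strips (p′ ∷ ps) (g ⟨ q ⟩) else 0#))) (ℕₚ.m+[n∸m]≡n p′≤p) ⟨
    convolve (p′ ℕ.+ (p ℕ.∸ p′)) (λ d q → pow R y d * (if p′ ℕ.≤ᵇ q then strips (p′ ∷ ps) (g ⟨ q ⟩) else 0#))
      ≈⟨ convolve-from p′ (p ℕ.∸ p′) _ ⟩
    convolve (p ℕ.∸ p′) (λ d i → pow R y d * strips (p′ ∷ ps) (g ⟨ p′ ℕ.+ i ⟩))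
      ≈⟨ convolve-cong′ (p ℕ.∸ p′) (λ d i eq → *-congˡ (strips-branch↓ p′ ps (g ⟨ p′ ℕ.+ i ⟩) dec
           (λ pos qs decqs posqs → e pos (p′ ℕ.+ i ∷ qs)
             (ℕₚ.≤-trans (ℕₚ.+-monoʳ-≤ p′ (ℕₚ.m+n≤o⇒n≤o d (ℕₚ.≤-reflexive eq))) (ℕₚ.≤-reflexive (ℕₚ.m+[n∸m]≡n p′≤p)) ,
              Decreasing-weaken qs (ℕₚ.m≤m+n p′ i) decqs)
             (ℕₚ.≤-trans pos (ℕₚ.≤-trans (lastOf-≤ p′ ps dec) (ℕₚ.m≤m+n p′ i)) , posqs)))) ⟩
    convolve (p ℕ.∸ p′) (λ d i → pow R y d * (pow R y (lastOf p′ ps) * branch↓ p′ ps (λ qs → g (p′ ℕ.+ i ∷ qs ++ 0 ∷ []))))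
      ≈⟨ convolve-cong (p ℕ.∸ p′) (λ d i → solve 3 (λ a b c → a :* (b :* c) := b :* (a :* c)) refl _ _ _) ⟩
    _ ≈⟨ convolve-* (p ℕ.∸ p′) _ _ ⟩
    pow R y (lastOf p′ ps) * branch↓ p (p′ ∷ ps) (λ qs → g (qs ++ 0 ∷ [])) ∎

  if-vanish : ∀ b {x} → (b ≡ true → x ≈ 0#) → (if b then x else 0#) ≈ 0#
  if-vanish true  e = e ≡.refl
  if-vanish false e = refl

  strips-zero : ∀ b ps g → Decreasing b ps → (∀ qs → Decreasing b qs → g qs ≈ 0#) → strips ps g ≈ 0#
  strips-zero b []       g dec e = e [] tt
  strips-zero b (p ∷ []) g (p≤b , dec) e = convolve-vanish p (λ d q eq → trans (*-congˡ
    (e (q ∷ []) (ℕₚ.≤-trans (ℕₚ.m+n≤o⇒n≤o d (ℕₚ.≤-reflexive eq)) p≤b , tt))) (zeroʳ _))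
  strips-zero b (p ∷ p′ ∷ ps) g (p≤b , _ , dec) e = convolve-vanish p (λ d q eq → trans (*-congˡ
    (if-vanish (p′ ℕ.≤ᵇ q) (λ p′≤q → strips-zero q (p′ ∷ ps) (g ⟨ q ⟩) (ℕₚ.≤ᵇ⇒≤ p′ q (≡.subst T (≡.sym p′≤q) tt) , dec)
      (λ qs decqs → e (q ∷ qs) (ℕₚ.≤-trans (ℕₚ.m+n≤o⇒n≤o d (ℕₚ.≤-reflexive eq)) p≤b , decqs))))) (zeroʳ _))

  -- Removing a horizontal strip loses at most one positive part, since each new part is at least
  -- the next old one.
  strips-vanish : ∀ k b ps g → Decreasing b ps → Positive (suc k) ps →
    (∀ qs → Decreasing b qs → Positive k qs → g qs ≈ 0#) → strips ps g ≈ 0#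
  strips-vanish zero b ps g dec pos e = strips-zero b ps g dec (λ qs decqs → e qs decqs tt)
  strips-vanish (suc k) b (p ∷ p′ ∷ ps) g (p≤b , _ , dec) (_ , pos′) e = convolve-vanish p (λ d q eq → trans (*-congˡ
    (if-vanish (p′ ℕ.≤ᵇ q) (λ p′≤ᵇq → let p′≤q = ℕₚ.≤ᵇ⇒≤ p′ q (≡.subst T (≡.sym p′≤ᵇq) tt) in
      strips-vanish k q (p′ ∷ ps) (g ⟨ q ⟩) (p′≤q , dec) pos′ (λ qs decqs posqs →
        e (q ∷ qs) (ℕₚ.≤-trans (ℕₚ.m+n≤o⇒n≤o d (ℕₚ.≤-reflexive eq)) p≤b , decqs) (ℕₚ.≤-trans (proj₁ pos′) p′≤q , posqs))))) (zeroʳ _))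

-- Semistandard tableaux and the removal of their largest entry.

strict : List ℕ → List ℕ → Bool
strict r r′ = all (λ pq → proj₁ pq ℕ.<ᵇ proj₂ pq) (zip r r′)

rows : ℕ → ℕ → List (List ℕ)
rows N p = filterᵇ weaklyInc (words p (range N))

range-suc : ∀ N → range (suc N) ≡ range N ++ suc N ∷ []
range-suc N = ≡.trans (≡.cong (map suc) (≡.trans (≡.sym (Listₚ.applyUpTo-∷ʳ (λ i → i) N)) ≡.refl)) (Listₚ.map-++ suc (upTo N) (N ∷ []))

∈-range⁻ : ∀ N {x} → x ∈ range N → 1 ℕ.≤ x × x ℕ.≤ N
∈-range⁻ N x∈ with i , i∈ , ≡.refl ← ∈-map⁻ suc x∈ = ℕ.s≤s ℕ.z≤n , ∈-upTo⁻ i∈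

words-∈ : ∀ {a} {X : Set a} k (as : List X) w → w ∈ words k as → length w ≡ k × All (_∈ as) w
words-∈ zero    as w (here ≡.refl) = ≡.refl , []
words-∈ (suc k) as w w∈ with x , x∈ , w∈′ ← concatMap-∈ (λ x → map (x ∷_) (words k as)) as w∈
  with w′ , w′∈ , ≡.refl ← ∈-map⁻ (x ∷_) w∈′ with len , mem ← words-∈ k as w′ w′∈ = ≡.cong suc len , x∈ ∷ mem

rows-∈ : ∀ N q r → r ∈ rows N q → length r ≡ q × All (ℕ._< suc N) r
rows-∈ N q r r∈ with len , mem ← words-∈ q (range N) r (proj₁ (∈-filterᵇ⁻ weaklyInc (words q (range N)) r∈)) =
  len , All.map (λ x∈ → ℕ.s≤s (proj₂ (∈-range⁻ N x∈))) mem

<⇒<ᵇ-true : ∀ {x t} → x ℕ.< t → (x ℕ.<ᵇ t) ≡ true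
<⇒<ᵇ-true {x} {t} x<t with x ℕ.<ᵇ t | ℕₚ.<⇒<ᵇ x<t
... | true | _ = ≡.refl

≥⇒<ᵇ-false : ∀ {x t} → t ℕ.≤ x → (x ℕ.<ᵇ t) ≡ false
≥⇒<ᵇ-false {x} {t} t≤x with x ℕ.<ᵇ t in eq
... | false = ≡.refl
... | true  = ⊥-elim (ℕₚ.<-irrefl ≡.refl (ℕₚ.<-≤-trans (ℕₚ.<ᵇ⇒< x t (≡.subst T (≡.sym eq) tt)) t≤x))

≤⇒≤ᵇ-true : ∀ {x t} → x ℕ.≤ t → (x ℕ.≤ᵇ t) ≡ true
≤⇒≤ᵇ-true {x} {t} x≤t with x ℕ.≤ᵇ t | ℕₚ.≤⇒≤ᵇ x≤t
... | true | _ = ≡.refl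

>⇒≤ᵇ-false : ∀ {x t} → t ℕ.< x → (x ℕ.≤ᵇ t) ≡ false
>⇒≤ᵇ-false {x} {t} t<x with x ℕ.≤ᵇ t in eq
... | false = ≡.refl
... | true  = ⊥-elim (ℕₚ.<-irrefl ≡.refl (ℕₚ.<-≤-trans t<x (ℕₚ.≤ᵇ⇒≤ x t (≡.subst T (≡.sym eq) tt))))

zip-[]ʳ : ∀ {a b} {X : Set a} {Y : Set b} (xs : List X) → zip {B = Y} xs [] ≡ []
zip-[]ʳ []       = ≡.refl
zip-[]ʳ (x ∷ xs) = ≡.refl

strict-[] : ∀ r → strict r [] ≡ true
strict-[] r = ≡.cong (all _) (zip-[]ʳ r)

-- Nothing can stand below an entry t, the largest one. So the lower row, its own entries t
-- included, must end within `prev`: the entries t form a horizontal strip.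
strict-append : ∀ t prev e r d → All (ℕ._< t) prev → All (ℕ._< t) r → length r ℕ.+ d ℕ.≤ length prev ℕ.+ e →
  strict (prev ++ replicate e t) (r ++ replicate d t) ≡ (length r ℕ.+ d ℕ.≤ᵇ length prev) ∧ strict prev r
strict-append t [] e [] zero _ _ _ = strict-[] (replicate e t)
strict-append t [] (suc e) [] (suc d) _ _ _ rewrite ≥⇒<ᵇ-false {t} {t} ℕₚ.≤-refl = ≡.refl
strict-append t [] (suc e) (z ∷ r) d _ (z<t ∷ _) _ rewrite ≥⇒<ᵇ-false (ℕₚ.<⇒≤ z<t) = ≡.refl
strict-append t (x ∷ prev) e [] zero _ _ _ = ≡.refl
strict-append t (x ∷ prev) e [] (suc d) (x<t ∷ prev<) [] (ℕ.s≤s le)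
  rewrite <⇒<ᵇ-true x<t | suc-≤ᵇ-suc d (length prev) =
  ≡.trans (strict-append t prev e [] d prev< [] le) (≡.cong ((d ℕ.≤ᵇ length prev) ∧_) (strict-[] prev))
strict-append t (x ∷ prev) e (z ∷ r) d (x<t ∷ prev<) (z<t ∷ r<) (ℕ.s≤s le)
  rewrite suc-≤ᵇ-suc (length r ℕ.+ d) (length prev) | strict-append t prev e r d prev< r< le =
  ∧-swap (x ℕ.<ᵇ z) (length r ℕ.+ d ℕ.≤ᵇ length prev) (strict prev r)
  where
  ∧-swap : ∀ a b c → a ∧ (b ∧ c) ≡ b ∧ (a ∧ c)
  ∧-swap true  b     c = ≡.refl
  ∧-swap false true  c = ≡.refl
  ∧-swap false false c = ≡.refl

module Tableaux {c ℓ} (R : CommutativeRing c ℓ) (val : ℕ → CommutativeRing.Carrier R) where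
  open CommutativeRing R hiding (zero)
  open IntegerSolver R
  open Functionals R
  open Tensor R
  open LinearForms R
  open SchurExtension R
  open Sums R
  open Branching R
  open import Relation.Binary.Reasoning.Setoid setoid

  ∑-linear : ∀ {a} {X : Set a} (xs : List X) → IsLinear (∑ xs)
  ∑-linear xs = record { cong = λ e → ∑-cong xs (λ x _ → e x) ; +-homo = ∑-+ xs ; *-homo = λ a F → ∑-*ˡ a xs F }

  L-∑ : ∀ {i a} {I : Set i} {X : Set a} {L : (I → Carrier) → Carrier} → IsLinear L →
    (xs : List X) (G : X → I → Carrier) → L (λ i → ∑ xs (λ x → G x i)) ≈ ∑ xs (λ x → L (G x))
  L-∑ lin []       G = IsLinear.0-homo lin
  L-∑ lin (x ∷ xs) G = trans (IsLinear.+-homo lin _ _) (+-congˡ (L-∑ lin xs G))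

  if-cong : ∀ b {x y x′ y′} → (b ≡ true → x ≈ x′) → (b ≡ false → y ≈ y′) → (if b then x else y) ≈ (if b then x′ else y′)
  if-cong true  e f = e ≡.refl
  if-cong false e f = f ≡.refl

  module _ (t : ℕ) (as : List ℕ) (as<t : All (ℕ._< t) as) where
    words-top : ∀ p f →
      ∑ (words p (as ++ t ∷ [])) (λ w → if weaklyInc (t ∷ w) then f w else 0#) ≈ f (replicate p t)
    words-top zero f = +-identityʳ _
    words-top (suc p) f = begin
      ∑ (concatMap (λ x → map (x ∷_) W) (as ++ t ∷ [])) (λ w → if weaklyInc (t ∷ w) then f w else 0#)
        ≈⟨ trans (∑-concatMap _ (as ++ t ∷ []) _) (∑-++ as (t ∷ []) _) ⟩
      _ ≈⟨ +-cong (trans (∑-cong as (λ x x∈ → trans (∑-map (x ∷_) W _) (trans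
             (∑-cong W (λ w _ → reflexive (≡.cong (λ b → if b ∧ weaklyInc (x ∷ w) then f (x ∷ w) else 0#)
               (>⇒≤ᵇ-false (All.lookup as<t x∈))))) (∑-zero W)))) (∑-zero as))
             (trans (+-identityʳ _) (∑-map (t ∷_) W _)) ⟩
      _ ≈⟨ +-identityˡ _ ⟩
      ∑ W (λ w → if weaklyInc (t ∷ t ∷ w) then f (t ∷ w) else 0#)
        ≈⟨ ∑-cong W (λ w _ → reflexive (≡.cong (λ b → if b ∧ weaklyInc (t ∷ w) then f (t ∷ w) else 0#) (≤⇒≤ᵇ-true (ℕₚ.≤-refl {t})))) ⟩
      ∑ W (λ w → if weaklyInc (t ∷ w) then f (t ∷ w) else 0#)
        ≈⟨ words-top p (λ w → f (t ∷ w)) ⟩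
      f (replicate (suc p) t) ∎
      where W = words p (as ++ t ∷ [])

    headFits : ℕ → List ℕ → Bool
    headFits x []      = true
    headFits x (z ∷ w) = x ℕ.≤ᵇ z

    weaklyInc-∷ : ∀ x w → weaklyInc (x ∷ w) ≡ headFits x w ∧ weaklyInc w
    weaklyInc-∷ x []      = ≡.refl
    weaklyInc-∷ x (z ∷ w) = ≡.refl

    if-∧ : ∀ b d {x : Carrier} → (if b ∧ d then x else 0#) ≈ (if d then (if b then x else 0#) else 0#)
    if-∧ true  d     = refl
    if-∧ false true  = refl
    if-∧ false false = refl

    headFits-append : ∀ x w d → x ∈ as → headFits x (w ++ replicate d t) ≡ headFits x w
    headFits-append x []      zero    x∈ = ≡.refl
    headFits-append x []      (suc d) x∈ = ≤⇒≤ᵇ-true (ℕₚ.<⇒≤ (All.lookup as<t x∈))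
    headFits-append x (z ∷ w) d       x∈ = ≡.refl

    -- In a weakly increasing word the largest letter t occurs only as a final block, here of length
    -- d.
    rows-split : ∀ p f → ∑ (words p (as ++ t ∷ [])) (λ w → if weaklyInc w then f w else 0#)
      ≈ convolve p (λ d q → ∑ (words q as) (λ w → if weaklyInc w then f (w ++ replicate d t) else 0#))
    rows-split zero f = refl
    rows-split (suc p) f = begin
      ∑ (concatMap (λ x → map (x ∷_) W) (as ++ t ∷ [])) (λ w → if weaklyInc w then f w else 0#)
        ≈⟨ trans (∑-concatMap _ (as ++ t ∷ []) _) (∑-++ as (t ∷ []) _) ⟩
      _ ≈⟨ +-comm _ _ ⟩
      _ ≈⟨ +-cong (trans (+-identityʳ _) (trans (∑-map (t ∷_) W _) (words-top p (λ w → f (t ∷ w)))))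
             (∑-cong as (λ x x∈ → trans (∑-map (x ∷_) W _) (first x x∈))) ⟩
      _ ≈⟨ +-cong (sym (+-identityʳ _)) (trans (convolve-swap (∑-linear as) p _)
             (convolve-cong p (λ d q → trans (∑-cong as (λ x _ → sym (∑-map (x ∷_) (words q as) _))) (sym (∑-concatMap _ as _))))) ⟩
      convolve (suc p) (λ d q → ∑ (words q as) (λ w → if weaklyInc w then f (w ++ replicate d t) else 0#)) ∎
      where
      W = words p (as ++ t ∷ [])
      first : ∀ x → x ∈ as → ∑ W (λ w → if weaklyInc (x ∷ w) then f (x ∷ w) else 0#)
        ≈ convolve p (λ d q → ∑ (words q as) (λ w → if weaklyInc (x ∷ w) then f (x ∷ w ++ replicate d t) else 0#))
      first x x∈ = begin
        _ ≈⟨ ∑-cong W (λ w _ → trans (reflexive (≡.cong (λ b → if b then f (x ∷ w) else 0#) (weaklyInc-∷ x w))) (if-∧ (headFits x w) (weaklyInc w))) ⟩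
        _ ≈⟨ rows-split p (λ w → if headFits x w then f (x ∷ w) else 0#) ⟩
        _ ≈⟨ convolve-cong p (λ d q → ∑-cong (words q as) (λ w _ → trans
               (reflexive (≡.cong (λ b → if weaklyInc w then (if b then f (x ∷ w ++ replicate d t) else 0#) else 0#) (headFits-append x w d x∈)))
               (trans (sym (if-∧ (headFits x w) (weaklyInc w)))
                 (reflexive (≡.cong (λ b → if b then f (x ∷ w ++ replicate d t) else 0#) (≡.sym (weaklyInc-∷ x w))))))) ⟩
        _ ∎

  monomial : List ℕ → Carrier
  monomial r = Π R (map val r)

  monomial-++ : ∀ r s → monomial (r ++ s) ≈ monomial r * monomial s
  monomial-++ []      s = sym (*-identityˡ _)
  monomial-++ (x ∷ r) s = trans (*-congˡ (monomial-++ r s)) (sym (*-assoc _ _ _))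

  monomial-replicate : ∀ d t → monomial (replicate d t) ≈ pow R (val t) d
  monomial-replicate zero    t = refl
  monomial-replicate (suc d) t = *-congˡ (monomial-replicate d t)

  tableauSum : ℕ → List ℕ → List ℕ → Carrier
  tableauSum N prev []       = 1#
  tableauSum N prev (p ∷ ps) = ∑ (rows N p) (λ r → if strict prev r then monomial r * tableauSum N r ps else 0#)

  -- Common to the first row and the later ones: S is the strictness test against the row above, and
  -- b is the part of it that concerns lengths only.
  row-step : ∀ N p ps (S S′ : List ℕ → Bool) b →
    (∀ r d → length r ℕ.+ d ≡ p → All (ℕ._< suc N) r → S (r ++ replicate d (suc N)) ≡ b ∧ S′ r) →
    (∀ r d → length r ℕ.+ d ≡ p → All (ℕ._< suc N) r → tableauSum (suc N) (r ++ replicate d (suc N)) ps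
      ≈ (if fits (val (suc N)) (length r) ps then strips (val (suc N)) ps (tableauSum N r) else 0#)) →
    ∑ (rows (suc N) p) (λ r → if S r then monomial r * tableauSum (suc N) r ps else 0#)
    ≈ (if b then convolve p (λ d q → pow R (val (suc N)) d * (if fits (val (suc N)) q ps
        then strips (val (suc N)) ps (λ qs → ∑ (rows N q) (λ r → if S′ r then monomial r * tableauSum N r qs else 0#)) else 0#)) else 0#)
  row-step N p ps S S′ b eqS eqT = begin
    ∑ (rows (suc N) p) f
      ≈⟨ ∑-filterᵇ weaklyInc (words p (range (suc N))) f ⟩
    ∑ (words p (range (suc N))) (λ r → if weaklyInc r then f r else 0#)
      ≡⟨ ≡.cong (λ as → ∑ (words p as) (λ r → if weaklyInc r then f r else 0#)) (range-suc N) ⟩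
    ∑ (words p (range N ++ t ∷ [])) (λ r → if weaklyInc r then f r else 0#)
      ≈⟨ rows-split t (range N) (All.tabulate (λ x∈ → ℕ.s≤s (proj₂ (∈-range⁻ N x∈)))) p f ⟩
    convolve p (λ d q → ∑ (words q (range N)) (λ r → if weaklyInc r then f (r ++ replicate d t) else 0#))
      ≈⟨ convolve-cong′ y p (λ d q eq → trans (sym (∑-filterᵇ weaklyInc (words q (range N)) _)) (inner d q eq)) ⟩
    convolve p (λ d q → if b then pow R y d * (if fits y q ps then strips y ps (G q) else 0#) else 0#)
      ≈⟨ pull b ⟩
    (if b then convolve p (λ d q → pow R y d * (if fits y q ps then strips y ps (G q) else 0#)) else 0#) ∎
    where
    t = suc N
    y = val t
    f : List ℕ → Carrier
    f r = if S r then monomial r * tableauSum (suc N) r ps else 0#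
    G : ℕ → Fun ℕ
    G q qs = ∑ (rows N q) (λ r → if S′ r then monomial r * tableauSum N r qs else 0#)
    pull : ∀ b → convolve p (λ d q → if b then pow R y d * (if fits y q ps then strips y ps (G q) else 0#) else 0#)
      ≈ (if b then convolve p (λ d q → pow R y d * (if fits y q ps then strips y ps (G q) else 0#)) else 0#)
    pull true  = refl
    pull false = convolve-vanish p (λ _ _ _ → refl)
    pointwise : ∀ bb s φ {z : Carrier} (m p′ : Carrier) →
      (if bb ∧ s then m * p′ * (if φ then z else 0#) else 0#)
      ≈ (if bb then p′ * (if φ then (if s then m * z else 0#) else 0#) else 0#)
    pointwise false s     φ     m p′ = refl
    pointwise true  true  true  m p′ = solve 3 (λ m p z → m :* p :* z := p :* (m :* z)) refl _ _ _
    pointwise true  true  false m p′ = solve 2 (λ m p → m :* p :* con (ℤ.+ 0) := p :* con (ℤ.+ 0)) refl _ _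
    pointwise true  false true  m p′ = sym (zeroʳ _)
    pointwise true  false false m p′ = sym (zeroʳ _)
    linear-if : ∀ s r → strips y ps (λ qs → if s then monomial r * tableauSum N r qs else 0#)
      ≈ (if s then monomial r * strips y ps (tableauSum N r) else 0#)
    linear-if true  r = IsLinear.*-homo (strips-linear y ps) _ _
    linear-if false r = IsLinear.0-homo (strips-linear y ps)
    inner : ∀ d q → d ℕ.+ q ≡ p → ∑ (rows N q) (λ r → f (r ++ replicate d t))
      ≈ (if b then pow R y d * (if fits y q ps then strips y ps (G q) else 0#) else 0#)
    inner d q eq = begin
      ∑ (rows N q) (λ r → f (r ++ replicate d t))
        ≈⟨ ∑-cong (rows N q) summand ⟩
      ∑ (rows N q) (λ r → if b then pow R y d * (if fits y q ps then strips y ps (λ qs → if S′ r then monomial r * tableauSum N r qs else 0#) else 0#) else 0#)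
        ≈⟨ collect b (fits y q ps) ⟩
      (if b then pow R y d * (if fits y q ps then strips y ps (G q) else 0#) else 0#) ∎
      where
      summand : ∀ r → r ∈ rows N q → f (r ++ replicate d t)
        ≈ (if b then pow R y d * (if fits y q ps then strips y ps (λ qs → if S′ r then monomial r * tableauSum N r qs else 0#) else 0#) else 0#)
      summand r r∈ with len , lt ← rows-∈ N q r r∈ = begin
        f (r ++ replicate d t)
          ≡⟨ ≡.cong (λ s → if s then monomial (r ++ replicate d t) * tableauSum (suc N) (r ++ replicate d t) ps else 0#) (eqS r d eq′ lt) ⟩
        (if b ∧ S′ r then monomial (r ++ replicate d t) * tableauSum (suc N) (r ++ replicate d t) ps else 0#)
          ≈⟨ if-cong (b ∧ S′ r) (λ _ → *-cong (trans (monomial-++ r _) (*-congˡ (monomial-replicate d t)))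
               (trans (eqT r d eq′ lt) (reflexive (≡.cong (λ n → if fits y n ps then strips y ps (tableauSum N r) else 0#) len)))) (λ _ → refl) ⟩
        (if b ∧ S′ r then monomial r * pow R y d * (if fits y q ps then strips y ps (tableauSum N r) else 0#) else 0#)
          ≈⟨ pointwise b (S′ r) (fits y q ps) (monomial r) (pow R y d) ⟩
        _ ≈⟨ if-cong b (λ _ → *-congˡ (if-cong (fits y q ps) (λ _ → sym (linear-if (S′ r) r)) (λ _ → refl))) (λ _ → refl) ⟩
        _ ∎
        where eq′ = ≡.trans (≡.cong (ℕ._+ d) len) (≡.trans (ℕₚ.+-comm q d) eq)
      collect : ∀ b φ → ∑ (rows N q) (λ r → if b then pow R y d * (if φ then strips y ps (λ qs → if S′ r then monomial r * tableauSum N r qs else 0#) else 0#) else 0#)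
        ≈ (if b then pow R y d * (if φ then strips y ps (G q) else 0#) else 0#)
      collect false φ     = ∑-zero (rows N q)
      collect true  false = trans (∑-*ˡ _ (rows N q) _) (*-congˡ (∑-zero (rows N q)))
      collect true  true  = trans (∑-*ˡ _ (rows N q) _) (*-congˡ (sym (L-∑ (strips-linear y ps) (rows N q) _)))

  -- The rows below see of the row above only `prev`, its entries up to N: their number bounds the
  -- next row, and their values enter its strictness test.
  tableauSum-append : ∀ N prev e ps p → All (ℕ._< suc N) prev → length prev ℕ.+ e ≡ p → Decreasing p ps →
    tableauSum (suc N) (prev ++ replicate e (suc N)) ps
    ≈ (if fits (val (suc N)) (length prev) ps then strips (val (suc N)) ps (tableauSum N prev) else 0#)
  tableauSum-append N prev e []        p prev< eq dec = refl
  tableauSum-append N prev e (p′ ∷ ps) p prev< eq (p′≤p , dec) =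
    row-step N p′ ps (strict (prev ++ replicate e (suc N))) (strict prev) (p′ ℕ.≤ᵇ length prev)
      (λ r d eq′ r< → ≡.trans
        (strict-append (suc N) prev e r d prev< r< (ℕₚ.≤-trans (ℕₚ.≤-reflexive eq′) (ℕₚ.≤-trans p′≤p (ℕₚ.≤-reflexive (≡.sym eq)))))
        (≡.cong (λ n → (n ℕ.≤ᵇ length prev) ∧ strict prev r) eq′))
      (λ r d eq′ r< → tableauSum-append N r d ps p′ r< eq′ dec)

  tableauSum-strips : ∀ N ps p → Decreasing p ps →
    tableauSum (suc N) [] ps ≈ strips (val (suc N)) ps (tableauSum N [])
  tableauSum-strips N []        p dec = refl
  tableauSum-strips N (p′ ∷ ps) p (_ , dec) = row-step N p′ ps (strict []) (strict []) true
    (λ r d _ _ → ≡.refl) (λ r d eq′ r< → tableauSum-append N r d ps p′ r< eq′ dec)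

  tableauSum-0-row : ∀ N prev ps → tableauSum N prev (ps ++ 0 ∷ []) ≈ tableauSum N prev ps
  tableauSum-0-row N prev [] rewrite strict-[] prev = trans (+-identityʳ _) (*-identityˡ _)
  tableauSum-0-row N prev (p ∷ ps) = ∑-cong (rows N p) (λ r _ → if-cong (strict prev r) (λ _ → *-congˡ (tableauSum-0-row N r ps)) (λ _ → refl))

  -- Each of the N letters fills a horizontal strip, and each strip accounts for at most one
  -- positive row.
  tableauSum-vanish : ∀ N b ps → Decreasing b ps → Positive (suc N) ps → tableauSum N [] ps ≈ 0#
  tableauSum-vanish zero    b (suc p ∷ ps) dec pos = refl
  tableauSum-vanish (suc N) b ps dec pos = trans (tableauSum-strips N ps b dec)
    (strips-vanish (val (suc N)) (suc N) b ps (tableauSum N []) dec pos (λ qs decqs → tableauSum-vanish N b qs decqs))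

  variables↓ : ℕ → List Carrier
  variables↓ zero    = []
  variables↓ (suc N) = val (suc N) ∷ variables↓ N

  reverse-increasing : ∀ p ps acc → Decreasing p ps → Increasing p acc →
    ∃ λ ms → ps ʳ++ (p ∷ acc) ≡ lastOf p ps ∷ ms × Increasing (lastOf p ps) ms
  reverse-increasing p []        acc dec inc = acc , ≡.refl , inc
  reverse-increasing p (p′ ∷ ps) acc (p′≤p , dec) inc = reverse-increasing p′ ps (p ∷ acc) dec (p′≤p , inc)

  -- Both sides obey the same branching rule. Without the largest letter, a tableau may still keep N
  -- + 1 rows in N letters; `tableauSum-vanish` and `tableauSum-0-row` reconcile this with the list
  -- of N parts on the left.
  schurExt-tableauSum : ∀ N ps b → length ps ≡ N → Decreasing b ps →
    schurExt (variables↓ N) (addStaircase 0 (reverse ps)) ≈ tableauSum N [] ps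
  schurExt-tableauSum zero    []       b len dec = refl
  schurExt-tableauSum (suc N) (p ∷ ps) b len (p≤b , dec) with ms , eq , inc ← reverse-increasing p ps [] dec tt = begin
    schurExt (y ∷ variables↓ N) (addStaircase 0 (ps ʳ++ (p ∷ [])))
      ≡⟨ ≡.cong (λ L → schurExt (y ∷ variables↓ N) (addStaircase 0 L)) eq ⟩
    schurExt (y ∷ variables↓ N) (addStaircase 0 (lastOf p ps ∷ ms))
      ≈⟨ schurExt-branch y (variables↓ N) (lastOf p ps) ms inc ⟩
    pow R y (lastOf p ps) * branchList y (lastOf p ps ∷ ms) (schurExt (variables↓ N) ∘ addStaircase 0)
      ≡⟨ ≡.cong (λ L → pow R y (lastOf p ps) * branchList y L (schurExt (variables↓ N) ∘ addStaircase 0)) eq ⟨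
    pow R y (lastOf p ps) * branchList y (ps ʳ++ (p ∷ [])) (schurExt (variables↓ N) ∘ addStaircase 0)
      ≈⟨ *-congˡ (branch-reverse y p ps [] _) ⟩
    pow R y (lastOf p ps) * branch↓ y p ps (λ qs → schurExt (variables↓ N) (addStaircase 0 (reverse qs)))
      ≈⟨ *-congˡ (branch↓-cong y p p ps ℕₚ.≤-refl dec (λ qs len′ decqs → trans
           (schurExt-tableauSum N qs p (≡.trans len′ (ℕₚ.suc-injective len)) decqs) (sym (tableauSum-0-row N [] qs)))) ⟩
    pow R y (lastOf p ps) * branch↓ y p ps (λ qs → tableauSum N [] (qs ++ 0 ∷ []))
      ≈⟨ strips-branch↓ y p ps (tableauSum N []) dec (λ _ qs decqs posqs → tableauSum-vanish N p qs decqs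
           (≡.subst (λ n → Positive (suc n) qs) (ℕₚ.suc-injective len) posqs)) ⟨
    strips y (p ∷ ps) (tableauSum N [])
      ≈⟨ tableauSum-strips N (p ∷ ps) p (ℕₚ.≤-refl , dec) ⟨
    tableauSum (suc N) [] (p ∷ ps) ∎
    where y = val (suc N)

  tableauSum-fillings : ∀ N prev ps →
    ∑ (rowFillings (range N) ps) (λ P → if colStrict (prev ∷ P) then monomial (concat P) else 0#) ≈ tableauSum N prev ps
  tableauSum-fillings N prev [] = +-identityʳ _
  tableauSum-fillings N prev (p ∷ ps) = begin
    ∑ (concatMap (λ r → map (r ∷_) (rowFillings (range N) ps)) (rows N p)) (λ P → if colStrict (prev ∷ P) then monomial (concat P) else 0#)
      ≈⟨ ∑-concatMap _ (rows N p) _ ⟩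
    ∑ (rows N p) (λ r → ∑ (map (r ∷_) (rowFillings (range N) ps)) (λ P → if colStrict (prev ∷ P) then monomial (concat P) else 0#))
      ≈⟨ ∑-cong (rows N p) (λ r _ → trans (∑-map (r ∷_) (rowFillings (range N) ps) _) (row r (strict prev r))) ⟩
    tableauSum N prev (p ∷ ps) ∎
    where
    row : ∀ r b → ∑ (rowFillings (range N) ps) (λ P → if b ∧ colStrict (r ∷ P) then monomial (r ++ concat P) else 0#)
      ≈ (if b then monomial r * tableauSum N r ps else 0#)
    row r false = ∑-zero (rowFillings (range N) ps)
    row r true = begin
      _ ≈⟨ ∑-cong (rowFillings (range N) ps) (λ P _ → scale P (colStrict (r ∷ P))) ⟩
      _ ≈⟨ ∑-*ˡ (monomial r) (rowFillings (range N) ps) _ ⟩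
      _ ≈⟨ *-congˡ (tableauSum-fillings N r ps) ⟩
      monomial r * tableauSum N r ps ∎
      where
      scale : ∀ P b → (if b then monomial (r ++ concat P) else 0#) ≈ monomial r * (if b then monomial (concat P) else 0#)
      scale P true  = monomial-++ r (concat P)
      scale P false = sym (zeroʳ _)

  tableauSum-SSYT : ∀ N ps → ∑ (SSYT N ps) (λ P → monomial (concat P)) ≈ tableauSum N [] ps
  tableauSum-SSYT N ps = trans (∑-filterᵇ colStrict (rowFillings (range N) ps) _)
    (trans (∑-cong (rowFillings (range N) ps) (λ P _ → reflexive (≡.cong (λ b → if b then monomial (concat P) else 0#) (first P))))
      (tableauSum-fillings N [] ps))
    where
    first : ∀ P → colStrict P ≡ colStrict ([] ∷ P)
    first []      = ≡.refl
    first (r ∷ P) = ≡.refl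

-- Alternating sign matrices as sequences of column sums.

columnSums : List ℤ → List (List ℤ) → List (List ℤ)
columnSums acc []       = []
columnSums acc (r ∷ rs) = zipWith ℤ._+_ acc r ∷ columnSums (zipWith ℤ._+_ acc r) rs

-- The local function of partialColumnSums has no name; the underscore in the type of
-- columnSums-local is solved to it by the second lemma.
mutual
  columnSums-local : ∀ n (A : List (List ℤ)) acc rs → _ ≡ columnSums acc rs

  partialColumnSums-∷ : ∀ n r rs → partialColumnSums n (r ∷ rs) ≡ columnSums (replicate n (+ 0)) (r ∷ rs)
  partialColumnSums-∷ n r rs with r ∷ rs | zipWith ℤ._+_ (replicate n (+ 0)) r
  ... | A | acc = ≡.cong (acc ∷_) (columnSums-local n A acc rs)

  columnSums-local n A acc []       = ≡.refl
  columnSums-local n A acc (r ∷ rs) = ≡.cong (zipWith ℤ._+_ acc r ∷_) (columnSums-local n A (zipWith ℤ._+_ acc r) rs)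

partialColumnSums-columnSums : ∀ n A → partialColumnSums n A ≡ columnSums (replicate n (+ 0)) A
partialColumnSums-columnSums n []       = ≡.refl
partialColumnSums-columnSums n (r ∷ rs) = partialColumnSums-∷ n r rs

signs : List ℤ
signs = -[1+ 0 ] ∷ + 0 ∷ + 1 ∷ []

-- A line of an alternating sign matrix is recognised by its partial sums staying in {0, 1}.
admits : Bool → ℤ → Bool
admits a (+ 0)      = true
admits a (+ 1)      = not a
admits a -[1+ 0 ]   = a
admits a _          = false

advance : Bool → ℤ → Bool
advance a (+ 0)      = a
advance a (+ suc _)  = true
advance a -[1+ _ ]   = false

line : Bool → List ℤ → Bool
line a []       = a
line a (e ∷ es) = admits a e ∧ line (advance a e) es

sumOf : List ℤ → ℤ
sumOf = foldr ℤ._+_ (+ 0)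

isYes-⇔ : ∀ {p q} {P : Set p} {Q : Set q} → (P → Q) → (Q → P) → (p? : Dec P) (q? : Dec Q) → ⌊ p? ⌋ ≡ ⌊ q? ⌋
isYes-⇔ f g (yes p) (yes q) = ≡.refl
isYes-⇔ f g (yes p) (no ¬q) = ⊥-elim (¬q (f p))
isYes-⇔ f g (no ¬p) (yes q) = ⊥-elim (¬p (g q))
isYes-⇔ f g (no ¬p) (no ¬q) = ≡.refl

open Algebra.Properties.Group (Algebra.Bundles.AbelianGroup.group ℤₚ.+-0-abelianGroup) using (∙-cancelˡ)

isYes-shift : ∀ e s i j → e ℤ.+ j ≡ i → ⌊ e ℤ.+ s ℤ.≟ i ⌋ ≡ ⌊ s ℤ.≟ j ⌋
isYes-shift e s i j eq = isYes-⇔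
  (λ p → ∙-cancelˡ e s j (≡.trans p (≡.sym eq))) (λ q → ≡.trans (≡.cong (λ z → e ℤ.+ z) q) eq) (e ℤ.+ s ℤ.≟ i) (s ℤ.≟ j)

-- After a +1 the partial sum is 1. So the entries still to come must add up to 0 and their first
-- nonzero one must be -1, as state `true` of `line` demands.
line-after-plus : ∀ r → All (_∈ signs) r → (⌊ sumOf r ℤ.≟ + 0 ⌋ ∧ alternating (+ 1 ∷ nonzeros r)) ≡ line true r
line-after-minus : ∀ r → All (_∈ signs) r → (⌊ sumOf r ℤ.≟ + 1 ⌋ ∧ alternating (-[1+ 0 ] ∷ nonzeros r)) ≡ line false r
line-after-plus [] [] = ≡.refl
line-after-plus (_ ∷ r) (here ≡.refl ∷ s) = ≡.trans
  (≡.cong (_∧ alternating (-[1+ 0 ] ∷ nonzeros r)) (isYes-shift -[1+ 0 ] (sumOf r) (+ 0) (+ 1) ≡.refl)) (line-after-minus r s)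
line-after-plus (_ ∷ r) (there (here ≡.refl) ∷ s) = ≡.trans
  (≡.cong (_∧ alternating (+ 1 ∷ nonzeros r)) (isYes-shift (+ 0) (sumOf r) (+ 0) (+ 0) ≡.refl)) (line-after-plus r s)
line-after-plus (_ ∷ r) (there (there (here ≡.refl)) ∷ s) = Boolₚ.∧-zeroʳ _
line-after-minus [] [] = ≡.refl
line-after-minus (_ ∷ r) (here ≡.refl ∷ s) = Boolₚ.∧-zeroʳ _
line-after-minus (_ ∷ r) (there (here ≡.refl) ∷ s) = ≡.trans
  (≡.cong (_∧ alternating (-[1+ 0 ] ∷ nonzeros r)) (isYes-shift (+ 0) (sumOf r) (+ 1) (+ 1) ≡.refl)) (line-after-minus r s)
line-after-minus (_ ∷ r) (there (there (here ≡.refl)) ∷ s) = ≡.trans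
  (≡.cong (_∧ alternating (+ 1 ∷ nonzeros r)) (isYes-shift (+ 1) (sumOf r) (+ 1) (+ 0) ≡.refl)) (line-after-plus r s)

-- Alternation alone bounds the sum. This rejects a line opening with -1, whose remaining entries
-- would have to add up to 2.
sum-after-plus : ∀ r → All (_∈ signs) r → alternating (+ 1 ∷ nonzeros r) ≡ true → sumOf r ≡ + 0 ⊎ sumOf r ≡ -[1+ 0 ]
sum-after-minus : ∀ r → All (_∈ signs) r → alternating (-[1+ 0 ] ∷ nonzeros r) ≡ true → sumOf r ≡ + 0 ⊎ sumOf r ≡ + 1
sum-after-plus [] [] _ = inj₁ ≡.refl
sum-after-plus (_ ∷ r) (here ≡.refl ∷ s) alt with sum-after-minus r s alt
... | inj₁ eq = inj₂ (≡.cong (λ z → -[1+ 0 ] ℤ.+ z) eq)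
... | inj₂ eq = inj₁ (≡.cong (λ z → -[1+ 0 ] ℤ.+ z) eq)
sum-after-plus (_ ∷ r) (there (here ≡.refl) ∷ s) alt with sum-after-plus r s alt
... | inj₁ eq = inj₁ (≡.cong (λ z → + 0 ℤ.+ z) eq)
... | inj₂ eq = inj₂ (≡.cong (λ z → + 0 ℤ.+ z) eq)
sum-after-plus (_ ∷ r) (there (there (here ≡.refl)) ∷ s) ()
sum-after-minus [] [] _ = inj₁ ≡.refl
sum-after-minus (_ ∷ r) (here ≡.refl ∷ s) ()
sum-after-minus (_ ∷ r) (there (here ≡.refl) ∷ s) alt with sum-after-minus r s alt
... | inj₁ eq = inj₁ (≡.cong (λ z → + 0 ℤ.+ z) eq)
... | inj₂ eq = inj₂ (≡.cong (λ z → + 0 ℤ.+ z) eq)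
sum-after-minus (_ ∷ r) (there (there (here ≡.refl)) ∷ s) alt with sum-after-plus r s alt
... | inj₁ eq = inj₂ (≡.cong (λ z → + 1 ℤ.+ z) eq)
... | inj₂ eq = inj₁ (≡.cong (λ z → + 1 ℤ.+ z) eq)

line-start : ∀ r → All (_∈ signs) r → (⌊ sumOf r ℤ.≟ + 1 ⌋ ∧ alternating (nonzeros r)) ≡ line false r
line-start [] [] = ≡.refl
line-start (_ ∷ r) (here ≡.refl ∷ s) with alternating (-[1+ 0 ] ∷ nonzeros r) in alt
... | false = Boolₚ.∧-zeroʳ _
... | true with sum-after-minus r s alt
...   | inj₁ eq rewrite eq = ≡.refl
...   | inj₂ eq rewrite eq = ≡.refl
line-start (_ ∷ r) (there (here ≡.refl) ∷ s) = ≡.trans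
  (≡.cong (_∧ alternating (nonzeros r)) (isYes-shift (+ 0) (sumOf r) (+ 1) (+ 1) ≡.refl)) (line-start r s)
line-start (_ ∷ r) (there (there (here ≡.refl)) ∷ s) = ≡.trans
  (≡.cong (_∧ alternating (+ 1 ∷ nonzeros r)) (isYes-shift (+ 1) (sumOf r) (+ 1) (+ 0) ≡.refl)) (line-after-plus r s)

all-true : ∀ {a} {X : Set a} (p : X → Bool) xs → All (λ x → p x ≡ true) xs → all p xs ≡ true
all-true p []       []         = ≡.refl
all-true p (x ∷ xs) (px ∷ pxs) rewrite px = all-true p xs pxs

lineOK-line : ∀ r → All (_∈ signs) r → lineOK r ≡ line false r
lineOK-line r s = ≡.trans (≡.cong (_∧ (⌊ sumOf r ℤ.≟ + 1 ⌋ ∧ alternating (nonzeros r))) (all-true _ r (All.map entry-sign s))) (line-start r s)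
  where
  entry-sign : ∀ {e} → e ∈ signs → _ ≡ true
  entry-sign (here ≡.refl)                 = ≡.refl
  entry-sign (there (here ≡.refl))         = ≡.refl
  entry-sign (there (there (here ≡.refl))) = ≡.refl

admitsAll : List Bool → List ℤ → Bool
admitsAll []       _        = true
admitsAll (_ ∷ _)  []       = true
admitsAll (a ∷ as) (e ∷ es) = admits a e ∧ admitsAll as es

-- All columns are tested at once, row by row; the states in `acc` are at the same time the partial
-- column sums.
run : List Bool → List (List ℤ) → Bool
run acc []       = all id acc
run acc (r ∷ rs) = admitsAll acc r ∧ run (zipWith advance acc r) rs

∧-interchange : ∀ a b c d → (a ∧ b) ∧ (c ∧ d) ≡ (a ∧ c) ∧ (b ∧ d)
∧-interchange true  true  c d = ≡.refl
∧-interchange true  false c d = ≡.sym (Boolₚ.∧-zeroʳ c)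
∧-interchange false b     c d = ≡.refl

run-[] : ∀ A → run [] A ≡ true
run-[] []      = ≡.refl
run-[] (r ∷ A) = run-[] A

run-∷ : ∀ n a acc A → All (λ r → length r ≡ suc n) A →
  run (a ∷ acc) A ≡ line a (map (λ r → at (+ 0) r 1) A) ∧ run acc (map (drop 1) A)
run-∷ n a acc []            []         = ≡.refl
run-∷ n a acc ((e ∷ r) ∷ A) (len ∷ ls) = ≡.trans
  (≡.cong ((admits a e ∧ admitsAll acc r) ∧_) (run-∷ n (advance a e) (zipWith advance acc r) A ls))
  (∧-interchange (admits a e) (admitsAll acc r) _ _)

range-∷ : ∀ n → range (suc n) ≡ 1 ∷ map suc (range n)
range-∷ n = ≡.cong (λ is → 1 ∷ map suc is) (≡.sym (Listₚ.map-applyUpTo id suc n))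

at-suc : ∀ {a} {X : Set a} (d : X) r j → at d r (suc (suc j)) ≡ at d (drop 1 r) (suc j)
at-suc d []      j = ≡.refl
at-suc d (e ∷ r) j = ≡.refl

columns-suc : ∀ n (A : List (List ℤ)) →
  columns (+ 0) (suc n) A ≡ map (λ r → at (+ 0) r 1) A ∷ columns (+ 0) n (map (drop 1) A)
columns-suc n A = ≡.trans (≡.cong (map _) (range-∷ n)) (≡.cong (map (λ r → at (+ 0) r 1) A ∷_)
  (≡.trans (≡.sym (Listₚ.map-∘ (range n))) (≡.trans (≡.sym (Listₚ.map-∘ (upTo n)))
    (≡.trans (Listₚ.map-cong (λ j → ≡.trans (Listₚ.map-cong (λ r → at-suc (+ 0) r j) A) (Listₚ.map-∘ A)) (upTo n)) (Listₚ.map-∘ (upTo n))))))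

columns-run : ∀ n A → All (λ r → length r ≡ n × All (_∈ signs) r) A →
  all lineOK (columns (+ 0) n A) ≡ run (replicate n false) A
columns-run zero    A s = ≡.sym (run-[] A)
columns-run (suc n) A s = ≡.trans (≡.cong (all lineOK) (columns-suc n A)) (≡.trans
  (≡.cong₂ _∧_ (lineOK-line _ (firsts A s)) (columns-run n (map (drop 1) A) (rests A s)))
  (≡.sym (run-∷ n false (replicate n false) A (All.map proj₁ s))))
  where
  firsts : ∀ A → All (λ r → length r ≡ suc n × All (_∈ signs) r) A → All (_∈ signs) (map (λ r → at (+ 0) r 1) A)
  firsts []            []                     = []
  firsts ((e ∷ r) ∷ A) ((len , e∈ ∷ r∈) ∷ ss) = e∈ ∷ firsts A ss
  rests : ∀ A → All (λ r → length r ≡ suc n × All (_∈ signs) r) A → All (λ r → length r ≡ n × All (_∈ signs) r) (map (drop 1) A)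
  rests []            []                     = []
  rests ((e ∷ r) ∷ A) ((len , e∈ ∷ r∈) ∷ ss) = (ℕₚ.suc-injective len , r∈) ∷ rests A ss

≡ᵇ-true : ∀ {m n} → m ≡ n → (m ℕ.≡ᵇ n) ≡ true
≡ᵇ-true {zero}  ≡.refl = ≡.refl
≡ᵇ-true {suc m} ≡.refl = ≡ᵇ-true {m} ≡.refl

all-cong : ∀ {a} {X : Set a} {p q : X → Bool} xs → All (λ x → p x ≡ q x) xs → all p xs ≡ all q xs
all-cong []       []       = ≡.refl
all-cong (x ∷ xs) (e ∷ es) = ≡.cong₂ _∧_ e (all-cong xs es)

isASM-run : ∀ n A → A ∈ words n (words n signs) → isASM n A ≡ all (line false) A ∧ run (replicate n false) A
isASM-run n A A∈ with len , mem ← words-∈ n (words n signs) A A∈ =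
  ≡.cong₂ _∧_ (≡ᵇ-true len) (≡.cong₂ _∧_ (all-true _ A (All.map (λ r∈ → ≡ᵇ-true (proj₁ (words-∈ n signs _ r∈))) mem))
    (≡.cong₂ _∧_ (all-cong A (All.map (λ r∈ → lineOK-line _ (proj₂ (words-∈ n signs _ r∈))) mem))
      (columns-run n A (All.map (words-∈ n signs _) mem))))

bitℤ : Bool → ℤ
bitℤ false = + 0
bitℤ true  = + 1

bitDifference : Bool → Bool → ℤ
bitDifference true  false = + 1
bitDifference false true  = -[1+ 0 ]
bitDifference _     _     = + 0

bits : List Bool
bits = false ∷ true ∷ []

add-difference : ∀ b acc → length b ≡ length acc → zipWith ℤ._+_ (map bitℤ acc) (zipWith bitDifference b acc) ≡ map bitℤ b
add-difference []          []            len = ≡.refl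
add-difference (true ∷ b)  (true ∷ acc)  len = ≡.cong (_ ∷_) (add-difference b acc (ℕₚ.suc-injective len))
add-difference (true ∷ b)  (false ∷ acc) len = ≡.cong (_ ∷_) (add-difference b acc (ℕₚ.suc-injective len))
add-difference (false ∷ b) (true ∷ acc)  len = ≡.cong (_ ∷_) (add-difference b acc (ℕₚ.suc-injective len))
add-difference (false ∷ b) (false ∷ acc) len = ≡.cong (_ ∷_) (add-difference b acc (ℕₚ.suc-injective len))

range-interval : ∀ n → range n ≡ interval 1 n
range-interval zero    = ≡.refl
range-interval (suc n) = ≡.trans (range-∷ n) (≡.cong (1 ∷_) (≡.trans (≡.cong (map suc) (range-interval n)) (map-suc-interval 1 n)))

onesPositions-bits : ∀ b → onesPositions (map bitℤ b) ≡ positions 1 b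
onesPositions-bits b = ≡.trans
  (≡.cong (λ is → map proj₁ (filterᵇ (λ q → ⌊ proj₂ q ℤ.≟ + 1 ⌋) (zip is (map bitℤ b))))
    (≡.trans (≡.cong range (Listₚ.length-map bitℤ b)) (range-interval (length b)))) (go 1 b)
  where
  go : ∀ p b → map proj₁ (filterᵇ (λ q → ⌊ proj₂ q ℤ.≟ + 1 ⌋) (zip (interval p (length b)) (map bitℤ b))) ≡ positions p b
  go p []          = ≡.refl
  go p (false ∷ b) = go (suc p) b
  go p (true ∷ b)  = ≡.cong (p ∷_) (go (suc p) b)

-- Interlacing of consecutive rows and its statistics.

data Path : Bool → List Bool → List Bool → (E S L R : ℕ) → Set where
  end       : Path true [] [] 0 0 0 0
  emptyOff  : ∀ {b a E S L R} → Path false b a E S L R → Path false (false ∷ b) (false ∷ a) (suc E) S L R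
  lowerOnly     : ∀ {b a E S L R} → Path true  b a E S L R → Path false (true ∷ b) (false ∷ a) E S L R
  leftLeaning      : ∀ {b a E S L R} → Path false b a E S L R → Path false (true ∷ b) (true ∷ a) E S (suc L) R
  emptyOn   : ∀ {b a E S L R} → Path true  b a E S L R → Path true (false ∷ b) (false ∷ a) E S L R
  isSpecial   : ∀ {b a E S L R} → Path false b a E S L R → Path true (false ∷ b) (true ∷ a) E (suc S) L R
  rightLeaning     : ∀ {b a E S L R} → Path true  b a E S L R → Path true (true ∷ b) (true ∷ a) E S L (suc R)

-- The row condition on the difference of two rows is their interlacing. The reading gives the
-- statistics: S, L and R count special, left- and right-leaning entries, and E the empty positions
-- passed in state `false`.
line-path : ∀ s b a → length b ≡ length a → line s (zipWith bitDifference b a) ≡ true →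
  ∃ λ E → ∃ λ S → ∃ λ L → ∃ λ R → Path s b a E S L R
line-path true  []          []          len ok = 0 , 0 , 0 , 0 , end
line-path false (false ∷ b) (false ∷ a) len ok with E , S , L , R , π ← line-path false b a (ℕₚ.suc-injective len) ok = suc E , S , L , R , emptyOff π
line-path false (true ∷ b)  (false ∷ a) len ok with E , S , L , R , π ← line-path true b a (ℕₚ.suc-injective len) ok = E , S , L , R , lowerOnly π
line-path false (true ∷ b)  (true ∷ a)  len ok with E , S , L , R , π ← line-path false b a (ℕₚ.suc-injective len) ok = E , S , suc L , R , leftLeaning π
line-path true  (false ∷ b) (false ∷ a) len ok with E , S , L , R , π ← line-path true b a (ℕₚ.suc-injective len) ok = E , S , L , R , emptyOn π
line-path true  (false ∷ b) (true ∷ a)  len ok with E , S , L , R , π ← line-path false b a (ℕₚ.suc-injective len) ok = E , suc S , L , R , isSpecial π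
line-path true  (true ∷ b)  (true ∷ a)  len ok with E , S , L , R , π ← line-path true b a (ℕₚ.suc-injective len) ok = E , S , L , suc R , rightLeaning π

specials lefts rights : List ℕ → List ℕ → ℕ
specials l k = specialᵢ (l ∷ k ∷ []) 1
lefts    l k = leftᵢ (l ∷ k ∷ []) 1
rights   l k = rightᵢ (l ∷ k ∷ []) 1

-- Readings end in state `true`, so in state `false` a further lower entry must follow; it is the
-- right neighbour of the upper entry just read.
path-nonempty : ∀ {b a E S L R} → Path false b a E S L R → ∀ p → ∃ λ q → ∃ λ ks → positions p b ≡ q ∷ ks × p ℕ.≤ q
path-nonempty (emptyOff π) p with q , ks , eq , le ← path-nonempty π (suc p) = q , ks , eq , ℕₚ.<⇒≤ le
path-nonempty (lowerOnly π)    p = p , _ , ≡.refl , ℕₚ.≤-refl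
path-nonempty (leftLeaning π)     p = p , _ , ≡.refl , ℕₚ.≤-refl

≡ᵇ-false : ∀ {m n} → m ℕ.< n → (m ℕ.≡ᵇ n) ≡ false
≡ᵇ-false {zero}  {suc n} _          = ≡.refl
≡ᵇ-false {suc m} {suc n} (ℕ.s≤s lt) = ≡ᵇ-false lt

≡ᵇ-false′ : ∀ {m n} → n ℕ.< m → (m ℕ.≡ᵇ n) ≡ false
≡ᵇ-false′ {suc m} {zero}  _          = ≡.refl
≡ᵇ-false′ {suc m} {suc n} (ℕ.s≤s lt) = ≡ᵇ-false′ lt

record Counts (l k : List ℕ) (S L R : ℕ) : Set where
  constructor counts
  field
    specials-≡ : specials l k ≡ S
    lefts-≡    : lefts l k ≡ L
    rights-≡   : rights l k ≡ R

count-∷ : ∀ {a} {X : Set a} (p : X → Bool) x xs → count p (x ∷ xs) ≡ (if p x then 1 else 0) ℕ.+ count p xs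
count-∷ p x xs with p x
... | true  = ≡.refl
... | false = ≡.refl

module _ (m p q : ℕ) (l k : List ℕ) where
  specials-∷ : specials (m ∷ l) (p ∷ q ∷ k) ≡ (if (p ℕ.<ᵇ m) ∧ (m ℕ.<ᵇ q) then 1 else 0) ℕ.+ specials l (q ∷ k)
  specials-∷ = count-∷ _ (m , p , q) (zip l (zip (q ∷ k) k))
  lefts-∷ : lefts (m ∷ l) (p ∷ q ∷ k) ≡ (if m ℕ.≡ᵇ p then 1 else 0) ℕ.+ lefts l (q ∷ k)
  lefts-∷ = count-∷ _ (m , p , q) (zip l (zip (q ∷ k) k))
  rights-∷ : rights (m ∷ l) (p ∷ q ∷ k) ≡ (if m ℕ.≡ᵇ q then 1 else 0) ℕ.+ rights l (q ∷ k)
  rights-∷ = count-∷ _ (m , p , q) (zip l (zip (q ∷ k) k))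

counts-∷ : ∀ {l k p m q S L R} x y z → (p ℕ.<ᵇ m) ∧ (m ℕ.<ᵇ q) ≡ x → (m ℕ.≡ᵇ p) ≡ y → (m ℕ.≡ᵇ q) ≡ z → Counts l (q ∷ k) S L R →
  Counts (m ∷ l) (p ∷ q ∷ k) ((if x then 1 else 0) ℕ.+ S) ((if y then 1 else 0) ℕ.+ L) ((if z then 1 else 0) ℕ.+ R)
counts-∷ {l} {k} {p} {m} {q} x y z ≡.refl ≡.refl ≡.refl (counts s≡ l≡ r≡) = counts
  (≡.trans (specials-∷ m p q l k) (≡.cong (_ ℕ.+_) s≡))
  (≡.trans (lefts-∷ m p q l k) (≡.cong (_ ℕ.+_) l≡))
  (≡.trans (rights-∷ m p q l k) (≡.cong (_ ℕ.+_) r≡))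

counts-special : ∀ {l k p m q S L R} → p ℕ.< m → m ℕ.< q → Counts l (q ∷ k) S L R → Counts (m ∷ l) (p ∷ q ∷ k) (suc S) L R
counts-special p<m m<q = counts-∷ true false false (≡.cong₂ _∧_ (<⇒<ᵇ-true p<m) (<⇒<ᵇ-true m<q)) (≡ᵇ-false′ p<m) (≡ᵇ-false m<q)

counts-left : ∀ {l k m q S L R} → m ℕ.< q → Counts l (q ∷ k) S L R → Counts (m ∷ l) (m ∷ q ∷ k) S (suc L) R
counts-left {m = m} {q} m<q = counts-∷ false true false (≡.cong (_∧ (m ℕ.<ᵇ q)) (≥⇒<ᵇ-false {m} ℕₚ.≤-refl)) (≡ᵇ-true {m} ≡.refl) (≡ᵇ-false m<q)

counts-right : ∀ {l k p m S L R} → p ℕ.< m → Counts l (m ∷ k) S L R → Counts (m ∷ l) (p ∷ m ∷ k) S L (suc R)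
counts-right {p = p} {m} p<m = counts-∷ false false true
  (≡.trans (≡.cong ((p ℕ.<ᵇ m) ∧_) (≥⇒<ᵇ-false {m} ℕₚ.≤-refl)) (Boolₚ.∧-zeroʳ _)) (≡ᵇ-false′ p<m) (≡ᵇ-true {m} ≡.refl)

path-counts : ∀ {b a E S L R} → Path false b a E S L R → ∀ p → Counts (positions p a) (positions p b) S L R
-- Here `k` is the last lower entry read, whose upper entry is still to come.
path-counts′ : ∀ {b a E S L R} → Path true b a E S L R → ∀ k p → k ℕ.< p → Counts (positions p a) (k ∷ positions p b) S L R
path-counts (emptyOff π) p = path-counts π (suc p)
path-counts (lowerOnly π)    p = path-counts′ π p (suc p) ℕₚ.≤-refl
path-counts {true ∷ b} {true ∷ a} (leftLeaning {S = S} {L} {R} π) p with q , ks , eq , le ← path-nonempty π (suc p) =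
  ≡.subst (λ z → Counts (p ∷ positions (suc p) a) (p ∷ z) S (suc L) R) (≡.sym eq)
    (counts-left le (≡.subst (λ z → Counts (positions (suc p) a) z S L R) eq (path-counts π (suc p))))
path-counts′ end          k p k<p = counts ≡.refl ≡.refl ≡.refl
path-counts′ (emptyOn π)  k p k<p = path-counts′ π k (suc p) (ℕₚ.m<n⇒m<1+n k<p)
path-counts′ (rightLeaning π)    k p k<p = counts-right k<p (path-counts′ π p (suc p) ℕₚ.≤-refl)
path-counts′ {false ∷ b} {true ∷ a} (isSpecial {S = S} {L} {R} π) k p k<p with q , ks , eq , le ← path-nonempty π (suc p) =
  ≡.subst (λ z → Counts (p ∷ positions (suc p) a) (k ∷ z) (suc S) L R) (≡.sym eq)
    (counts-special k<p le (≡.subst (λ z → Counts (positions (suc p) a) z S L R) eq (path-counts π (suc p))))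

module _ where
  open Data.Nat.Solver.+-*-Solver

  -- What is left of the lower row has one entry more than what is left of the upper row exactly in
  -- state `false`. The sums therefore differ by p plus the number of steps that end in this state.
  path-sum : ∀ {b a E S L R} → Path false b a E S L R → ∀ p →
    sumℕ (positions p b) ≡ sumℕ (positions p a) ℕ.+ (p ℕ.+ (E ℕ.+ L ℕ.+ S))
  path-sum′ : ∀ {b a E S L R} → Path true b a E S L R → ∀ p →
    sumℕ (positions p b) ≡ sumℕ (positions p a) ℕ.+ (E ℕ.+ L ℕ.+ S)
  path-sum {_ ∷ b} {_ ∷ a} (emptyOff π) p = ≡.trans (path-sum π (suc p)) (≡.cong (sumℕ (positions (suc p) a) ℕ.+_) (≡.sym (ℕₚ.+-suc p _)))
  path-sum {_ ∷ b} {_ ∷ a} (lowerOnly {E = E} {S} {L} π) p = ≡.trans (≡.cong (p ℕ.+_) (path-sum′ π (suc p)))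
    (solve 3 (λ p s t → p :+ (s :+ t) := s :+ (p :+ t)) ≡.refl p (sumℕ (positions (suc p) a)) (E ℕ.+ L ℕ.+ S))
  path-sum {_ ∷ b} {_ ∷ a} (leftLeaning {E = E} {S} {L} π) p = ≡.trans (≡.cong (p ℕ.+_) (path-sum π (suc p)))
    (solve 5 (λ p s e l t → p :+ (s :+ (con 1 :+ p :+ (e :+ l :+ t))) := (p :+ s) :+ (p :+ (e :+ (con 1 :+ l) :+ t))) ≡.refl p (sumℕ (positions (suc p) a)) E L S)
  path-sum′ end         p = ≡.refl
  path-sum′ (emptyOn π) p = path-sum′ π (suc p)
  path-sum′ {_ ∷ b} {_ ∷ a} (isSpecial {E = E} {S} {L} π) p = ≡.trans (path-sum π (suc p))
    (solve 5 (λ p s e l t → s :+ (con 1 :+ p :+ (e :+ l :+ t)) := (p :+ s) :+ (e :+ l :+ (con 1 :+ t))) ≡.refl p (sumℕ (positions (suc p) a)) E L S)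
  path-sum′ {_ ∷ b} {_ ∷ a} (rightLeaning {E = E} {S} {L} π) p = ≡.trans (≡.cong (p ℕ.+_) (path-sum′ π (suc p)))
    (≡.sym (ℕₚ.+-assoc p (sumℕ (positions (suc p) a)) (E ℕ.+ L ℕ.+ S)))

module _ where
  open Data.Integer.Solver.+-*-Solver

  -- The exponent is a natural number, so the inverse of the variable enters only through the
  -- factors of special entries.
  path-dHat : ∀ {b a E S L R} → Path false b a E S L R → dHat (positions 1 a ∷ positions 1 b ∷ []) 2 ≡ + (E ℕ.+ S ℕ.+ R)
  path-dHat {b} {a} {E} {S} {L} {R} π with counts s≡ l≡ r≡ ← path-counts π 1 | sum≡ ← path-sum π 1
    rewrite l≡ | r≡ | sum≡ = ≡.trans
    (≡.cong (λ z → z ℤ.- + Σa ℤ.+ + R ℤ.- + L ℤ.- + 1)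
      (≡.trans (ℤₚ.pos-+ Σa _) (≡.cong (λ z → + Σa ℤ.+ (+ 1 ℤ.+ z)) (≡.trans (ℤₚ.pos-+ (E ℕ.+ L) S) (≡.cong (ℤ._+ + S) (ℤₚ.pos-+ E L))))))
    (≡.trans (solve 5 (λ σ e l s r → (σ :+ (con (+ 1) :+ (e :+ l :+ s))) :- σ :+ r :- l :- con (+ 1) := e :+ s :+ r) ≡.refl (+ Σa) (+ E) (+ L) (+ S) (+ R))
      (≡.sym (≡.trans (ℤₚ.pos-+ (E ℕ.+ S) R) (≡.cong (ℤ._+ + R) (ℤₚ.pos-+ E S)))))
    where Σa = sumℕ (positions 1 a)

at-0 : ∀ {a} {X : Set a} (d : X) xs → at d xs 0 ≡ d
at-0 d []       = ≡.refl
at-0 d (x ∷ xs) = ≡.refl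

all-id-replicate : ∀ n → all id (replicate n true) ≡ true
all-id-replicate zero    = ≡.refl
all-id-replicate (suc n) = all-id-replicate n

-- The weighted sum over matrices as a composition of row transfers.

module AlternatingSignMatrices {c ℓ} (R : CommutativeRing c ℓ) (u v w : CommutativeRing.Carrier R) where
  open CommutativeRing R hiding (zero)
  open IntegerSolver R
  open Functionals R using (Fun; _⟨_⟩; IsLinear; pow-+)
  open Sums R
  open Coupling R u v w using (vertex; vertex-linear)
  open SchurExtension R
  open Triangles R u v w
  open Tableaux R using (if-cong; variables↓)
  open import Relation.Binary.Reasoning.Setoid setoid

  chain : ℕ → ℕ → List Bool → (List (List Bool) → Carrier) → Carrier
  chain n zero    acc G = if all id acc then G [] else 0#
  chain n (suc k) acc G = ∑ (words n bits) (λ b → if line false (zipWith bitDifference b acc) then chain n k b (G ⟨ b ⟩) else 0#)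

  chain-cong : ∀ n k acc {F G} → (∀ bs → length bs ≡ k → F bs ≈ G bs) → chain n k acc F ≈ chain n k acc G
  chain-cong n zero    acc e = if-cong (λ _ → 0#) (all id acc) (λ _ → e [] ≡.refl) (λ _ → refl)
  chain-cong n (suc k) acc e = ∑-cong (words n bits) (λ b _ → if-cong (λ _ → 0#) (line false (zipWith bitDifference b acc))
    (λ _ → chain-cong n k b (λ bs len → e (b ∷ bs) (≡.cong suc len))) (λ _ → refl))

  if-*ˡ : ∀ b z {x} → (if b then z * x else 0#) ≈ z * (if b then x else 0#)
  if-*ˡ true  z = refl
  if-*ˡ false z = sym (zeroʳ z)

  chain-*ˡ : ∀ n k acc z G → chain n k acc (λ bs → z * G bs) ≈ z * chain n k acc G
  chain-*ˡ n zero    acc z G = if-*ˡ (all id acc) z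
  chain-*ˡ n (suc k) acc z G = trans
    (∑-cong (words n bits) (λ b _ → trans
      (if-cong (λ _ → 0#) (line false (zipWith bitDifference b acc)) (λ _ → chain-*ˡ n k b z (G ⟨ b ⟩)) (λ _ → refl))
      (if-*ˡ (line false (zipWith bitDifference b acc)) z)))
    (∑-*ˡ z (words n bits) _)

  ∑-words-suc : ∀ {a} {X : Set a} n (as : List X) (f : List X → Carrier) →
    ∑ (words (suc n) as) f ≈ ∑ as (λ x → ∑ (words n as) (λ w → f (x ∷ w)))
  ∑-words-suc n as f = trans (∑-concatMap (λ x → map (x ∷_) (words n as)) as f)
    (∑-cong as (λ x _ → ∑-map (x ∷_) (words n as) f))

  words-reindex : ∀ n acc → length acc ≡ n → (H : List ℤ → List Bool → Carrier) →
    ∑ (words n signs) (λ r → if admitsAll acc r then H r (zipWith advance acc r) else 0#)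
    ≈ ∑ (words n bits) (λ b → H (zipWith bitDifference b acc) b)
  words-reindex zero    []            len H = refl
  words-reindex (suc n) (false ∷ acc) len H = begin
    _ ≈⟨ ∑-words-suc n signs _ ⟩
    _ ≈⟨ +-cong (∑-zero (words n signs)) (+-cong
           (words-reindex n acc (ℕₚ.suc-injective len) (λ r b → H (+ 0 ∷ r) (false ∷ b)))
           (+-congʳ (words-reindex n acc (ℕₚ.suc-injective len) (λ r b → H (+ 1 ∷ r) (true ∷ b))))) ⟩
    _ ≈⟨ +-identityˡ _ ⟩
    _ ≈⟨ ∑-words-suc n bits _ ⟨
    _ ∎
  words-reindex (suc n) (true ∷ acc) len H = begin
    _ ≈⟨ ∑-words-suc n signs _ ⟩
    _ ≈⟨ +-cong (words-reindex n acc (ℕₚ.suc-injective len) (λ r b → H (-[1+ 0 ] ∷ r) (false ∷ b)))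
           (+-cong (words-reindex n acc (ℕₚ.suc-injective len) (λ r b → H (+ 0 ∷ r) (true ∷ b)))
             (+-congʳ (∑-zero (words n signs)))) ⟩
    _ ≈⟨ +-congˡ (+-congˡ (+-identityˡ _)) ⟩
    _ ≈⟨ ∑-words-suc n bits _ ⟨
    _ ∎

  matrices-chain : ∀ n k acc → length acc ≡ n → (F : List (List ℤ) → Carrier) →
    ∑ (words k (words n signs)) (λ A → if all (line false) A ∧ run acc A then F (columnSums (map bitℤ acc) A) else 0#)
    ≈ chain n k acc (λ bs → F (map (map bitℤ) bs))
  matrices-chain n zero    acc len F = +-identityʳ _
  matrices-chain n (suc k) acc len F = begin
    _ ≈⟨ ∑-words-suc k (words n signs) _ ⟩
    _ ≈⟨ ∑-cong (words n signs) (λ r _ → trans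
           (∑-cong (words k (words n signs)) (λ A _ → reorder (line false r) _ (admitsAll acc r) _))
           (pull (admitsAll acc r) (line false r) _)) ⟩
    ∑ (words n signs) (λ r → if admitsAll acc r then H r (zipWith advance acc r) else 0#)
      ≈⟨ words-reindex n acc len H ⟩
    ∑ (words n bits) (λ b → H (zipWith bitDifference b acc) b)
      ≈⟨ ∑-cong (words n bits) (λ b b∈ → if-cong (λ _ → 0#) (line false (zipWith bitDifference b acc)) (λ _ → step b (proj₁ (words-∈ n bits b b∈))) (λ _ → refl)) ⟩
    chain n (suc k) acc (λ bs → F (map (map bitℤ) bs)) ∎
    where
    S : List ℤ → List ℤ
    S r = zipWith ℤ._+_ (map bitℤ acc) r
    H : List ℤ → List Bool → Carrier
    H r b = if line false r then ∑ (words k (words n signs)) (λ A → if all (line false) A ∧ run b A then F (S r ∷ columnSums (S r) A) else 0#) else 0#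
    reorder : ∀ a b c d {x : Carrier} → (if (a ∧ b) ∧ (c ∧ d) then x else 0#) ≈ (if c then (if a then (if b ∧ d then x else 0#) else 0#) else 0#)
    reorder true  true  true  d = refl
    reorder true  true  false d = refl
    reorder true  false true  d = refl
    reorder true  false false d = refl
    reorder false b     true  d = refl
    reorder false b     false d = refl
    pull : ∀ c a (f : List (List ℤ) → Carrier) → ∑ (words k (words n signs)) (λ A → if c then (if a then f A else 0#) else 0#)
      ≈ (if c then (if a then ∑ (words k (words n signs)) f else 0#) else 0#)
    pull true  true  f = refl
    pull true  false f = ∑-zero (words k (words n signs))
    pull false a     f = ∑-zero (words k (words n signs))
    step : ∀ b → length b ≡ n → ∑ (words k (words n signs)) (λ A → if all (line false) A ∧ run b A
        then F (S (zipWith bitDifference b acc) ∷ columnSums (S (zipWith bitDifference b acc)) A) else 0#)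
      ≈ chain n k b (λ bs → F (map bitℤ b ∷ map (map bitℤ) bs))
    step b lenb rewrite add-difference b acc (≡.trans lenb (≡.sym len)) = matrices-chain n k b lenb (λ P → F (map bitℤ b ∷ P))

  vertexWeight : Carrier → Bool → List Bool → List Bool → Carrier
  vertexWeight y true  []          []          = 1#
  vertexWeight y false (false ∷ b) (false ∷ a) = y * vertexWeight y false b a
  vertexWeight y false (true ∷ b)  (false ∷ a) = vertexWeight y true b a
  vertexWeight y false (true ∷ b)  (true ∷ a)  = v * vertexWeight y false b a
  vertexWeight y true  (false ∷ b) (false ∷ a) = vertexWeight y true b a
  vertexWeight y true  (false ∷ b) (true ∷ a)  = (v + w * y + u * y * y) * vertexWeight y false b a
  vertexWeight y true  (true ∷ b)  (true ∷ a)  = u * y * vertexWeight y true b a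
  vertexWeight y _     _           _           = 0#

  zero-sum : ∀ ws (f : List Bool → Carrier) → ∑ ws (λ a → 0# * f a) ≈ 0#
  zero-sum ws f = trans (∑-cong ws (λ a _ → zeroˡ _)) (∑-zero ws)
  scale-sum : ∀ z ws (f g : List Bool → Carrier) → ∑ ws (λ a → z * f a * g a) ≈ z * ∑ ws (λ a → f a * g a)
  scale-sum z ws f g = trans (∑-cong ws (λ a _ → *-assoc _ _ _)) (∑-*ˡ z ws _)

  vertex-∑ : ∀ y s b g → vertex y s b g ≈ ∑ (words (length b) bits) (λ a → vertexWeight y s b a * g a)
  vertex-∑ y false [] g = sym (trans (+-identityʳ _) (zeroˡ _))
  vertex-∑ y true  [] g = sym (trans (+-identityʳ _) (*-identityˡ _))
  vertex-∑ y false (false ∷ b) g = begin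
    _ ≈⟨ *-congˡ (vertex-∑ y false b (g ⟨ false ⟩)) ⟩
    _ ≈⟨ trans (+-congˡ (trans (+-identityʳ _) (zero-sum (words (length b) bits) _))) (trans (+-identityʳ _) (scale-sum y (words (length b) bits) _ _)) ⟨
    _ ≈⟨ ∑-words-suc (length b) bits _ ⟨
    _ ∎
  vertex-∑ y true (true ∷ b) g = begin
    _ ≈⟨ *-congˡ (vertex-∑ y true b (g ⟨ true ⟩)) ⟩
    _ ≈⟨ trans (+-cong (zero-sum (words (length b) bits) _) (trans (+-identityʳ _) (scale-sum (u * y) (words (length b) bits) _ _))) (+-identityˡ _) ⟨
    _ ≈⟨ ∑-words-suc (length b) bits _ ⟨
    _ ∎
  vertex-∑ y false (true ∷ b) g = begin
    _ ≈⟨ +-cong (vertex-∑ y true b (g ⟨ false ⟩)) (*-congˡ (vertex-∑ y false b (g ⟨ true ⟩))) ⟩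
    _ ≈⟨ +-congˡ (trans (+-identityʳ _) (trans (∑-cong (words (length b) bits) (λ a _ → *-assoc _ _ _)) (∑-*ˡ v (words (length b) bits) _))) ⟨
    _ ≈⟨ ∑-words-suc (length b) bits _ ⟨
    _ ∎
  vertex-∑ y true (false ∷ b) g = begin
    _ ≈⟨ +-cong (vertex-∑ y true b (g ⟨ false ⟩)) (*-congˡ (vertex-∑ y false b (g ⟨ true ⟩))) ⟩
    _ ≈⟨ +-congˡ (trans (+-identityʳ _) (trans (∑-cong (words (length b) bits) (λ a _ → *-assoc _ _ _)) (∑-*ˡ _ (words (length b) bits) _))) ⟨
    _ ≈⟨ ∑-words-suc (length b) bits _ ⟨
    _ ∎

  vertexWeight-vanish : ∀ y s b a → length b ≡ length a → line s (zipWith bitDifference b a) ≡ false → vertexWeight y s b a ≈ 0#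
  vertexWeight-vanish y false []          []          len bad = refl
  vertexWeight-vanish y false (false ∷ b) (false ∷ a) len bad = trans (*-congˡ (vertexWeight-vanish y false b a (ℕₚ.suc-injective len) bad)) (zeroʳ _)
  vertexWeight-vanish y false (false ∷ b) (true ∷ a)  len bad = refl
  vertexWeight-vanish y false (true ∷ b)  (false ∷ a) len bad = vertexWeight-vanish y true b a (ℕₚ.suc-injective len) bad
  vertexWeight-vanish y false (true ∷ b)  (true ∷ a)  len bad = trans (*-congˡ (vertexWeight-vanish y false b a (ℕₚ.suc-injective len) bad)) (zeroʳ _)
  vertexWeight-vanish y true  (false ∷ b) (false ∷ a) len bad = vertexWeight-vanish y true b a (ℕₚ.suc-injective len) bad
  vertexWeight-vanish y true  (false ∷ b) (true ∷ a)  len bad = trans (*-congˡ (vertexWeight-vanish y false b a (ℕₚ.suc-injective len) bad)) (zeroʳ _)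
  vertexWeight-vanish y true  (true ∷ b)  (false ∷ a) len bad = refl
  vertexWeight-vanish y true  (true ∷ b)  (true ∷ a)  len bad = trans (*-congˡ (vertexWeight-vanish y true b a (ℕₚ.suc-injective len) bad)) (zeroʳ _)

  vertexWeight-path : ∀ y {s b a E S L K} → Path s b a E S L K →
    vertexWeight y s b a ≈ pow R y E * pow R (v + w * y + u * y * y) S * pow R v L * pow R (u * y) K
  vertexWeight-path y end = solve 0 (con (ℤ.+ 1) := con (ℤ.+ 1) :* con (ℤ.+ 1) :* con (ℤ.+ 1) :* con (ℤ.+ 1)) refl
  vertexWeight-path y (emptyOff π) = trans (*-congˡ (vertexWeight-path y π))
    (solve 5 (λ y a b c d → y :* (a :* b :* c :* d) := y :* a :* b :* c :* d) refl y _ _ _ _)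
  vertexWeight-path y (lowerOnly π) = vertexWeight-path y π
  vertexWeight-path y (leftLeaning π) = trans (*-congˡ (vertexWeight-path y π))
    (solve 5 (λ y a b c d → y :* (a :* b :* c :* d) := a :* b :* (y :* c) :* d) refl v _ _ _ _)
  vertexWeight-path y (emptyOn π) = vertexWeight-path y π
  vertexWeight-path y (isSpecial π) = trans (*-congˡ (vertexWeight-path y π))
    (solve 5 (λ y a b c d → y :* (a :* b :* c :* d) := a :* (y :* b) :* c :* d) refl _ _ _ _ _)
  vertexWeight-path y (rightLeaning π) = trans (*-congˡ (vertexWeight-path y π))
    (solve 5 (λ y a b c d → y :* (a :* b :* c :* d) := a :* b :* c :* (y :* d)) refl (u * y) _ _ _ _)

  pow-* : ∀ x y n → pow R (x * y) n ≈ pow R x n * pow R y n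
  pow-* x y zero    = sym (*-identityˡ _)
  pow-* x y (suc n) = trans (*-congˡ (pow-* x y n)) (solve 4 (λ x y a b → x :* y :* (a :* b) := x :* a :* (y :* b)) refl x y _ _)

  pow-cong : ∀ {x y} n → x ≈ y → pow R x n ≈ pow R y n
  pow-cong zero    e = refl
  pow-cong (suc n) e = *-cong e (pow-cong n e)

  rowWeight : Carrier → Carrier → List ℕ → List ℕ → Carrier
  rowWeight y ȳ l k = pow R u (rights l k) * pow R v (lefts l k)
    * (zpow R y ȳ (dHat (l ∷ k ∷ []) 2) * pow R (u * y + w + v * ȳ) (specials l k))

  -- Every special entry contributes one y to the exponent E + S + R, and this clears the inverse: y
  -- (u y + w + v ȳ) = F(y, y).
  rowWeight-path : ∀ y ȳ → y * ȳ ≈ 1# → ∀ {b a E S L K} → Path false b a E S L K →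
    rowWeight y ȳ (positions 1 a) (positions 1 b) ≈ vertexWeight y false b a
  rowWeight-path y ȳ inv {b} {a} {E} {S} {L} {K} π with counts s≡ l≡ r≡ ← path-counts π 1 | d≡ ← path-dHat π
    rewrite d≡ | s≡ | l≡ | r≡ = begin
    pow R u K * pow R v L * (pow R y (E ℕ.+ S ℕ.+ K) * pow R (u * y + w + v * ȳ) S)
      ≈⟨ *-congˡ (*-congʳ (trans (pow-+ y (E ℕ.+ S) K) (*-congʳ (pow-+ y E S)))) ⟩
    pow R u K * pow R v L * (pow R y E * pow R y S * pow R y K * pow R (u * y + w + v * ȳ) S)
      ≈⟨ solve 6 (λ a b e s k f → a :* b :* (e :* s :* k :* f) := e :* (s :* f) :* b :* (a :* k)) refl _ _ _ _ _ _ ⟩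
    pow R y E * (pow R y S * pow R (u * y + w + v * ȳ) S) * pow R v L * (pow R u K * pow R y K)
      ≈⟨ *-cong (*-congʳ (*-congˡ (trans (sym (pow-* y _ S)) (pow-cong S clear)))) (sym (pow-* u y K)) ⟩
    pow R y E * pow R (v + w * y + u * y * y) S * pow R v L * pow R (u * y) K
      ≈⟨ vertexWeight-path y π ⟨
    vertexWeight y false b a ∎
    where
    clear : y * (u * y + w + v * ȳ) ≈ v + w * y + u * y * y
    clear = trans (solve 5 (λ u v w y z → y :* (u :* y :+ w :+ v :* z) := v :* (y :* z) :+ w :* y :+ u :* y :* y) refl u v w y ȳ)
      (+-congʳ (+-congʳ (trans (*-congˡ inv) (*-identityʳ v))))

  module _ (n : ℕ) (val val⁻¹ : ℕ → Carrier) (inverse : ∀ i → i ℕ.< n → val (suc i) * val⁻¹ (suc i) ≈ 1#) where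

    chainWeight : ℕ → List Bool → List (List Bool) → Carrier
    chainWeight i acc []       = 1#
    chainWeight i acc (b ∷ bs) = rowWeight (val (suc i)) (val⁻¹ (suc i)) (positions 1 acc) (positions 1 b) * chainWeight (suc i) b bs

    transfer : ℕ → ℕ → List Bool → Carrier
    transfer i zero    acc = if all id acc then 1# else 0#
    transfer i (suc k) acc = ∑ (words n bits) (λ b → vertexWeight (val (suc i)) false b acc * transfer (suc i) k b)

    chain-transfer : ∀ k i → i ℕ.+ k ≡ n → ∀ acc → length acc ≡ n → chain n k acc (chainWeight i acc) ≈ transfer i k acc
    chain-transfer zero    i eq acc len = refl
    chain-transfer (suc k) i eq acc len = ∑-cong (words n bits) (λ b b∈ → step b (proj₁ (words-∈ n bits b b∈)))
      where
      step : ∀ b → length b ≡ n → (if line false (zipWith bitDifference b acc)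
          then chain n k b (λ bs → rowWeight (val (suc i)) (val⁻¹ (suc i)) (positions 1 acc) (positions 1 b) * chainWeight (suc i) b bs) else 0#)
        ≈ vertexWeight (val (suc i)) false b acc * transfer (suc i) k b
      step b lenb with line false (zipWith bitDifference b acc) in eqL
      ... | false = sym (trans (*-congʳ (vertexWeight-vanish _ false b acc (≡.trans lenb (≡.sym len)) eqL)) (zeroˡ _))
      ... | true with E , S , L , K , π ← line-path false b acc (≡.trans lenb (≡.sym len)) eqL = trans (chain-*ˡ n k b _ _)
        (*-cong (rowWeight-path _ _ (inverse i (≡.subst (suc i ℕ.≤_) (≡.trans (≡.sym (ℕₚ.+-suc i k)) eq) (ℕ.s≤s (ℕₚ.m≤m+n i k)))) π)
          (chain-transfer k (suc i) (≡.trans (≡.sym (ℕₚ.+-suc i k)) eq) b lenb))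

    -- `triangleSum` recurses from the bottom row and `transfer` from the top. Cutting the triangles
    -- at row i combines both, and the sum does not depend on the cut; the two extreme cuts give
    -- `transfer-triangleSum`.
    triangle-transfer : ∀ k i → ∑ (words n bits) (λ b → triangleSum (variables↓ val i) b * transfer i k b)
      ≈ ∑ (words n bits) (λ b → triangleSum (variables↓ val (i ℕ.+ k)) b * transfer (i ℕ.+ k) 0 b)
    triangle-transfer zero    i = reflexive (≡.cong (λ j → ∑ (words n bits) (λ b → triangleSum (variables↓ val j) b * transfer j 0 b)) (≡.sym (ℕₚ.+-identityʳ i)))
    triangle-transfer (suc k) i = begin
      ∑ (words n bits) (λ b → triangleSum (variables↓ val i) b * ∑ (words n bits) (λ b′ → vertexWeight y false b′ b * transfer (suc i) k b′))
        ≈⟨ ∑-cong (words n bits) (λ b _ → sym (∑-*ˡ _ (words n bits) _)) ⟩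
      _ ≈⟨ ∑-swap (words n bits) (words n bits) _ ⟩
      ∑ (words n bits) (λ b′ → ∑ (words n bits) (λ b → triangleSum (variables↓ val i) b * (vertexWeight y false b′ b * transfer (suc i) k b′)))
        ≈⟨ ∑-cong (words n bits) (λ b′ b′∈ → trans
             (∑-cong (words n bits) (λ b _ → solve 3 (λ a b c → a :* (b :* c) := c :* (b :* a)) refl _ _ _))
             (trans (∑-*ˡ _ (words n bits) _) (trans (*-comm _ _) (*-congʳ (sym (trans (vertex-∑ y false b′ (triangleSum (variables↓ val i)))
               (reflexive (≡.cong (λ m → ∑ (words m bits) (λ a → vertexWeight y false b′ a * triangleSum (variables↓ val i) a)) (proj₁ (words-∈ n bits b′ b′∈)))))))))) ⟩
      ∑ (words n bits) (λ b′ → triangleSum (variables↓ val (suc i)) b′ * transfer (suc i) k b′)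
        ≈⟨ triangle-transfer k (suc i) ⟩
      ∑ (words n bits) (λ b → triangleSum (variables↓ val (suc i ℕ.+ k)) b * transfer (suc i ℕ.+ k) 0 b)
        ≈⟨ reflexive (≡.cong (λ j → ∑ (words n bits) (λ b → triangleSum (variables↓ val j) b * transfer j 0 b)) (≡.sym (ℕₚ.+-suc i k))) ⟩
      _ ∎
      where y = val (suc i)

    ∑-bits-true : ∀ m (f : List Bool → Carrier) → ∑ (words m bits) (λ b → f b * (if all id b then 1# else 0#)) ≈ f (replicate m true)
    ∑-bits-true zero    f = trans (+-identityʳ _) (*-identityʳ _)
    ∑-bits-true (suc m) f = begin
      _ ≈⟨ ∑-words-suc m bits _ ⟩
      _ ≈⟨ +-cong (trans (∑-cong (words m bits) (λ b _ → zeroʳ _)) (∑-zero (words m bits))) (trans (+-identityʳ _) (∑-bits-true m (λ b → f (true ∷ b)))) ⟩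
      _ ≈⟨ +-identityˡ _ ⟩
      _ ∎

    ∑-bits-false : ∀ m p (f : List Bool → Carrier) → ∑ (words m bits) (λ b → emptyFun (positions p b) * f b) ≈ f (replicate m false)
    ∑-bits-false zero    p f = trans (+-identityʳ _) (*-identityˡ _)
    ∑-bits-false (suc m) p f = begin
      _ ≈⟨ ∑-words-suc m bits _ ⟩
      _ ≈⟨ +-cong (∑-bits-false m (suc p) (λ b → f (false ∷ b))) (trans (+-identityʳ _) (trans (∑-cong (words m bits) (λ b _ → zeroˡ _)) (∑-zero (words m bits)))) ⟩
      _ ≈⟨ +-identityʳ _ ⟩
      _ ∎

    transfer-triangleSum : transfer 0 n (replicate n false) ≈ triangleSum (variables↓ val n) (replicate n true)
    transfer-triangleSum = trans (sym (∑-bits-false n 0 (transfer 0 n))) (trans (triangle-transfer n 0) (∑-bits-true n _))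

    Π↑ : (ℕ → Carrier) → ℕ → Carrier
    Π↑ f m = Π R (applyUpTo f m)

    Π↑-cong : ∀ m {f g} → (∀ j → f j ≈ g j) → Π↑ f m ≈ Π↑ g m
    Π↑-cong zero    e = refl
    Π↑-cong (suc m) e = *-cong (e 0) (Π↑-cong m (λ j → e (suc j)))

    Π↑-* : ∀ m f g → Π↑ (λ j → f j * g j) m ≈ Π↑ f m * Π↑ g m
    Π↑-* zero    f g = sym (*-identityˡ _)
    Π↑-* (suc m) f g = trans (*-congˡ (Π↑-* m _ _)) (solve 4 (λ a b c d → a :* b :* (c :* d) := a :* c :* (b :* d)) refl _ _ _ _)

    pow-sum : ∀ z (g : ℕ → ℕ) m → pow R z (sumℕ (map g (range m))) ≈ Π↑ (λ j → pow R z (g (suc j))) m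
    pow-sum z g m = trans (reflexive (≡.cong (λ is → pow R z (sumℕ is))
        (≡.trans (≡.sym (Listₚ.map-∘ (upTo m))) (Listₚ.map-applyUpTo id (g ∘ suc) m)))) (go (g ∘ suc) m)
      where
      go : ∀ g m → pow R z (sumℕ (applyUpTo g m)) ≈ Π↑ (λ j → pow R z (g j)) m
      go g zero    = refl
      go g (suc m) = trans (pow-+ z (g 0) _) (*-congˡ (go (g ∘ suc) m))

    triangleWeight : List (List ℕ) → Carrier
    triangleWeight M = pow R u (rightTotal n M) * pow R v (leftTotal n M)
      * Π R (map (λ i → zpow R (val i) (val⁻¹ i) (dHat M i) * pow R (u * val i + w + v * val⁻¹ i) (specialᵢ M (i ℕ.∸ 1))) (range n))

    triangleWeight-product : 1 ℕ.≤ n → ∀ M →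
      triangleWeight M ≈ Π↑ (λ j → rowWeight (val (suc j)) (val⁻¹ (suc j)) (at [] M j) (at [] M (suc j))) n
    triangleWeight-product (ℕ.s≤s {n = m} _) M = begin
      triangleWeight M
        ≈⟨ *-cong (*-cong (extend u (rightᵢ M) right₀) (extend v (leftᵢ M) left₀))
             (reflexive (≡.cong (Π R) (≡.trans (≡.sym (Listₚ.map-∘ (upTo n))) (Listₚ.map-applyUpTo id _ n)))) ⟩
      Π↑ f n * Π↑ g n * Π↑ h n
        ≈⟨ *-congʳ (Π↑-* n f g) ⟨
      Π↑ (λ j → f j * g j) n * Π↑ h n
        ≈⟨ Π↑-* n (λ j → f j * g j) h ⟨
      Π↑ (λ j → f j * g j * h j) n ∎
      where
      f g h : ℕ → Carrier
      f j = pow R u (rightᵢ M j)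
      g j = pow R v (leftᵢ M j)
      h j = zpow R (val (suc j)) (val⁻¹ (suc j)) (dHat M (suc j)) * pow R (u * val (suc j) + w + v * val⁻¹ (suc j)) (specialᵢ M j)
      right₀ : rightᵢ M 0 ≡ 0
      -- Row 0 is the default value `[]` of `at`: the empty row above the triangle.
      right₀ rewrite at-0 [] M = ≡.refl
      left₀ : leftᵢ M 0 ≡ 0
      left₀ rewrite at-0 [] M = ≡.refl
      extend : ∀ z (g : ℕ → ℕ) → g 0 ≡ 0 → pow R z (sumℕ (map g (range m))) ≈ Π↑ (λ j → pow R z (g j)) (suc m)
      extend z g g₀ = trans (pow-sum z g m) (sym (trans (*-congʳ (reflexive (≡.cong (pow R z) g₀))) (*-identityˡ _)))

    product-chainWeight : ∀ i acc bs → Π↑ (λ j → rowWeight (val (suc (i ℕ.+ j))) (val⁻¹ (suc (i ℕ.+ j)))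
        (at [] (positions 1 acc ∷ map (positions 1) bs) (suc j)) (at [] (map (positions 1) bs) (suc j))) (length bs)
      ≈ chainWeight i acc bs
    product-chainWeight i acc []       = refl
    product-chainWeight i acc (b ∷ bs) = *-cong
      (reflexive (≡.cong (λ k → rowWeight (val (suc k)) (val⁻¹ (suc k)) (positions 1 acc) (positions 1 b)) (ℕₚ.+-identityʳ i)))
      (trans (Π↑-cong (length bs) (λ j → reflexive (≡.cong (λ k → rowWeight (val (suc k)) (val⁻¹ (suc k))
          (at [] (positions 1 b ∷ map (positions 1) bs) (suc j)) (at [] (map (positions 1) bs) (suc j))) (ℕₚ.+-suc i j))))
        (product-chainWeight (suc i) b bs))

    positions-false : ∀ p m → positions p (replicate m false) ≡ []
    positions-false p zero    = ≡.refl
    positions-false p (suc m) = positions-false (suc p) m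

    triangleWeight-chainWeight : 1 ℕ.≤ n → ∀ bs → length bs ≡ n →
      triangleWeight (map onesPositions (map (map bitℤ) bs)) ≈ chainWeight 0 (replicate n false) bs
    triangleWeight-chainWeight 1≤n bs len = begin
      triangleWeight (map onesPositions (map (map bitℤ) bs))
        ≡⟨ ≡.cong triangleWeight (≡.trans (≡.sym (Listₚ.map-∘ bs)) (Listₚ.map-cong onesPositions-bits bs)) ⟩
      triangleWeight M
        ≈⟨ triangleWeight-product 1≤n M ⟩
      Π↑ (λ j → rowWeight (val (suc j)) (val⁻¹ (suc j)) (at [] M j) (at [] M (suc j))) n
        ≈⟨ Π↑-cong n (λ j → reflexive (≡.cong (λ l → rowWeight (val (suc j)) (val⁻¹ (suc j)) l (at [] M (suc j))) (shift j))) ⟩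
      Π↑ (λ j → rowWeight (val (suc j)) (val⁻¹ (suc j)) (at [] (positions 1 (replicate n false) ∷ M) (suc j)) (at [] M (suc j))) n
        ≡⟨ ≡.cong (Π↑ _) (≡.sym len) ⟩
      Π↑ (λ j → rowWeight (val (suc j)) (val⁻¹ (suc j)) (at [] (positions 1 (replicate n false) ∷ M) (suc j)) (at [] M (suc j))) (length bs)
        ≈⟨ product-chainWeight 0 (replicate n false) bs ⟩
      chainWeight 0 (replicate n false) bs ∎
      where
      M = map (positions 1) bs
      shift : ∀ j → at [] M j ≡ at [] (positions 1 (replicate n false) ∷ M) (suc j)
      shift zero    = ≡.trans (at-0 [] M) (≡.sym (positions-false 1 n))
      shift (suc j) = ≡.refl

    matrices-triangleSum : 1 ℕ.≤ n →
      ∑ (ASM n) (λ A → triangleWeight (monotoneTriangle n A)) ≈ triangleSum (variables↓ val n) (replicate n true)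
    matrices-triangleSum 1≤n = begin
      ∑ (ASM n) (λ A → triangleWeight (monotoneTriangle n A))
        ≈⟨ ∑-filterᵇ (isASM n) (words n (words n signs)) _ ⟩
      ∑ (words n (words n signs)) (λ A → if isASM n A then triangleWeight (monotoneTriangle n A) else 0#)
        ≈⟨ ∑-cong (words n (words n signs)) (λ A A∈ → reflexive (≡.cong₂ (λ b P → if b then triangleWeight (map onesPositions P) else 0#)
             (isASM-run n A A∈) (≡.trans (partialColumnSums-columnSums n A) (≡.cong (λ z → columnSums z A) (≡.sym (Listₚ.map-replicate bitℤ n false)))))) ⟩
      ∑ (words n (words n signs)) (λ A → if all (line false) A ∧ run (replicate n false) A
          then triangleWeight (map onesPositions (columnSums (map bitℤ (replicate n false)) A)) else 0#)
        ≈⟨ matrices-chain n n (replicate n false) (Listₚ.length-replicate n) (λ P → triangleWeight (map onesPositions P)) ⟩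
      chain n n (replicate n false) (λ bs → triangleWeight (map onesPositions (map (map bitℤ) bs)))
        ≈⟨ chain-cong n n (replicate n false) (triangleWeight-chainWeight 1≤n) ⟩
      chain n n (replicate n false) (chainWeight 0 (replicate n false))
        ≈⟨ chain-transfer n 0 ≡.refl (replicate n false) (Listₚ.length-replicate n) ⟩
      transfer 0 n (replicate n false)
        ≈⟨ transfer-triangleSum ⟩
      triangleSum (variables↓ val n) (replicate n true) ∎

-- Totally symmetric solids given by their sorted points.

<ᵇ-sound : ∀ {x y} → (x ℕ.<ᵇ y) ≡ true → x ℕ.< y
<ᵇ-sound {x} {y} eq = ℕₚ.<ᵇ⇒< x y (≡.subst T (≡.sym eq) tt)

≤-from-< : ∀ {a b} → (∀ x → x ℕ.< a → x ℕ.< b) → a ℕ.≤ b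
≤-from-< {zero}  f = ℕ.z≤n
≤-from-< {suc a} f = f a ℕₚ.≤-refl

∸-<⇒+-< : ∀ p n x → x ℕ.< n ℕ.∸ p → p ℕ.+ x ℕ.< n
∸-<⇒+-< zero    n       x h = h
∸-<⇒+-< (suc p) (suc n) x h = ℕ.s≤s (∸-<⇒+-< p n x h)

+-<⇒∸-< : ∀ p n x → p ℕ.+ x ℕ.< n → x ℕ.< n ℕ.∸ p
+-<⇒∸-< zero    n       x h         = h
+-<⇒∸-< (suc p) (suc n) x (ℕ.s≤s h) = +-<⇒∸-< p n x h

≡-from-< : ∀ {a b} → (∀ x → x ℕ.< a → x ℕ.< b) → (∀ x → x ℕ.< b → x ℕ.< a) → a ≡ b
≡-from-< f g = ℕₚ.≤-antisym (≤-from-< f) (≤-from-< g)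

-- The length of the initial run of `true`; for a down-closed decidable set this is its height, with
-- M as a bound.
runLength : ℕ → (ℕ → Bool) → ℕ
runLength zero    P = 0
runLength (suc M) P = if P 0 then suc (runLength M (P ∘ suc)) else 0

runLength-sound : ∀ M P c → c ℕ.< runLength M P → P c ≡ true × c ℕ.< M
runLength-sound (suc M) P c c< with P 0 in eq
runLength-sound (suc M) P zero    c<         | true = eq , ℕ.s≤s ℕ.z≤n
runLength-sound (suc M) P (suc c) (ℕ.s≤s c<) | true with Pc , c<M ← runLength-sound M (P ∘ suc) c c< = Pc , ℕ.s≤s c<M

runLength-complete : ∀ M P c → (∀ c′ → c′ ℕ.≤ c → P c′ ≡ true) → c ℕ.< M → c ℕ.< runLength M P
runLength-complete (suc M) P zero    all≤ c<M rewrite all≤ 0 ℕ.z≤n = ℕ.s≤s ℕ.z≤n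
runLength-complete (suc M) P (suc c) all≤ (ℕ.s≤s c<M) rewrite all≤ 0 ℕ.z≤n =
  ℕ.s≤s (runLength-complete M (P ∘ suc) c (λ c′ c′≤ → all≤ (suc c′) (ℕ.s≤s c′≤)) c<M)

lo mid hi : ℕ → ℕ → ℕ → ℕ
lo  i j c = i ⊓ (j ⊓ c)
mid i j c = (i ⊓ j) ⊔ ((i ⊓ c) ⊔ (j ⊓ c))
hi  i j c = i ⊔ (j ⊔ c)

record Swappable (f : ℕ → ℕ → ℕ → ℕ) : Set where
  field
    swap₁₂ : ∀ i j c → f i j c ≡ f j i c
    swap₂₃ : ∀ i j c → f i j c ≡ f i c j

lo-swappable : Swappable lo
lo-swappable = record
  { swap₁₂ = λ i j c → ≡.trans (≡.sym (ℕₚ.⊓-assoc i j c)) (≡.trans (≡.cong (_⊓ c) (ℕₚ.⊓-comm i j)) (ℕₚ.⊓-assoc j i c))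
  ; swap₂₃ = λ i j c → ≡.cong (i ⊓_) (ℕₚ.⊓-comm j c) }

hi-swappable : Swappable hi
hi-swappable = record
  { swap₁₂ = λ i j c → ≡.trans (≡.sym (ℕₚ.⊔-assoc i j c)) (≡.trans (≡.cong (_⊔ c) (ℕₚ.⊔-comm i j)) (ℕₚ.⊔-assoc j i c))
  ; swap₂₃ = λ i j c → ≡.cong (i ⊔_) (ℕₚ.⊔-comm j c) }

mid-swappable : Swappable mid
mid-swappable = record
  { swap₁₂ = λ i j c → ≡.cong₂ _⊔_ (ℕₚ.⊓-comm i j) (ℕₚ.⊔-comm (i ⊓ c) (j ⊓ c))
  ; swap₂₃ = λ i j c → ≡.trans (Swappable.swap₁₂ hi-swappable (i ⊓ j) (i ⊓ c) (j ⊓ c))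
      (≡.cong (λ z → (i ⊓ c) ⊔ ((i ⊓ j) ⊔ z)) (ℕₚ.⊓-comm j c)) }

lo-sorted : ∀ {p q r} → p ℕ.≤ q → q ℕ.≤ r → lo p q r ≡ p
lo-sorted p≤q q≤r = ≡.trans (≡.cong (_ ⊓_) (ℕₚ.m≤n⇒m⊓n≡m q≤r)) (ℕₚ.m≤n⇒m⊓n≡m p≤q)

mid-sorted : ∀ {p q r} → p ℕ.≤ q → q ℕ.≤ r → mid p q r ≡ q
mid-sorted {p} {q} {r} p≤q q≤r
  rewrite ℕₚ.m≤n⇒m⊓n≡m p≤q | ℕₚ.m≤n⇒m⊓n≡m (ℕₚ.≤-trans p≤q q≤r) | ℕₚ.m≤n⇒m⊓n≡m q≤r | ℕₚ.m≤n⇒m⊔n≡n p≤q = ℕₚ.m≤n⇒m⊔n≡n p≤q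

hi-sorted : ∀ {p q r} → p ℕ.≤ q → q ℕ.≤ r → hi p q r ≡ r
hi-sorted p≤q q≤r = ≡.trans (≡.cong (_ ⊔_) (ℕₚ.m≤n⇒m⊔n≡n q≤r)) (ℕₚ.m≤n⇒m⊔n≡n (ℕₚ.≤-trans p≤q q≤r))

wlog-sorted : (P : ℕ → ℕ → ℕ → Set) → (∀ {i j c} → P i j c → P j i c) → (∀ {i j c} → P i j c → P i c j) →
  (∀ p q r → p ℕ.≤ q → q ℕ.≤ r → P p q r) → ∀ i j c → P i j c
wlog-sorted P s₁₂ s₂₃ sorted i j c with ℕₚ.≤-total i j | ℕₚ.≤-total j c | ℕₚ.≤-total i c
... | inj₁ i≤j | inj₁ j≤c | _        = sorted i j c i≤j j≤c
... | inj₁ i≤j | inj₂ c≤j | inj₁ i≤c = s₂₃ (sorted i c j i≤c c≤j)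
... | inj₁ i≤j | inj₂ c≤j | inj₂ c≤i = s₂₃ (s₁₂ (sorted c i j c≤i i≤j))
... | inj₂ j≤i | inj₁ j≤c | inj₁ i≤c = s₁₂ (sorted j i c j≤i i≤c)
... | inj₂ j≤i | inj₁ j≤c | inj₂ c≤i = s₁₂ (s₂₃ (sorted j c i j≤c c≤i))
... | inj₂ j≤i | inj₂ c≤j | _        = s₁₂ (s₂₃ (s₁₂ (sorted c j i c≤j j≤i)))

lo≤mid : ∀ i j c → lo i j c ℕ.≤ mid i j c
lo≤mid i j c = ℕₚ.≤-trans (ℕₚ.⊓-monoʳ-≤ i (ℕₚ.m⊓n≤m j c)) (ℕₚ.m≤m⊔n (i ⊓ j) _)

mid≤hi : ∀ i j c → mid i j c ℕ.≤ hi i j c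
mid≤hi i j c = ℕₚ.⊔-lub (ℕₚ.≤-trans (ℕₚ.m⊓n≤m i j) (ℕₚ.m≤m⊔n i _))
  (ℕₚ.⊔-lub (ℕₚ.≤-trans (ℕₚ.m⊓n≤m i c) (ℕₚ.m≤m⊔n i _)) (ℕₚ.≤-trans (ℕₚ.m⊓n≤m j c) (ℕₚ.≤-trans (ℕₚ.m≤m⊔n j c) (ℕₚ.m≤n⊔m i _))))

-- The totally symmetric plane partitions in [m]³ with all three coordinates counted from 0:
-- (i, j, c) belongs to the solid when c < e i j.
record Plane (m : ℕ) (e : ℕ → ℕ → ℕ) : Set where
  field
    bound  : ∀ {i j c} → c ℕ.< e i j → i ℕ.< m × j ℕ.< m × c ℕ.< m
    swap₁₂ : ∀ {i j c} → c ℕ.< e i j → c ℕ.< e j i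
    swap₂₃ : ∀ {i j c} → c ℕ.< e i j → j ℕ.< e i c

  -- Lowering c is immediate for a solid given by heights; the swaps bring i and j into the place of
  -- c.
  shrink : ∀ {i j c i′ j′ c′} → i′ ℕ.≤ i → j′ ℕ.≤ j → c′ ℕ.≤ c → c ℕ.< e i j → c′ ℕ.< e i′ j′
  shrink i′≤i j′≤j c′≤c c< =
    ℕₚ.≤-<-trans c′≤c (swap₂₃ (ℕₚ.≤-<-trans j′≤j (swap₂₃ (swap₁₂ (swap₂₃ (ℕₚ.≤-<-trans i′≤i (swap₂₃ (swap₁₂ c<))))))))

  private
    Sorted : ℕ → ℕ → ℕ → Set
    Sorted i j c = hi i j c ℕ.< e (lo i j c) (mid i j c)

    sorted-≡ : ∀ {i j c l m h} → lo i j c ≡ l → mid i j c ≡ m → hi i j c ≡ h → Sorted i j c ≡ (h ℕ.< e l m)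
    sorted-≡ ≡.refl ≡.refl ≡.refl = ≡.refl

    sorted-swap₁₂ : ∀ i j c → Sorted i j c ≡ Sorted j i c
    sorted-swap₁₂ i j c = sorted-≡ (S.swap₁₂ lo-swappable i j c) (S.swap₁₂ mid-swappable i j c) (S.swap₁₂ hi-swappable i j c)
      where module S = Swappable

    sorted-swap₂₃ : ∀ i j c → Sorted i j c ≡ Sorted i c j
    sorted-swap₂₃ i j c = sorted-≡ (S.swap₂₃ lo-swappable i j c) (S.swap₂₃ mid-swappable i j c) (S.swap₂₃ hi-swappable i j c)
      where module S = Swappable

    sorted-id : ∀ {p q r} → p ℕ.≤ q → q ℕ.≤ r → Sorted p q r ≡ (r ℕ.< e p q)
    sorted-id p≤q q≤r = sorted-≡ (lo-sorted p≤q q≤r) (mid-sorted p≤q q≤r) (hi-sorted p≤q q≤r)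

  sort : ∀ i j c → c ℕ.< e i j → hi i j c ℕ.< e (lo i j c) (mid i j c)
  sort = wlog-sorted _
    (λ {i} {j} {c} IH c< → ≡.subst id (sorted-swap₁₂ i j c) (IH (swap₁₂ c<)))
    (λ {i} {j} {c} IH c< → ≡.subst id (sorted-swap₂₃ i j c) (IH (swap₂₃ c<)))
    (λ p q r p≤q q≤r → ≡.subst id (≡.sym (sorted-id p≤q q≤r)))

  unsort : ∀ i j c → hi i j c ℕ.< e (lo i j c) (mid i j c) → c ℕ.< e i j
  unsort = wlog-sorted _
    (λ {i} {j} {c} IH h → swap₁₂ (IH (≡.subst id (sorted-swap₁₂ j i c) h)))
    (λ {i} {j} {c} IH h → swap₂₃ (IH (≡.subst id (sorted-swap₂₃ i c j) h)))
    (λ p q r p≤q q≤r → ≡.subst id (sorted-id p≤q q≤r))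

Plane-≡ : ∀ {m m′ e f} → Plane m e → Plane m′ f →
  (∀ p q r → p ℕ.≤ q → q ℕ.≤ r → r ℕ.< e p q → r ℕ.< f p q) →
  (∀ p q r → p ℕ.≤ q → q ℕ.≤ r → r ℕ.< f p q → r ℕ.< e p q) → ∀ i j → e i j ≡ f i j
Plane-≡ πe πf e⊆f f⊆e i j = ≡-from-<
  (λ c c< → Plane.unsort πf i j c (e⊆f _ _ _ (lo≤mid i j c) (mid≤hi i j c) (Plane.sort πe i j c c<)))
  (λ c c< → Plane.unsort πe i j c (f⊆e _ _ _ (lo≤mid i j c) (mid≤hi i j c) (Plane.sort πf i j c c<)))

-- S describes a solid through its points p ≤ q ≤ r, so the closure is asked for between sorted
-- points.
record DownClosed (M : ℕ) (S : ℕ → ℕ → ℕ → Bool) : Set where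
  field
    down : ∀ {p q r p′ q′ r′} → p′ ℕ.≤ p → q′ ℕ.≤ q → r′ ℕ.≤ r → p′ ℕ.≤ q′ → q′ ℕ.≤ r′ → p ℕ.≤ q → q ℕ.≤ r →
      S p q r ≡ true → S p′ q′ r′ ≡ true
    inside : ∀ {p q r} → p ℕ.≤ q → q ℕ.≤ r → S p q r ≡ true → r ℕ.< M

symmetrise : ℕ → (ℕ → ℕ → ℕ → Bool) → ℕ → ℕ → ℕ
symmetrise M S i j = runLength M (λ c → S (lo i j c) (mid i j c) (hi i j c))

module Symmetrise {M S} (dc : DownClosed M S) where
  open DownClosed dc

  symmetrise-sound : ∀ i j c → c ℕ.< symmetrise M S i j → S (lo i j c) (mid i j c) (hi i j c) ≡ true
  symmetrise-sound i j c c< = proj₁ (runLength-sound M _ c c<)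

  symmetrise-complete : ∀ i j c → S (lo i j c) (mid i j c) (hi i j c) ≡ true → c ℕ.< symmetrise M S i j
  symmetrise-complete i j c s = runLength-complete M _ c
    (λ c′ c′≤c → down (ℕₚ.⊓-monoʳ-≤ i (ℕₚ.⊓-monoʳ-≤ j c′≤c))
      (ℕₚ.⊔-monoʳ-≤ (i ⊓ j) (ℕₚ.⊔-mono-≤ (ℕₚ.⊓-monoʳ-≤ i c′≤c) (ℕₚ.⊓-monoʳ-≤ j c′≤c)))
      (ℕₚ.⊔-monoʳ-≤ i (ℕₚ.⊔-monoʳ-≤ j c′≤c)) (lo≤mid i j c′) (mid≤hi i j c′) (lo≤mid i j c) (mid≤hi i j c) s)
    (ℕₚ.≤-<-trans (ℕₚ.≤-trans (ℕₚ.m≤n⊔m j c) (ℕₚ.m≤n⊔m i _)) (inside (lo≤mid i j c) (mid≤hi i j c) s))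

  private
    transport : ∀ i j c i′ j′ c′ → lo i j c ≡ lo i′ j′ c′ → mid i j c ≡ mid i′ j′ c′ → hi i j c ≡ hi i′ j′ c′ →
      S (lo i j c) (mid i j c) (hi i j c) ≡ true → S (lo i′ j′ c′) (mid i′ j′ c′) (hi i′ j′ c′) ≡ true
    transport i j c i′ j′ c′ l m h s = ≡.trans (≡.sym (≡.trans (≡.cong₂ (λ a b → S a b (hi i j c)) l m) (≡.cong (S _ _) h))) s

  symmetrise-plane : Plane M (symmetrise M S)
  symmetrise-plane = record
    { bound = λ {i} {j} {c} c< → let hi< = inside (lo≤mid i j c) (mid≤hi i j c) (symmetrise-sound i j c c<) in
        ℕₚ.≤-<-trans (ℕₚ.m≤m⊔n i _) hi< , ℕₚ.≤-<-trans (ℕₚ.≤-trans (ℕₚ.m≤m⊔n j c) (ℕₚ.m≤n⊔m i _)) hi< , proj₂ (runLength-sound M _ c c<)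
    ; swap₁₂ = λ {i} {j} {c} c< → symmetrise-complete j i c (transport i j c j i c
        (Swappable.swap₁₂ lo-swappable i j c) (Swappable.swap₁₂ mid-swappable i j c) (Swappable.swap₁₂ hi-swappable i j c) (symmetrise-sound i j c c<))
    ; swap₂₃ = λ {i} {j} {c} c< → symmetrise-complete i c j (transport i j c i c j
        (Swappable.swap₂₃ lo-swappable i j c) (Swappable.swap₂₃ mid-swappable i j c) (Swappable.swap₂₃ hi-swappable i j c) (symmetrise-sound i j c c<)) }

  private
    sorted-S : ∀ {p q r} → p ℕ.≤ q → q ℕ.≤ r → S (lo p q r) (mid p q r) (hi p q r) ≡ S p q r
    sorted-S {p} {q} {r} p≤q q≤r = ≡.trans (≡.cong₂ (λ a b → S a b (hi p q r)) (lo-sorted p≤q q≤r) (mid-sorted p≤q q≤r)) (≡.cong (S _ _) (hi-sorted p≤q q≤r))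

  sorted-sound : ∀ {p q r} → p ℕ.≤ q → q ℕ.≤ r → r ℕ.< symmetrise M S p q → S p q r ≡ true
  sorted-sound p≤q q≤r r< = ≡.trans (≡.sym (sorted-S p≤q q≤r)) (symmetrise-sound _ _ _ r<)

  sorted-complete : ∀ {p q r} → p ℕ.≤ q → q ℕ.≤ r → S p q r ≡ true → r ℕ.< symmetrise M S p q
  sorted-complete p≤q q≤r s = symmetrise-complete _ _ _ (≡.trans (sorted-S p≤q q≤r) s)

-- Arms, legs, and the growth of a solid by walls.

part : List ℕ → ℕ → ℕ
part []       p       = 0
part (a ∷ as) zero    = suc a
part (a ∷ as) (suc p) = part as p

part-injective : ∀ as bs → (∀ p → part as p ≡ part bs p) → as ≡ bs
part-injective []       []       e = ≡.refl
part-injective []       (b ∷ bs) e with () ← e 0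
part-injective (a ∷ as) []       e with () ← e 0
part-injective (a ∷ as) (b ∷ bs) e = ≡.cong₂ _∷_ (ℕₚ.suc-injective (e 0)) (part-injective as bs (e ∘ suc))

Strict : List ℕ → Set
Strict as = ∀ p x → x ℕ.< part as (suc p) → suc x ℕ.< part as p

headBelow : ℕ → List ℕ → Bool
headBelow a []      = true
headBelow a (b ∷ _) = b ℕ.<ᵇ a

armSuccessors : List ℕ → List (List ℕ)
armSuccessors []       = [] ∷ (0 ∷ []) ∷ []
armSuccessors (a ∷ as) = map (a ∷_) (filterᵇ (headBelow a) (armSuccessors as)) ++ map (suc a ∷_) (armSuccessors as)

-- `part` is 0 for a missing arm and a + 1 for the arm a. So the bounds say that an arm stays or
-- grows by one, and that a new arm is 0.
record Succeeds (as bs : List ℕ) : Set where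
  field
    lower  : ∀ p → part as p ℕ.≤ part bs p
    upper  : ∀ p → part bs p ℕ.≤ suc (part as p)
    strict-parts : Strict bs

∈-filterᵇ⁺ : ∀ {a} {X : Set a} (p : X → Bool) {x} xs → x ∈ xs → p x ≡ true → x ∈ filterᵇ p xs
∈-filterᵇ⁺ p (y ∷ xs) x∈ px with p y in eq
∈-filterᵇ⁺ p (y ∷ xs) (here ≡.refl) px | true  = here ≡.refl
∈-filterᵇ⁺ p (y ∷ xs) (there x∈)    px | true  = there (∈-filterᵇ⁺ p xs x∈ px)
∈-filterᵇ⁺ p (y ∷ xs) (here ≡.refl) px | false with () ← ≡.trans (≡.sym px) eq
∈-filterᵇ⁺ p (y ∷ xs) (there x∈)    px | false = ∈-filterᵇ⁺ p xs x∈ px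

armSuccessors-complete : ∀ as bs → Succeeds as bs → bs ∈ armSuccessors as
armSuccessors-complete [] [] s = here ≡.refl
armSuccessors-complete [] (zero ∷ []) s = there (here ≡.refl)
armSuccessors-complete [] (suc b ∷ bs) s with ℕ.s≤s () ← Succeeds.upper s 0
armSuccessors-complete [] (zero ∷ b′ ∷ bs) s with ℕ.s≤s () ← Succeeds.strict-parts s 0 0 (ℕ.s≤s ℕ.z≤n)
armSuccessors-complete (a ∷ as) [] s with () ← Succeeds.lower s 0
armSuccessors-complete (a ∷ as) (b ∷ bs) s = place (ℕ.s≤s⁻¹ (Succeeds.lower s 0)) (ℕ.s≤s⁻¹ (Succeeds.upper s 0))
  where
  tails : bs ∈ armSuccessors as
  tails = armSuccessors-complete as bs (record
    { lower = λ p → Succeeds.lower s (suc p) ; upper = λ p → Succeeds.upper s (suc p) ; strict-parts = λ p → Succeeds.strict-parts s (suc p) })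
  below′ : ∀ bs → Strict (b ∷ bs) → headBelow b bs ≡ true
  below′ []        st = ≡.refl
  below′ (b′ ∷ bs) st = <⇒<ᵇ-true (ℕ.s≤s⁻¹ (st 0 b′ ℕₚ.≤-refl))
  place : a ℕ.≤ b → b ℕ.≤ suc a → (b ∷ bs) ∈ armSuccessors (a ∷ as)
  place a≤b b≤sa with ℕₚ.m≤n⇒m<n∨m≡n a≤b
  ... | inj₂ ≡.refl = ∈-++⁺ˡ (∈-map⁺ (a ∷_) (∈-filterᵇ⁺ (headBelow a) (armSuccessors as) tails (below′ bs (Succeeds.strict-parts s))))
  ... | inj₁ a<b with ≡.refl ← ℕₚ.≤-antisym b≤sa a<b = ∈-++⁺ʳ (map (a ∷_) (filterᵇ (headBelow a) (armSuccessors as))) (∈-map⁺ (suc a ∷_) tails)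

armSuccessors-sound : ∀ as bs → Strict as → bs ∈ armSuccessors as → Succeeds as bs
armSuccessors-sound [] _ st (here ≡.refl) = record { lower = λ p → ℕ.z≤n ; upper = λ p → ℕ.z≤n ; strict-parts = λ p x () }
armSuccessors-sound [] _ st (there (here ≡.refl)) = record
  { lower = λ p → ℕ.z≤n ; upper = λ { zero → ℕₚ.≤-refl ; (suc p) → ℕ.z≤n } ; strict-parts = λ { zero x () ; (suc p) x () } }
armSuccessors-sound (a ∷ as) bs st bs∈ with ∈-++⁻ (map (a ∷_) (filterᵇ (headBelow a) (armSuccessors as))) bs∈
... | inj₁ bs∈₁ with bs′ , bs′∈ , ≡.refl ← ∈-map⁻ (a ∷_) bs∈₁
  with bs′∈′ , below′ ← ∈-filterᵇ⁻ (headBelow a) (armSuccessors as) bs′∈ = record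
  { lower = λ { zero → ℕₚ.≤-refl ; (suc p) → Succeeds.lower IH p }
  ; upper = λ { zero → ℕₚ.n≤1+n _ ; (suc p) → Succeeds.upper IH p }
  ; strict-parts = λ { zero → first bs′ below′ ; (suc p) → Succeeds.strict-parts IH p } }
  where
  IH = armSuccessors-sound as bs′ (st ∘ suc) bs′∈′
  first : ∀ bs → headBelow a bs ≡ true → ∀ x → x ℕ.< part bs 0 → suc x ℕ.< suc a
  first (b ∷ bs) below′ x x< = ℕ.s≤s (ℕₚ.≤-trans x< (<ᵇ-sound below′))
... | inj₂ bs∈₂ with bs′ , bs′∈ , ≡.refl ← ∈-map⁻ (suc a ∷_) bs∈₂ = record
  { lower = λ { zero → ℕₚ.n≤1+n _ ; (suc p) → Succeeds.lower IH p }
  ; upper = λ { zero → ℕₚ.≤-refl ; (suc p) → Succeeds.upper IH p }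
  ; strict-parts = λ { zero x x< → ℕ.s≤s (ℕₚ.≤-trans x< (ℕₚ.≤-trans (Succeeds.upper IH 0) (ℕ.s≤s (≤-from-< (λ z z< → ℕ.s≤s⁻¹ (st 0 z z<))))))
                     ; (suc p) → Succeeds.strict-parts IH p } }
  where IH = armSuccessors-sound as bs′ (st ∘ suc) bs′∈

listOf : (ℕ → ℕ) → ℕ → List ℕ
listOf f l = applyUpTo (λ p → f p ℕ.∸ 1) l

part-listOf : ∀ f l → (∀ p → p ℕ.< l → 0 ℕ.< f p) → (∀ p → 0 ℕ.< f p → p ℕ.< l) → ∀ p → part (listOf f l) p ≡ f p
part-listOf f zero    pos bnd p = ≡.sym (ℕₚ.n≤0⇒n≡0 (ℕₚ.≮⇒≥ (λ 0<f → ℕₚ.n≮0 (bnd p 0<f))))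
part-listOf f (suc l) pos bnd zero    = ℕₚ.m+[n∸m]≡n (pos 0 (ℕ.s≤s ℕ.z≤n))
part-listOf f (suc l) pos bnd (suc p) = part-listOf (f ∘ suc) l (λ p p< → pos (suc p) (ℕ.s≤s p<)) (λ p f> → ℕ.s≤s⁻¹ (bnd (suc p) f>)) p

-- The number of (p, q, q) in the solid with q ≥ p; for p below the Durfee size this is one more than
-- the p-th arm of diag.
rowSize : ℕ → (ℕ → ℕ → ℕ) → ℕ → ℕ
rowSize m e p = runLength m (λ j → (p ℕ.+ j) ℕ.<ᵇ e p (p ℕ.+ j))

durfeeSize : ℕ → (ℕ → ℕ → ℕ) → ℕ
durfeeSize m e = runLength m (λ p → p ℕ.<ᵇ e p p)

arms legs : ℕ → (ℕ → ℕ → ℕ) → List ℕ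
arms m e = listOf (rowSize m e) (durfeeSize m e)
legs m e = listOf (λ p → e p p ℕ.∸ p) (durfeeSize m e)

module PlaneShape {m e} (π : Plane m e) where
  open Plane π

  rowSize-sound : ∀ p x → x ℕ.< rowSize m e p → p ℕ.+ x ℕ.< e p (p ℕ.+ x)
  rowSize-sound p x x< = <ᵇ-sound (proj₁ (runLength-sound m _ x x<))

  rowSize-complete : ∀ p x → p ℕ.+ x ℕ.< e p (p ℕ.+ x) → x ℕ.< rowSize m e p
  rowSize-complete p x h = runLength-complete m _ x
    (λ x′ x′≤x → <⇒<ᵇ-true (shrink ℕₚ.≤-refl (ℕₚ.+-monoʳ-≤ p x′≤x) (ℕₚ.+-monoʳ-≤ p x′≤x) h))
    (ℕₚ.≤-<-trans (ℕₚ.m≤n+m x p) (proj₂ (proj₂ (bound h))))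

  durfee-sound : ∀ p → p ℕ.< durfeeSize m e → p ℕ.< e p p
  durfee-sound p p< = <ᵇ-sound (proj₁ (runLength-sound m _ p p<))

  durfee-complete : ∀ p → p ℕ.< e p p → p ℕ.< durfeeSize m e
  durfee-complete p h = runLength-complete m _ p (λ p′ p′≤p → <⇒<ᵇ-true (shrink p′≤p p′≤p p′≤p h)) (proj₁ (bound h))

  part-arms : ∀ p → part (arms m e) p ≡ rowSize m e p
  part-arms = part-listOf (rowSize m e) (durfeeSize m e)
    (λ p p< → rowSize-complete p 0 (≡.subst (λ z → z ℕ.< e p z) (≡.sym (ℕₚ.+-identityʳ p)) (durfee-sound p p<)))
    (λ p n> → durfee-complete p (≡.subst (λ z → z ℕ.< e p z) (ℕₚ.+-identityʳ p) (rowSize-sound p 0 n>)))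

  part-legs : ∀ p → part (legs m e) p ≡ e p p ℕ.∸ p
  part-legs = part-listOf (λ p → e p p ℕ.∸ p) (durfeeSize m e)
    (λ p p< → ℕₚ.m<n⇒0<n∸m (durfee-sound p p<)) (λ p n> → durfee-complete p (≡.subst (ℕ._< e p p) (ℕₚ.+-identityʳ p) (∸-<⇒+-< p (e p p) 0 n>)))

  -- A point (p + 1, q, q) forces (p, q, q), which lies one step further along its row of the wall.
  arms-strict : Strict (arms m e)
  arms-strict p x x< rewrite part-arms p | part-arms (suc p) = rowSize-complete p (suc x)
    (≡.subst (λ z → z ℕ.< e p z) (≡.sym (ℕₚ.+-suc p x)) (shrink (ℕₚ.n≤1+n p) ℕₚ.≤-refl ℕₚ.≤-refl (rowSize-sound (suc p) x x<)))

-- reduce deletes the walls {(p, q, q) : p ≤ q} of the solid; extend puts back walls with given arms.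
reduceSolid : (ℕ → ℕ → ℕ) → ℕ → ℕ → ℕ → Bool
reduceSolid e p q r = suc r ℕ.<ᵇ e p q

reduce : ℕ → (ℕ → ℕ → ℕ) → ℕ → ℕ → ℕ
reduce m e = symmetrise m (reduceSolid e)

-- Sorted points off the wall have q < r; they are the old points with the largest coordinate raised
-- by one.
extendSolid : (ℕ → ℕ → ℕ) → List ℕ → ℕ → ℕ → ℕ → Bool
extendSolid e as p q r = if q ℕ.<ᵇ r then (r ℕ.∸ 1) ℕ.<ᵇ e p q else (q ℕ.∸ p) ℕ.<ᵇ part as p

extend : ℕ → (ℕ → ℕ → ℕ) → List ℕ → ℕ → ℕ → ℕ
extend m e as = symmetrise (suc m) (extendSolid e as)

module Reduce {m e} (π : Plane (suc m) e) where
  open Plane π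

  reduce-closed : DownClosed m (reduceSolid e)
  reduce-closed = record
    { down = λ p′≤ q′≤ r′≤ _ _ _ _ s → <⇒<ᵇ-true (shrink p′≤ q′≤ (ℕ.s≤s r′≤) (<ᵇ-sound s))
    ; inside = λ _ _ s → ℕ.s≤s⁻¹ (proj₂ (proj₂ (bound (<ᵇ-sound s)))) }

  open Symmetrise reduce-closed public
    renaming (symmetrise-plane to reduce-plane; sorted-sound to reduce-sound′; sorted-complete to reduce-complete′)
    using ()

  reduce-sound : ∀ {p q r} → p ℕ.≤ q → q ℕ.≤ r → r ℕ.< reduce m e p q → suc r ℕ.< e p q
  reduce-sound p≤q q≤r h = <ᵇ-sound (reduce-sound′ p≤q q≤r h)

  reduce-complete : ∀ {p q r} → p ℕ.≤ q → q ℕ.≤ r → suc r ℕ.< e p q → r ℕ.< reduce m e p q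
  reduce-complete p≤q q≤r h = reduce-complete′ p≤q q≤r (<⇒<ᵇ-true h)

  -- The reduced wall contains (p, q, q) exactly when the solid contains (p, q, q + 1). That point
  -- implies (p, q, q) and is implied by (p, q + 1, q + 1), whence the two bounds.
  arms-succeed : Succeeds (arms m (reduce m e)) (arms (suc m) e)
  arms-succeed = record
    { lower = λ p → ≡.subst₂ ℕ._≤_ (≡.sym (R′.part-arms p)) (≡.sym (R.part-arms p)) (≤-from-< (λ x x< →
        R.rowSize-complete p x (ℕₚ.<-trans (ℕₚ.n<1+n _) (reduce-sound (ℕₚ.m≤m+n p x) ℕₚ.≤-refl (R′.rowSize-sound p x x<)))))
    ; upper = λ p → ≡.subst₂ (λ a b → a ℕ.≤ suc b) (≡.sym (R.part-arms p)) (≡.sym (R′.part-arms p)) (≤-from-< (λ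
        { zero    _  → ℕ.s≤s ℕ.z≤n
        ; (suc x) x< → ℕ.s≤s (R′.rowSize-complete p x (reduce-complete (ℕₚ.m≤m+n p x) ℕₚ.≤-refl
            (shrink ℕₚ.≤-refl (ℕₚ.n≤1+n _) ℕₚ.≤-refl (≡.subst (λ z → z ℕ.< e p z) (ℕₚ.+-suc p x) (R.rowSize-sound p (suc x) x<))))) }))
    ; strict-parts = R.arms-strict }
    where
    module R = PlaneShape π
    module R′ = PlaneShape reduce-plane

module Extend {m e as} (π : Plane m e) (s : Succeeds (arms m e) as) where
  open Plane π
  open Succeeds s
  module E = PlaneShape π

  Wall : ℕ → ℕ → Set
  Wall p q = q ℕ.∸ p ℕ.< part as p

  wall-up : ∀ {p q} → p ℕ.< q → Wall (suc p) q → Wall p q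
  wall-up {p} {q} p<q h = ≡.subst (ℕ._< part as p) (≡.sym (ℕₚ.+-∸-assoc 1 p<q)) (strict-parts p (q ℕ.∸ suc p) h)

  wall-down : ∀ {p q p′ q′} → p′ ℕ.≤ p → q′ ℕ.≤ q → p ℕ.≤ q → Wall p q → Wall p′ q′
  wall-down {p} {q} {p′} {q′} p′≤p q′≤q p≤q h = ℕₚ.≤-<-trans (ℕₚ.∸-monoˡ-≤ p′ q′≤q) (climb p p′≤p p≤q h)
    where
    climb : ∀ p → p′ ℕ.≤ p → p ℕ.≤ q → Wall p q → Wall p′ q
    climb p p′≤p p≤q h with ℕₚ.m≤n⇒m<n∨m≡n p′≤p
    ... | inj₂ ≡.refl = h
    climb (suc p) p′≤p p≤q h | inj₁ (ℕ.s≤s p′≤) = climb p p′≤ (ℕₚ.<⇒≤ p≤q) (wall-up p≤q h)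

  -- The new wall overhangs the old one by at most one step, by `upper`; conversely it covers the
  -- old one, by `lower`, which is `solid-wall`.
  wall-solid : ∀ {p q} → p ℕ.≤ q → Wall p (suc q) → q ℕ.< e p q
  wall-solid {p} {q} p≤q h = ≡.subst (λ z → z ℕ.< e p z) (ℕₚ.m+[n∸m]≡n p≤q) (E.rowSize-sound p (q ℕ.∸ p)
    (≡.subst (q ℕ.∸ p ℕ.<_) (E.part-arms p) (ℕ.s≤s⁻¹ (ℕₚ.≤-trans (≡.subst (λ z → suc z ℕ.≤ part as p) (ℕₚ.+-∸-assoc 1 p≤q) h) (upper p)))))

  solid-wall : ∀ {p q} → p ℕ.≤ q → q ℕ.< e p q → Wall p q
  solid-wall {p} {q} p≤q h = ℕₚ.≤-trans (≡.subst (q ℕ.∸ p ℕ.<_) (≡.sym (E.part-arms p)) (E.rowSize-complete p (q ℕ.∸ p)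
    (≡.subst (λ z → z ℕ.< e p z) (≡.sym (ℕₚ.m+[n∸m]≡n p≤q)) h))) (lower p)

  -- the corner (q, q) of the wall can only be reached over (q - 1, q - 1, q - 1)
  corner-solid : ∀ {q} → Wall (suc q) (suc q) → q ℕ.< e q q
  corner-solid {q} h = wall-solid ℕₚ.≤-refl (wall-up ℕₚ.≤-refl h)

  wall-solid′ : ∀ {p q} → p ℕ.≤ suc q → Wall p (suc q) → ∃ λ p₀ → q ℕ.< e p₀ q × (p ℕ.≤ p₀ ⊎ p₀ ≡ q)
  wall-solid′ {p} {q} p≤ h with ℕₚ.m≤n⇒m<n∨m≡n p≤
  ... | inj₁ (ℕ.s≤s p≤q) = p , wall-solid p≤q h , inj₁ ℕₚ.≤-refl
  ... | inj₂ ≡.refl      = q , corner-solid h , inj₂ ≡.refl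

  data Cases (p q r : ℕ) : Set where
    inner : q ℕ.< r → r ℕ.∸ 1 ℕ.< e p q → Cases p q r
    wall  : r ℕ.≤ q → Wall p q → Cases p q r

  cases : ∀ {p q r} → extendSolid e as p q r ≡ true → Cases p q r
  cases {p} {q} {r} h with q ℕ.<ᵇ r in eq
  ... | true  = inner (<ᵇ-sound eq) (<ᵇ-sound h)
  ... | false = wall (ℕₚ.≮⇒≥ (λ q<r → true≢false (≡.trans (≡.sym (<⇒<ᵇ-true q<r)) eq))) (<ᵇ-sound h)
    where
    true≢false : true ≡ false → ⊥
    true≢false ()

  uncases : ∀ {p q r} → Cases p q r → extendSolid e as p q r ≡ true
  uncases (inner q<r h) rewrite <⇒<ᵇ-true q<r = <⇒<ᵇ-true h
  uncases (wall r≤q h) rewrite ≥⇒<ᵇ-false r≤q = <⇒<ᵇ-true h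

  -- Going down from an old point to the wall uses `solid-wall`, and from the wall to an old point
  -- `wall-solid′`. Its corner case, where the first coordinate is replaced by q, is harmless
  -- because p′ ≤ q′ stays below it.
  extend-down : ∀ {p q r p′ q′ r′} → p′ ℕ.≤ p → q′ ℕ.≤ q → r′ ℕ.≤ r → p′ ℕ.≤ q′ → q′ ℕ.≤ r′ → p ℕ.≤ q → q ℕ.≤ r →
    Cases p q r → Cases p′ q′ r′
  extend-down {p} {q} {r} {p′} {q′} {r′} p′≤p q′≤q r′≤r p′≤q′ q′≤r′ p≤q q≤r h with ℕₚ.m≤n⇒m<n∨m≡n q′≤r′ | h
  ... | inj₁ q′<r′ | inner q<r h′ = inner q′<r′ (shrink p′≤p q′≤q (ℕₚ.∸-monoˡ-≤ 1 r′≤r) h′)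
  ... | inj₂ ≡.refl | wall _ h′ = wall ℕₚ.≤-refl (wall-down p′≤p q′≤q p≤q h′)
  ... | inj₂ ≡.refl | inner q<r h′ = wall ℕₚ.≤-refl (wall-down p′≤p q′≤q p≤q (solid-wall p≤q (ℕₚ.≤-<-trans (ℕₚ.∸-monoˡ-≤ 1 q<r) h′)))
  extend-down {p} {suc q} {r} {p′} {q′} {suc r′} p′≤p q′≤q r′≤r p′≤q′ q′≤r′ p≤q q≤r h | inj₁ (ℕ.s≤s q′≤r′₀) | wall r≤q h′
    with p₀ , h₀ , rel ← wall-solid′ p≤q h′ = inner (ℕ.s≤s q′≤r′₀) (shrink (p′≤p₀ rel) (ℕₚ.≤-trans q′≤r′₀ r′≤q) r′≤q h₀)
    where
    r′≤q : r′ ℕ.≤ q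
    r′≤q = ℕ.s≤s⁻¹ (ℕₚ.≤-trans r′≤r r≤q)
    p′≤p₀ : ∀ {p₀} → p ℕ.≤ p₀ ⊎ p₀ ≡ q → p′ ℕ.≤ p₀
    p′≤p₀ (inj₁ p≤p₀) = ℕₚ.≤-trans p′≤p p≤p₀
    p′≤p₀ (inj₂ ≡.refl) = ℕₚ.≤-trans p′≤q′ (ℕₚ.≤-trans q′≤r′₀ r′≤q)
  extend-down {p} {zero} {r} {p′} {q′} {suc r′} p′≤p q′≤q r′≤r p′≤q′ q′≤r′ p≤q q≤r h | inj₁ q′<r′ | wall r≤q h′
    with () ← ℕₚ.≤-trans r′≤r r≤q

  extend-inside : ∀ {p q r} → p ℕ.≤ q → q ℕ.≤ r → Cases p q r → r ℕ.< suc m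
  extend-inside {r = suc r} p≤q q≤r (inner q<r h) = ℕ.s≤s (proj₂ (proj₂ (bound h)))
  extend-inside {q = zero} p≤q q≤r (wall r≤q h) = ℕ.s≤s (ℕₚ.≤-trans r≤q ℕ.z≤n)
  extend-inside {q = suc q} p≤q q≤r (wall r≤q h) with p₀ , h₀ , _ ← wall-solid′ p≤q h =
    ℕ.s≤s (ℕₚ.≤-trans r≤q (proj₁ (proj₂ (bound h₀))))

  extend-closed : DownClosed (suc m) (extendSolid e as)
  extend-closed = record
    { down = λ a b c d f g h s → uncases (extend-down a b c d f g h (cases s))
    ; inside = λ a b s → extend-inside a b (cases s) }

  open Symmetrise extend-closed public
    renaming (symmetrise-plane to extend-plane; sorted-sound to extend-sound′; sorted-complete to extend-complete′)
    using ()

  extend-sound : ∀ {p q r} → p ℕ.≤ q → q ℕ.≤ r → r ℕ.< extend m e as p q → Cases p q r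
  extend-sound p≤q q≤r h = cases (extend-sound′ p≤q q≤r h)

  extend-complete : ∀ {p q r} → p ℕ.≤ q → q ℕ.≤ r → Cases p q r → r ℕ.< extend m e as p q
  extend-complete p≤q q≤r h = extend-complete′ p≤q q≤r (uncases h)

  module X = PlaneShape extend-plane

  reduce-extend : ∀ i j → reduce m (extend m e as) i j ≡ e i j
  reduce-extend = Plane-≡ R.reduce-plane π
    (λ p q r p≤q q≤r h → unwall q≤r (extend-sound p≤q (ℕₚ.m≤n⇒m≤1+n q≤r) (R.reduce-sound p≤q q≤r h)))
    (λ p q r p≤q q≤r h → R.reduce-complete p≤q q≤r (extend-complete p≤q (ℕₚ.m≤n⇒m≤1+n q≤r) (inner (ℕ.s≤s q≤r) h)))
    where
    module R = Reduce extend-plane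
    unwall : ∀ {p q r} → q ℕ.≤ r → Cases p q (suc r) → r ℕ.< e p q
    unwall q≤r (inner _ h) = h
    unwall q≤r (wall r<q _) = ⊥-elim (ℕₚ.<-irrefl ≡.refl (ℕₚ.≤-trans r<q q≤r))

  diagonal-wall : ∀ {p q} → Cases p q q → Wall p q
  diagonal-wall (inner q<q _) = ⊥-elim (ℕₚ.<-irrefl ≡.refl q<q)
  diagonal-wall (wall _ h)    = h

  arms-extend : arms (suc m) (extend m e as) ≡ as
  arms-extend = part-injective _ as (λ p → ≡.trans (X.part-arms p) (≡-from-<
    (λ x x< → ≡.subst (ℕ._< part as p) (ℕₚ.m+n∸m≡n p x) (diagonal-wall (extend-sound (ℕₚ.m≤m+n p x) ℕₚ.≤-refl (X.rowSize-sound p x x<))))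
    (λ x x< → X.rowSize-complete p x (extend-complete (ℕₚ.m≤m+n p x) ℕₚ.≤-refl
      (wall ℕₚ.≤-refl (≡.subst (ℕ._< part as p) (≡.sym (ℕₚ.m+n∸m≡n p x)) x<))))))

  -- The points (p, p, r) with r ≥ p move up by one, and the corner (p, p, p) is supplied by the
  -- wall whenever it has a p-th row. So old legs grow by one and a new leg is 0.
  part-legs-extend : ∀ p → part (legs (suc m) (extend m e as)) p ≡ (if 0 ℕ.<ᵇ part as p then suc (part (legs m e) p) else 0)
  part-legs-extend p = ≡.trans (X.part-legs p) (≡.trans (≡-from-< to from) (≡.cong (λ z → if 0 ℕ.<ᵇ part as p then suc z else 0) (≡.sym (E.part-legs p))))
    where
    leg = if 0 ℕ.<ᵇ part as p then suc (e p p ℕ.∸ p) else 0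
    0∸ : ∀ p → p ℕ.∸ p ≡ 0
    0∸ = ℕₚ.n∸n≡0
    to : ∀ x → x ℕ.< extend m e as p p ℕ.∸ p → x ℕ.< leg
    to x x< = go x (extend-sound ℕₚ.≤-refl (ℕₚ.m≤m+n p x) (∸-<⇒+-< p _ x x<)) (extend-sound ℕₚ.≤-refl ℕₚ.≤-refl
      (Plane.shrink extend-plane ℕₚ.≤-refl ℕₚ.≤-refl (ℕₚ.m≤m+n p x) (∸-<⇒+-< p _ x x<)))
      where
      go : ∀ x → Cases p p (p ℕ.+ x) → Cases p p p → x ℕ.< leg
      go zero    h h₀ rewrite <⇒<ᵇ-true (≡.subst (ℕ._< part as p) (0∸ p) (diagonal-wall h₀)) = ℕ.s≤s ℕ.z≤n
      go (suc x) (wall le _) h₀ = ⊥-elim (ℕₚ.<-irrefl ≡.refl (ℕₚ.≤-trans (ℕₚ.m<m+n p (ℕ.s≤s ℕ.z≤n)) le))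
      go (suc x) (inner _ h) h₀ rewrite <⇒<ᵇ-true (≡.subst (ℕ._< part as p) (0∸ p) (diagonal-wall h₀)) | ℕₚ.+-suc p x =
        ℕ.s≤s (+-<⇒∸-< p _ x h)
    from : ∀ x → x ℕ.< leg → x ℕ.< extend m e as p p ℕ.∸ p
    from x x< with 0 ℕ.<ᵇ part as p in eq
    from zero x< | true = +-<⇒∸-< p _ 0 (extend-complete ℕₚ.≤-refl (ℕₚ.m≤m+n p 0) (≡.subst (Cases p p) (≡.sym (ℕₚ.+-identityʳ p))
      (wall ℕₚ.≤-refl (≡.subst (ℕ._< part as p) (≡.sym (0∸ p)) (<ᵇ-sound eq)))))
    from (suc x) (ℕ.s≤s x<) | true = +-<⇒∸-< p _ (suc x) (extend-complete ℕₚ.≤-refl (ℕₚ.m≤m+n p (suc x))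
      (≡.subst (Cases p p) (≡.sym (ℕₚ.+-suc p x)) (inner (ℕ.s≤s (ℕₚ.m≤m+n p x)) (∸-<⇒+-< p _ x x<))))

extend-reduce : ∀ {m e} (π : Plane (suc m) e) → ∀ i j → extend m (reduce m e) (arms (suc m) e) i j ≡ e i j
extend-reduce {m} {e} π = Plane-≡ X.extend-plane π
  (λ p q r p≤q q≤r h → to p≤q (X.extend-sound p≤q q≤r h) q≤r)
  (λ p q r p≤q q≤r h → X.extend-complete p≤q q≤r (from p≤q q≤r h))
  where
  module R = Reduce π
  module X = Extend R.reduce-plane R.arms-succeed
  module P = PlaneShape π
  to : ∀ {p q r} → p ℕ.≤ q → X.Cases p q r → q ℕ.≤ r → r ℕ.< e p q
  to {r = suc r} p≤q (X.inner (ℕ.s≤s q≤r) h) _ = R.reduce-sound p≤q q≤r h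
  to {p} {q} p≤q (X.wall r≤q h) q≤r with ≡.refl ← ℕₚ.≤-antisym r≤q q≤r =
    ≡.subst (λ z → z ℕ.< e p z) (ℕₚ.m+[n∸m]≡n p≤q) (P.rowSize-sound p (q ℕ.∸ p) (≡.subst (q ℕ.∸ p ℕ.<_) (P.part-arms p) h))
  from : ∀ {p q r} → p ℕ.≤ q → q ℕ.≤ r → r ℕ.< e p q → X.Cases p q r
  from {p} {q} {r} p≤q q≤r h with ℕₚ.m≤n⇒m<n∨m≡n q≤r
  from {p} {q} {suc r} p≤q q≤r h | inj₁ (ℕ.s≤s q≤r′) = X.inner (ℕ.s≤s q≤r′) (R.reduce-complete p≤q q≤r′ h)
  ... | inj₂ ≡.refl = X.wall ℕₚ.≤-refl (≡.subst (q ℕ.∸ p ℕ.<_) (≡.sym (P.part-arms p)) (P.rowSize-complete p (q ℕ.∸ p)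
    (≡.subst (λ z → z ℕ.< e p z) (≡.sym (ℕₚ.m+[n∸m]≡n p≤q)) h)))

runLength-cong : ∀ M {P Q : ℕ → Bool} → (∀ c → P c ≡ Q c) → runLength M P ≡ runLength M Q
runLength-cong zero    e = ≡.refl
runLength-cong (suc M) e = ≡.cong₂ (λ b n → if b then suc n else 0) (e 0) (runLength-cong M (e ∘ suc))

applyUpTo-cong : ∀ {a} {X : Set a} n {f g : ℕ → X} → (∀ i → i ℕ.< n → f i ≡ g i) → applyUpTo f n ≡ applyUpTo g n
applyUpTo-cong zero    e = ≡.refl
applyUpTo-cong (suc n) e = ≡.cong₂ _∷_ (e 0 (ℕ.s≤s ℕ.z≤n)) (applyUpTo-cong n (λ i i< → e (suc i) (ℕ.s≤s i<)))

map-upTo : ∀ {a} {X : Set a} (f : ℕ → X) n → map f (upTo n) ≡ applyUpTo f n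
map-upTo = Listₚ.map-applyUpTo id

map-range : ∀ {a} {X : Set a} (f : ℕ → X) n → map f (range n) ≡ applyUpTo (f ∘ suc) n
map-range f n = ≡.trans (≡.sym (Listₚ.map-∘ (upTo n))) (map-upTo (f ∘ suc) n)

arms-cong : ∀ m {e f : ℕ → ℕ → ℕ} → (∀ i j → e i j ≡ f i j) → arms m e ≡ arms m f
arms-cong m {e} eq = ≡.trans
  (≡.cong (listOf (rowSize m e)) (runLength-cong m (λ p → ≡.cong (p ℕ.<ᵇ_) (eq p p))))
  (applyUpTo-cong _ (λ p _ → ≡.cong (ℕ._∸ 1) (runLength-cong m (λ j → ≡.cong (_ ℕ.<ᵇ_) (eq p (p ℕ.+ j))))))

legs-cong : ∀ m {e f : ℕ → ℕ → ℕ} → (∀ i j → e i j ≡ f i j) → legs m e ≡ legs m f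
legs-cong m {e} eq = ≡.trans
  (≡.cong (listOf (λ p → e p p ℕ.∸ p)) (runLength-cong m (λ p → ≡.cong (p ℕ.<ᵇ_) (eq p p))))
  (applyUpTo-cong _ (λ p _ → ≡.cong (λ z → z ℕ.∸ p ℕ.∸ 1) (eq p p)))

reduce-cong : ∀ m {e f : ℕ → ℕ → ℕ} → (∀ i j → e i j ≡ f i j) → ∀ i j → reduce m e i j ≡ reduce m f i j
reduce-cong m eq i j = runLength-cong m (λ c → ≡.cong (_ ℕ.<ᵇ_) (eq (lo i j c) (mid i j c)))

extend-cong : ∀ m as {e f : ℕ → ℕ → ℕ} → (∀ i j → e i j ≡ f i j) → ∀ i j → extend m e as i j ≡ extend m f as i j
extend-cong m as eq i j = runLength-cong (suc m) (λ c → ≡.cong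
  (λ z → if mid i j c ℕ.<ᵇ hi i j c then (hi i j c ℕ.∸ 1) ℕ.<ᵇ z else (mid i j c ℕ.∸ lo i j c) ℕ.<ᵇ part as (lo i j c)) (eq (lo i j c) (mid i j c)))

-- Between arrays of the list `TSPP` and symmetric solids.

at-applyUpTo : ∀ {a} {X : Set a} (d : X) f m i → i ℕ.< m → at d (applyUpTo f m) (suc i) ≡ f i
at-applyUpTo d f (suc m) zero    i<         = ≡.refl
at-applyUpTo d f (suc m) (suc i) (ℕ.s≤s i<) = at-applyUpTo d (f ∘ suc) m i i<

at-beyond : ∀ {a} {X : Set a} (d : X) xs i → length xs ℕ.≤ i → at d xs (suc i) ≡ d
at-beyond d []       i       le         = ≡.refl
at-beyond d (x ∷ xs) (suc i) (ℕ.s≤s le) = at-beyond d xs i le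

applyUpTo-at : ∀ {a} {X : Set a} (d : X) xs → applyUpTo (λ i → at d xs (suc i)) (length xs) ≡ xs
applyUpTo-at d []       = ≡.refl
applyUpTo-at d (x ∷ xs) = ≡.cong (x ∷_) (applyUpTo-at d xs)

ent : List (List ℕ) → ℕ → ℕ → ℕ
ent T i j = entry T (suc i) (suc j)

mat : ℕ → (ℕ → ℕ → ℕ) → List (List ℕ)
mat m e = applyUpTo (λ i → applyUpTo (e i) m) m

mat-cong : ∀ m {e f : ℕ → ℕ → ℕ} → (∀ i j → e i j ≡ f i j) → mat m e ≡ mat m f
mat-cong m eq = applyUpTo-cong m (λ i _ → applyUpTo-cong m (λ j _ → eq i j))

ent-mat : ∀ {m e} → Plane m e → ∀ i j → ent (mat m e) i j ≡ e i j
ent-mat {m} {e} π i j with i ℕₚ.<? m | j ℕₚ.<? m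
... | yes i<m | yes j<m = ≡.trans (≡.cong (λ r → at 0 r (suc j)) (at-applyUpTo [] _ m i i<m)) (at-applyUpTo 0 (e i) m j j<m)
... | no ¬i<m | _ = ≡.trans
  (≡.cong (λ r → at 0 r (suc j)) (at-beyond [] (mat m e) i (ℕₚ.≤-trans (ℕₚ.≤-reflexive (Listₚ.length-applyUpTo _ m)) (ℕₚ.≮⇒≥ ¬i<m))))
  (≡.sym (ℕₚ.n≤0⇒n≡0 (ℕₚ.≮⇒≥ (λ 0<e → ¬i<m (proj₁ (Plane.bound π 0<e))))))
... | yes i<m | no ¬j<m = ≡.trans (≡.cong (λ r → at 0 r (suc j)) (at-applyUpTo [] _ m i i<m)) (≡.trans
  (at-beyond 0 (applyUpTo (e i) m) j (ℕₚ.≤-trans (ℕₚ.≤-reflexive (Listₚ.length-applyUpTo _ m)) (ℕₚ.≮⇒≥ ¬j<m)))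
  (≡.sym (ℕₚ.n≤0⇒n≡0 (ℕₚ.≮⇒≥ (λ 0<e → ¬j<m (proj₁ (proj₂ (Plane.bound π 0<e))))))))

∧-trueˡ : ∀ {a b} → (a ∧ b) ≡ true → a ≡ true
∧-trueˡ {true} _ = ≡.refl

∧-trueʳ : ∀ {a b} → (a ∧ b) ≡ true → b ≡ true
∧-trueʳ {true} eq = eq

∧-true : ∀ {a b} → a ≡ true → b ≡ true → (a ∧ b) ≡ true
∧-true ≡.refl ≡.refl = ≡.refl

all-elim : ∀ {a} {X : Set a} (p : X → Bool) xs → all p xs ≡ true → ∀ {x} → x ∈ xs → p x ≡ true
all-elim p (y ∷ xs) eq (here ≡.refl) = ∧-trueˡ eq
all-elim p (y ∷ xs) eq (there x∈)    = all-elim p xs (∧-trueʳ {p y} eq) x∈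

∈-range⁺ : ∀ {i m} → i ℕ.< m → suc i ∈ range m
∈-range⁺ i<m = ∈-map⁺ suc (∈-upTo⁺ i<m)

at-All : ∀ {b} row j → All (ℕ._≤ b) row → at 0 row (suc j) ℕ.≤ b
at-All []        j       []       = ℕ.z≤n
at-All (x ∷ row) zero    (x≤ ∷ _) = x≤
at-All (x ∷ row) (suc j) (_ ∷ a)  = at-All row j a

at-rows : ∀ {P : List ℕ → Set} T i → P [] → All P T → P (at [] T (suc i))
at-rows []      i       p[] []      = p[]
at-rows (r ∷ T) zero    p[] (p ∷ _) = p
at-rows (r ∷ T) (suc i) p[] (_ ∷ a) = at-rows T i p[] a

module _ {m : ℕ} {T : List (List ℕ)} (T∈ : T ∈ TSPP m) where
  private
    T∈words = proj₁ (∈-filterᵇ⁻ (isTSPP m) (words m (words m (upTo (suc m)))) T∈)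
    len = proj₁ (words-∈ m _ T T∈words)
    rows∈ : All (λ r → length r ≡ m × All (ℕ._≤ m) r) T
    rows∈ = All.map (λ r∈ → let l , a = words-∈ m (upTo (suc m)) _ r∈ in l , All.map (λ x∈ → ℕ.s≤s⁻¹ (∈-upTo⁻ x∈)) a)
      (proj₂ (words-∈ m _ T T∈words))
    symmetric = ∧-trueʳ {all weaklyDec (columns 0 m T)} (∧-trueʳ {all weaklyDec T} (∧-trueʳ {all (all (λ e → e ℕ.≤ᵇ m)) T}
      (∧-trueʳ {all (λ r → length r ℕ.≡ᵇ m) T} (∧-trueʳ {length T ℕ.≡ᵇ m} (proj₂ (∈-filterᵇ⁻ (isTSPP m) (words m (words m (upTo (suc m)))) T∈))))))

    ent-≤ : ∀ i j → ent T i j ℕ.≤ m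
    ent-≤ i j = at-All _ j (at-rows {λ r → All (ℕ._≤ m) r} T i [] (All.map proj₂ rows∈))

    ent-bound : ∀ {i j c} → c ℕ.< ent T i j → i ℕ.< m × j ℕ.< m × c ℕ.< m
    ent-bound {i} {j} {c} c< = i<m , j<m , ℕₚ.≤-trans c< (ent-≤ i j)
      where
      i<m : i ℕ.< m
      i<m with i ℕₚ.<? m
      ... | yes h = h
      ... | no ¬h = ⊥-elim (ℕₚ.n≮0 (≡.subst (λ r → c ℕ.< at 0 r (suc j)) (at-beyond [] T i (≡.subst (ℕ._≤ i) (≡.sym len) (ℕₚ.≮⇒≥ ¬h))) c<))
      j<m : j ℕ.< m
      j<m with j ℕₚ.<? m
      ... | yes h = h
      ... | no ¬h = ⊥-elim (ℕₚ.n≮0 (≡.subst (c ℕ.<_) (at-beyond 0 (at [] T (suc i)) j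
        (at-rows {λ r → length r ℕ.≤ j} T i ℕ.z≤n (All.map (λ lr → ≡.subst (ℕ._≤ j) (≡.sym (proj₁ lr)) (ℕₚ.≮⇒≥ ¬h)) rows∈))) c<))

    implies : ∀ {a b} → (not a ∨ (a ∧ b)) ≡ true → a ≡ true → b ≡ true
    implies eq ≡.refl = eq

    -- The two transpositions of neighbouring coordinates, which generate all permutations.
    images : ∀ {i j c} → c ℕ.< ent T i j → c ℕ.< ent T j i × j ℕ.< ent T i c
    images {i} {j} {c} c< = <ᵇ-sound (∧-trueˡ (∧-trueʳ {inSolid T (suc i) (suc c) (suc j)} six)) , <ᵇ-sound (∧-trueˡ six)
      where
      b = ent-bound c<
      six = implies {a = inSolid T (suc i) (suc j) (suc c)}
        (all-elim _ (range m) (all-elim _ (range m) (all-elim _ (range m) symmetric (∈-range⁺ (proj₁ b))) (∈-range⁺ (proj₁ (proj₂ b)))) (∈-range⁺ (proj₂ (proj₂ b))))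
        (<⇒<ᵇ-true c<)

  TSPP-plane : Plane m (ent T)
  TSPP-plane = record { bound = ent-bound ; swap₁₂ = proj₁ ∘ images ; swap₂₃ = proj₂ ∘ images }

  TSPP-mat : T ≡ mat m (ent T)
  TSPP-mat = ≡.sym (≡.trans (applyUpTo-cong m (λ i i<m → ≡.trans (≡.cong (applyUpTo (ent T i))
      (≡.sym (row-length T rows∈ i (≡.subst (i ℕ.<_) (≡.sym len) i<m)))) (applyUpTo-at 0 (at [] T (suc i)))))
    (≡.trans (≡.cong (applyUpTo _) (≡.sym len)) (applyUpTo-at [] T)))
    where
    row-length : ∀ T → All (λ r → length r ≡ m × All (ℕ._≤ m) r) T → ∀ i → i ℕ.< length T → length (at [] T (suc i)) ≡ m
    row-length (r ∷ T) (lr ∷ _) zero    _          = proj₁ lr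
    row-length (r ∷ T) (_ ∷ a)  (suc i) (ℕ.s≤s i<) = row-length T a i i<

∈-concatMap⁺ : ∀ {a b} {X : Set a} {Y : Set b} (h : X → List Y) xs {x y} → x ∈ xs → y ∈ h x → y ∈ concatMap h xs
∈-concatMap⁺ h (x ∷ xs) (here ≡.refl) y∈ = ∈-++⁺ˡ y∈
∈-concatMap⁺ h (x ∷ xs) (there x∈)    y∈ = ∈-++⁺ʳ (h x) (∈-concatMap⁺ h xs x∈ y∈)

words-∈⁺ : ∀ {a} {X : Set a} (as : List X) w → All (_∈ as) w → w ∈ words (length w) as
words-∈⁺ as []      []       = here ≡.refl
words-∈⁺ as (x ∷ w) (x∈ ∷ a) = ∈-concatMap⁺ (λ x → map (x ∷_) (words (length w) as)) as x∈ (∈-map⁺ (x ∷_) (words-∈⁺ as w a))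

All-applyUpTo : ∀ {a} {X : Set a} {P : X → Set} f n → (∀ i → i ℕ.< n → P (f i)) → All P (applyUpTo f n)
All-applyUpTo f zero    p = []
All-applyUpTo f (suc n) p = p 0 (ℕ.s≤s ℕ.z≤n) ∷ All-applyUpTo (f ∘ suc) n (λ i i< → p (suc i) (ℕ.s≤s i<))

weaklyDec-applyUpTo : ∀ f n → (∀ i → f (suc i) ℕ.≤ f i) → weaklyDec (applyUpTo f n) ≡ true
weaklyDec-applyUpTo f zero          dec = ≡.refl
weaklyDec-applyUpTo f (suc zero)    dec = ≡.refl
weaklyDec-applyUpTo f (suc (suc n)) dec = ∧-true (≤⇒≤ᵇ-true (dec 0)) (weaklyDec-applyUpTo (f ∘ suc) (suc n) (dec ∘ suc))

module _ {m : ℕ} {e : ℕ → ℕ → ℕ} (π : Plane m e) where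
  open Plane π

  private
    e-≤ : ∀ i j → e i j ℕ.≤ m
    e-≤ i j = ≤-from-< (λ x x< → proj₂ (proj₂ (bound x<)))

    column : ∀ j → j ∈ range m → weaklyDec (map (λ row → at 0 row j) (mat m e)) ≡ true
    column j j∈ with k , k∈ , ≡.refl ← ∈-map⁻ suc j∈ = ≡.trans
      (≡.cong weaklyDec (≡.trans (Listₚ.map-applyUpTo (λ i → applyUpTo (e i) m) (λ row → at 0 row (suc k)) m)
        (applyUpTo-cong m (λ i _ → at-applyUpTo 0 (e i) m k (∈-upTo⁻ k∈)))))
      (weaklyDec-applyUpTo (λ i → e i k) m (λ i → ≤-from-< (λ x → shrink (ℕₚ.n≤1+n i) ℕₚ.≤-refl ℕₚ.≤-refl)))

    solid : ∀ i j c → i ∈ range m → j ∈ range m → c ∈ range m →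
      (not (inSolid (mat m e) i j c) ∨ (inSolid (mat m e) i j c ∧ inSolid (mat m e) i c j ∧ inSolid (mat m e) j i c
         ∧ inSolid (mat m e) j c i ∧ inSolid (mat m e) c i j ∧ inSolid (mat m e) c j i)) ≡ true
    solid i j c i∈ j∈ c∈ with i′ , _ , ≡.refl ← ∈-map⁻ suc i∈ | j′ , _ , ≡.refl ← ∈-map⁻ suc j∈ | c′ , _ , ≡.refl ← ∈-map⁻ suc c∈
      with c′ ℕ.<ᵇ ent (mat m e) i′ j′ in eq
    ... | false = ≡.refl
    ... | true  = ∧-true (S i′ c′ j′ (swap₂₃ h)) (∧-true (S j′ i′ c′ (swap₁₂ h)) (∧-true (S j′ c′ i′ (swap₂₃ (swap₁₂ h)))
      (∧-true (S c′ i′ j′ (swap₁₂ (swap₂₃ h))) (S c′ j′ i′ (swap₂₃ (swap₁₂ (swap₂₃ h)))))))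
      where
      h : c′ ℕ.< e i′ j′
      h = ≡.subst (c′ ℕ.<_) (ent-mat π i′ j′) (<ᵇ-sound eq)
      S : ∀ i j c → c ℕ.< e i j → (c ℕ.<ᵇ ent (mat m e) i j) ≡ true
      S i j c c< = <⇒<ᵇ-true (≡.subst (c ℕ.<_) (≡.sym (ent-mat π i j)) c<)

  mat-TSPP : mat m e ∈ TSPP m
  mat-TSPP = ∈-filterᵇ⁺ (isTSPP m) _ in-words
    (∧-true (≡ᵇ-true (Listₚ.length-applyUpTo _ m)) (∧-true lengths (∧-true entries (∧-true rows-dec (∧-true columns-dec symmetric)))))
    where
    lengths = all-true (λ r → length r ℕ.≡ᵇ m) (mat m e) (All-applyUpTo _ m (λ i _ → ≡ᵇ-true (Listₚ.length-applyUpTo (e i) m)))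
    entries = all-true (all (λ x → x ℕ.≤ᵇ m)) (mat m e)
      (All-applyUpTo _ m (λ i _ → all-true _ _ (All-applyUpTo (e i) m (λ j _ → ≤⇒≤ᵇ-true (e-≤ i j)))))
    rows-dec = all-true weaklyDec (mat m e)
      (All-applyUpTo _ m (λ i _ → weaklyDec-applyUpTo (e i) m (λ j → ≤-from-< (λ x → shrink ℕₚ.≤-refl (ℕₚ.n≤1+n j) ℕₚ.≤-refl))))
    columns-dec = all-true weaklyDec (columns 0 m (mat m e)) (≡.subst (All (λ r → weaklyDec r ≡ true))
      (≡.sym (map-range (λ j → map (λ row → at 0 row j) (mat m e)) m)) (All-applyUpTo _ m (λ j j< → column (suc j) (∈-range⁺ j<))))
    symmetric = all-true _ (range m) (All.tabulate (λ {i} i∈ → all-true _ (range m) (All.tabulate (λ {j} j∈ →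
      all-true _ (range m) (All.tabulate (λ {c} c∈ → solid i j c i∈ j∈ c∈))))))
    in-words : mat m e ∈ words m (words m (upTo (suc m)))
    in-words = ≡.subst (λ k → mat m e ∈ words k (words m (upTo (suc m)))) (Listₚ.length-applyUpTo _ m)
      (words-∈⁺ _ (mat m e) (All-applyUpTo _ m (λ i _ → ≡.subst (λ k → applyUpTo (e i) m ∈ words k (upTo (suc m))) (Listₚ.length-applyUpTo (e i) m)
        (words-∈⁺ _ _ (All-applyUpTo (e i) m (λ j _ → ∈-upTo⁺ (ℕ.s≤s (e-≤ i j))))))))

-- Recursive enumeration of totally symmetric plane partitions.

unique-concatMap : ∀ {a b} {X : Set a} {Y : Set b} (h : X → List Y) (ρ : Y → X) xs → Unique xs →
  (∀ x → x ∈ xs → Unique (h x)) → (∀ x y → x ∈ xs → y ∈ h x → ρ y ≡ x) → Unique (concatMap h xs)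
unique-concatMap h ρ []       _        uh ret = []
unique-concatMap h ρ (x ∷ xs) (x∉ ∷ u) uh ret = Uniqueₚ.++⁺ (uh x (here ≡.refl))
  (unique-concatMap h ρ xs u (λ z z∈ → uh z (there z∈)) (λ z y z∈ → ret z y (there z∈)))
  (λ { (y∈ , y∈′) → let z , z∈ , y∈hz = concatMap-∈ h xs y∈′ in
       All.lookup x∉ z∈ (≡.trans (≡.sym (ret x _ (here ≡.refl) y∈)) (ret z _ (there z∈) y∈hz)) })

unique-map : ∀ {a b} {X : Set a} {Y : Set b} (h : X → Y) (ρ : Y → X) xs → Unique xs →
  (∀ x → x ∈ xs → ρ (h x) ≡ x) → Unique (map h xs)
unique-map h ρ xs u ret = ≡.subst Unique (concatMap-[_] xs) (unique-concatMap (λ x → h x ∷ []) ρ xs u (λ _ _ → [] ∷ [])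
  (λ { x y x∈ (here ≡.refl) → ret x x∈ }))
  where
  concatMap-[_] : ∀ xs → concatMap (λ x → h x ∷ []) xs ≡ map h xs
  concatMap-[ [] ]     = ≡.refl
  concatMap-[ x ∷ xs ] = ≡.cong (h x ∷_) (concatMap-[ xs ])

unique-words : ∀ {a} {X : Set a} k (as : List X) → Unique as → Unique (words k as)
unique-words zero    as       u = [] ∷ []
unique-words (suc k) []       u = []
unique-words (suc k) (a ∷ as) u = unique-concatMap (λ x → map (x ∷_) (words k (a ∷ as))) (λ w → at a w 1) (a ∷ as) u
  (λ x x∈ → Uniqueₚ.map⁺ (λ { ≡.refl → ≡.refl }) (unique-words k (a ∷ as) u))
  (λ x y x∈ y∈ → ≡.cong (λ w → at a w 1) (proj₂ (proj₂ (∈-map⁻ (x ∷_) y∈))))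

unique-TSPP : ∀ m → Unique (TSPP m)
unique-TSPP m = Uniqueₚ.filter⁺ (λ T → T? (isTSPP m T)) (unique-words m _ (unique-words m _ (Uniqueₚ.upTo⁺ (suc m))))

unique-armSuccessors : ∀ as → Unique (armSuccessors as)
unique-armSuccessors []       = ((λ ()) ∷ []) ∷ [] ∷ []
unique-armSuccessors (a ∷ as) = Uniqueₚ.++⁺
  (Uniqueₚ.map⁺ (λ { ≡.refl → ≡.refl }) (Uniqueₚ.filter⁺ (λ bs → T? (headBelow a bs)) (unique-armSuccessors as)))
  (Uniqueₚ.map⁺ (λ { ≡.refl → ≡.refl }) (unique-armSuccessors as))
  (λ { (bs∈₁ , bs∈₂) → heads (∈-map⁻ (a ∷_) bs∈₁) (∈-map⁻ (suc a ∷_) bs∈₂) })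
  where
  heads : ∀ {bs xs ys} → (∃ λ z → z ∈ xs × bs ≡ a ∷ z) → (∃ λ z → z ∈ ys × bs ≡ suc a ∷ z) → ⊥
  heads (_ , _ , ≡.refl) (_ , _ , ())

extendMatrix : ℕ → List (List ℕ) → List ℕ → List (List ℕ)
extendMatrix m T as = mat (suc m) (extend m (ent T) as)

reduceMatrix : ℕ → List (List ℕ) → List (List ℕ)
reduceMatrix m T = mat m (reduce m (ent T))

module _ (m : ℕ) where
  module _ {T : List (List ℕ)} (T∈ : T ∈ TSPP m) {as : List ℕ} (as∈ : as ∈ armSuccessors (arms m (ent T))) where
    private
      π : Plane m (ent T)
      π = TSPP-plane T∈
      module X = Extend π (armSuccessors-sound (arms m (ent T)) as (PlaneShape.arms-strict π) as∈)

    ent-extendMatrix : ∀ i j → ent (extendMatrix m T as) i j ≡ extend m (ent T) as i j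
    ent-extendMatrix = ent-mat X.extend-plane

    extendMatrix-TSPP : extendMatrix m T as ∈ TSPP (suc m)
    extendMatrix-TSPP = mat-TSPP X.extend-plane

    reduceMatrix-extendMatrix : reduceMatrix m (extendMatrix m T as) ≡ T
    reduceMatrix-extendMatrix = ≡.trans
      (mat-cong m (λ i j → ≡.trans (reduce-cong m ent-extendMatrix i j) (X.reduce-extend i j))) (≡.sym (TSPP-mat T∈))

    arms-extendMatrix : arms (suc m) (ent (extendMatrix m T as)) ≡ as
    arms-extendMatrix = ≡.trans (arms-cong (suc m) ent-extendMatrix) X.arms-extend

    part-legs-extendMatrix : ∀ p → part (legs (suc m) (ent (extendMatrix m T as))) p ≡ (if 0 ℕ.<ᵇ part as p then suc (part (legs m (ent T)) p) else 0)
    part-legs-extendMatrix p = ≡.trans (≡.cong (λ bs → part bs p) (legs-cong (suc m) ent-extendMatrix)) (X.part-legs-extend p)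

  module _ {T : List (List ℕ)} (T∈ : T ∈ TSPP (suc m)) where
    private
      π : Plane (suc m) (ent T)
      π = TSPP-plane T∈
      module Rd = Reduce π

    reduceMatrix-TSPP : reduceMatrix m T ∈ TSPP m
    reduceMatrix-TSPP = mat-TSPP Rd.reduce-plane

    arms-∈ : arms (suc m) (ent T) ∈ armSuccessors (arms m (ent (reduceMatrix m T)))
    arms-∈ = ≡.subst (λ as → arms (suc m) (ent T) ∈ armSuccessors as) (arms-cong m (λ i j → ≡.sym (ent-mat Rd.reduce-plane i j)))
      (armSuccessors-complete _ _ Rd.arms-succeed)

    extendMatrix-reduceMatrix : extendMatrix m (reduceMatrix m T) (arms (suc m) (ent T)) ≡ T
    extendMatrix-reduceMatrix = ≡.trans
      (mat-cong (suc m) (λ i j → ≡.trans (extend-cong m (arms (suc m) (ent T)) (ent-mat Rd.reduce-plane) i j) (extend-reduce π i j)))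
      (≡.sym (TSPP-mat T∈))

extensions : ℕ → List (List ℕ) → List (List (List ℕ))
extensions m T = map (extendMatrix m T) (armSuccessors (arms m (ent T)))

-- Both lists are free of repetitions and have the same elements: `extendMatrix` is inverted by
-- taking `reduceMatrix` together with the arms.
TSPP-suc-↭ : ∀ m → TSPP (suc m) ↭ concatMap (extensions m) (TSPP m)
TSPP-suc-↭ m = ∼bag⇒↭ (unique∧set⇒bag (unique-TSPP (suc m))
  (unique-concatMap (extensions m) (reduceMatrix m) (TSPP m) (unique-TSPP m)
    (λ T T∈ → unique-map (extendMatrix m T) (λ U → arms (suc m) (ent U)) (armSuccessors (arms m (ent T))) (unique-armSuccessors (arms m (ent T))) (λ as as∈ → arms-extendMatrix m T∈ as∈))
    (λ T U T∈ U∈ → let as , as∈ , eq = ∈-map⁻ (extendMatrix m T) U∈ in ≡.trans (≡.cong (reduceMatrix m) eq) (reduceMatrix-extendMatrix m T∈ as∈)))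
  (mk⇔ to from))
  where
  to : ∀ {T} → T ∈ TSPP (suc m) → T ∈ concatMap (extensions m) (TSPP m)
  to {T} T∈ = ∈-concatMap⁺ (extensions m) (TSPP m) (reduceMatrix-TSPP m T∈)
    (≡.subst (_∈ extensions m (reduceMatrix m T)) (extendMatrix-reduceMatrix m T∈) (∈-map⁺ (extendMatrix m (reduceMatrix m T)) (arms-∈ m T∈)))
  from : ∀ {U} → U ∈ concatMap (extensions m) (TSPP m) → U ∈ TSPP (suc m)
  from U∈ with T , T∈ , U∈′ ← concatMap-∈ (extensions m) (TSPP m) U∈ with as , as∈ , eq ← ∈-map⁻ (extendMatrix m T) U∈′ =
    ≡.subst (_∈ TSPP (suc m)) (≡.sym eq) (extendMatrix-TSPP m T∈ as∈)

-- Plane partitions and states have the same Frobenius symbols, with multiplicity.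

legsAfter : List ℕ → List ℕ → List ℕ
legsAfter []       bs       = []
legsAfter (a ∷ as) []       = 0 ∷ legsAfter as []
legsAfter (a ∷ as) (b ∷ bs) = suc b ∷ legsAfter as bs

part-legsAfter : ∀ as bs p → part (legsAfter as bs) p ≡ (if 0 ℕ.<ᵇ part as p then suc (part bs p) else 0)
part-legsAfter []       bs       p       = ≡.refl
part-legsAfter (a ∷ as) []       zero    = ≡.refl
part-legsAfter (a ∷ as) []       (suc p) = part-legsAfter as [] p
part-legsAfter (a ∷ as) (b ∷ bs) zero    = ≡.refl
part-legsAfter (a ∷ as) (b ∷ bs) (suc p) = part-legsAfter as bs p

map-filterᵇ : ∀ {a b} {X : Set a} {Y : Set b} (f : X → Y) (p : X → Bool) (q : Y → Bool) → (∀ x → p x ≡ q (f x)) →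
  ∀ xs → map f (filterᵇ p xs) ≡ filterᵇ q (map f xs)
map-filterᵇ f p q e []       = ≡.refl
map-filterᵇ f p q e (x ∷ xs) with p x | q (f x) | e x
... | true  | true  | _ = ≡.cong (f x ∷_) (map-filterᵇ f p q e xs)
... | false | false | _ = map-filterᵇ f p q e xs

below-headBelow : ∀ a s → below a s ≡ headBelow a (armsOf s)
below-headBelow a []            = ≡.refl
below-headBelow a (nothing ∷ s) = below-headBelow a s
below-headBelow a (just b ∷ s)  = ≡.refl

arms-successors : ∀ s → map armsOf (successors s) ≡ armSuccessors (armsOf s)
arms-successors []            = ≡.refl
arms-successors (nothing ∷ s) = ≡.trans (≡.sym (Listₚ.map-∘ (successors s))) (arms-successors s)
arms-successors (just a ∷ s)  = ≡.trans (Listₚ.map-++ armsOf (map (just a ∷_) (filterᵇ (below a) (successors s))) _) (≡.cong₂ _++_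
  (≡.trans (≡.sym (Listₚ.map-∘ (filterᵇ (below a) (successors s)))) (≡.trans (Listₚ.map-∘ (filterᵇ (below a) (successors s)))
    (≡.cong (map (a ∷_)) (≡.trans (map-filterᵇ armsOf (below a) (headBelow a) (below-headBelow a) (successors s)) (≡.cong (filterᵇ (headBelow a)) (arms-successors s))))))
  (≡.trans (≡.sym (Listₚ.map-∘ (successors s))) (≡.trans (Listₚ.map-∘ (successors s)) (≡.cong (map (suc a ∷_)) (arms-successors s)))))

legs-successors : ∀ s t → t ∈ successors s → legsOf t ≡ legsAfter (armsOf t) (legsOf s)
legs-successors [] t (here ≡.refl) = ≡.refl
legs-successors [] t (there (here ≡.refl)) = ≡.refl
legs-successors (nothing ∷ s) t t∈ with t′ , t′∈ , ≡.refl ← ∈-map⁻ (nothing ∷_) t∈ = legs-successors s t′ t′∈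
legs-successors (just a ∷ s) t t∈ with ∈-++⁻ (map (just a ∷_) (filterᵇ (below a) (successors s))) t∈
... | inj₁ t∈₁ with t′ , t′∈ , ≡.refl ← ∈-map⁻ (just a ∷_) t∈₁ with t′∈′ , _ ← ∈-filterᵇ⁻ (below a) (successors s) t′∈ =
  ≡.cong₂ _∷_ (length-successors s t′ t′∈′) (legs-successors s t′ t′∈′)
... | inj₂ t∈₂ with t′ , t′∈ , ≡.refl ← ∈-map⁻ (just (suc a) ∷_) t∈₂ =
  ≡.cong₂ _∷_ (length-successors s t′ t′∈) (legs-successors s t′ t′∈)

module PartitionSums {c ℓ} (R : CommutativeRing c ℓ) where
  open CommutativeRing R hiding (zero)
  open Sums R
  open import Relation.Binary.Reasoning.Setoid setoid

  -- Arms and legs do not determine a plane partition, but they determine the list of arms and legs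
  -- of its extensions. As G is arbitrary, the last growth step can be absorbed into it, and
  -- multiplicities agree by induction.
  TSPP-states : ∀ m (G : List ℕ → List ℕ → Carrier) →
    ∑ (TSPP m) (λ T → G (arms m (ent T)) (legs m (ent T))) ≈ ∑ (states m) (λ s → G (armsOf s) (legsOf s))
  TSPP-states zero    G = refl
  TSPP-states (suc m) G = begin
    ∑ (TSPP (suc m)) (λ T → G (arms (suc m) (ent T)) (legs (suc m) (ent T)))
      ≈⟨ ∑-↭ (TSPP-suc-↭ m) _ ⟩
    ∑ (concatMap (extensions m) (TSPP m)) (λ T → G (arms (suc m) (ent T)) (legs (suc m) (ent T)))
      ≈⟨ ∑-concatMap (extensions m) (TSPP m) _ ⟩
    ∑ (TSPP m) (λ T → ∑ (extensions m T) (λ U → G (arms (suc m) (ent U)) (legs (suc m) (ent U))))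
      ≈⟨ ∑-cong (TSPP m) (λ T T∈ → trans (∑-map (extendMatrix m T) (armSuccessors (arms m (ent T))) _)
           (∑-cong (armSuccessors (arms m (ent T))) (λ as as∈ → reflexive (≡.cong₂ G (arms-extendMatrix m T∈ as∈)
             (part-injective _ (legsAfter as (legs m (ent T)))
               (λ p → ≡.trans (part-legs-extendMatrix m T∈ as∈ p) (≡.sym (part-legsAfter as (legs m (ent T)) p)))))))) ⟩
    ∑ (TSPP m) (λ T → next (arms m (ent T)) (legs m (ent T)))
      ≈⟨ TSPP-states m next ⟩
    ∑ (states m) (λ s → next (armsOf s) (legsOf s))
      ≈⟨ ∑-cong (states m) (λ s _ → trans (reflexive (≡.cong (λ xs → ∑ xs (λ as → G as (legsAfter as (legsOf s)))) (≡.sym (arms-successors s))))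
           (trans (∑-map armsOf (successors s) _) (∑-cong (successors s) (λ t t∈ → reflexive (≡.cong (G (armsOf t)) (≡.sym (legs-successors s t t∈))))))) ⟩
    ∑ (states m) (λ s → ∑ (successors s) (λ t → G (armsOf t) (legsOf t)))
      ≈⟨ ∑-concatMap successors (states m) _ ⟨
    ∑ (states (suc m)) (λ s → G (armsOf s) (legsOf s)) ∎
    where
    next : List ℕ → List ℕ → Carrier
    next as bs = ∑ (armSuccessors as) (λ as′ → G as′ (legsAfter as′ bs))

-- The Frobenius symbol of the diagonal.

count-false : ∀ {a} {X : Set a} (P : X → Bool) xs → All (λ x → P x ≡ false) xs → count P xs ≡ 0
count-false P []       []       = ≡.refl
count-false P (x ∷ xs) (p ∷ ps) = ≡.trans (count-∷ P x xs) (≡.cong₂ (λ b n → (if b then 1 else 0) ℕ.+ n) p (count-false P xs ps))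

count-runLength : ∀ {a} {X : Set a} (P : X → Bool) (f : ℕ → X) m → (∀ i → P (f (suc i)) ≡ true → P (f i) ≡ true) →
  count P (applyUpTo f m) ≡ runLength m (P ∘ f)
count-runLength P f zero    dec = ≡.refl
count-runLength P f (suc m) dec = ≡.trans (count-∷ P (f 0) _) (go (P (f 0)) ≡.refl)
  where
  stays : ∀ i → P (f 0) ≡ false → P (f i) ≡ false
  stays zero    eq = eq
  stays (suc i) eq with P (f (suc i)) in eq′
  ... | false = ≡.refl
  ... | true  with () ← ≡.trans (≡.sym (stays i eq)) (dec i eq′)
  go : ∀ b → P (f 0) ≡ b → (if b then 1 else 0) ℕ.+ count P (applyUpTo (f ∘ suc) m) ≡ (if b then suc (runLength m (P ∘ f ∘ suc)) else 0)
  go true  eq = ≡.cong suc (count-runLength P (f ∘ suc) m (dec ∘ suc))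
  go false eq = count-false P _ (All-applyUpTo (f ∘ suc) m (λ i _ → stays (suc i) eq))

maxℕ-upper : ∀ b xs → All (ℕ._≤ b) xs → maxℕ xs ℕ.≤ b
maxℕ-upper b []       []       = ℕ.z≤n
maxℕ-upper b (x ∷ xs) (p ∷ ps) = ℕₚ.⊔-lub p (maxℕ-upper b xs ps)

maxℕ-∈ : ∀ xs → All (ℕ._≤ maxℕ xs) xs
maxℕ-∈ []       = []
maxℕ-∈ (x ∷ xs) = ℕₚ.m≤m⊔n x (maxℕ xs) ∷ All.map (λ p → ℕₚ.≤-trans p (ℕₚ.m≤n⊔m x (maxℕ xs))) (maxℕ-∈ xs)

applyUpTo-≤-maxℕ : ∀ f n i → i ℕ.< n → f i ℕ.≤ maxℕ (applyUpTo f n)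
applyUpTo-≤-maxℕ f (suc n) zero    _          = ℕₚ.m≤m⊔n (f 0) _
applyUpTo-≤-maxℕ f (suc n) (suc i) (ℕ.s≤s i<) = ℕₚ.≤-trans (applyUpTo-≤-maxℕ (f ∘ suc) n i i<) (ℕₚ.m≤n⊔m (f 0) _)

conj-applyUpTo : ∀ d → conj d ≡ applyUpTo (λ p → count (λ x → suc p ℕ.≤ᵇ x) d) (maxℕ d)
conj-applyUpTo d = map-range (λ i → count (λ x → i ℕ.≤ᵇ x) d) (maxℕ d)

at-conj : ∀ d p → at 0 (conj d) (suc p) ≡ count (λ x → suc p ℕ.≤ᵇ x) d
at-conj d p with p ℕₚ.<? maxℕ d
... | yes p< = ≡.trans (≡.cong (λ xs → at 0 xs (suc p)) (conj-applyUpTo d)) (at-applyUpTo 0 _ (maxℕ d) p p<)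
... | no ¬p< = ≡.trans (at-beyond 0 (conj d) p (≡.subst (ℕ._≤ p) (≡.sym (≡.trans (≡.cong length (conj-applyUpTo d)) (Listₚ.length-applyUpTo _ (maxℕ d)))) (ℕₚ.≮⇒≥ ¬p<)))
  (≡.sym (count-false _ d (All.map (λ x≤ → >⇒≤ᵇ-false (ℕ.s≤s (ℕₚ.≤-trans x≤ (ℕₚ.≮⇒≥ ¬p<)))) (maxℕ-∈ d))))

module _ {m : ℕ} {e : ℕ → ℕ → ℕ} (π : Plane m e) {T : List (List ℕ)} (ent≡ : ∀ i j → ent T i j ≡ e i j) where
  open Plane π
  open PlaneShape π

  private
    d = applyUpTo (λ i → e i i) m
    la = conj d

    diag≡ : diagT m T ≡ la
    diag≡ = ≡.cong conj (≡.trans (map-range (λ i → entry T i i) m) (applyUpTo-cong m (λ i _ → ent≡ i i)))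

    ρ : ℕ → ℕ
    ρ p = count (λ x → suc p ℕ.≤ᵇ x) d

    ρ≡ : ∀ p → ρ p ≡ runLength m (λ i → p ℕ.<ᵇ e i i)
    ρ≡ p = count-runLength (λ x → suc p ℕ.≤ᵇ x) (λ i → e i i) m
      (λ i h → <⇒<ᵇ-true (shrink (ℕₚ.n≤1+n i) (ℕₚ.n≤1+n i) ℕₚ.≤-refl (<ᵇ-sound h)))

    ρ-sound : ∀ p k → k ℕ.< ρ p → p ℕ.< e k k
    ρ-sound p k k< = <ᵇ-sound (proj₁ (runLength-sound m _ k (≡.subst (k ℕ.<_) (ρ≡ p) k<)))

    ρ-complete : ∀ p k → p ℕ.< e k k → k ℕ.< ρ p
    ρ-complete p k h = ≡.subst (k ℕ.<_) (≡.sym (ρ≡ p)) (runLength-complete m _ k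
      (λ k′ k′≤ → <⇒<ᵇ-true (shrink k′≤ k′≤ ℕₚ.≤-refl h)) (proj₁ (bound h)))

    diag-≤ : ∀ i → e i i ℕ.≤ maxℕ d
    diag-≤ i with i ℕₚ.<? m
    ... | yes i<m = applyUpTo-≤-maxℕ (λ i → e i i) m i i<m
    ... | no ¬i<m = ≤-from-< (λ x x< → ⊥-elim (¬i<m (proj₁ (bound x<))))

    l = durfeeSize m e

    l-≤ : l ℕ.≤ maxℕ d
    l-≤ = ≤-from-< (λ p p< → ℕₚ.<-≤-trans (durfee-sound p p<) (diag-≤ p))

    length-la : length la ≡ maxℕ d
    length-la = ≡.trans (≡.cong length (conj-applyUpTo d)) (Listₚ.length-applyUpTo _ (maxℕ d))

    durfee≡ : durfee la ≡ l
    durfee≡ = ≡.trans (≡.cong maxℕ (≡.trans (≡.cong (λ n → map (λ i → if i ℕ.≤ᵇ at 0 la i then i else 0) (range n)) length-la) (≡.trans (map-range (λ i → if i ℕ.≤ᵇ at 0 la i then i else 0) (maxℕ d))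
      (applyUpTo-cong (maxℕ d) (λ p _ → g≡ p))))) (ℕₚ.≤-antisym (maxℕ-upper l _ (All-applyUpTo g (maxℕ d) (λ p _ → g-≤ p))) (≤-from-< top))
      where
      g : ℕ → ℕ
      g p = if p ℕ.<ᵇ l then suc p else 0
      same : ∀ p → (p ℕ.<ᵇ ρ p) ≡ (p ℕ.<ᵇ l)
      same p with p ℕₚ.<? l
      ... | yes h = ≡.trans (<⇒<ᵇ-true (ρ-complete p p (durfee-sound p h))) (≡.sym (<⇒<ᵇ-true h))
      ... | no ¬h = ≡.trans (≥⇒<ᵇ-false (ℕₚ.≮⇒≥ (λ h → ¬h (durfee-complete p (ρ-sound p p h))))) (≡.sym (≥⇒<ᵇ-false (ℕₚ.≮⇒≥ ¬h)))
      g≡ : ∀ p → (if suc p ℕ.≤ᵇ at 0 la (suc p) then suc p else 0) ≡ g p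
      g≡ p = ≡.cong (λ b → if b then suc p else 0) (≡.trans (≡.cong (p ℕ.<ᵇ_) (at-conj d p)) (same p))
      g-≤ : ∀ p → g p ℕ.≤ l
      g-≤ p with p ℕ.<ᵇ l in eq
      ... | true  = <ᵇ-sound eq
      ... | false = ℕ.z≤n
      top : ∀ p → p ℕ.< l → p ℕ.< maxℕ (applyUpTo g (maxℕ d))
      top p p<l = ℕₚ.≤-trans (ℕₚ.≤-reflexive (≡.sym (≡.cong (λ b → if b then suc p else 0) (<⇒<ᵇ-true p<l))))
        (applyUpTo-≤-maxℕ g (maxℕ d) p (ℕₚ.<-≤-trans p<l l-≤))

    -- Row p of diag(T) counts the points (k, k, p). Those with k < p are all present because p is
    -- below the Durfee size; from k = p on they are permuted wall points (p, k, k).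
    ρ-rowSize : ∀ p → p ℕ.< l → ρ p ≡ p ℕ.+ rowSize m e p
    ρ-rowSize p p<l = ≡-from-< to from
      where
      h : p ℕ.< e p p
      h = durfee-sound p p<l
      to : ∀ k → k ℕ.< ρ p → k ℕ.< p ℕ.+ rowSize m e p
      to k k< with k ℕₚ.<? p
      ... | yes k<p = ℕₚ.<-≤-trans k<p (ℕₚ.m≤m+n p _)
      ... | no ¬k<p = ≡.subst (ℕ._< p ℕ.+ rowSize m e p) (ℕₚ.m+[n∸m]≡n p≤k)
        (ℕₚ.+-monoʳ-< p (rowSize-complete p (k ℕ.∸ p) (≡.subst (λ z → z ℕ.< e p z) (≡.sym (ℕₚ.m+[n∸m]≡n p≤k)) (swap₁₂ (swap₂₃ (ρ-sound p k k<))))))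
        where p≤k = ℕₚ.≮⇒≥ ¬k<p
      from : ∀ k → k ℕ.< p ℕ.+ rowSize m e p → k ℕ.< ρ p
      from k k< with k ℕₚ.<? p
      ... | yes k<p = ρ-complete p k (shrink (ℕₚ.<⇒≤ k<p) (ℕₚ.<⇒≤ k<p) ℕₚ.≤-refl h)
      ... | no ¬k<p = ρ-complete p k (swap₂₃ (swap₁₂ (≡.subst (λ z → z ℕ.< e p z) (ℕₚ.m+[n∸m]≡n p≤k)
        (rowSize-sound p (k ℕ.∸ p) (ℕₚ.+-cancelˡ-< p _ _ (≡.subst (ℕ._< p ℕ.+ rowSize m e p) (≡.sym (ℕₚ.m+[n∸m]≡n p≤k)) k<))))))
        where p≤k = ℕₚ.≮⇒≥ ¬k<p

  frobA-arms : frobA (diagT m T) ≡ arms m e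
  frobA-arms = ≡.trans (≡.cong frobA diag≡) (≡.trans (≡.cong (λ n → map (λ i → at 0 la i ℕ.∸ i) (range n)) durfee≡) (≡.trans (map-range (λ i → at 0 la i ℕ.∸ i) l)
    (applyUpTo-cong l (λ p p<l → ≡.trans (≡.cong (ℕ._∸ suc p) (≡.trans (at-conj d p) (ρ-rowSize p p<l)))
      (≡.trans (≡.cong (ℕ._∸ suc p) (ℕₚ.+-comm p _)) (≡.trans (≡.cong (rowSize m e p ℕ.+ p ℕ.∸_) (ℕₚ.+-comm 1 p))
        (≡.trans (≡.sym (ℕₚ.∸-+-assoc (rowSize m e p ℕ.+ p) p 1)) (≡.cong (ℕ._∸ 1) (ℕₚ.m+n∸n≡m _ p)))))))))

  -- Conjugating the conjugate gives back the decreasing diagonal, so the p-th leg is read off from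
  -- the entry `e p p`.
  frobB-legs : frobB (diagT m T) ≡ legs m e
  frobB-legs = ≡.trans (≡.cong frobB diag≡) (≡.trans (≡.cong (λ n → map (λ i → at 0 (conj la) i ℕ.∸ i) (range n)) durfee≡) (≡.trans (map-range (λ i → at 0 (conj la) i ℕ.∸ i) l)
    (applyUpTo-cong l (λ p _ → ≡.trans (≡.cong (ℕ._∸ suc p) (at-conj-conj p))
      (≡.trans (≡.cong (e p p ℕ.∸_) (ℕₚ.+-comm 1 p)) (≡.sym (ℕₚ.∸-+-assoc (e p p) p 1)))))))
    where
    at-conj-conj : ∀ p → at 0 (conj la) (suc p) ≡ e p p
    at-conj-conj p = ≡.trans (at-conj la p) (≡.trans (≡.cong (count (λ x → suc p ℕ.≤ᵇ x)) (conj-applyUpTo d))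
      (≡.trans (count-runLength (λ x → suc p ℕ.≤ᵇ x) ρ (maxℕ d) (λ k h → <⇒<ᵇ-true (ρ-complete k p (ℕₚ.<-trans (ℕₚ.n<1+n k) (ρ-sound (suc k) p (<ᵇ-sound h))))))
        (≡-from-< (λ k k< → ρ-sound k p (<ᵇ-sound (proj₁ (runLength-sound (maxℕ d) _ k k<))))
          (λ k k< → runLength-complete (maxℕ d) _ k (λ k′ k′≤ → <⇒<ᵇ-true (ρ-complete k′ p (ℕₚ.≤-<-trans k′≤ k<))) (ℕₚ.<-≤-trans k< (diag-≤ p))))))

-- From sorted exponents to the partition with the given Frobenius symbol.

addStaircase-++ : ∀ j xs ys → addStaircase j (xs ++ ys) ≡ addStaircase j xs ++ addStaircase (j ℕ.+ length xs) ys
addStaircase-++ j []       ys = ≡.cong (λ k → addStaircase k ys) (≡.sym (ℕₚ.+-identityʳ j))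
addStaircase-++ j (x ∷ xs) ys = ≡.cong (x ℕ.+ j ∷_) (≡.trans (addStaircase-++ (suc j) xs ys)
  (≡.cong (λ k → addStaircase (suc j) xs ++ addStaircase k ys) (≡.sym (ℕₚ.+-suc j (length xs)))))

-- The parts λ_{l+1} ≥ ⋯ ≥ λ_{N+1} in increasing order: the part belonging to a letter low b is the
-- number of high letters to its left, k counting those already passed.
lowParts : ℕ → State → List ℕ
lowParts k []            = k ∷ []
lowParts k (nothing ∷ s) = k ∷ lowParts k s
lowParts k (just a ∷ s)  = lowParts (suc k) s

armRows : ℕ → List ℕ → List ℕ
armRows i []       = []
armRows i (a ∷ as) = a ℕ.+ suc i ∷ armRows (suc i) as

stateParts : State → List ℕ
stateParts s = armRows 0 (armsOf s) ++ reverse (lowParts 0 s)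

length-lowParts : ∀ k s → length (lowParts k s) ℕ.+ length (armsOf s) ≡ suc (length s)
length-lowParts k []            = ≡.refl
length-lowParts k (nothing ∷ s) = ≡.cong suc (length-lowParts k s)
length-lowParts k (just a ∷ s)  = ≡.trans (ℕₚ.+-suc _ _) (≡.cong suc (length-lowParts (suc k) s))

length-armRows : ∀ i as → length (armRows i as) ≡ length as
length-armRows i []       = ≡.refl
length-armRows i (a ∷ as) = ≡.cong suc (length-armRows (suc i) as)

-- When k high and j low letters have been passed, the next low letter has exponent k + j: part k
-- plus the staircase entry j.
exponents-lows : ∀ N j k s hs → k ℕ.+ j ℕ.+ length s ≡ N →
  map (exponent N) (lows s ++ low 0 ∷ hs) ≡ addStaircase j (lowParts k s) ++ map (exponent N) hs
exponents-lows N j k [] hs eq = ≡.cong (_∷ map (exponent N) hs) (≡.trans (≡.sym eq) (ℕₚ.+-identityʳ _))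
exponents-lows N j k (nothing ∷ s) hs eq = ≡.cong₂ _∷_
  (≡.trans (≡.cong (ℕ._∸ suc (length s)) (≡.sym eq)) (ℕₚ.m+n∸n≡m (k ℕ.+ j) (suc (length s))))
  (exponents-lows N (suc j) k s hs (≡.trans (≡.cong (ℕ._+ length s) (ℕₚ.+-suc k j)) (≡.trans (≡.sym (ℕₚ.+-suc (k ℕ.+ j) (length s))) eq)))
exponents-lows N j k (just a ∷ s) hs eq = exponents-lows N j (suc k) s hs (≡.trans (≡.sym (ℕₚ.+-suc (k ℕ.+ j) (length s))) eq)

highs-arms : ∀ s hs → highs s hs ≡ map high (armsOf s) ʳ++ hs
highs-arms []            hs = ≡.refl
highs-arms (nothing ∷ s) hs = highs-arms s hs
highs-arms (just a ∷ s)  hs = highs-arms s (high a ∷ hs)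

exponents-highs : ∀ N j i as hs js → i ℕ.+ j ℕ.+ length as ≡ suc N → map (exponent N) hs ≡ addStaircase (j ℕ.+ length as) js →
  map (exponent N) (map high as ʳ++ hs) ≡ addStaircase j (armRows i as ʳ++ js)
exponents-highs N j i []       hs js eq eqh = ≡.trans eqh (≡.cong (λ k → addStaircase k js) (ℕₚ.+-identityʳ j))
exponents-highs N j i (a ∷ as) hs js eq eqh = exponents-highs N j (suc i) as (high a ∷ hs) (a ℕ.+ suc i ∷ js)
  (≡.trans (≡.sym (ℕₚ.+-suc (i ℕ.+ j) (length as))) eq)
  (≡.cong₂ _∷_ (≡.trans (≡.cong (ℕ._+ a) (≡.sym eq)) arithmetic)
    (≡.trans eqh (≡.cong (λ k → addStaircase k js) (ℕₚ.+-suc j (length as)))))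
  where
  open Data.Nat.Solver.+-*-Solver
  arithmetic : i ℕ.+ j ℕ.+ suc (length as) ℕ.+ a ≡ a ℕ.+ suc i ℕ.+ (j ℕ.+ length as)
  arithmetic = solve 4 (λ i j l a → i :+ j :+ (con 1 :+ l) :+ a := a :+ (con 1 :+ i) :+ (j :+ l)) ≡.refl i j (length as) a

sortedExponents-parts : ∀ N s → length s ≡ N → sortedExponents N s ≡ addStaircase 0 (reverse (stateParts s))
sortedExponents-parts N s len = ≡.trans (exponents-lows N 0 0 s (highs s []) len) (≡.trans
  (≡.cong (addStaircase 0 (lowParts 0 s) ++_) (≡.trans (≡.cong (map (exponent N)) (highs-arms s []))
    (exponents-highs N (length (lowParts 0 s)) 0 (armsOf s) [] [] (≡.trans (length-lowParts 0 s) (≡.cong suc len)) ≡.refl)))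
  (≡.trans (≡.sym (addStaircase-++ 0 (lowParts 0 s) (reverse (armRows 0 (armsOf s)))))
    (≡.cong (addStaircase 0) (≡.sym (≡.trans (Listₚ.reverse-++ (armRows 0 (armsOf s)) (reverse (lowParts 0 s)))
      (≡.cong (_++ reverse (armRows 0 (armsOf s))) (Listₚ.reverse-involutive (lowParts 0 s))))))))

length-stateParts : ∀ s → length (stateParts s) ≡ suc (length s)
length-stateParts s = ≡.trans (Listₚ.length-++ (armRows 0 (armsOf s))) (≡.trans
  (≡.cong₂ ℕ._+_ (length-armRows 0 (armsOf s)) (Listₚ.length-reverse (lowParts 0 s)))
  (≡.trans (ℕₚ.+-comm (length (armsOf s)) _) (length-lowParts 0 s)))

reverse-lowParts-decreasing : ∀ k s acc b → k ℕ.+ length (armsOf s) ℕ.≤ b → Decreasing k acc → Decreasing b (lowParts k s ʳ++ acc)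
reverse-lowParts-decreasing k []            acc b le dec = ≡.subst (ℕ._≤ b) (ℕₚ.+-identityʳ k) le , dec
reverse-lowParts-decreasing k (nothing ∷ s) acc b le dec = reverse-lowParts-decreasing k s (k ∷ acc) b le (ℕₚ.≤-refl , dec)
reverse-lowParts-decreasing k (just a ∷ s)  acc b le dec = reverse-lowParts-decreasing (suc k) s acc b
  (≡.subst (ℕ._≤ b) (ℕₚ.+-suc k _) le) (Decreasing-weaken acc (ℕₚ.n≤1+n k) dec)

arms-descending : ∀ s → Valid s → Strict (armsOf s)
arms-descending (nothing ∷ s) val = arms-descending s val
arms-descending (just a ∷ s) (val , bel , _) zero x x< = first (armsOf s) (≡.trans (≡.sym (below-headBelow a s)) bel) x<
  where
  first : ∀ as → headBelow a as ≡ true → x ℕ.< part as 0 → suc x ℕ.< suc a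
  first (b ∷ as) bel x< = ℕ.s≤s (ℕₚ.≤-trans x< (<ᵇ-sound bel))
arms-descending (just a ∷ s) (val , _) (suc p) x x< = arms-descending s val p x x<

armRows-decreasing : ∀ i as b tl → Strict as → part as 0 ℕ.+ i ℕ.≤ b → i ℕ.+ length as ℕ.≤ b →
  (∀ b → i ℕ.+ length as ℕ.≤ b → Decreasing b tl) → Decreasing b (armRows i as ++ tl)
armRows-decreasing i []       b tl st le le′ dec = dec b le′
armRows-decreasing i (a ∷ as) b tl st le le′ dec = ≡.subst (ℕ._≤ b) (≡.sym (ℕₚ.+-suc a i)) le ,
  armRows-decreasing (suc i) as (a ℕ.+ suc i) tl (st ∘ suc)
    (≡.subst (ℕ._≤ a ℕ.+ suc i) (≡.sym (ℕₚ.+-suc (part as 0) i)) (≡.subst (suc (part as 0 ℕ.+ i) ℕ.≤_) (≡.sym (ℕₚ.+-suc a i)) (ℕ.s≤s (ℕₚ.+-monoˡ-≤ i next≤))))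
    (tails as st)
    (λ b le → dec b (≡.subst (ℕ._≤ b) (≡.sym (ℕₚ.+-suc i (length as))) le))
  where
  next≤ : part as 0 ℕ.≤ a
  next≤ = ≤-from-< (λ x x< → ℕ.s≤s⁻¹ (st 0 x x<))
  long : ∀ as a → Strict (a ∷ as) → length as ℕ.≤ a
  long []       a st = ℕ.z≤n
  long (b ∷ as) a st = ℕₚ.≤-trans (ℕ.s≤s (long as b (st ∘ suc))) (ℕ.s≤s⁻¹ (st 0 b ℕₚ.≤-refl))
  tails : ∀ as → Strict (a ∷ as) → suc i ℕ.+ length as ℕ.≤ a ℕ.+ suc i
  tails as st = ≡.subst (ℕ._≤ a ℕ.+ suc i) (ℕₚ.+-comm (length as) (suc i)) (ℕₚ.+-monoˡ-≤ (suc i) (long as a st))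

stateParts-decreasing : ∀ s → Valid s → ∃ λ b → Decreasing b (stateParts s)
stateParts-decreasing s val = b , armRows-decreasing 0 (armsOf s) b _ (arms-descending s val)
  (≡.subst (ℕ._≤ b) (≡.sym (ℕₚ.+-identityʳ _)) (ℕₚ.m≤m+n _ _)) (ℕₚ.m≤n+m _ _)
  (λ b le → reverse-lowParts-decreasing 0 s [] b le tt)
  where b = part (armsOf s) 0 ℕ.+ length (armsOf s)

count-prefix : ∀ {a} {X : Set a} (P : X → Bool) (f : ℕ → X) m k → k ℕ.≤ m →
  (∀ i → i ℕ.< k → P (f i) ≡ true) → (∀ i → k ℕ.≤ i → i ℕ.< m → P (f i) ≡ false) → count P (applyUpTo f m) ≡ k
count-prefix P f zero    zero    le tr fa = ≡.refl
count-prefix P f (suc m) zero    le tr fa = count-false P _ (All-applyUpTo f (suc m) (λ i i< → fa i ℕ.z≤n i<))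
count-prefix P f (suc m) (suc k) le tr fa = ≡.trans (count-∷ P (f 0) _) (≡.cong₂ (λ b n → (if b then 1 else 0) ℕ.+ n) (tr 0 (ℕ.s≤s ℕ.z≤n))
  (count-prefix P (f ∘ suc) m k (ℕ.s≤s⁻¹ le) (λ i i< → tr (suc i) (ℕ.s≤s i<)) (λ i k≤ i< → fa (suc i) (ℕ.s≤s k≤) (ℕ.s≤s i<))))

length-legs-arms : ∀ s → length (legsOf s) ≡ length (armsOf s)
length-legs-arms []            = ≡.refl
length-legs-arms (nothing ∷ s) = length-legs-arms s
length-legs-arms (just a ∷ s)  = ≡.cong suc (length-legs-arms s)

part-legs-≤ : ∀ s i → i ℕ.< length (armsOf s) → part (legsOf s) i ℕ.+ i ℕ.≤ length s
part-legs-≤ (nothing ∷ s) i       i<         = ℕₚ.m≤n⇒m≤1+n (part-legs-≤ s i i<)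
part-legs-≤ (just a ∷ s)  zero    i<         = ℕₚ.≤-reflexive (ℕₚ.+-identityʳ _)
part-legs-≤ (just a ∷ s)  (suc i) (ℕ.s≤s i<) = ≡.subst (ℕ._≤ suc (length s)) (≡.sym (ℕₚ.+-suc _ i)) (ℕ.s≤s (part-legs-≤ s i i<))

part-legs-first : ∀ s i → i ℕ.< length (armsOf s) → part (legsOf s) i ℕ.+ i ℕ.≤ part (legsOf s) 0
part-legs-first (nothing ∷ s) i       i<         = part-legs-first s i i<
part-legs-first (just a ∷ s)  zero    i<         = ℕₚ.≤-reflexive (ℕₚ.+-identityʳ _)
part-legs-first (just a ∷ s)  (suc i) (ℕ.s≤s i<) = ≡.subst (ℕ._≤ suc (length s)) (≡.sym (ℕₚ.+-suc _ i)) (ℕ.s≤s (part-legs-≤ s i i<))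

arms-≤-length : ∀ s → length (armsOf s) ℕ.≤ length s
arms-≤-length []            = ℕ.z≤n
arms-≤-length (nothing ∷ s) = ℕₚ.m≤n⇒m≤1+n (arms-≤-length s)
arms-≤-length (just a ∷ s)  = ℕ.s≤s (arms-≤-length s)

at-shifted-legs : ∀ bs i → at 0 (map (ℕ._+ 1) bs) (suc i) ≡ part bs i
at-shifted-legs []       i       = ≡.refl
at-shifted-legs (b ∷ bs) zero    = ℕₚ.+-comm b 1
at-shifted-legs (b ∷ bs) (suc i) = at-shifted-legs bs i

frobeniusRow : List ℕ → List ℕ → ℕ → ℕ
frobeniusRow a b i = if i ℕ.≤ᵇ length a then at 0 a i ℕ.+ i else count (λ j → i ℕ.≤ᵇ at 0 b j ℕ.+ j) (range (length a))

module _ (S : State) where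
  private
    as = armsOf S
    bs = legsOf S
    l  = length as
    row = frobeniusRow as (map (ℕ._+ 1) bs)

  row-beyond : ∀ i k → l ℕ.< i → k ℕ.≤ l →
    (∀ j → j ℕ.< k → i ℕ.≤ part bs j ℕ.+ suc j) → (∀ j → k ℕ.≤ j → j ℕ.< l → part bs j ℕ.+ suc j ℕ.< i) → row i ≡ k
  row-beyond i k l<i k≤l tr fa rewrite >⇒≤ᵇ-false l<i = ≡.trans (≡.cong (count _) (map-upTo suc l))
    (count-prefix _ suc l k k≤l
      (λ j j< → ≤⇒≤ᵇ-true (≡.subst (λ z → i ℕ.≤ z ℕ.+ suc j) (≡.sym (at-shifted-legs bs j)) (tr j j<)))
      (λ j k≤ j< → >⇒≤ᵇ-false (≡.subst (λ z → z ℕ.+ suc j ℕ.< i) (≡.sym (at-shifted-legs bs j)) (fa j k≤ j<))))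

  rowsDown : ℕ → ℕ → List ℕ
  rowsDown i zero    = []
  rowsDown i (suc n) = row (i ℕ.+ suc n) ∷ rowsDown i n

  -- The part at a low letter counts the hooks that reach its row. Those of the k high letters
  -- already passed do so, by `big`; the later ones end above it, by `same` and `part-legs-≤`.
  lowParts-rows : ∀ k s → k ℕ.+ length (armsOf s) ≡ l → (∀ j → j ℕ.< k → length s ℕ.+ k ℕ.≤ part bs j ℕ.+ j) →
    (∀ j → part bs (k ℕ.+ j) ≡ part (legsOf s) j) → lowParts k s ≡ rowsDown l (length (lowParts k s))
  lowParts-rows k [] eql big same = ≡.cong (_∷ []) (≡.sym (row-beyond (l ℕ.+ 1) k (ℕₚ.≤-reflexive (ℕₚ.+-comm 1 l)) (ℕₚ.≤-reflexive k≡l)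
    (λ j j< → ≡.subst₂ ℕ._≤_ (≡.trans (≡.cong suc k≡l) (ℕₚ.+-comm 1 l)) (≡.sym (ℕₚ.+-suc _ j)) (ℕ.s≤s (big j j<)))
    (λ j k≤ j< → ⊥-elim (ℕₚ.<-irrefl k≡l (ℕₚ.≤-<-trans k≤ j<)))))
    where k≡l = ≡.trans (≡.sym (ℕₚ.+-identityʳ k)) eql
  lowParts-rows k (nothing ∷ s) eql big same = ≡.cong₂ _∷_
    (≡.sym (row-beyond (l ℕ.+ suc n) k (ℕₚ.m<m+n l (ℕ.s≤s ℕ.z≤n)) (≡.subst (k ℕ.≤_) eql (ℕₚ.m≤m+n k _))
      (λ j j< → ≡.subst₂ ℕ._≤_ (≡.sym index) (≡.sym (ℕₚ.+-suc _ j)) (ℕ.s≤s (big j j<)))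
      (λ j k≤j j<l → ≡.subst (part bs j ℕ.+ suc j ℕ.<_) (≡.sym index) (small j k≤j j<l))))
    (lowParts-rows k s eql (λ j j< → ℕₚ.≤-trans (ℕₚ.n≤1+n _) (big j j<)) same)
    where
    open Data.Nat.Solver.+-*-Solver
    n = length (lowParts k s)
    index : l ℕ.+ suc n ≡ suc (suc (length s) ℕ.+ k)
    index = ≡.trans (≡.cong (ℕ._+ suc n) (≡.sym eql)) (≡.trans
      (solve 3 (λ k a n → k :+ a :+ (con 1 :+ n) := con 1 :+ (n :+ a) :+ k) ≡.refl k (length (armsOf s)) n)
      (≡.cong (λ z → suc z ℕ.+ k) (length-lowParts k s)))
    small : ∀ j → k ℕ.≤ j → j ℕ.< l → part bs j ℕ.+ suc j ℕ.< suc (suc (length s) ℕ.+ k)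
    small j k≤j j<l = ≡.subst (λ z → part bs z ℕ.+ suc z ℕ.< suc (suc (length s) ℕ.+ k)) (ℕₚ.m+[n∸m]≡n k≤j)
      (≡.subst (λ z → z ℕ.+ suc (k ℕ.+ t) ℕ.< suc (suc (length s) ℕ.+ k)) (≡.sym (same t))
        (≡.subst (ℕ._≤ suc (suc (length s) ℕ.+ k)) (solve 3 (λ p k t → con 2 :+ (p :+ t :+ k) := con 1 :+ (p :+ (con 1 :+ (k :+ t)))) ≡.refl (part (legsOf s) t) k t)
          (ℕ.s≤s (ℕ.s≤s (ℕₚ.+-monoˡ-≤ k (part-legs-≤ s t t<))))))
      where
      t = j ℕ.∸ k
      t< : t ℕ.< length (armsOf s)
      t< = ℕₚ.+-cancelˡ-< k t _ (≡.subst₂ ℕ._<_ (≡.sym (ℕₚ.m+[n∸m]≡n k≤j)) (≡.sym eql) j<l)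
  lowParts-rows k (just a ∷ s) eql big same = lowParts-rows (suc k) s (≡.trans (≡.sym (ℕₚ.+-suc k _)) eql)
    (λ j j< → ≡.subst (ℕ._≤ part bs j ℕ.+ j) (≡.sym (ℕₚ.+-suc (length s) k)) (grow j j<))
    (λ j → ≡.trans (≡.cong (part bs) (≡.sym (ℕₚ.+-suc k j))) (same (suc j)))
    where
    grow : ∀ j → j ℕ.< suc k → suc (length s) ℕ.+ k ℕ.≤ part bs j ℕ.+ j
    grow j j<sk with ℕₚ.m≤n⇒m<n∨m≡n (ℕ.s≤s⁻¹ j<sk)
    ... | inj₁ j<k = big j j<k
    ... | inj₂ ≡.refl = ℕₚ.≤-reflexive (≡.cong (ℕ._+ j) (≡.sym (≡.trans (≡.cong (part bs) (≡.sym (ℕₚ.+-identityʳ j))) (same 0))))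

  reverse-rowsDown : ∀ i n acc → rowsDown i n ʳ++ acc ≡ applyUpTo (λ t → row (i ℕ.+ suc t)) n ++ acc
  reverse-rowsDown i zero    acc = ≡.refl
  reverse-rowsDown i (suc n) acc = ≡.trans (reverse-rowsDown i n (row (i ℕ.+ suc n) ∷ acc))
    (≡.trans (≡.sym (Listₚ.++-assoc (applyUpTo (λ t → row (i ℕ.+ suc t)) n) (row (i ℕ.+ suc n) ∷ []) acc))
      (≡.cong (_++ acc) (Listₚ.applyUpTo-∷ʳ (λ t → row (i ℕ.+ suc t)) n)))

  armRows-rows : ∀ i ys → armRows i ys ≡ applyUpTo (λ t → at 0 ys (suc t) ℕ.+ suc (i ℕ.+ t)) (length ys)
  armRows-rows i []       = ≡.refl
  armRows-rows i (y ∷ ys) = ≡.cong₂ _∷_ (≡.cong (λ z → y ℕ.+ suc z) (≡.sym (ℕₚ.+-identityʳ i)))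
    (≡.trans (armRows-rows (suc i) ys) (applyUpTo-cong (length ys) (λ t _ → ≡.cong (λ z → at 0 ys (suc t) ℕ.+ suc z) (≡.sym (ℕₚ.+-suc i t)))))

  applyUpTo-+ : ∀ (f : ℕ → ℕ) m n → applyUpTo f (m ℕ.+ n) ≡ applyUpTo f m ++ applyUpTo (λ t → f (m ℕ.+ t)) n
  applyUpTo-+ f zero    n = ≡.refl
  applyUpTo-+ f (suc m) n = ≡.cong (f 0 ∷_) (applyUpTo-+ (f ∘ suc) m n)

  stateParts-rows : stateParts S ≡ applyUpTo (row ∘ suc) (suc (length S))
  stateParts-rows = ≡.trans (≡.cong₂ _++_
      (≡.trans (armRows-rows 0 as) (applyUpTo-cong l (λ t t< → ≡.cong (λ b → if b then at 0 as (suc t) ℕ.+ suc t else count (λ j → suc t ℕ.≤ᵇ at 0 (map (ℕ._+ 1) bs) j ℕ.+ j) (range l)) (≡.sym (≤⇒≤ᵇ-true t<)))))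
      (≡.trans (≡.cong reverse (lowParts-rows 0 S ≡.refl (λ j ()) (λ j → ≡.refl))) (≡.trans (reverse-rowsDown l n []) (≡.trans (Listₚ.++-identityʳ _)
        (applyUpTo-cong n (λ t _ → ≡.cong row (ℕₚ.+-suc l t)))))))
    (≡.trans (≡.sym (applyUpTo-+ (row ∘ suc) l n)) (≡.cong (applyUpTo (row ∘ suc)) (≡.trans (ℕₚ.+-comm l n) (length-lowParts 0 S))))
    where n = length (lowParts 0 S)

  numberOfRows : ℕ
  numberOfRows = if l ℕ.≡ᵇ 0 then 0 else suc (at 0 (map (ℕ._+ 1) bs) 1)

  fromFrobenius-rows : fromFrobenius as (map (ℕ._+ 1) bs) ≡ applyUpTo (row ∘ suc) numberOfRows
  fromFrobenius-rows = map-range row numberOfRows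

  private
    rows-bound : l ≡ 0 ⊎ (∃ λ l′ → l ≡ suc l′)
    rows-bound with l
    ... | zero   = inj₁ ≡.refl
    ... | suc l′ = inj₂ (l′ , ≡.refl)

    nrows≡ : ∀ {l′} → l ≡ suc l′ → numberOfRows ≡ suc (part bs 0)
    nrows≡ eq rewrite eq = ≡.cong suc (at-shifted-legs bs 0)

  numberOfRows-≤ : numberOfRows ℕ.≤ suc (length S)
  numberOfRows-≤ with rows-bound
  ... | inj₁ eq rewrite eq = ℕ.z≤n
  ... | inj₂ (l′ , eq) = ≡.subst (ℕ._≤ suc (length S)) (≡.sym (nrows≡ eq)) (ℕ.s≤s (≡.subst (ℕ._≤ length S) (ℕₚ.+-identityʳ _)
    (part-legs-≤ S 0 (≡.subst (0 ℕ.<_) (≡.sym eq) (ℕ.s≤s ℕ.z≤n)))))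

  row-zero : ∀ t → row (suc (numberOfRows ℕ.+ t)) ≡ 0
  row-zero t with rows-bound
  ... | inj₁ eq = row-beyond _ 0 (≡.subst (ℕ._< suc (numberOfRows ℕ.+ t)) (≡.sym eq) (ℕ.s≤s ℕ.z≤n)) ℕ.z≤n (λ j ())
    (λ j _ j< → ⊥-elim (ℕₚ.n≮0 (≡.subst (j ℕ.<_) eq j<)))
  ... | inj₂ (l′ , eq) = row-beyond _ 0 (ℕ.s≤s (ℕₚ.≤-trans l≤ large)) ℕ.z≤n (λ j ()) (λ j _ j< → ℕ.s≤s (ℕₚ.≤-trans (step j j<) large))
    where
    large : suc (part bs 0) ℕ.≤ numberOfRows ℕ.+ t
    large = ≡.subst (ℕ._≤ numberOfRows ℕ.+ t) (nrows≡ eq) (ℕₚ.m≤m+n _ t)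
    step : ∀ j → j ℕ.< l → part bs j ℕ.+ suc j ℕ.≤ suc (part bs 0)
    step j j< = ≡.subst (ℕ._≤ suc (part bs 0)) (≡.sym (ℕₚ.+-suc _ j)) (ℕ.s≤s (part-legs-first S j j<))
    l≤ : l ℕ.≤ suc (part bs 0)
    l≤ = ≡.subst (ℕ._≤ suc (part bs 0)) (≡.sym eq) (ℕₚ.≤-trans (ℕₚ.m≤n+m (suc l′) _) (step l′ (≡.subst (l′ ℕ.<_) (≡.sym eq) ℕₚ.≤-refl)))

  applyUpTo-zeros : ∀ (f : ℕ → ℕ) n → (∀ t → f t ≡ 0) → applyUpTo f n ≡ replicate n 0
  applyUpTo-zeros f zero    z = ≡.refl
  applyUpTo-zeros f (suc n) z = ≡.cong₂ _∷_ (z 0) (applyUpTo-zeros (f ∘ suc) n (z ∘ suc))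

  -- Zero rows fill the partition up to one part for each variable, the length at which the Schur
  -- functional is evaluated.
  stateParts-fromFrobenius : ∃ λ k → stateParts S ≡ fromFrobenius as (map (ℕ._+ 1) bs) ++ replicate k 0
  stateParts-fromFrobenius = k , ≡.trans stateParts-rows (≡.trans (≡.cong (applyUpTo (row ∘ suc)) (≡.sym (ℕₚ.m+[n∸m]≡n numberOfRows-≤)))
    (≡.trans (applyUpTo-+ (row ∘ suc) numberOfRows k) (≡.cong₂ _++_ (≡.sym fromFrobenius-rows)
      (applyUpTo-zeros (λ t → row (suc (numberOfRows ℕ.+ t))) k row-zero))))
    where k = suc (length S) ℕ.∸ numberOfRows

-- Comparison of the exponents in the weights.

lowWeight gapWeight : State → ℕ
lowWeight []            = 0
lowWeight (nothing ∷ s) = suc (length s) ℕ.+ lowWeight s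
lowWeight (just a ∷ s)  = lowWeight s
gapWeight []            = 0
gapWeight (nothing ∷ s) = gapWeight s
gapWeight (just a ∷ s)  = (length s ℕ.∸ a) ℕ.+ gapWeight s

suc-C-2 : ∀ n → suc n C 2 ≡ n ℕ.+ n C 2
suc-C-2 n = ≡.trans (≡.sym (nCk+nC[k+1]≡[n+1]C[k+1] n 1)) (≡.cong (ℕ._+ n C 2) (nC1≡n n))

-- Every position contributes its index, from 1 to `length s`, either to the exponent of v or to the
-- sum of the b_i + 1. Hence the truncated subtraction in the exponent of v is exact.
lowWeight-legs : ∀ s → lowWeight s ℕ.+ sumℕ (map suc (legsOf s)) ≡ suc (length s) C 2
lowWeight-legs []            = ≡.refl
lowWeight-legs (nothing ∷ s) = ≡.trans (ℕₚ.+-assoc (suc (length s)) _ _)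
  (≡.trans (≡.cong (suc (length s) ℕ.+_) (lowWeight-legs s)) (≡.sym (suc-C-2 (suc (length s)))))
lowWeight-legs (just a ∷ s)  = ≡.trans (solve 3 (λ x y z → x :+ (y :+ z) := y :+ (x :+ z)) ≡.refl (lowWeight s) (suc (length s)) (sumℕ (map suc (legsOf s))))
  (≡.trans (≡.cong (suc (length s) ℕ.+_) (lowWeight-legs s)) (≡.sym (suc-C-2 (suc (length s)))))
  where open Data.Nat.Solver.+-*-Solver

-- Each gap is an honest difference because `Valid` keeps arms within their legs; so the exponent of
-- w is exact too.
gapWeight-arms : ∀ s → Valid s → gapWeight s ℕ.+ sumℕ (armsOf s) ≡ sumℕ (legsOf s)
gapWeight-arms []            val = ≡.refl
gapWeight-arms (nothing ∷ s) val = gapWeight-arms s val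
gapWeight-arms (just a ∷ s) (val , _ , a≤) = ≡.trans
  (solve 4 (λ g h a x → g :+ h :+ (a :+ x) := (g :+ a) :+ (h :+ x)) ≡.refl (length s ℕ.∸ a) (gapWeight s) a (sumℕ (armsOf s)))
  (≡.cong₂ ℕ._+_ (ℕₚ.m∸n+n≡m a≤) (gapWeight-arms s val))
  where open Data.Nat.Solver.+-*-Solver

positions-true : ∀ p n → positions p (replicate n true) ≡ interval p n
positions-true p zero    = ≡.refl
positions-true p (suc n) = ≡.cong (p ∷_) (positions-true (suc p) n)

at-tabulate : ∀ {a} {X : Set a} (d : X) n (f : Fin n → X) i (i<n : i ℕ.< n) → at d (tabulate f) (suc i) ≡ f (fromℕ< i<n)
at-tabulate d (suc n) f zero    i<n         = ≡.refl
at-tabulate d (suc n) f (suc i) (ℕ.s≤s i<n) = at-tabulate d n (f ∘ Fin.suc) i i<n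

-- Both sides of the identity as the same sum over states.

module _ {c ℓ} (R : CommutativeRing c ℓ) where
  open CommutativeRing R hiding (zero)
  open IntegerSolver R
  open Sums R
  open SchurExtension R
  open PartitionSums R
  open import Relation.Binary.Reasoning.Setoid setoid

  tableauSum-zeros : ∀ val N k ps → Tableaux.tableauSum R val N [] (ps ++ replicate k 0) ≈ Tableaux.tableauSum R val N [] ps
  tableauSum-zeros val N zero    ps = reflexive (≡.cong (Tableaux.tableauSum R val N []) (Listₚ.++-identityʳ ps))
  tableauSum-zeros val N (suc k) ps = trans
    (reflexive (≡.cong (Tableaux.tableauSum R val N []) (≡.sym (Listₚ.++-assoc ps (0 ∷ []) (replicate k 0)))))
    (trans (tableauSum-zeros val N k (ps ++ 0 ∷ [])) (Tableaux.tableauSum-0-row R val N [] ps))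

  schur-state : ∀ N (x : Fin (suc N) → Carrier) s → s ∈ states N →
    schur R (suc N) x (fromFrobenius (armsOf s) (map (ℕ._+ 1) (legsOf s)))
    ≈ schurExt (Tableaux.variables↓ R (at 0# (tabulate x)) (suc N)) (sortedExponents N s)
  schur-state N x s s∈ with b , dec ← stateParts-decreasing s (states-valid N s s∈) | k , eq ← stateParts-fromFrobenius s = begin
    schur R (suc N) x la
      ≈⟨ tableauSum-SSYT (suc N) la ⟩
    tableauSum (suc N) [] la
      ≈⟨ tableauSum-zeros (at 0# (tabulate x)) (suc N) k la ⟨
    tableauSum (suc N) [] (la ++ replicate k 0)
      ≡⟨ ≡.cong (tableauSum (suc N) []) eq ⟨
    tableauSum (suc N) [] (stateParts s)
      ≈⟨ schurExt-tableauSum (suc N) (stateParts s) b (≡.trans (length-stateParts s) (≡.cong suc len)) dec ⟨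
    schurExt (variables↓ (suc N)) (addStaircase 0 (reverse (stateParts s)))
      ≡⟨ ≡.cong (schurExt (variables↓ (suc N))) (sortedExponents-parts N s len) ⟨
    schurExt (variables↓ (suc N)) (sortedExponents N s) ∎
    where
    open Tableaux R (at 0# (tabulate x))
    len = length-states N s s∈
    la = fromFrobenius (armsOf s) (map (ℕ._+ 1) (legsOf s))

  module _ (u v w : Carrier) where
    open AlternatingSignMatrices R u v w using (matrices-triangleSum)
    open Functionals R using (pow-+)
    open StateExpansion R u v w
    open Triangles R u v w
    open Coupling R u v w using (coupleAll)

    symbolWeight : ℕ → List ℕ → List ℕ → Carrier
    symbolWeight N a b = pow R 1# (length a) * pow R u (sumℕ (map suc a)) * pow R v ((suc N C 2) ℕ.∸ sumℕ (map suc b)) * pow R w (sumℕ b ℕ.∸ sumℕ a)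

    pow-1 : ∀ n → pow R 1# n ≈ 1#
    pow-1 zero    = refl
    pow-1 (suc n) = trans (*-identityˡ _) (pow-1 n)

    stateWeight-powers : ∀ s → stateWeight s ≈ pow R u (sumℕ (map suc (armsOf s))) * pow R v (lowWeight s) * pow R w (gapWeight s)
    stateWeight-powers [] = solve 0 (con (ℤ.+ 1) := con (ℤ.+ 1) :* con (ℤ.+ 1) :* con (ℤ.+ 1)) refl
    stateWeight-powers (nothing ∷ s) = trans (*-congˡ (stateWeight-powers s)) (trans
      (solve 4 (λ p a b c → p :* (a :* b :* c) := a :* (p :* b) :* c) refl _ _ _ _)
      (*-congʳ (*-congˡ (sym (pow-+ v (suc (length s)) (lowWeight s))))))
    stateWeight-powers (just a ∷ s) = trans (*-congˡ (stateWeight-powers s)) (trans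
      (solve 5 (λ p q a b c → p :* q :* (a :* b :* c) := (p :* a) :* b :* (q :* c)) refl _ _ _ _ _)
      (*-cong (*-congʳ (sym (pow-+ u (suc a) _))) (sym (pow-+ w (length s ℕ.∸ a) (gapWeight s)))))

    symbolWeight-state : ∀ N s → s ∈ states N → symbolWeight N (armsOf s) (legsOf s) ≈ stateWeight s
    symbolWeight-state N s s∈ = trans
      (*-cong (*-cong (trans (*-congʳ (pow-1 (length (armsOf s)))) (*-identityˡ _))
        (reflexive (≡.cong (pow R v) (≡.trans (≡.cong (ℕ._∸ sumℕ (map suc (legsOf s)))
          (≡.trans (≡.cong (λ n → suc n C 2) (≡.sym (length-states N s s∈))) (≡.sym (lowWeight-legs s)))) (ℕₚ.m+n∸n≡m (lowWeight s) (sumℕ (map suc (legsOf s))))))))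
        (reflexive (≡.cong (pow R w) (≡.trans (≡.cong (ℕ._∸ sumℕ (armsOf s)) (≡.sym (gapWeight-arms s (states-valid N s s∈)))) (ℕₚ.m+n∸n≡m (gapWeight s) (sumℕ (armsOf s)))))))
      (sym (stateWeight-powers s))

    calA-states : ∀ N (x : Fin (suc N) → Carrier) → calA R (suc N) 1 1# u v w x
      ≈ ∑ (states N) (λ s → stateWeight s * schurExt (Tableaux.variables↓ R (at 0# (tabulate x)) (suc N)) (sortedExponents N s))
    calA-states N x = begin
      calA R (suc N) 1 1# u v w x
        ≈⟨ ∑-cong (TSPP N) (λ T T∈ → reflexive (≡.cong₂ G
             (frobA-arms {N} (TSPP-plane {N} T∈) {T} (λ i j → ≡.refl)) (frobB-legs {N} (TSPP-plane {N} T∈) {T} (λ i j → ≡.refl)))) ⟩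
      ∑ (TSPP N) (λ T → G (arms N (ent T)) (legs N (ent T)))
        ≈⟨ TSPP-states N G ⟩
      ∑ (states N) (λ s → G (armsOf s) (legsOf s))
        ≈⟨ ∑-cong (states N) (λ s s∈ → *-cong (symbolWeight-state N s s∈) (schur-state N x s s∈)) ⟩
      _ ∎
      where
      G : List ℕ → List ℕ → Carrier
      G a b = symbolWeight N a b * schur R (suc N) x (fromFrobenius a (map (ℕ._+ 1) b))

    ASMsum-calA : ∀ N (x xinv : Fin (suc N) → Carrier) → (∀ i → x i * xinv i ≈ 1#) →
      ASMsum R (suc N) u v w x xinv ≈ calA R (suc N) 1 1# u v w x
    ASMsum-calA N x xinv inverse = begin
      ASMsum R (suc N) u v w x xinv
        ≈⟨ matrices-triangleSum (suc N) val val⁻¹ val-inverse (ℕ.s≤s ℕ.z≤n) ⟩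
      triangleSum variables (replicate (suc N) true)
        ≈⟨ triangleSum-coupleAll variables (replicate (suc N) true) ⟩
      coupleAll (schurExt variables) (positions 0 (replicate (suc N) true))
        -- Positions are counted from 0 here, so the bottom row 1, ..., n becomes the exponents 0,
        -- ..., n - 1.
        ≡⟨ ≡.cong (coupleAll (schurExt variables)) (positions-true 0 (suc N)) ⟩
      coupleAll (schurExt variables) (interval 0 (suc N))
        ≈⟨ coupleAll-states N (schurExt-alternating variables) ⟩
      ∑ (states N) (λ s → stateWeight s * schurExt variables (sortedExponents N s))
        ≈⟨ calA-states N x ⟨
      calA R (suc N) 1 1# u v w x ∎
      where
      val val⁻¹ : ℕ → Carrier
      val   = at 0# (tabulate x)
      val⁻¹ = at 0# (tabulate xinv)
      variables = Tableaux.variables↓ R val (suc N)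
      val-inverse : ∀ i → i ℕ.< suc N → val (suc i) * val⁻¹ (suc i) ≈ 1#
      val-inverse i i< = trans (*-cong (reflexive (at-tabulate 0# (suc N) x i i<)) (reflexive (at-tabulate 0# (suc N) xinv i i<))) (inverse (fromℕ< i<))

theorem1 : ∀ {c ℓ} (R : CommutativeRing c ℓ) (n : ℕ) → 1 ≤ n →
    (u v w : CommutativeRing.Carrier R) (x xinv : Fin n → CommutativeRing.Carrier R) →
    (∀ i → CommutativeRing._≈_ R (CommutativeRing._*_ R (x i) (xinv i)) (CommutativeRing.1# R)) →
    CommutativeRing._≈_ R (ASMsum R n u v w x xinv) (calA R n 1 (CommutativeRing.1# R) u v w x)
theorem1 R (suc N) _ u v w x xinv inverse = ASMsum-calA R u v w N x xinv inverse
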